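{- Let $\pi,\tau \in S_n$ be independent and uniformly random permutations. There are constants $C,c>0$ such that for all sufficiently large $n$, $$\exp\left(-C\log^2 n\right) \le \mathbb{P}(\pi \le \tau) \le \exp\left(-c\log^2 n\right),$$ where $\le$ denotes the strong Bruhat order on $S_n$.
   Context: For a permutation $\sigma\in S_n$ let $M_\sigma$ be its $n\times n$ permutation matrix, $M_\sigma(i,j)=1$ if $\sigma(i)=j$ and $0$ otherwise. The strong Bruhat order is characterized by: $\pi \le \tau$ if and only if $\sum_{i\le a,\, j\le b} M_\tau(i,j) \le \sum_{i\le a,\, j\le b} M_\pi(i,j)$ for all $a,b\in\{1,\dots,n\}$. -}

module Defs where

open import Data.Nat using (ℕ; zero; suc; _<_; _≤_; _<?_; _≤?_)
open import Data.Fin using (Fin; toℕ; _≟_)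
open import Data.Fin.Properties using (all?)
open import Data.List using (List; []; _∷_; [_]; map; concatMap; filter; length; allFin; cartesianProduct)
open import Data.Vec using (Vec; lookup) renaming ([] to []ᵥ; _∷_ to _∷ᵥ_)
open import Data.Product using (_×_; _,_; proj₁; proj₂)
open import Relation.Binary.PropositionalEquality using (_≡_)
open import Relation.Nullary using (Dec)
open import Relation.Nullary.Decidable using (_→-dec_)

allWords : (k n : ℕ) → List (Vec (Fin n) k)
allWords zero    n = [ []ᵥ ]
allWords (suc k) n = concatMap (λ i → map (i ∷ᵥ_) (allWords k n)) (allFin n)

-- A word σ = (σ(0),…,σ(n-1)) of length n over Fin n is a permutation of
-- Fin n iff i ↦ σ(i) is injective (finite set).
IsPerm : {n : ℕ} → Vec (Fin n) n → Set
IsPerm {n} σ = (i j : Fin n) → lookup σ i ≡ lookup σ j → i ≡ j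

isPerm? : {n : ℕ} (σ : Vec (Fin n) n) → Dec (IsPerm σ)
isPerm? σ = all? (λ i → all? (λ j → (lookup σ i ≟ lookup σ j) →-dec (i ≟ j)))

-- S_n, listed (each permutation exactly once).
Sym : (n : ℕ) → List (Vec (Fin n) n)
Sym n = filter isPerm? (allWords n n)

-- Rank function: r_σ(a,b) = Σ_{i ≤ a, j ≤ b} M_σ(i,j)
--   = #{ i ∈ {1..a} : σ(i) ≤ b }  (1-indexed a,b).
-- Here with 0-indexed Fin, a,b ∈ {1..n} correspond to ℕ-values a,b and
-- the condition is toℕ i < a and toℕ (σ i) < b.
rank : {n : ℕ} → Vec (Fin n) n → ℕ → ℕ → ℕ
rank {n} σ a b =
  length (filter (λ i → toℕ i <? a) (filter (λ i → toℕ (lookup σ i) <? b) (allFin n)))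

-- Strong Bruhat order: π ≤ τ iff r_τ(a,b) ≤ r_π(a,b) for all a,b ∈ {1,…,n}.
-- (a,b : Fin n encode the values toℕ a + 1, toℕ b + 1.)
BruhatLeq : {n : ℕ} → Vec (Fin n) n → Vec (Fin n) n → Set
BruhatLeq {n} π τ =
  (a b : Fin n) → rank τ (suc (toℕ a)) (suc (toℕ b)) ≤ rank π (suc (toℕ a)) (suc (toℕ b))

bruhatLeq? : {n : ℕ} (π τ : Vec (Fin n) n) → Dec (BruhatLeq π τ)
bruhatLeq? π τ = all? (λ a → all? (λ b → _ ≤? _))

-- Number of pairs (π,τ) ∈ S_n × S_n with π ≤ τ in strong Bruhat order.
-- P(π ≤ τ) for independent uniform π,τ equals comparablePairs n / |S_n|^2.
comparablePairs : ℕ → ℕ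
comparablePairs n =
  length (filter (λ p → bruhatLeq? (proj₁ p) (proj₂ p)) (cartesianProduct (Sym n) (Sym n)))

symSize : ℕ → ℕ
symSize n = length (Sym n)

{-# OPTIONS --safe #-}
-- Lower bound.  The uniform measure on S_n satisfies Harris' correlation inequality for the strong Bruhat
-- order, so it suffices to show that r_τ ≤ r_π holds with probability bounded below on each of the O(log² n)
-- dyadic boxes [a/2,a] × [b/2,b] at the four corners.  If ab = O(n), with positive probability τ has no point
-- in [0,a) × [0,b).  Otherwise a two-parameter Doob inequality gives |r - ab/n| = O(√(ab/n)) on the box for
-- both permutations with probability at least 1/2.  Exchanging two values of π raises r_π by one on the
-- whole box, and by double counting costs a factor 1 - O(√(n/ab)) in probability, so raising r_π by a
-- multiple of √(ab/n) costs a constant factor.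
--
-- Upper bound.  Up to a constant factor, the points of π in the first n^(2/3-ε) rows and columns are dominated
-- by a field of independent Bernoulli variables.  Hence D = r_π - r_τ, observed at the points
-- (2^(u+26i), 2^(v+26j)), may be treated as a sum of independent lazy symmetric random walks, one for each
-- cell of this grid.  Let s be proportional to the standard deviation of a cell.  The product of the potentials
-- 2^⌊|D|/s⌋ contracts by 63/64 at every cell in the presence of the constraint D ≥ 0: if the contribution of
-- the earlier cells is small, the new cell makes D negative with probability 1/16; if it is large, the passage
-- to the larger scale lowers the potential.  The grid has order log² n cells.
module Submission where

open import Defs
import Algebra.Properties.CommutativeMonoid.Sum
open import Data.Bool using (Bool; true; false)
open import Data.Fin using (Fin; toℕ; punchIn; opposite; fromℕ<) renaming (zero to fz; suc to fs)
import Data.Fin.Permutation as Perm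
import Data.Fin.Properties as F
open import Data.Integer using (ℤ; ∣_∣)
import Data.Integer as ℤ
import Data.Integer.Properties as ℤₚ
import Data.Integer.Tactic.RingSolver as ℤR
open import Data.List using (List; []; _∷_; filter; length; allFin; tabulate; map; concatMap; cartesianProduct; _++_)
open import Data.Nat
open import Data.Nat.DivMod
open import Data.Nat.Logarithm using (⌊log₂_⌋; ⌊log₂⌊n/2⌋⌋≡⌊log₂n⌋∸1; ⌊log₂⌋-mono-≤; ⌊log₂[2^n]⌋≡n)
open import Data.Nat.Properties
open import Data.Nat.Tactic.RingSolver using (solve-∀)
open import Data.Product using (_×_; ∃-syntax; _,_; proj₁; proj₂; Σ)
open import Data.Sum using (_⊎_; inj₁; inj₂)
open import Data.Unit using (⊤; tt)
open import Data.Vec using (Vec; lookup; replicate) renaming ([] to []ᵥ; _∷_ to _∷ᵥ_; map to mapᵥ)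
import Data.Vec.Properties as V
open import Function using (_∘_; id; case_of_)
open import Relation.Binary.Definitions using (tri<; tri≈; tri>)
open import Relation.Binary.PropositionalEquality hiding (J)
open import Relation.Nullary using (Dec; yes; no; ¬_; contradiction)
open import Relation.Nullary.Decidable using (_×-dec_; _→-dec_; ¬?)
open import Relation.Unary using (Decidable)

-- The value of D at a grid point sums all cells above and to the left, so a new cell meets two
-- carried quantities: the entry of its column and the running sum of its row. Each gets a potential
-- at the scale of the cell. One step of the grid down or to the right multiplies the number of
-- sites of a cell, hence its variance, by about 2^26 and the standard deviation by about 2^13. This
-- is the ratio s/r by which `OneStep` coarsens a potential, so that the cells below and to the
-- right receive theirs at their own scale.
--
-- The Bernoulli field costs a constant factor because an A × B corner is free of points with
-- probability at most (1 - 1/n)^(AB) for a permutation and exactly (1 + 1/M)^(-AB) for the field,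
-- where M = n - A - B. The quotient is at most 2 once 2AB(A + B) ≤ nM, and this is where the
-- exponent 2/3 comes from.
--
-- All probabilities are counts with denominators cleared, and the constant c of the upper bound is
-- realised as 1/d by raising the inequality to an integer power d.

module Sumₚ = Algebra.Properties.CommutativeMonoid.Sum +-0-commutativeMonoid

-- Finite sums and additive functionals

sum : ∀ {n} → (Fin n → ℕ) → ℕ
sum {zero} f = 0
sum {suc n} f = f fz + sum (λ i → f (fs i))

sum≡ : ∀ {n} (f : Fin n → ℕ) → sum f ≡ Sumₚ.sum f
sum≡ {zero} f = refl
sum≡ {suc n} f = cong (f fz +_) (sum≡ (f ∘ fs))

sum-remove : ∀ {n} (i : Fin (suc n)) (f : Fin (suc n) → ℕ) → sum f ≡ f i + sum (λ u → f (punchIn i u))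
sum-remove i f = trans (sum≡ f) (trans (Sumₚ.sum-remove {i = i} f) (cong (f i +_) (sym (sum≡ (λ u → f (punchIn i u))))))

-- Unnormalised expectations. Sums over indices, words and codes are instances, and later the walk
-- expectation `E N`, the Bernoulli expectation `bern s N` and the row operator `op`; interchange
-- lemmas such as `sum-swap` are stated against an arbitrary second functional.
record Additive {A : Set} (S : (A → ℕ) → ℕ) : Set where
  field
    cong-S : ∀ {f g} → (∀ x → f x ≡ g x) → S f ≡ S g
    +-S    : ∀ f g → S (λ x → f x + g x) ≡ S f + S g
    *-S    : ∀ c f → S (λ x → c * f x) ≡ c * S f

  mono-S : ∀ {f g} → (∀ x → f x ≤ g x) → S f ≤ S g
  mono-S {f} {g} f≤g = begin
    S f ≤⟨ m≤m+n _ _ ⟩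
    S f + S (λ x → g x ∸ f x) ≡⟨ +-S _ _ ⟨
    S (λ x → f x + (g x ∸ f x)) ≡⟨ cong-S (λ x → m+[n∸m]≡n (f≤g x)) ⟩
    S g ∎
    where open ≤-Reasoning

  zero-S : S (λ _ → 0) ≡ 0
  zero-S = *-S 0 (λ _ → 0)

  *ʳ-S : ∀ c f → S (λ x → f x * c) ≡ S f * c
  *ʳ-S c f = trans (cong-S λ x → *-comm (f x) c) (trans (*-S c f) (*-comm c _))

  const-S : ∀ c → S (λ _ → c) ≡ S (λ _ → 1) * c
  const-S c = trans (cong-S λ _ → sym (+-identityʳ c)) (*ʳ-S c (λ _ → 1))

open Additive

sum-additive : ∀ {n} → Additive (sum {n})
sum-additive {zero} = record { cong-S = λ _ → refl ; +-S = λ _ _ → refl ; *-S = λ c _ → sym (*-zeroʳ c) }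
sum-additive {suc n} = record
  { cong-S = λ e → cong₂ _+_ (e fz) (cong-S (sum-additive {n}) (e ∘ fs))
  ; +-S = λ f g → trans (cong (λ x → f fz + g fz + x) (+-S (sum-additive {n}) (f ∘ fs) (g ∘ fs)))
                        (+-interchange (f fz) (g fz) _ _)
  ; *-S = λ c f → trans (cong (c * f fz +_) (*-S (sum-additive {n}) c (f ∘ fs)))
                        (sym (*-distribˡ-+ c (f fz) _)) }
  where
  +-interchange : ∀ a b c d → (a + b) + (c + d) ≡ (a + c) + (b + d)
  +-interchange = solve-∀

∘-additive : ∀ {A B : Set} {S : (A → ℕ) → ℕ} {T : A → (B → ℕ) → ℕ} {C : Set} {h : A → B → C} →
             Additive S → (∀ a → Additive (T a)) → Additive (λ (f : C → ℕ) → S (λ a → T a (λ b → f (h a b))))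
∘-additive s t = record
  { cong-S = λ e → cong-S s λ a → cong-S (t a) λ b → e _
  ; +-S = λ f g → trans (cong-S s λ a → +-S (t a) _ _) (+-S s _ _)
  ; *-S = λ c f → trans (cong-S s λ a → *-S (t a) c _) (*-S s c _) }

sum-swap : ∀ {n} {B : Set} {S : (B → ℕ) → ℕ} → Additive S → (f : Fin n → B → ℕ) →
           S (λ b → sum (λ k → f k b)) ≡ sum (λ k → S (f k))
sum-swap {zero} s f = zero-S s
sum-swap {suc n} s f = trans (+-S s (f fz) _) (cong₂ _+_ refl (sum-swap s (f ∘ fs)))

sum-const : ∀ n c → sum {n} (λ _ → c) ≡ n * c
sum-const zero c = refl
sum-const (suc n) c = cong (c +_) (sum-const n c)

-- Lehmer codes: (k , σ) stands for the permutation k ∷ map (punchIn k) σ.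
Code : ℕ → Set
Code zero    = ⊤
Code (suc n) = Fin (suc n) × Code n

∑ : ∀ n → (Code n → ℕ) → ℕ
∑ zero f = f tt
∑ (suc n) f = sum (λ k → ∑ n (λ σ → f (k , σ)))

∑-additive : ∀ n → Additive (∑ n)
∑-additive zero = record { cong-S = λ e → e tt ; +-S = λ _ _ → refl ; *-S = λ _ _ → refl }
∑-additive (suc n) = ∘-additive {h = _,_} sum-additive (λ _ → ∑-additive n)

∑-swap : ∀ n {B : Set} {S : (B → ℕ) → ℕ} → Additive S → (f : Code n → B → ℕ) →
         S (λ b → ∑ n (λ σ → f σ b)) ≡ ∑ n (λ σ → S (f σ))
∑-swap zero s f = refl
∑-swap (suc n) s f = trans (sum-swap s (λ k b → ∑ n (λ σ → f (k , σ) b)))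
  (cong-S sum-additive λ k → ∑-swap n s (λ σ → f (k , σ)))

∑-const : ∀ n c → ∑ n (λ _ → c) ≡ n ! * c
∑-const zero c = sym (+-identityʳ c)
∑-const (suc n) c = begin
  sum {suc n} (λ _ → ∑ n (λ _ → c)) ≡⟨ sum-const (suc n) _ ⟩
  suc n * ∑ n (λ _ → c) ≡⟨ cong (suc n *_) (∑-const n c) ⟩
  suc n * (n ! * c) ≡⟨ *-assoc (suc n) (n !) c ⟨
  suc n ! * c ∎
  where open ≡-Reasoning

-- The indicator of k < b as a number, so that it can be subtracted: deleting the value k turns the
-- threshold b into `b ∸ lt k b`.
lt : ℕ → ℕ → ℕ
lt _       zero    = 0
lt zero    (suc b) = 1
lt (suc k) (suc b) = lt k b

lt≤1 : ∀ k b → lt k b ≤ 1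
lt≤1 k       zero    = z≤n
lt≤1 zero    (suc b) = ≤-refl
lt≤1 (suc k) (suc b) = lt≤1 k b

lt≤ : ∀ k b → lt k b ≤ b
lt≤ k       zero    = z≤n
lt≤ zero    (suc b) = s≤s z≤n
lt≤ (suc k) (suc b) = m≤n⇒m≤1+n (lt≤ k b)

lt-yes : ∀ {k b} → k < b → lt k b ≡ 1
lt-yes {zero}  (s≤s _) = refl
lt-yes {suc k} (s≤s p) = lt-yes p

lt-no : ∀ {k b} → b ≤ k → lt k b ≡ 0
lt-no z≤n     = refl
lt-no (s≤s p) = lt-no p

lt-monoʳ : ∀ k {b c} → b ≤ c → lt k b ≤ lt k c
lt-monoʳ k       z≤n     = z≤n
lt-monoʳ zero    (s≤s p) = ≤-refl
lt-monoʳ (suc k) (s≤s p) = lt-monoʳ k p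

lt-antiˡ : ∀ {k l} b → k ≤ l → lt l b ≤ lt k b
lt-antiˡ zero    p       = z≤n
lt-antiˡ {k} {l} (suc b) z≤n = lt≤1 l (suc b)
lt-antiˡ (suc b) (s≤s p) = lt-antiˡ b p

-- The rank function computed on the code. The tail permutes the values left after k has been
-- removed and the rest relabelled; those that were below b are then the first `b ∸ lt k b`.
ρ : ∀ {n} → Code n → ℕ → ℕ → ℕ
ρ {zero}  _       a       b = 0
ρ {suc n} _       zero    b = 0
ρ {suc n} (k , σ) (suc a) b = lt (toℕ k) b + ρ σ a (b ∸ lt (toℕ k) b)

𝟙 : ∀ {P : Set} → Dec P → ℕ
𝟙 (yes _) = 1
𝟙 (no _)  = 0

𝟙-yes : ∀ {P : Set} (d : Dec P) → P → 𝟙 d ≡ 1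
𝟙-yes (yes _) p = refl
𝟙-yes (no ¬p) p = contradiction p ¬p

𝟙-no : ∀ {P : Set} (d : Dec P) → ¬ P → 𝟙 d ≡ 0
𝟙-no (yes p) ¬p = contradiction p ¬p
𝟙-no (no _)  ¬p = refl

𝟙≤1 : ∀ {P : Set} (d : Dec P) → 𝟙 d ≤ 1
𝟙≤1 (yes _) = ≤-refl
𝟙≤1 (no _)  = z≤n

𝟙-mono : ∀ {P Q : Set} (d : Dec P) (e : Dec Q) → (P → Q) → 𝟙 d ≤ 𝟙 e
𝟙-mono (yes p) e i = ≤-reflexive (sym (𝟙-yes e (i p)))
𝟙-mono (no _)  e i = z≤n

𝟙-cong : ∀ {P Q : Set} (d : Dec P) (e : Dec Q) → (P → Q) → (Q → P) → 𝟙 d ≡ 𝟙 e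
𝟙-cong d e i j = ≤-antisym (𝟙-mono d e i) (𝟙-mono e d j)

𝟙-× : ∀ {P Q : Set} (d : Dec P) (e : Dec Q) → 𝟙 (d ×-dec e) ≡ 𝟙 d * 𝟙 e
𝟙-× (yes _) (yes _) = refl
𝟙-× (yes _) (no _)  = refl
𝟙-× (no _)  e       = refl

lt-𝟙 : ∀ k b → lt k b ≡ 𝟙 (k <? b)
lt-𝟙 k b with k <? b
... | yes p = lt-yes p
... | no ¬p = lt-no (≮⇒≥ ¬p)

-- From lists of vectors to sums over codes

length-filter : ∀ {A : Set} {P : A → Set} (P? : Decidable P) x xs →
                length (filter P? (x ∷ xs)) ≡ 𝟙 (P? x) + length (filter P? xs)
length-filter P? x xs with P? x
... | yes p = refl
... | no ¬p = refl

count : ∀ {n} {A : Set} {P Q : A → Set} (P? : Decidable P) (Q? : Decidable Q) (f : Fin n → A) →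
        length (filter P? (filter Q? (tabulate f))) ≡ sum (λ i → 𝟙 (P? (f i)) * 𝟙 (Q? (f i)))
count {zero}  P? Q? f = refl
count {suc n} P? Q? f with Q? (f fz)
... | yes q = trans (length-filter P? (f fz) _) (cong₂ _+_ (sym (*-identityʳ _)) (count P? Q? (f ∘ fs)))
... | no ¬q = trans (count P? Q? (f ∘ fs)) (cong₂ _+_ (sym (*-zeroʳ (𝟙 (P? (f fz))))) refl)

rk : ∀ {m n} → Vec (Fin n) m → ℕ → ℕ → ℕ
rk v a b = sum (λ i → lt (toℕ i) a * lt (toℕ (lookup v i)) b)

rank≡rk : ∀ {n} (v : Vec (Fin n) n) a b → rank v a b ≡ rk v a b
rank≡rk {n} v a b = trans (count (λ i → toℕ i <? a) (λ i → toℕ (lookup v i) <? b) id)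
  (cong-S sum-additive λ i → sym (cong₂ _*_ (lt-𝟙 (toℕ i) a) (lt-𝟙 (toℕ (lookup v i)) b)))

lt-punchIn : ∀ {n} (k : Fin (suc n)) (j : Fin n) b → lt (toℕ (punchIn k j)) b ≡ lt (toℕ j) (b ∸ lt (toℕ k) b)
lt-punchIn fz     j      zero    = refl
lt-punchIn fz     j      (suc b) = refl
lt-punchIn (fs i) fz     zero    = refl
lt-punchIn (fs i) fz     (suc zero) = sym (cong (λ x → lt 0 (1 ∸ x)) (n≤0⇒n≡0 (lt≤ (toℕ i) 0)))
lt-punchIn (fs i) fz     (suc (suc b)) with lt (toℕ i) (suc b) | lt≤1 (toℕ i) (suc b)
... | zero     | _       = refl
... | suc zero | _       = refl
... | suc (suc _) | s≤s ()
lt-punchIn (fs i) (fs j) zero    = refl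
lt-punchIn (fs i) (fs j) (suc b) = trans (lt-punchIn i j b)
  (cong (lt (suc (toℕ j))) (sym (+-∸-assoc 1 (lt≤ (toℕ i) b))))

decode : ∀ {n} → Code n → Vec (Fin n) n
decode {zero}  _       = []ᵥ
decode {suc n} (k , σ) = k ∷ᵥ mapᵥ (punchIn k) (decode σ)

rk-decode : ∀ {n} (σ : Code n) a b → rk (decode σ) a b ≡ ρ σ a b
rk-decode {zero}  σ       a       b = refl
rk-decode {suc n} (k , σ) zero    b = trans (sum-const (suc n) 0) (*-zeroʳ (suc n))
rk-decode {suc n} (k , σ) (suc a) b = cong₂ _+_ (+-identityʳ (lt (toℕ k) b)) (begin
  sum (λ i → lt (toℕ i) a * lt (toℕ (lookup (mapᵥ (punchIn k) (decode σ)) i)) b)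
    ≡⟨ cong-S sum-additive (λ i → cong (lt (toℕ i) a *_) (trans
         (cong (λ j → lt (toℕ j) b) (V.lookup-map i (punchIn k) (decode σ)))
         (lt-punchIn k (lookup (decode σ) i) b))) ⟩
  rk (decode σ) a (b ∸ lt (toℕ k) b) ≡⟨ rk-decode σ a _ ⟩
  ρ σ a (b ∸ lt (toℕ k) b) ∎)
  where open ≡-Reasoning

∑w : ∀ m n → (Vec (Fin n) m → ℕ) → ℕ
∑w zero n f = f []ᵥ
∑w (suc m) n f = sum (λ i → ∑w m n (λ w → f (i ∷ᵥ w)))

∑w-additive : ∀ m n → Additive (∑w m n)
∑w-additive zero n = record { cong-S = λ e → e []ᵥ ; +-S = λ _ _ → refl ; *-S = λ _ _ → refl }
∑w-additive (suc m) n = ∘-additive {h = _∷ᵥ_} sum-additive (λ _ → ∑w-additive m n)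

Inj : ∀ {m n} → Vec (Fin n) m → Set
Inj {m} σ = (i j : Fin m) → lookup σ i ≡ lookup σ j → i ≡ j

abstract
  inj? : ∀ {m n} (σ : Vec (Fin n) m) → Dec (Inj σ)
  inj? σ = F.all? (λ i → F.all? (λ j → (lookup σ i F.≟ lookup σ j) →-dec (i F.≟ j)))

Avoids : ∀ {m n} → Fin n → Vec (Fin n) m → Set
Avoids {m} i w = (j : Fin m) → ¬ i ≡ lookup w j

avoids? : ∀ {m n} (i : Fin n) (w : Vec (Fin n) m) → Dec (Avoids i w)
avoids? i w = F.all? (λ j → ¬? (i F.≟ lookup w j))

-- Words that avoid the letter i are the images under `punchIn i` of the words over an alphabet with
-- one letter fewer: the sum over the first letter loses its i-th term, and the rest is induction.
∑w-avoids : ∀ m n (i : Fin (suc n)) (G : Vec (Fin (suc n)) m → ℕ) →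
            ∑w m (suc n) (λ w → 𝟙 (avoids? i w) * G w) ≡ ∑w m n (λ u → G (mapᵥ (punchIn i) u))
∑w-avoids zero n i G = +-identityʳ (G []ᵥ)
∑w-avoids (suc m) n i G = begin
  sum (λ j → ∑w m (suc n) (λ w → 𝟙 (avoids? i (j ∷ᵥ w)) * G (j ∷ᵥ w)))
    ≡⟨ cong-S sum-additive (λ j → trans (cong-S (∑w-additive m (suc n)) (λ w → split j w))
         (*-S (∑w-additive m (suc n)) (𝟙 (¬? (i F.≟ j))) _)) ⟩
  sum (λ j → 𝟙 (¬? (i F.≟ j)) * T j)
    ≡⟨ sum-remove i (λ j → 𝟙 (¬? (i F.≟ j)) * T j) ⟩
  𝟙 (¬? (i F.≟ i)) * T i + sum (λ u → 𝟙 (¬? (i F.≟ punchIn i u)) * T (punchIn i u))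
    ≡⟨ cong₂ _+_ (cong (_* T i) (𝟙-no (¬? (i F.≟ i)) (λ p → p refl)))
         (cong-S sum-additive λ u → trans (cong (_* T (punchIn i u))
            (𝟙-yes (¬? (i F.≟ punchIn i u)) (λ e → F.punchInᵢ≢i i u (sym e)))) (+-identityʳ _)) ⟩
  sum (λ u → T (punchIn i u))
    ≡⟨ cong-S sum-additive (λ u → ∑w-avoids m n i (λ w → G (punchIn i u ∷ᵥ w))) ⟩
  sum (λ u → ∑w m n (λ w → G (punchIn i u ∷ᵥ mapᵥ (punchIn i) w))) ∎
  where
  open ≡-Reasoning
  T : Fin (suc n) → ℕ
  T j = ∑w m (suc n) (λ w → 𝟙 (avoids? i w) * G (j ∷ᵥ w))
  split : ∀ j w → 𝟙 (avoids? i (j ∷ᵥ w)) * G (j ∷ᵥ w) ≡ 𝟙 (¬? (i F.≟ j)) * (𝟙 (avoids? i w) * G (j ∷ᵥ w))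
  split j w = trans (cong (_* G (j ∷ᵥ w)) (trans
      (𝟙-cong (avoids? i (j ∷ᵥ w)) (¬? (i F.≟ j) ×-dec avoids? i w) (λ p → p fz , p ∘ fs) (λ { (p , q) fz → p ; (p , q) (fs l) → q l }))
      (𝟙-× (¬? (i F.≟ j)) (avoids? i w)))) (*-assoc (𝟙 (¬? (i F.≟ j))) _ _)

-- An injective word is a first letter i followed by an injective word avoiding i, hence, by
-- `∑w-avoids`, by a relabelled injective word over n letters. This is the recursion of `decode`.
∑w-inj : ∀ n (G : Vec (Fin n) n → ℕ) → ∑w n n (λ w → 𝟙 (inj? w) * G w) ≡ ∑ n (G ∘ decode)
∑w-inj zero G = trans (cong (_* G []ᵥ) (𝟙-yes (inj? []ᵥ) (λ ()))) (+-identityʳ (G []ᵥ))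
∑w-inj (suc n) G = cong-S sum-additive λ i → begin
  ∑w n (suc n) (λ w → 𝟙 (inj? (i ∷ᵥ w)) * G (i ∷ᵥ w))
    ≡⟨ cong-S (∑w-additive n (suc n)) (split i) ⟩
  ∑w n (suc n) (λ w → 𝟙 (avoids? i w) * (𝟙 (inj? w) * G (i ∷ᵥ w)))
    ≡⟨ ∑w-avoids n n i _ ⟩
  ∑w n n (λ u → 𝟙 (inj? (mapᵥ (punchIn i) u)) * G (i ∷ᵥ mapᵥ (punchIn i) u))
    ≡⟨ cong-S (∑w-additive n n) (λ u → cong (_* G (i ∷ᵥ mapᵥ (punchIn i) u))
         (𝟙-cong (inj? (mapᵥ (punchIn i) u)) (inj? u)
           (λ p j l e → p j l (trans (V.lookup-map j (punchIn i) u) (trans (cong (punchIn i) e) (sym (V.lookup-map l (punchIn i) u)))))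
           (λ p j l e → p j l (F.punchIn-injective i _ _ (trans (sym (V.lookup-map j (punchIn i) u)) (trans e (V.lookup-map l (punchIn i) u))))))) ⟩
  ∑w n n (λ u → 𝟙 (inj? u) * G (i ∷ᵥ mapᵥ (punchIn i) u))
    ≡⟨ ∑w-inj n (λ u → G (i ∷ᵥ mapᵥ (punchIn i) u)) ⟩
  ∑ n (λ σ → G (decode (i , σ))) ∎
  where
  open ≡-Reasoning
  to : ∀ i (w : Vec (Fin (suc n)) n) → Avoids i w × Inj w → Inj (i ∷ᵥ w)
  to i w (p , q) fz     fz     e = refl
  to i w (p , q) fz     (fs l) e = contradiction e (p l)
  to i w (p , q) (fs j) fz     e = contradiction (sym e) (p j)
  to i w (p , q) (fs j) (fs l) e = cong fs (q j l e)
  split : ∀ i (w : Vec (Fin (suc n)) n) → 𝟙 (inj? (i ∷ᵥ w)) * G (i ∷ᵥ w) ≡ 𝟙 (avoids? i w) * (𝟙 (inj? w) * G (i ∷ᵥ w))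
  split i w = trans (cong (_* G (i ∷ᵥ w)) (trans
    (𝟙-cong (inj? (i ∷ᵥ w)) (avoids? i w ×-dec inj? w)
      (λ p → (λ j e → case p fz (fs j) e of λ ()) , (λ j l e → F.suc-injective (p (fs j) (fs l) e))) (to i w))
    (𝟙-× (avoids? i w) (inj? w)))) (*-assoc (𝟙 (avoids? i w)) _ _)

∑l : ∀ {A : Set} → List A → (A → ℕ) → ℕ
∑l [] f = 0
∑l (x ∷ xs) f = f x + ∑l xs f

∑l-cong : ∀ {A : Set} (xs : List A) {f g : A → ℕ} → (∀ x → f x ≡ g x) → ∑l xs f ≡ ∑l xs g
∑l-cong [] e = refl
∑l-cong (x ∷ xs) e = cong₂ _+_ (e x) (∑l-cong xs e)

∑l-++ : ∀ {A : Set} (xs ys : List A) f → ∑l (xs ++ ys) f ≡ ∑l xs f + ∑l ys f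
∑l-++ [] ys f = refl
∑l-++ (x ∷ xs) ys f = trans (cong (f x +_) (∑l-++ xs ys f)) (sym (+-assoc (f x) _ _))

∑l-map : ∀ {A B : Set} (h : A → B) xs f → ∑l (map h xs) f ≡ ∑l xs (f ∘ h)
∑l-map h [] f = refl
∑l-map h (x ∷ xs) f = cong (f (h x) +_) (∑l-map h xs f)

∑l-concatMap : ∀ {A B : Set} (h : A → List B) xs f → ∑l (concatMap h xs) f ≡ ∑l xs (λ x → ∑l (h x) f)
∑l-concatMap h [] f = refl
∑l-concatMap h (x ∷ xs) f = trans (∑l-++ (h x) (concatMap h xs) f) (cong (∑l (h x) f +_) (∑l-concatMap h xs f))

∑l-tabulate : ∀ {A : Set} {n} (h : Fin n → A) f → ∑l (tabulate h) f ≡ sum (f ∘ h)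
∑l-tabulate {n = zero} h f = refl
∑l-tabulate {n = suc n} h f = cong (f (h fz) +_) (∑l-tabulate (h ∘ fs) f)

∑l-filter : ∀ {A : Set} {P : A → Set} (P? : Decidable P) xs f → ∑l (filter P? xs) f ≡ ∑l xs (λ x → 𝟙 (P? x) * f x)
∑l-filter P? [] f = refl
∑l-filter P? (x ∷ xs) f with P? x
... | yes p = cong₂ _+_ (sym (+-identityʳ (f x))) (∑l-filter P? xs f)
... | no ¬p = ∑l-filter P? xs f

length-∑l : ∀ {A : Set} (xs : List A) → length xs ≡ ∑l xs (λ _ → 1)
length-∑l []       = refl
length-∑l (x ∷ xs) = cong suc (length-∑l xs)

∑l-allWords : ∀ m n f → ∑l (allWords m n) f ≡ ∑w m n f
∑l-allWords zero n f = +-identityʳ _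
∑l-allWords (suc m) n f = trans (∑l-concatMap _ (allFin n) f)
  (trans (∑l-tabulate {n = n} id (λ i → ∑l (map (i ∷ᵥ_) (allWords m n)) f)) (cong-S sum-additive λ i → trans (∑l-map (i ∷ᵥ_) (allWords m n) f) (∑l-allWords m n (λ w → f (i ∷ᵥ w)))))

∑l-Sym : ∀ n f → ∑l (Sym n) f ≡ ∑ n (f ∘ decode)
∑l-Sym n f = begin
  ∑l (Sym n) f ≡⟨ ∑l-filter isPerm? (allWords n n) f ⟩
  ∑l (allWords n n) (λ w → 𝟙 (isPerm? w) * f w) ≡⟨ ∑l-cong (allWords n n) (λ w → cong (_* f w) (𝟙-cong (isPerm? w) (inj? w) (λ p → p) (λ p → p))) ⟩
  ∑l (allWords n n) (λ w → 𝟙 (inj? w) * f w) ≡⟨ ∑l-allWords n n _ ⟩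
  ∑w n n (λ w → 𝟙 (inj? w) * f w) ≡⟨ ∑w-inj n f ⟩
  ∑ n (f ∘ decode) ∎
  where open ≡-Reasoning

symSize≡ : ∀ n → symSize n ≡ n !
symSize≡ n = trans (length-∑l (Sym n)) (trans (∑l-Sym n _) (trans (∑-const n 1) (*-identityʳ (n !))))

comparablePairs≡ : ∀ n → comparablePairs n ≡
  ∑ n (λ π → ∑ n (λ τ → 𝟙 (bruhatLeq? (decode π) (decode τ))))
comparablePairs≡ n = begin
  comparablePairs n ≡⟨ length-∑l (filter D (cartesianProduct (Sym n) (Sym n))) ⟩
  ∑l (filter D (cartesianProduct (Sym n) (Sym n))) (λ _ → 1)
    ≡⟨ ∑l-filter D (cartesianProduct (Sym n) (Sym n)) _ ⟩
  ∑l (cartesianProduct (Sym n) (Sym n)) (λ p → 𝟙 (D p) * 1)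
    ≡⟨ pairs (Sym n) _ ⟩
  ∑l (Sym n) (λ π → ∑l (Sym n) (λ τ → 𝟙 (D (π , τ)) * 1))
    ≡⟨ ∑l-Sym n _ ⟩
  ∑ n (λ π → ∑l (Sym n) (λ τ → 𝟙 (D (decode π , τ)) * 1))
    ≡⟨ cong-S (∑-additive n) (λ π → trans (∑l-Sym n _) (cong-S (∑-additive n) (λ τ → *-identityʳ _))) ⟩
  ∑ n (λ π → ∑ n (λ τ → 𝟙 (bruhatLeq? (decode π) (decode τ)))) ∎
  where
  open ≡-Reasoning
  D : (p : Vec (Fin n) n × Vec (Fin n) n) → Dec (BruhatLeq (proj₁ p) (proj₂ p))
  D p = bruhatLeq? (proj₁ p) (proj₂ p)
  pairs : ∀ {A B : Set} (xs : List A) {ys : List B} (f : A × B → ℕ) →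
          ∑l (cartesianProduct xs ys) f ≡ ∑l xs (λ x → ∑l ys (λ y → f (x , y)))
  pairs []       f = refl
  pairs (x ∷ xs) {ys} f = trans (∑l-++ (map (x ,_) ys) _ f) (cong₂ _+_ (∑l-map (x ,_) ys f) (pairs xs f))

-- Correlation inequality for the strong Bruhat order

ρ-monoʳ : ∀ {n} (σ : Code n) a {b c} → b ≤ c → ρ σ a b ≤ ρ σ a c
-- One further column contains at most one point. In `⊑-head` this pays for the shift of the tail's
-- threshold by one when b lies between the two first values.
ρ-lip : ∀ {n} (σ : Code n) a b → ρ σ a (suc b) ≤ suc (ρ σ a b)

ρ-lip {zero}  σ       a       b = z≤n
ρ-lip {suc n} σ       zero    b = z≤n
ρ-lip {suc n} (k , σ) (suc a) b with <-cmp (toℕ k) b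
... | tri< k<b _ _ rewrite lt-yes (m≤n⇒m≤1+n k<b) | lt-yes k<b with b
...   | suc b′ = s≤s (ρ-lip σ a b′)
ρ-lip {suc n} (k , σ) (suc a) b | tri≈ _ refl _ rewrite lt-yes (≤-refl {suc b}) | lt-no (≤-refl {b}) = ≤-refl
ρ-lip {suc n} (k , σ) (suc a) b | tri> _ _ b<k rewrite lt-no b<k | lt-no (<⇒≤ b<k) = ρ-lip σ a b

ρ-monoʳ {zero}  σ       a       p = z≤n
ρ-monoʳ {suc n} σ       zero    p = z≤n
ρ-monoʳ {suc n} (k , σ) (suc a) {b} {c} p with <-≤-connex (toℕ k) b
... | inj₁ k<b rewrite lt-yes k<b | lt-yes (<-≤-trans k<b p) = s≤s (ρ-monoʳ σ a (∸-monoˡ-≤ 1 p))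
... | inj₂ b≤k rewrite lt-no b≤k with <-≤-connex (toℕ k) c
...   | inj₂ c≤k rewrite lt-no c≤k = ρ-monoʳ σ a p
...   | inj₁ k<c rewrite lt-yes k<c = m≤n⇒m≤1+n (ρ-monoʳ σ a (<⇒≤pred (≤-<-trans b≤k k<c)))

-- The Bruhat order upside down: a larger rank function belongs to a smaller permutation, so π ≤ τ
-- corresponds to τ ⊑ π.
_⊑_ : ∀ {n} → Code n → Code n → Set
σ ⊑ σ′ = ∀ a b → ρ σ a b ≤ ρ σ′ a b

⊑-cons : ∀ {n} (k : Fin (suc n)) {σ σ′ : Code n} → σ ⊑ σ′ → (k , σ) ⊑ (k , σ′)
⊑-cons k p zero    b = z≤n
⊑-cons k p (suc a) b = +-monoʳ-≤ (lt (toℕ k) b) (p a _)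

⊑-head : ∀ {n} {k l : Fin (suc n)} → toℕ l ≤ toℕ k → (σ : Code n) → (k , σ) ⊑ (l , σ)
⊑-head l≤k σ zero    b = z≤n
⊑-head {k = k} {l} l≤k σ (suc a) b with <-≤-connex (toℕ l) b
... | inj₂ b≤l rewrite lt-no b≤l | lt-no (≤-trans b≤l l≤k) = ≤-refl
... | inj₁ l<b rewrite lt-yes l<b with <-≤-connex (toℕ k) b
...   | inj₁ k<b rewrite lt-yes k<b = ≤-refl
...   | inj₂ b≤k rewrite lt-no b≤k with b
...     | suc b′ = ρ-lip σ a b′

-- What an induction over digits takes from an order on codes: prepending a digit is monotone, and
-- two first digits compare in the same direction for every tail. Reversal preserves both
-- properties, which gives `bruhatᵒᵖ` for the second permutation.
record DigitOrder : Set₁ where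
  field
    _≼_  : ∀ {n} → Code n → Code n → Set
    cons : ∀ {n} (k : Fin (suc n)) {σ σ′ : Code n} → σ ≼ σ′ → (k , σ) ≼ (k , σ′)
    head : ∀ {n} (k l : Fin (suc n)) → (∀ σ → (k , σ) ≼ (l , σ)) ⊎ (∀ σ → (l , σ) ≼ (k , σ))

  Mono : ∀ {n} → (Code n → ℕ) → Set
  Mono f = ∀ {σ σ′} → σ ≼ σ′ → f σ ≤ f σ′

bruhat bruhatᵒᵖ : DigitOrder
bruhat = record { _≼_ = _⊑_ ; cons = ⊑-cons ; head = head }
  where
  head : ∀ {n} (k l : Fin (suc n)) → (∀ σ → (k , σ) ⊑ (l , σ)) ⊎ (∀ σ → (l , σ) ⊑ (k , σ))
  head k l with ≤-total (toℕ k) (toℕ l)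
  ... | inj₁ p = inj₂ (⊑-head p)
  ... | inj₂ p = inj₁ (⊑-head p)
bruhatᵒᵖ = record { _≼_ = λ σ σ′ → σ′ ⊑ σ ; cons = λ k p → ⊑-cons k p ; head = λ k l → DigitOrder.head bruhat l k }

-- Chebyshev's sum inequality. Splitting off index 0 leaves cross terms, each bounded by the
-- rearrangement inequality for the pair 0, l.
chebyshev : ∀ {m} (f g : Fin m → ℕ) →
            (∀ k l → (f k ≤ f l × g k ≤ g l) ⊎ (f l ≤ f k × g l ≤ g k)) →
            sum f * sum g ≤ m * sum (λ k → f k * g k)
chebyshev {zero}  f g similar = z≤n
chebyshev {suc m} f g similar = begin
  (f fz + F) * (g fz + G) ≡⟨ expand (f fz) (g fz) F G ⟩
  f fz * g fz + (f fz * G + g fz * F) + F * G ≤⟨ +-mono-≤ (+-monoʳ-≤ (f fz * g fz) cross) (chebyshev (f ∘ fs) (g ∘ fs) (λ k l → similar (fs k) (fs l))) ⟩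
  f fz * g fz + (m * (f fz * g fz) + FG) + m * FG ≡⟨ collect (f fz * g fz) m FG ⟩
  suc m * (f fz * g fz + FG) ∎
  where
  open ≤-Reasoning
  F = sum (f ∘ fs)
  G = sum (g ∘ fs)
  FG = sum (λ k → f (fs k) * g (fs k))
  expand : ∀ a b x y → (a + x) * (b + y) ≡ a * b + (a * y + b * x) + x * y
  expand = solve-∀
  collect : ∀ p m q → p + (m * p + q) + m * q ≡ p + q + m * (p + q)
  collect = solve-∀
  rearrangement : ∀ {a b c d} → a ≤ c → b ≤ d → a * d + b * c ≤ a * b + c * d
  rearrangement {a} {b} a≤c b≤d with m≤n⇒∃[o]m+o≡n a≤c | m≤n⇒∃[o]m+o≡n b≤d
  ... | u , refl | v , refl = subst (a * (b + v) + b * (a + u) ≤_) (eq a b u v) (m≤m+n _ (u * v))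
    where
    eq : ∀ a b u v → a * (b + v) + b * (a + u) + u * v ≡ a * b + (a + u) * (b + v)
    eq = solve-∀
  flip-eq : ∀ a b c d → a * d + b * c ≡ c * b + d * a
  flip-eq = solve-∀
  cross₁ : ∀ l → f fz * g (fs l) + g fz * f (fs l) ≤ f fz * g fz + f (fs l) * g (fs l)
  cross₁ l with similar fz (fs l)
  ... | inj₁ (p , q) = rearrangement p q
  ... | inj₂ (p , q) = subst₂ _≤_
          (flip-eq (f (fs l)) (g (fs l)) (f fz) (g fz)) (+-comm (f (fs l) * g (fs l)) _) (rearrangement p q)
  cross : f fz * G + g fz * F ≤ m * (f fz * g fz) + FG
  cross = begin
    f fz * G + g fz * F
      ≡⟨ cong₂ _+_ (*-S sum-additive (f fz) (g ∘ fs)) (*-S sum-additive (g fz) (f ∘ fs)) ⟨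
    sum (λ l → f fz * g (fs l)) + sum (λ l → g fz * f (fs l)) ≡⟨ +-S sum-additive (λ l → f fz * g (fs l)) (λ l → g fz * f (fs l)) ⟨
    sum (λ l → f fz * g (fs l) + g fz * f (fs l)) ≤⟨ mono-S sum-additive cross₁ ⟩
    sum (λ l → f fz * g fz + f (fs l) * g (fs l)) ≡⟨ +-S (sum-additive {m}) _ _ ⟩
    sum {m} (λ l → f fz * g fz) + FG ≡⟨ cong (_+ FG) (sum-const m _) ⟩
    m * (f fz * g fz) + FG ∎

-- The sections at a fixed first value are monotone, and so are their averages as functions of that value.
harris : ∀ (O : DigitOrder) → let open DigitOrder O in
         ∀ n {f g : Code n → ℕ} → Mono f → Mono g → ∑ n f * ∑ n g ≤ n ! * ∑ n (λ σ → f σ * g σ)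
harris O zero    mf mg = m≤m+n _ 0
harris O (suc n) {f} {g} mf mg = begin
  sum F * sum G ≤⟨ chebyshev F G similar ⟩
  suc n * sum (λ k → F k * G k) ≤⟨ *-monoʳ-≤ (suc n) (mono-S sum-additive λ k → harris O n (mf ∘ cons k) (mg ∘ cons k)) ⟩
  suc n * sum (λ k → n ! * ∑ n (λ σ → f (k , σ) * g (k , σ)))
                                                   ≡⟨ cong (suc n *_) (*-S sum-additive (n !) (λ k → ∑ n (λ σ → f (k , σ) * g (k , σ)))) ⟩
  suc n * (n ! * ∑ (suc n) (λ σ → f σ * g σ)) ≡⟨ *-assoc (suc n) (n !) _ ⟨
  suc n ! * ∑ (suc n) (λ σ → f σ * g σ) ∎
  where
  open ≤-Reasoning
  open DigitOrder O
  F G : Fin (suc n) → ℕ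
  F k = ∑ n (λ σ → f (k , σ))
  G k = ∑ n (λ σ → g (k , σ))
  similar : ∀ k l → (F k ≤ F l × G k ≤ G l) ⊎ (F l ≤ F k × G l ≤ G k)
  similar k l with head k l
  ... | inj₁ p = inj₁ (mono-S (∑-additive n) (λ σ → mf (p σ)) , mono-S (∑-additive n) (λ σ → mg (p σ)))
  ... | inj₂ p = inj₂ (mono-S (∑-additive n) (λ σ → mf (p σ)) , mono-S (∑-additive n) (λ σ → mg (p σ)))

∑∑ : ∀ n → (Code n → Code n → ℕ) → ℕ
∑∑ n f = ∑ n (λ π → ∑ n (λ τ → f π τ))

-- The direction fits events of the form r_τ ≤ r_π: they survive when r_π grows and r_τ shrinks.
Mono₂ : ∀ {n} → (Code n → Code n → ℕ) → Set
Mono₂ f = ∀ {π π′ τ τ′} → π ⊑ π′ → τ′ ⊑ τ → f π τ ≤ f π′ τ′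

⊑-refl : ∀ {n} (σ : Code n) → σ ⊑ σ
⊑-refl σ a b = ≤-refl

-- The sums over τ are again monotone in π, so Harris applies to them first; then, for each fixed π,
-- it applies in τ with the reversed order.
harris₂ : ∀ n {f g : Code n → Code n → ℕ} → Mono₂ f → Mono₂ g →
          ∑∑ n f * ∑∑ n g ≤ n ! * n ! * ∑∑ n (λ π τ → f π τ * g π τ)
harris₂ n {f} {g} mf mg = begin
  ∑∑ n f * ∑∑ n g
    ≤⟨ harris bruhat n (λ p → mono-S (∑-additive n) (λ τ → mf p (⊑-refl τ))) (λ p → mono-S (∑-additive n) (λ τ → mg p (⊑-refl τ))) ⟩
  n ! * ∑ n (λ π → ∑ n (f π) * ∑ n (g π))
    ≤⟨ *-monoʳ-≤ (n !) (mono-S (∑-additive n) λ π → harris bruhatᵒᵖ n (λ p → mf (⊑-refl π) p) (λ p → mg (⊑-refl π) p)) ⟩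
  n ! * ∑ n (λ π → n ! * ∑ n (λ τ → f π τ * g π τ))
    ≡⟨ cong (n ! *_) (*-S (∑-additive n) (n !) _) ⟩
  n ! * (n ! * ∑∑ n (λ π τ → f π τ * g π τ)) ≡⟨ *-assoc (n !) (n !) _ ⟨
  n ! * n ! * ∑∑ n (λ π τ → f π τ * g π τ) ∎
  where open ≤-Reasoning

-- Inverse and complement

ρ-zeroʳ : ∀ {n} (σ : Code n) a → ρ σ a 0 ≡ 0
ρ-zeroʳ {zero}  σ       a       = refl
ρ-zeroʳ {suc n} σ       zero    = refl
ρ-zeroʳ {suc n} (k , σ) (suc a) = ρ-zeroʳ σ a

ρ-zeroˡ : ∀ {n} (σ : Code n) b → ρ σ 0 b ≡ 0
ρ-zeroˡ {zero}  σ b = refl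
ρ-zeroˡ {suc n} σ b = refl

-- Deleting row 0 (value suc k) and column 0 (in row suc l) in either order leaves the same permutation.
inv : ∀ n → Code n → Code n
inv zero          _          = tt
inv (suc n)       (fz , σ)   = fz , inv n σ
inv (suc (suc n)) (fs k , σ) = fs (proj₁ (inv (suc n) σ)) , inv (suc n) (k , inv n (proj₂ (inv (suc n) σ)))

ρ-inv : ∀ n (σ : Code n) a b → ρ (inv n σ) a b ≡ ρ σ b a
ρ-inv zero          σ          a       b       = refl
ρ-inv (suc n)       σ          zero    b       = trans (ρ-zeroˡ (inv (suc n) σ) b) (sym (ρ-zeroʳ σ b))
ρ-inv (suc n)       σ          (suc a) zero    = trans (ρ-zeroʳ (inv (suc n) σ) (suc a)) (sym (ρ-zeroˡ σ (suc a)))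
ρ-inv (suc n)       (fz , σ)   (suc a) (suc b) = cong suc (ρ-inv n σ a b)
ρ-inv (suc (suc n)) (fs k , σ) (suc a) (suc b) = begin
  lb + ρ (inv (suc n) (k , inv n σ″)) a (suc b ∸ lb) ≡⟨ cong (lb +_) (ρ-inv (suc n) (k , inv n σ″) a (suc b ∸ lb)) ⟩
  lb + ρ (k , inv n σ″) (suc b ∸ lb) a ≡⟨ cong (λ x → lb + ρ (k , inv n σ″) x a) (+-∸-assoc 1 (lt≤ (toℕ l) b)) ⟩
  lb + (ka + ρ (inv n σ″) (b ∸ lb) (a ∸ ka)) ≡⟨ cong (λ x → lb + (ka + x)) (ρ-inv n σ″ (b ∸ lb) (a ∸ ka)) ⟩
  lb + (ka + ρ σ″ (a ∸ ka) (b ∸ lb)) ≡⟨ swap-+ lb ka _ ⟩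
  ka + ρ (l , σ″) (suc (a ∸ ka)) b ≡⟨ cong (λ x → ka + ρ (inv (suc n) σ) x b) (+-∸-assoc 1 (lt≤ (toℕ k) a)) ⟨
  ka + ρ (inv (suc n) σ) (suc a ∸ ka) b ≡⟨ cong (ka +_) (ρ-inv (suc n) σ (suc a ∸ ka) b) ⟩
  ka + ρ σ b (suc a ∸ ka) ∎
  where
  open ≡-Reasoning
  l = proj₁ (inv (suc n) σ)
  σ″ = proj₂ (inv (suc n) σ)
  lb = lt (toℕ l) b
  ka = lt (toℕ k) a
  swap-+ : ∀ x y z → x + (y + z) ≡ y + (x + z)
  swap-+ = solve-∀

-- On codes with nonzero first digit, `inv` consists of three inversions of smaller codes and an
-- interchange of the digits k and l. Each of these preserves the sum.
∑-inv : ∀ n (G : Code n → ℕ) → ∑ n (λ σ → G (inv n σ)) ≡ ∑ n G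
∑-inv zero G = refl
∑-inv (suc zero) G = refl
∑-inv (suc (suc n)) G = cong₂ _+_ (∑-inv (suc n) (λ σ → G (fz , σ))) (begin
  sum (λ k → ∑ (suc n) (λ σ → H k (inv (suc n) σ)))
    ≡⟨ cong-S sum-additive (λ k → ∑-inv (suc n) (H k)) ⟩
  sum (λ k → sum (λ l → ∑ n (λ σ → G (fs l , inv (suc n) (k , inv n σ)))))
    ≡⟨ cong-S sum-additive (λ k → cong-S sum-additive (λ l → ∑-inv n (λ σ → G (fs l , inv (suc n) (k , σ))))) ⟩
  sum (λ k → sum (λ l → ∑ n (λ σ → G (fs l , inv (suc n) (k , σ)))))
    ≡⟨ sum-swap sum-additive (λ l k → ∑ n (λ σ → G (fs l , inv (suc n) (k , σ)))) ⟩
  sum (λ l → ∑ (suc n) (λ θ → G (fs l , inv (suc n) θ)))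
    ≡⟨ cong-S sum-additive (λ l → ∑-inv (suc n) (λ θ → G (fs l , θ))) ⟩
  sum (λ l → ∑ (suc n) (λ θ → G (fs l , θ))) ∎)
  where
  open ≡-Reasoning
  H : Fin (suc n) → Code (suc n) → ℕ
  H k θ = G (fs (proj₁ θ) , inv (suc n) (k , inv n (proj₂ θ)))

-- Reflection of the values acts digit by digit, because relabelling after a deletion commutes with
-- reflection.
comp : ∀ n → Code n → Code n
comp zero    _       = tt
comp (suc n) (k , σ) = opposite k , comp n σ

lt-opposite : ∀ {n} (k : Fin (suc n)) {b} → b ≤ suc n →
              (suc n ∸ b ≤ toℕ k × lt (toℕ (opposite k)) b ≡ 1 × lt (toℕ k) (suc n ∸ b) ≡ 0) ⊎
              (toℕ k < suc n ∸ b × lt (toℕ (opposite k)) b ≡ 0 × lt (toℕ k) (suc n ∸ b) ≡ 1)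
lt-opposite {n} k {b} b≤ rewrite F.opposite-prop k with <-≤-connex (toℕ k) (suc n ∸ b)
... | inj₁ p = inj₂ (p , lt-no (m+n≤o⇒m≤o∸n b (≤-pred (subst (_≤ suc n) (+-suc b (toℕ k)) (m≤n∸o⇒o+m≤n′ b≤ p)))) , lt-yes p)
  where
  m≤n∸o⇒o+m≤n′ : ∀ {m n o} → o ≤ n → m ≤ n ∸ o → o + m ≤ n
  m≤n∸o⇒o+m≤n′ {m} {n} {o} o≤n q = subst (o + m ≤_) (m+[n∸m]≡n o≤n) (+-monoʳ-≤ o q)
... | inj₂ p = inj₁ (p , lt-yes (+-cancelʳ-< (toℕ k) _ _ lemma) , lt-no p)
  where
  lemma : n ∸ toℕ k + toℕ k < b + toℕ k
  lemma = subst₂ _≤_ (cong suc (sym (m∸n+n≡m (F.toℕ≤pred[n] k)))) refl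
            (subst (_≤ b + toℕ k) (m+[n∸m]≡n b≤) (+-monoʳ-≤ b p))

ρ-comp : ∀ n (σ : Code n) {a b} → a ≤ n → b ≤ n → ρ (comp n σ) a b + ρ σ a (n ∸ b) ≡ a
ρ-comp zero    σ       z≤n     b≤ = refl
ρ-comp (suc n) σ       {zero}  z≤n b≤ = refl
ρ-comp (suc n) (k , σ) {suc a} {b} (s≤s a≤n) b≤ with lt-opposite k b≤
... | inj₁ (p , e₁ , e₂) rewrite e₁ | e₂ with b
...   | zero  = contradiction (≤-trans p (F.toℕ≤pred[n] k)) (<⇒≱ ≤-refl)
...   | suc b′ = cong suc (ρ-comp n σ a≤n (≤-pred b≤))
ρ-comp (suc n) (k , σ) {suc a} {b} (s≤s a≤n) b≤ | inj₂ (p , e₁ , e₂) rewrite e₁ | e₂ =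
  trans (+-suc (ρ (comp n σ) a b) _) (cong suc (trans (cong (λ x → ρ (comp n σ) a b + ρ σ a x) (∸-+-assoc-comm)) (ρ-comp n σ a≤n b≤n)))
  where
  b≤n : b ≤ n
  b≤n = ≮⇒≥ λ n<b → case subst (toℕ k <_) (m≤n⇒m∸n≡0 n<b) p of λ ()
  ∸-+-assoc-comm : suc n ∸ b ∸ 1 ≡ n ∸ b
  ∸-+-assoc-comm = cong (_∸ 1) (+-∸-assoc 1 b≤n)

∑-comp : ∀ n (G : Code n → ℕ) → ∑ n (λ σ → G (comp n σ)) ≡ ∑ n G
∑-comp zero G = refl
∑-comp (suc n) G = begin
  sum (λ k → ∑ n (λ σ → G (opposite k , comp n σ))) ≡⟨ cong-S sum-additive (λ k → ∑-comp n (λ σ → G (opposite k , σ))) ⟩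
  sum (λ k → f (opposite k)) ≡⟨ sum≡ (f ∘ opposite) ⟩
  Sumₚ.sum (λ k → f (opposite k)) ≡⟨ Sumₚ.sum-permute f Perm.reverse ⟨
  Sumₚ.sum f ≡⟨ sum≡ f ⟨
  sum f ∎
  where
  open ≡-Reasoning
  f : Fin (suc n) → ℕ
  f k = ∑ n (λ σ → G (k , σ))

-- Moments of the rank and the two-parameter maximal inequality

sum-lt : ∀ m b (g : ℕ → ℕ) → b ≤ m → sum {m} (λ k → g (lt (toℕ k) b)) ≡ b * g 1 + (m ∸ b) * g 0
sum-lt m zero g p = sum-const m (g 0)
sum-lt (suc m) (suc b) g (s≤s p) = trans (cong (g 1 +_) (sum-lt m b g p)) (sym (+-assoc (g 1) (b * g 1) _))

∑-ρ-step : ∀ n a b (h : ℕ → ℕ) → b ≤ suc n →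
           ∑ (suc n) (λ σ → h (ρ σ (suc a) b)) ≡
           b * ∑ n (λ σ → h (suc (ρ σ a (b ∸ 1)))) + (suc n ∸ b) * ∑ n (λ σ → h (ρ σ a b))
∑-ρ-step n a b h p = sum-lt (suc n) b (λ x → ∑ n (λ σ → h (x + ρ σ a (b ∸ x)))) p

∑-suc : ∀ n (f : Code n → ℕ) → ∑ n (λ σ → suc (f σ)) ≡ n ! + ∑ n f
∑-suc n f = trans (+-S (∑-additive n) (λ _ → 1) f) (cong (_+ ∑ n f) (trans (∑-const n 1) (*-identityʳ (n !))))

-- The mean of the rank on `suc n` letters is ab/(n + 1); multiplied by (n + 1)! it becomes an
-- integer identity. The induction conditions on the first row.
first-moment : ∀ n {a b} → a ≤ suc n → b ≤ suc n → ∑ (suc n) (λ σ → ρ σ a b) ≡ n ! * (a * b)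
first-moment n {zero}  {b} p q = trans (∑-const (suc n) 0) (trans (*-zeroʳ (suc n !)) (sym (*-zeroʳ (n !))))
first-moment n {suc a} {zero} p q =
  trans (cong-S (∑-additive (suc n)) λ σ → ρ-zeroʳ σ (suc a)) (trans (∑-const (suc n) 0)
    (trans (*-zeroʳ (suc n !)) (sym (trans (cong (n ! *_) (*-zeroʳ (suc a))) (*-zeroʳ (n !))))))
first-moment zero {suc zero} {suc zero} p q = refl
first-moment zero {suc (suc a)} (s≤s ()) q
first-moment zero {suc zero} {suc (suc b)} p (s≤s ())
first-moment (suc n) {suc a} {suc b} (s≤s p) (s≤s q) = begin
  ∑ (2 + n) (λ σ → ρ σ (suc a) (suc b))
    ≡⟨ ∑-ρ-step (suc n) a (suc b) id (s≤s q) ⟩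
  suc b * ∑ (suc n) (λ σ → suc (ρ σ a b)) + c * ∑ (suc n) (λ σ → ρ σ a (suc b))
    ≡⟨ cong₂ (λ x y → suc b * x + y) (trans (∑-suc (suc n) (λ σ → ρ σ a b)) (cong (suc n ! +_) (first-moment n p q))) right ⟩
  suc b * (suc n ! + n ! * (a * b)) + c * (n ! * (a * suc b))
    ≡⟨ cong (λ x → suc b * (x * n ! + n ! * (a * b)) + c * (n ! * (a * suc b))) (sym (m+[n∸m]≡n q)) ⟩
  suc b * ((b + c) * n ! + n ! * (a * b)) + c * (n ! * (a * suc b))
    ≡⟨ alg a b c (n !) ⟩
  ((b + c) * n !) * (suc a * suc b)
    ≡⟨ cong (λ x → (x * n !) * (suc a * suc b)) (m+[n∸m]≡n q) ⟩
  suc n ! * (suc a * suc b) ∎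
  where
  open ≡-Reasoning
  c = suc n ∸ b
  alg : ∀ a b c w → suc b * ((b + c) * w + w * (a * b)) + c * (w * (a * suc b)) ≡ ((b + c) * w) * (suc a * suc b)
  alg = solve-∀
  -- For b = suc n the column count is beyond the range of the induction hypothesis, but then the
  -- factor c vanishes.
  right : c * ∑ (suc n) (λ σ → ρ σ a (suc b)) ≡ c * (n ! * (a * suc b))
  right with m≤n⇒m<n∨m≡n q
  ... | inj₁ b<n = cong (c *_) (first-moment n p b<n)
  ... | inj₂ refl rewrite n∸n≡0 n = refl

∑-suc² : ∀ n (f : Code n → ℕ) → ∑ n (λ σ → suc (f σ) * suc (f σ)) ≡ n ! + 2 * ∑ n f + ∑ n (λ σ → f σ * f σ)
∑-suc² n f = begin
  ∑ n (λ σ → suc (f σ) * suc (f σ)) ≡⟨ cong-S A (λ σ → alg (f σ)) ⟩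
  ∑ n (λ σ → suc (2 * f σ) + f σ * f σ) ≡⟨ +-S A (λ σ → suc (2 * f σ)) (λ σ → f σ * f σ) ⟩
  ∑ n (λ σ → suc (2 * f σ)) + _ ≡⟨ cong (_+ ∑ n (λ σ → f σ * f σ)) (trans (∑-suc n (λ σ → 2 * f σ)) (cong (n ! +_) (*-S A 2 f))) ⟩
  n ! + 2 * ∑ n f + ∑ n (λ σ → f σ * f σ) ∎
  where
  open ≡-Reasoning
  A = ∑-additive n
  alg : ∀ x → suc x * suc x ≡ suc (2 * x) + x * x
  alg = solve-∀

-- Σ ρ² = n! (a(a-1)b(b-1) + (n+1)ab), with both sides moved so that no subtraction occurs.
second-moment : ∀ n {a b} → a ≤ 2 + n → b ≤ 2 + n →
  ∑ (2 + n) (λ σ → ρ σ a b * ρ σ a b) + n ! * (a * a * b + a * (b * b)) ≡ n ! * (a * a * (b * b) + (2 + n) * (a * b))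
second-moment n {zero} {b} p q =
  trans (cong (_+ n ! * 0) (trans (∑-const (2 + n) 0) (*-zeroʳ ((2 + n) !)))) (cong (n ! *_) (sym (*-zeroʳ (2 + n))))
second-moment n {suc a} {zero} p q = begin
  ∑ (2 + n) (λ σ → ρ σ (suc a) 0 * ρ σ (suc a) 0) + n ! * (suc a * suc a * 0 + suc a * 0)
    ≡⟨ cong (_+ n ! * (suc a * suc a * 0 + suc a * 0)) (trans (cong-S (∑-additive (2 + n)) λ σ → cong (λ x → x * x) (ρ-zeroʳ σ (suc a))) (trans (∑-const (2 + n) 0) (*-zeroʳ ((2 + n) !)))) ⟩
  n ! * (suc a * suc a * 0 + suc a * 0) ≡⟨ alg a n (n !) ⟩
  n ! * (suc a * suc a * 0 + (2 + n) * (suc a * 0)) ∎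
  where
  open ≡-Reasoning
  alg : ∀ a n w → w * (suc a * suc a * 0 + suc a * 0) ≡ w * (suc a * suc a * 0 + (2 + n) * (suc a * 0))
  alg = solve-∀
second-moment n {suc a} {suc b} (s≤s p) (s≤s q) = begin
  ∑ (2 + n) (λ σ → ρ σ (suc a) (suc b) * ρ σ (suc a) (suc b)) + Z
    ≡⟨ cong (_+ Z) (∑-ρ-step (suc n) a (suc b) (λ x → x * x) (s≤s q)) ⟩
  suc b * ∑ (suc n) (λ σ → suc (ρ σ a b) * suc (ρ σ a b)) + c * X (suc b) + Z
    ≡⟨ cong (λ x → suc b * x + c * X (suc b) + Z) (trans (∑-suc² (suc n) (λ σ → ρ σ a b)) (cong (λ x → suc n ! + 2 * x + X b) (first-moment n p q))) ⟩
  suc b * (suc n ! + 2 * (n ! * (a * b)) + X b) + c * X (suc b) + Z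
    ≡⟨ finish n c p (m+[n∸m]≡n q) (λ c≢0 → ≰⇒> λ n<b → c≢0 (m≤n⇒m∸n≡0 n<b)) ⟩
  n ! * (suc a * suc a * (suc b * suc b) + (2 + n) * (suc a * suc b)) ∎
  where
  open ≡-Reasoning
  c = suc n ∸ b
  X : ℕ → ℕ
  X b = ∑ (suc n) (λ σ → ρ σ a b * ρ σ a b)
  Z = n ! * (suc a * suc a * suc b + suc a * (suc b * suc b))
  X₁ : ∀ {a} b → a ≤ 1 → b ≤ 1 → ∑ 1 (λ σ → ρ σ a b * ρ σ a b) ≡ a * b
  X₁ zero z≤n q = refl
  X₁ zero (s≤s z≤n) q = refl
  X₁ (suc zero) z≤n q = refl
  X₁ (suc zero) (s≤s z≤n) q = refl
  X₁ (suc (suc b)) z≤n q = refl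
  X₁ (suc (suc b)) (s≤s z≤n) (s≤s ())
  finish : ∀ n c → a ≤ suc n → b + c ≡ suc n → (¬ c ≡ 0 → b < suc n) →
    suc b * (suc n ! + 2 * (n ! * (a * b)) + ∑ (suc n) (λ σ → ρ σ a b * ρ σ a b)) + c * ∑ (suc n) (λ σ → ρ σ a (suc b) * ρ σ a (suc b))
      + n ! * (suc a * suc a * suc b + suc a * (suc b * suc b)) ≡
    n ! * (suc a * suc a * (suc b * suc b) + (2 + n) * (suc a * suc b))
  finish zero c p e c≢0 = begin
    suc b * (1 + 2 * (1 * (a * b)) + ∑ 1 (λ σ → ρ σ a b * ρ σ a b)) + c * ∑ 1 (λ σ → ρ σ a (suc b) * ρ σ a (suc b)) + 1 * W
      ≡⟨ cong₂ (λ x y → suc b * (1 + 2 * (1 * (a * b)) + x) + y + 1 * W) (X₁ b p (m+n≤o⇒m≤o b (≤-reflexive e))) (right c c≢0) ⟩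
    suc b * (1 + 2 * (1 * (a * b)) + a * b) + c * (a * suc b) + 1 * W ≡⟨ alg′ c p e ⟩
    1 * (suc a * suc a * (suc b * suc b) + 2 * (suc a * suc b)) ∎
    where
    W = suc a * suc a * suc b + suc a * (suc b * suc b)
    right : ∀ c → (¬ c ≡ 0 → b < 1) → c * ∑ 1 (λ σ → ρ σ a (suc b) * ρ σ a (suc b)) ≡ c * (a * suc b)
    right zero    _  = refl
    right (suc c) hb = cong (suc c *_) (X₁ (suc b) p (hb λ ()))
    alg0 : ∀ b c → suc b * (1 + 2 * (1 * (0 * b)) + 0 * b) + c * (0 * suc b) + 1 * (1 * 1 * suc b + 1 * (suc b * suc b)) ≡ 1 * (1 * 1 * (suc b * suc b) + 2 * (1 * suc b))
    alg0 = solve-∀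
    alg1 : ∀ b c → suc b * (1 + 2 * (1 * (1 * b)) + 1 * b) + c * (1 * suc b) + 1 * (2 * 2 * suc b + 2 * (suc b * suc b)) ≡ suc b * (5 + (b + c) + 2 * b + 2 * suc b)
    alg1 = solve-∀
    alg2 : ∀ b → suc b * (5 + 1 + 2 * b + 2 * suc b) ≡ 1 * (2 * 2 * (suc b * suc b) + 2 * (2 * suc b))
    alg2 = solve-∀
    alg′ : ∀ {a} c → a ≤ 1 → b + c ≡ 1 → suc b * (1 + 2 * (1 * (a * b)) + a * b) + c * (a * suc b) + 1 * (suc a * suc a * suc b + suc a * (suc b * suc b)) ≡ 1 * (suc a * suc a * (suc b * suc b) + 2 * (suc a * suc b))
    alg′ c z≤n       e = alg0 b c
    alg′ c (s≤s z≤n) e = trans (alg1 b c) (trans (cong (λ x → suc b * (5 + x + 2 * b + 2 * suc b)) e) (alg2 b))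
  finish (suc n) c p e c≢0 = +-cancelʳ-≡ (R₁ + R₂) _ _ (begin
    suc b * (suc (suc n) ! + 2 * (suc n ! * (a * b)) + Xb) + c * Xsb + Z′ + (suc b * (n ! * U) + c * (n ! * U′))
      ≡⟨ alg1 b c (suc (suc n) ! + 2 * (suc n ! * (a * b))) Xb Xsb Z′ (n ! * U) (n ! * U′) ⟩
    suc b * (suc (suc n) ! + 2 * (suc n ! * (a * b)) + (Xb + n ! * U)) + c * (Xsb + n ! * U′) + Z′
      ≡⟨ cong₂ (λ x y → suc b * (suc (suc n) ! + 2 * (suc n ! * (a * b)) + x) + y + Z′) (second-moment n p (m+n≤o⇒m≤o b (≤-reflexive e))) (right c c≢0) ⟩
    suc b * (suc (suc n) ! + 2 * (suc n ! * (a * b)) + n ! * V) + c * (n ! * V′) + Z′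
      ≡⟨ alg2 a b c (suc n) (n !) e ⟩
    suc n ! * (suc a * suc a * (suc b * suc b) + (3 + n) * (suc a * suc b)) + (suc b * (n ! * U) + c * (n ! * U′)) ∎)
    where
    Xb = ∑ (2 + n) (λ σ → ρ σ a b * ρ σ a b)
    Xsb = ∑ (2 + n) (λ σ → ρ σ a (suc b) * ρ σ a (suc b))
    Z′ = suc n ! * (suc a * suc a * suc b + suc a * (suc b * suc b))
    U = a * a * b + a * (b * b)
    U′ = a * a * suc b + a * (suc b * suc b)
    V = a * a * (b * b) + (2 + n) * (a * b)
    V′ = a * a * (suc b * suc b) + (2 + n) * (a * suc b)
    R₁ = suc b * (n ! * U)
    R₂ = c * (n ! * U′)
    right : ∀ c → (¬ c ≡ 0 → b < 2 + n) → c * (Xsb + n ! * U′) ≡ c * (n ! * V′)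
    right zero    _  = refl
    right (suc c) hb = cong (suc c *_) (second-moment n p (hb λ ()))
    alg1 : ∀ b c t x y z u v → suc b * (t + x) + c * y + z + (suc b * u + c * v) ≡ suc b * (t + (x + u)) + c * (y + v) + z
    alg1 = solve-∀
    alg2-0 : ∀ a m w →
       1 * (suc m * (m * w) + 2 * (m * w * (a * 0)) + w * (a * a * (0 * 0) + suc m * (a * 0))) + suc m * (w * (a * a * (1 * 1) + suc m * (a * 1))) + m * w * (suc a * suc a * 1 + suc a * (1 * 1))
       ≡ m * w * (suc a * suc a * (1 * 1) + (2 + m) * (suc a * 1)) + (1 * (w * (a * a * 0 + a * (0 * 0))) + suc m * (w * (a * a * 1 + a * (1 * 1))))
    alg2-0 = solve-∀
    alg2-s : ∀ a b c w →
       (2 + b) * ((1 + b + c) * ((b + c) * w) + 2 * ((b + c) * w * (a * suc b)) + w * (a * a * (suc b * suc b) + (1 + b + c) * (a * suc b))) + c * (w * (a * a * ((2 + b) * (2 + b)) + (1 + b + c) * (a * (2 + b)))) + (b + c) * w * (suc a * suc a * (2 + b) + suc a * ((2 + b) * (2 + b)))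
       ≡ (b + c) * w * (suc a * suc a * ((2 + b) * (2 + b)) + (2 + b + c) * (suc a * (2 + b))) + ((2 + b) * (w * (a * a * suc b + a * (suc b * suc b))) + c * (w * (a * a * (2 + b) + a * ((2 + b) * (2 + b)))))
    alg2-s = solve-∀
    alg2 : ∀ a b c m w → b + c ≡ suc m →
       suc b * (suc m * (m * w) + 2 * (m * w * (a * b)) + w * (a * a * (b * b) + suc m * (a * b))) + c * (w * (a * a * (suc b * suc b) + suc m * (a * suc b))) + m * w * (suc a * suc a * suc b + suc a * (suc b * suc b))
       ≡ m * w * (suc a * suc a * (suc b * suc b) + (2 + m) * (suc a * suc b)) + (suc b * (w * (a * a * b + a * (b * b))) + c * (w * (a * a * suc b + a * (suc b * suc b))))
    alg2 a zero    c m w refl = alg2-0 a m w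
    alg2 a (suc b) c .(b + c) w refl = alg2-s a b c w

m²+n²≡dist²+2mn : ∀ m n → ∣ m - n ∣ * ∣ m - n ∣ + 2 * (m * n) ≡ m * m + n * n
m²+n²≡dist²+2mn zero    n       = +-identityʳ (n * n)
m²+n²≡dist²+2mn (suc m) zero    = trans (cong (suc m * suc m +_) (cong (2 *_) (*-zeroʳ (suc m)))) refl
m²+n²≡dist²+2mn (suc m) (suc n) = begin
  d + 2 * (suc m * suc n) ≡⟨ alg₁ d m n ⟩
  d + 2 * (m * n) + 2 * (m + n + 1) ≡⟨ cong (_+ 2 * (m + n + 1)) (m²+n²≡dist²+2mn m n) ⟩
  m * m + n * n + 2 * (m + n + 1) ≡⟨ alg₂ m n ⟩
  suc m * suc m + suc n * suc n ∎
  where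
  open ≡-Reasoning
  d = ∣ m - n ∣ * ∣ m - n ∣
  alg₁ : ∀ d m n → d + 2 * (suc m * suc n) ≡ d + 2 * (m * n) + 2 * (m + n + 1)
  alg₁ = solve-∀
  alg₂ : ∀ m n → m * m + n * n + 2 * (m + n + 1) ≡ suc m * suc m + suc n * suc n
  alg₂ = solve-∀

2mn≤m²+n² : ∀ m n → 2 * (m * n) ≤ m * m + n * n
2mn≤m²+n² m n = subst (2 * (m * n) ≤_) (m²+n²≡dist²+2mn m n) (m≤n+m (2 * (m * n)) (∣ m - n ∣ * ∣ m - n ∣))

-- n times the distance of the rank from its mean ab/n.
dev : ∀ n → Code n → ℕ → ℕ → ℕ
dev n σ a b = ∣ n * ρ σ a b - a * b ∣

-- In normalised form Var ρ ≤ ab/N. `T` is the cross term of the square and `U` the negative part of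
-- the second moment; both are added on each side so that no subtraction occurs.
variance : ∀ n {a b} → a ≤ 2 + n → b ≤ 2 + n →
           ∑ (2 + n) (λ σ → dev (2 + n) σ a b * dev (2 + n) σ a b) ≤ (2 + n) ! * ((2 + n) * (a * b))
variance n {a} {b} p q = +-cancelʳ-≤ (T + U) _ _ (begin
  ∑ N (λ σ → dev N σ a b * dev N σ a b) + (T + U)
    ≡⟨ +-assoc V T U ⟨
  V + T + U
    ≡⟨ cong (_+ U) sums ⟩
  N * N * R₂ + N ! * (a * b * (a * b)) + U
    ≡⟨ alg₁ N R₂ (N !) (a * b * (a * b)) (n !) (a * a * b + a * (b * b)) ⟩
  N * N * (R₂ + n ! * (a * a * b + a * (b * b))) + N ! * (a * b * (a * b))
    ≡⟨ cong (λ x → N * N * x + N ! * (a * b * (a * b))) (second-moment n p q) ⟩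
  N * N * (n ! * (a * a * (b * b) + N * (a * b))) + N ! * (a * b * (a * b))
    ≤⟨ final p q ⟩
  N ! * (N * (a * b)) + (T + U) ∎)
  where
  open ≤-Reasoning
  N = 2 + n
  A = ∑-additive N
  R₁ = ∑ N (λ σ → ρ σ a b)
  R₂ = ∑ N (λ σ → ρ σ a b * ρ σ a b)
  V = ∑ N (λ σ → dev N σ a b * dev N σ a b)
  T = 2 * (N * (a * b) * (suc n ! * (a * b)))
  U = N * N * (n ! * (a * a * b + a * (b * b)))
  alg₁ : ∀ N R w x v y → N * N * R + w * x + N * N * (v * y) ≡ N * N * (R + v * y) + w * x
  alg₁ = solve-∀
  alg₂ : ∀ N r a b → 2 * (N * r * (a * b)) ≡ 2 * (N * (a * b)) * r
  alg₂ = solve-∀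
  alg₃ : ∀ N r → N * r * (N * r) ≡ N * N * (r * r)
  alg₃ = solve-∀
  alg₄ : ∀ N x r → 2 * (N * x * r) ≡ 2 * (N * x) * r
  alg₄ = solve-∀
  pointwise : ∀ σ → dev N σ a b * dev N σ a b + 2 * (N * (a * b)) * ρ σ a b ≡ N * N * (ρ σ a b * ρ σ a b) + a * b * (a * b)
  pointwise σ = trans (cong (dev N σ a b * dev N σ a b +_) (sym (alg₂ N (ρ σ a b) a b)))
    (trans (m²+n²≡dist²+2mn (N * ρ σ a b) (a * b)) (cong (_+ a * b * (a * b)) (alg₃ N (ρ σ a b))))
  sums : V + T ≡ N * N * R₂ + N ! * (a * b * (a * b))
  sums = begin-equality
    V + T ≡⟨ cong (V +_) (trans (alg₄ N (a * b) (suc n ! * (a * b))) (cong (2 * (N * (a * b)) *_) (sym (first-moment (suc n) p q)))) ⟩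
    V + 2 * (N * (a * b)) * R₁ ≡⟨ cong (V +_) (*-S A (2 * (N * (a * b))) (λ σ → ρ σ a b)) ⟨
    V + ∑ N (λ σ → 2 * (N * (a * b)) * ρ σ a b) ≡⟨ +-S A (λ σ → dev N σ a b * dev N σ a b) (λ σ → 2 * (N * (a * b)) * ρ σ a b) ⟨
    ∑ N (λ σ → dev N σ a b * dev N σ a b + 2 * (N * (a * b)) * ρ σ a b) ≡⟨ cong-S A pointwise ⟩
    ∑ N (λ σ → N * N * (ρ σ a b * ρ σ a b) + a * b * (a * b)) ≡⟨ +-S A (λ σ → N * N * (ρ σ a b * ρ σ a b)) (λ _ → a * b * (a * b)) ⟩
    ∑ N (λ σ → N * N * (ρ σ a b * ρ σ a b)) + ∑ N (λ _ → a * b * (a * b)) ≡⟨ cong₂ _+_ (*-S A (N * N) (λ σ → ρ σ a b * ρ σ a b)) (∑-const N (a * b * (a * b))) ⟩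
    N * N * R₂ + N ! * (a * b * (a * b)) ∎
  final : ∀ {a b} → a ≤ N → b ≤ N → N * N * (n ! * (a * a * (b * b) + N * (a * b))) + N ! * (a * b * (a * b)) ≤
          N ! * (N * (a * b)) + (2 * (N * (a * b) * (suc n ! * (a * b))) + N * N * (n ! * (a * a * b + a * (b * b))))
  final {zero}  {b} p q = ≤-trans (≤-reflexive (zero₁ N (n !) (N !) b)) z≤n
    where
    zero₁ : ∀ N w v b → N * N * (w * (0 * 0 * (b * b) + N * (0 * b))) + v * (0 * b * (0 * b)) ≡ 0
    zero₁ = solve-∀
  final {suc a} {zero} p q = ≤-trans (≤-reflexive (zero₂ N (n !) (N !) a)) z≤n
    where
    zero₂ : ∀ N w v a → N * N * (w * (suc a * suc a * (0 * 0) + N * (suc a * 0))) + v * (suc a * 0 * (suc a * 0)) ≡ 0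
    zero₂ = solve-∀
  final {suc a} {suc b} (s≤s p) (s≤s q) with m≤n⇒∃[o]m+o≡n q
  ... | d , e′ = subst₂ _≤_ (sym (lhs (suc a * suc b) n (n !) (suc a) (suc b))) (sym (rhs (suc a * suc b) n (n !) (suc a) (suc b)))
      (*-monoʳ-≤ ((2 + n) * n ! * (suc a * suc b)) core)
    where
    lhs : ∀ p n w a b → (2 + n) * (2 + n) * (w * (a * a * (b * b) + (2 + n) * (a * b))) + (2 + n) * ((1 + n) * w) * (a * b * (a * b))
          ≡ (2 + n) * w * (a * b) * ((2 + n) * (a * b + (2 + n)) + (1 + n) * (a * b))
    lhs = solve-∀
    rhs : ∀ p n w a b → (2 + n) * ((1 + n) * w) * ((2 + n) * (a * b)) + (2 * ((2 + n) * (a * b) * ((1 + n) * w * (a * b))) + (2 + n) * (2 + n) * (w * (a * a * b + a * (b * b))))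
          ≡ (2 + n) * w * (a * b) * ((1 + n) * (2 + n) + (2 * ((1 + n) * (a * b)) + (2 + n) * (a + b)))
    rhs = solve-∀
    alg : ∀ x b d → suc (b + d) * (x * suc b + suc (b + d)) + (b + d) * (x * suc b) + (suc (b + d) * b + x * d)
          ≡ (b + d) * suc (b + d) + (2 * ((b + d) * (x * suc b)) + suc (b + d) * (x + suc b))
    alg = solve-∀
    -- With m = 1 + n, A = 1 + a and B = 1 + b this amounts to AB + m + 1 ≤ (m + 1)(A + B); the
    -- slack is (m + 1)b + Ad, where d = m - b.
    core : (2 + n) * (suc a * suc b + (2 + n)) + (1 + n) * (suc a * suc b) ≤ (1 + n) * (2 + n) + (2 * ((1 + n) * (suc a * suc b)) + (2 + n) * (suc a + suc b))
    core = subst (λ m → suc m * (suc a * suc b + suc m) + m * (suc a * suc b) ≤ m * suc m + (2 * (m * (suc a * suc b)) + suc m * (suc a + suc b))) e′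
             (≤-trans (m≤m+n _ _) (≤-reflexive (alg (suc a) b d)))

sum-dist : ∀ {n} (f g : Fin n → ℕ) → ∣ sum f - sum g ∣ ≤ sum (λ k → ∣ f k - g k ∣)
sum-dist {zero} f g = z≤n
sum-dist {suc n} f g = begin
  ∣ f fz + F - g fz + G ∣ ≤⟨ ∣-∣-triangle (f fz + F) (g fz + F) (g fz + G) ⟩
  ∣ f fz + F - g fz + F ∣ + ∣ g fz + F - g fz + G ∣
    ≡⟨ cong₂ _+_ (trans (cong₂ ∣_-_∣ (+-comm (f fz) F) (+-comm (g fz) F)) (∣m+n-m+o∣≡∣n-o∣ F (f fz) (g fz))) (∣m+n-m+o∣≡∣n-o∣ (g fz) F G) ⟩
  ∣ f fz - g fz ∣ + ∣ F - G ∣ ≤⟨ +-monoʳ-≤ ∣ f fz - g fz ∣ (sum-dist (f ∘ fs) (g ∘ fs)) ⟩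
  ∣ f fz - g fz ∣ + sum (λ k → ∣ f (fs k) - g (fs k) ∣) ∎
  where
  open ≤-Reasoning
  F = sum (f ∘ fs)
  G = sum (g ∘ fs)

-- A process indexed by the number m of rows still to be revealed.  The condition `drift` says that
-- size / m is a submartingale along a uniformly random permutation.
record Process : Set₁ where
  field
    State : ℕ → Set
    next  : ∀ {m} → State (suc m) → Fin (suc m) → State m
    size  : ∀ {m} → State m → ℕ
    drift : ∀ {m} (s : State (suc m)) → m * size s ≤ sum (λ k → size (next s k))

  final : ∀ {m} → State m → ℕ → Code m → ℕ
  final         s zero    σ       = size s
  final {zero}  s (suc a) σ       = size s
  final {suc m} s (suc a) (k , σ) = final (next s k) a σ

  maximum : ∀ {m} → State m → ℕ → Code m → ℕ → ℕ
  maximum         s zero    σ       M = M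
  maximum {zero}  s (suc a) σ       M = M
  maximum {suc m} s (suc a) (k , σ) M = maximum (next s k) a σ (M ⊔ size (next s k))

  -- Doob's L² inequality, with the potential 2M² - 8 M size (m - a) / m carried along.
  doob-step : ∀ m a (s : State m) M → size s ≤ M → a ≤ m → m ≤ 2 * (m ∸ a) →
         m * ∑ m (λ σ → maximum s a σ M * maximum s a σ M) + 8 * (M * size s * ((m ∸ a) * m !)) ≤
         16 * (m * ∑ m (λ σ → final s a σ * final s a σ)) + 2 * (m * (M * M * m !))
  doob-step m zero s M q≤M _ _ = subst₂ _≤_
    (trans (lhs m (m !) M (size s)) (cong (λ x → m * x + 8 * (M * size s * (m * m !))) (sym (∑-const m (M * M)))))
    (trans (rhs m (m !) M (size s)) (cong (λ x → 16 * (m * x) + 2 * (m * (M * M * m !))) (sym (∑-const m (size s * size s)))))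
    -- With nothing left to reveal, the claim is 2 · M · 4q ≤ M² + (4q)² for q = `size s`; this is
    -- the source of the constants 8 and 16.
    (*-monoʳ-≤ (m * m !) (+-monoʳ-≤ (M * M) (2mn≤m²+n² M (4 * size s))))
    where
    lhs : ∀ m w M q → m * w * (M * M + 2 * (M * (4 * q))) ≡ m * (w * (M * M)) + 8 * (M * q * (m * w))
    lhs = solve-∀
    rhs : ∀ m w M q → m * w * (M * M + (M * M + 4 * q * (4 * q))) ≡ 16 * (m * (w * (q * q))) + 2 * (m * (M * M * w))
    rhs = solve-∀
  doob-step (suc zero) (suc a) s M q≤M (s≤s z≤n) ()
  doob-step (suc m@(suc _)) (suc a) s M q≤M (s≤s a≤m) m<2e = subst₂ _≤_
    (alg₁ (suc m) S₁ M (size s) e (m !)) (alg₂ (suc m) S₂ M (m !))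
    (*-monoʳ-≤ (suc m) (*-cancelˡ-≤ m (begin
      m * (S₁ + 8 * (M * size s * (e * m !)))
        ≡⟨ alg₃ m S₁ M (size s) (e * m !) ⟩
      m * S₁ + 8 * (M * (e * m !)) * (m * size s)
        ≤⟨ +-monoʳ-≤ (m * S₁) (*-monoʳ-≤ (8 * (M * (e * m !))) (drift s)) ⟩
      m * S₁ + 8 * (M * (e * m !)) * sum (λ k → size (next s k))
        ≡⟨ cong₂ _+_ (*-S sum-additive m S₁ₖ) (*-S sum-additive (8 * (M * (e * m !))) (λ k → size (next s k))) ⟨
      sum (λ k → m * S₁ₖ k) + sum (λ k → 8 * (M * (e * m !)) * size (next s k))
        ≡⟨ +-S sum-additive (λ k → m * S₁ₖ k) (λ k → 8 * (M * (e * m !)) * size (next s k)) ⟨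
      sum (λ k → m * S₁ₖ k + 8 * (M * (e * m !)) * size (next s k))
        ≤⟨ mono-S sum-additive child ⟩
      sum (λ k → 16 * m * S₂ₖ k + 2 * (m * (M * M * m !)))
        ≡⟨ +-S sum-additive (λ k → 16 * m * S₂ₖ k) (λ k → 2 * (m * (M * M * m !))) ⟩
      sum (λ k → 16 * m * S₂ₖ k) + sum {suc m} (λ _ → 2 * (m * (M * M * m !)))
        ≡⟨ cong₂ _+_ (*-S sum-additive (16 * m) S₂ₖ) (sum-const (suc m) (2 * (m * (M * M * m !)))) ⟩
      16 * m * S₂ + suc m * (2 * (m * (M * M * m !)))
        ≡⟨ alg₄ m S₂ (M * M * m !) ⟩
      m * (16 * S₂ + suc m * (2 * (M * M * m !))) ∎)))
    where
    open ≤-Reasoning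
    e = m ∸ a
    S₁ₖ S₂ₖ : Fin (suc m) → ℕ
    S₁ₖ k = ∑ m (λ σ → maximum (next s k) a σ (M ⊔ size (next s k)) * maximum (next s k) a σ (M ⊔ size (next s k)))
    S₂ₖ k = ∑ m (λ σ → final (next s k) a σ * final (next s k) a σ)
    S₁ = sum S₁ₖ
    S₂ = sum S₂ₖ
    alg₁ : ∀ n S M q e w → n * (S + 8 * (M * q * (e * w))) ≡ n * S + 8 * (M * q * (e * (n * w)))
    alg₁ = solve-∀
    alg₂ : ∀ n S M w → n * (16 * S + n * (2 * (M * M * w))) ≡ 16 * (n * S) + 2 * (n * (M * M * (n * w)))
    alg₂ = solve-∀
    alg₃ : ∀ m S M q x → m * (S + 8 * (M * q * x)) ≡ m * S + 8 * (M * x) * (m * q)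
    alg₃ = solve-∀
    alg₄ : ∀ m S x → 16 * m * S + suc m * (2 * (m * x)) ≡ m * (16 * S + suc m * (2 * x))
    alg₄ = solve-∀
    -- Raising the running maximum from M to Q does not increase the potential: 2m(Q² - M²) ≤ 4m(Q -
    -- M)Q ≤ 8e(Q - M)Q, where m ≤ 2e because at least half of the rows remain at the end.
    raise : ∀ Q → 2 * (m * ((M ⊔ Q) * (M ⊔ Q))) + 8 * (M * Q * e) ≤ 2 * (m * (M * M)) + 8 * ((M ⊔ Q) * Q * e)
    raise Q with ≤-total Q M
    ... | inj₁ Q≤M rewrite m≥n⇒m⊔n≡m Q≤M = ≤-refl
    ... | inj₂ M≤Q rewrite m≤n⇒m⊔n≡n M≤Q with m≤n⇒∃[o]m+o≡n M≤Q
    ...   | d , refl with m≤n⇒∃[o]m+o≡n (≤-trans (n≤1+n m) m<2e)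
    ...     | x , 2e = ≤-trans (m≤m+n _ (4 * ((M + d) * d * x) + 2 * (m * (d * d)))) (≤-reflexive (trans (eq m M d e x) (trans (cong (λ y → 2 * (m * (M * M)) + 8 * (M * (M + d) * e) + 4 * ((M + d) * d * y)) 2e) (eq′ m M d e))))
      where
      eq : ∀ m M d e x → 2 * (m * ((M + d) * (M + d))) + 8 * (M * (M + d) * e) + (4 * ((M + d) * d * x) + 2 * (m * (d * d))) ≡ 2 * (m * (M * M)) + 8 * (M * (M + d) * e) + 4 * ((M + d) * d * (m + x))
      eq = solve-∀
      eq′ : ∀ m M d e → 2 * (m * (M * M)) + 8 * (M * (M + d) * e) + 4 * ((M + d) * d * (2 * e)) ≡ 2 * (m * (M * M)) + 8 * ((M + d) * (M + d) * e)
      eq′ = solve-∀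
    child : ∀ k → m * S₁ₖ k + 8 * (M * (e * m !)) * size (next s k) ≤ 16 * m * S₂ₖ k + 2 * (m * (M * M * m !))
    child k = +-cancelʳ-≤ (8 * (Mₖ * Q * (e * m !)) + 2 * (m * (Mₖ * Mₖ * m !))) _ _ (subst₂ _≤_
      (eq₁ m (S₁ₖ k) M Q e (m !) Mₖ) (eq₂ m (S₂ₖ k) M Q e (m !) Mₖ)
      (+-mono-≤ (doob-step m a (next s k) Mₖ (m≤n⊔m M Q) a≤m (≤-trans (n≤1+n m) m<2e)) (*-monoʳ-≤ (m !) (raise Q))))
      where
      Q = size (next s k)
      Mₖ = M ⊔ Q
      eq₁ : ∀ m S M Q e w Mₖ → m * S + 8 * (Mₖ * Q * (e * w)) + w * (2 * (m * (Mₖ * Mₖ)) + 8 * (M * Q * e)) ≡ m * S + 8 * (M * (e * w)) * Q + (8 * (Mₖ * Q * (e * w)) + 2 * (m * (Mₖ * Mₖ * w)))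
      eq₁ = solve-∀
      eq₂ : ∀ m S M Q e w Mₖ → 16 * (m * S) + 2 * (m * (Mₖ * Mₖ * w)) + w * (2 * (m * (M * M)) + 8 * (Mₖ * Q * e)) ≡ 16 * m * S + 2 * (m * (M * M * w)) + (8 * (Mₖ * Q * (e * w)) + 2 * (m * (Mₖ * Mₖ * w)))
      eq₂ = solve-∀

  -- Doob's factor 4 belongs to size / m. The denominator shrinks by at most a factor 2 during the
  -- run, and 4 · 2² = 16.
  doob : ∀ m a (s : State m) → 0 < m → size s ≡ 0 → a ≤ m → m ≤ 2 * (m ∸ a) →
         ∑ m (λ σ → maximum s a σ 0 * maximum s a σ 0) ≤ 16 * ∑ m (λ σ → final s a σ * final s a σ)
  doob m@(suc _) a s _ z a≤m p = *-cancelˡ-≤ m (subst₂ _≤_ (+-identityʳ _) (alg m (∑ m (λ σ → final s a σ * final s a σ)))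
    (doob-step m a s 0 (≤-reflexive z) a≤m p))
    where
    alg : ∀ m S → 16 * (m * S) + 2 * (m * 0) ≡ m * (16 * S)
    alg = solve-∀

maxF : ∀ {p} → (Fin p → ℕ) → ℕ
maxF {zero}  f = 0
maxF {suc p} f = f fz ⊔ maxF (f ∘ fs)

≤maxF : ∀ {p} (f : Fin p → ℕ) i → f i ≤ maxF f
≤maxF f fz     = m≤m⊔n _ _
≤maxF f (fs i) = ≤-trans (≤maxF (f ∘ fs) i) (m≤n⊔m (f fz) _)

*-maxF≤ : ∀ {p} m {x} (f : Fin p → ℕ) → (∀ i → m * f i ≤ x) → m * maxF f ≤ x
*-maxF≤ {zero}  m {x} f h = subst (_≤ x) (sym (*-zeroʳ m)) z≤n
*-maxF≤ {suc p} m {x} f h = subst (_≤ x) (sym (*-distribˡ-⊔ m (f fz) (maxF (f ∘ fs)))) (⊔-lub (h fz) (*-maxF≤ m (f ∘ fs) (h ∘ fs)))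

maxF-lub : ∀ {p} {x} (f : Fin p → ℕ) → (∀ i → f i ≤ x) → maxF f ≤ x
maxF-lub {x = x} f h = subst (_≤ x) (*-identityˡ (maxF f)) (*-maxF≤ 1 f (λ i → subst (_≤ x) (sym (*-identityˡ (f i))) (h i)))

maxF-cong : ∀ {p} {f g : Fin p → ℕ} → (∀ i → f i ≡ g i) → maxF f ≡ maxF g
maxF-cong {zero}  e = refl
maxF-cong {suc p} e = cong₂ _⊔_ (e fz) (maxF-cong (e ∘ fs))

remaining-≤ : ∀ {m} c (k : Fin (suc m)) → c ≤ suc m → c ∸ lt (toℕ k) c ≤ m
remaining-≤ {m} c k c≤ with m≤n⇒m<n∨m≡n c≤
... | inj₁ (s≤s c≤m) = ≤-trans (m∸n≤m c (lt (toℕ k) c)) c≤m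
... | inj₂ refl rewrite lt-yes (F.toℕ<n k) = ≤-refl

sum-remaining : ∀ m c → c ≤ suc m → sum {suc m} (λ k → c ∸ lt (toℕ k) c) ≡ m * c
sum-remaining m zero p = trans (sum-const (suc m) 0) (trans (*-zeroʳ (suc m)) (sym (*-zeroʳ m)))
sum-remaining m (suc c) (s≤s p) = trans (sum-lt (suc m) (suc c) (suc c ∸_) (s≤s p)) (trans (alg c (m ∸ c)) (cong (_* suc c) (m+[n∸m]≡n p)))
  where
  alg : ∀ c d → suc c * c + d * suc c ≡ (c + d) * suc c
  alg = solve-∀

module Urn (n : ℕ) {p : ℕ} (col : Fin p → ℕ) where

  -- c i is the number of values below col i that are still available.
  urn : Process
  urn = record
    { State = λ m → Σ (Fin p → ℕ) (λ c → ∀ i → c i ≤ m)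
    ; next  = λ (c , c≤) k → (λ i → c i ∸ lt (toℕ k) (c i)) , (λ i → remaining-≤ (c i) k (c≤ i))
    ; size  = λ {m} (c , _) → maxF (λ i → ∣ col i * m - n * c i ∣)
    ; drift = λ {m} (c , c≤) → *-maxF≤ m _ (λ i → begin
        m * ∣ col i * suc m - n * c i ∣ ≡⟨ *-distribˡ-∣-∣ m (col i * suc m) (n * c i) ⟩
        ∣ m * (col i * suc m) - m * (n * c i) ∣ ≡⟨ cong₂ ∣_-_∣ (trans (alg m (col i)) (sym (sum-const (suc m) (col i * m)))) (trans (alg′ m n (c i)) (trans (cong (n *_) (sym (sum-remaining m (c i) (c≤ i)))) (sym (*-S (sum-additive {suc m}) n (λ k → c i ∸ lt (toℕ k) (c i)))))) ⟩
        ∣ sum {suc m} (λ k → col i * m) - sum {suc m} (λ k → n * (c i ∸ lt (toℕ k) (c i))) ∣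
          ≤⟨ sum-dist {suc m} (λ k → col i * m) (λ k → n * (c i ∸ lt (toℕ k) (c i))) ⟩
        sum {suc m} (λ k → ∣ col i * m - n * (c i ∸ lt (toℕ k) (c i)) ∣)
          ≤⟨ mono-S (sum-additive {suc m}) (λ k → ≤maxF (λ i → ∣ col i * m - n * (c i ∸ lt (toℕ k) (c i)) ∣) i) ⟩
        sum {suc m} (λ k → maxF (λ i → ∣ col i * m - n * (c i ∸ lt (toℕ k) (c i)) ∣)) ∎) }
    where
    open ≤-Reasoning
    alg : ∀ m b → m * (b * suc m) ≡ suc m * (b * m)
    alg = solve-∀
    alg′ : ∀ m n c → m * (n * c) ≡ n * (m * c)
    alg′ = solve-∀

  open Process urn public

  at : ∀ {m} → State m → Code m → ℕ → Fin p → ℕ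
  at {m} (c , _) σ t i = ∣ col i * (m ∸ t) - n * (c i ∸ ρ σ t (c i)) ∣

  at-zero : ∀ {m} (s : State m) σ i → at s σ 0 i ≡ ∣ col i * m - n * proj₁ s i ∣
  at-zero {m} (c , _) σ i = cong (λ x → ∣ col i * m - n * (c i ∸ x) ∣) (ρ-zeroˡ σ (c i))

  at-suc : ∀ {m} (s : State (suc m)) k σ t i → at s (k , σ) (suc t) i ≡ at (next s k) σ t i
  at-suc {m} (c , _) k σ t i = cong (λ x → ∣ col i * (m ∸ t) - n * x ∣) (sym (∸-+-assoc (c i) (lt (toℕ k) (c i)) (ρ σ t (c i ∸ lt (toℕ k) (c i)))))

  M≤maximum : ∀ {m} (s : State m) a σ M → M ≤ maximum s a σ M
  M≤maximum         s zero    σ       M = ≤-refl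
  M≤maximum {zero}  s (suc a) σ       M = ≤-refl
  M≤maximum {suc m} s (suc a) (k , σ) M = ≤-trans (m≤m⊔n M _) (M≤maximum (next s k) a σ _)

  at≤maximum : ∀ {m} (s : State m) a σ M {t} i → size s ≤ M → t ≤ a → a ≤ m → at s σ t i ≤ maximum s a σ M
  at≤maximum s a σ M {zero} i q≤M _ _ = ≤-trans (≤-reflexive (at-zero s σ i))
    (≤-trans (≤maxF (λ i → ∣ col i * _ - n * proj₁ s i ∣) i) (≤-trans q≤M (M≤maximum s a σ M)))
  at≤maximum {suc m} s (suc a) (k , σ) M {suc t} i q≤M (s≤s t≤a) (s≤s a≤m) =
    subst (_≤ maximum (next s k) a σ (M ⊔ size (next s k))) (sym (at-suc s k σ t i))
      (at≤maximum (next s k) a σ (M ⊔ size (next s k)) i (m≤n⊔m M _) t≤a a≤m)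

  final≡ : ∀ {m} (s : State m) a σ → a ≤ m → final s a σ ≡ maxF (at s σ a)
  final≡         s zero    σ       _ = maxF-cong (λ i → sym (at-zero s σ i))
  final≡ {suc m} s (suc a) (k , σ) (s≤s a≤m) = trans (final≡ (next s k) a σ a≤m) (maxF-cong (λ i → sym (at-suc s k σ a i)))

ρ≤b : ∀ {n} (σ : Code n) a b → ρ σ a b ≤ b
ρ≤b {zero}  σ       a       b = z≤n
ρ≤b {suc n} σ       zero    b = z≤n
ρ≤b {suc n} (k , σ) (suc a) b = subst (lt (toℕ k) b + ρ σ a (b ∸ lt (toℕ k) b) ≤_) (m+[n∸m]≡n (lt≤ (toℕ k) b)) (+-monoʳ-≤ (lt (toℕ k) b) (ρ≤b σ a _))

dist-exchange : ∀ {x y u v} → x + u ≡ y + v → ∣ x - y ∣ ≡ ∣ v - u ∣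
dist-exchange {x} {y} {u} {v} e = begin
  ∣ x - y ∣ ≡⟨ ∣m+n-m+o∣≡∣n-o∣ u x y ⟨
  ∣ u + x - u + y ∣ ≡⟨ cong₂ ∣_-_∣ (trans (+-comm u x) e) (+-comm u y) ⟩
  ∣ y + v - y + u ∣ ≡⟨ ∣m+n-m+o∣≡∣n-o∣ y v u ⟩
  ∣ v - u ∣ ∎
  where open ≡-Reasoning

-- The imbalance of the urn after t rows is the deviation of the rank r: b(n - t) - n(b - r) = nr -
-- bt.
dev-urn : ∀ n (σ : Code n) {t} b → t ≤ n → ∣ b * (n ∸ t) - n * (b ∸ ρ σ t b) ∣ ≡ dev n σ t b
dev-urn n σ {t} b t≤n = trans (dist-exchange {u = b * t} {v = n * ρ σ t b} (begin
  b * (n ∸ t) + b * t ≡⟨ *-distribˡ-+ b (n ∸ t) t ⟨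
  b * (n ∸ t + t) ≡⟨ cong (b *_) (m∸n+n≡m t≤n) ⟩
  b * n ≡⟨ *-comm b n ⟩
  n * b ≡⟨ cong (n *_) (m∸n+n≡m (ρ≤b σ t b)) ⟨
  n * (b ∸ ρ σ t b + ρ σ t b) ≡⟨ *-distribˡ-+ n (b ∸ ρ σ t b) (ρ σ t b) ⟩
  n * (b ∸ ρ σ t b) + n * ρ σ t b ∎)) (cong (λ x → ∣ n * ρ σ t b - x ∣) (*-comm b t))
  where open ≡-Reasoning

dev-inv : ∀ n (σ : Code n) a b → dev n (inv n σ) a b ≡ dev n σ b a
dev-inv n σ a b = cong₂ (λ x y → ∣ n * x - y ∣) (ρ-inv n σ a b) (*-comm a b)

module Columns (n : ℕ) {p : ℕ} (col : Fin p → ℕ) (col≤n : ∀ i → col i ≤ n) where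
  open Urn n col public

  root : State n
  root = col , col≤n

  size-root : size root ≡ 0
  size-root = n≤0⇒n≡0 (maxF-lub (λ i → ∣ col i * n - n * col i ∣) (λ i → ≤-reflexive (m≡n⇒∣m-n∣≡0 (*-comm (col i) n))))

  dev≤maximum : ∀ {a t} σ i → t ≤ a → a ≤ n → dev n σ t (col i) ≤ maximum root a σ 0
  dev≤maximum {a} {t} σ i t≤a a≤n = subst (_≤ maximum root a σ 0) (dev-urn n σ (col i) (≤-trans t≤a a≤n))
    (at≤maximum root a σ 0 i (≤-reflexive size-root) t≤a a≤n)

  final≤ : ∀ {a x} σ → a ≤ n → (∀ i → dev n σ a (col i) ≤ x) → final root a σ ≤ x
  final≤ {a} {x} σ a≤n h = subst (_≤ x) (sym (final≡ root a σ a≤n))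
    (maxF-lub (at root σ a) (λ i → subst (_≤ x) (sym (dev-urn n σ (col i) a≤n)) (h i)))

half-remains : ∀ n a → 2 * a ≤ n → n ≤ 2 * (n ∸ a)
half-remains n a p = subst (n ≤_) (sym (*-distribˡ-∸ 2 n a)) (≤-trans (≤-reflexive (sym (m+n∸n≡m n n)))
  (subst (λ x → n + n ∸ n ≤ n + x ∸ 2 * a) (sym (+-identityʳ n)) (∸-monoʳ-≤ (n + n) p)))

double≤⇒≤ : ∀ n a → 2 * a ≤ n → a ≤ n
double≤⇒≤ n a = ≤-trans (m≤m+n a _)

-- Doob along the rows, for all columns up to b₁ at once, reduces the maximum over the rectangle to
-- a maximum along its last row. Inversion turns that row into a column of a uniform permutation,
-- and a second use of Doob reduces it to the corner; hence 256 = 16².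
maximal : ∀ N → 0 < N → ∀ {a₁ b₁} → 2 * a₁ ≤ N → 2 * b₁ ≤ N →
  ∑ N (λ σ → dev N σ b₁ a₁ * dev N σ b₁ a₁) ≤ N ! * (N * (b₁ * a₁)) →
  Σ (Code N → ℕ) λ F → (∀ σ {a b} → a ≤ a₁ → b ≤ b₁ → dev N σ a b ≤ F σ) ×
    ∑ N (λ σ → F σ * F σ) ≤ 256 * (N ! * (N * (a₁ * b₁)))
maximal N 0<N {a₁} {b₁} 2a₁≤n 2b₁≤n var = F , bound , (begin
  ∑ N (λ σ → F σ * F σ)
    ≤⟨ R.doob N a₁ R.root 0<N R.size-root (double≤⇒≤ N a₁ 2a₁≤n) (half-remains N a₁ 2a₁≤n) ⟩
  16 * ∑ N (λ σ → R.final R.root a₁ σ * R.final R.root a₁ σ)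
    ≤⟨ *-monoʳ-≤ 16 (mono-S (∑-additive N) (λ σ → *-mono-≤ (transposed σ) (transposed σ))) ⟩
  16 * ∑ N (λ σ → G (inv N σ) * G (inv N σ))
    ≡⟨ cong (16 *_) (∑-inv N (λ σ → G σ * G σ)) ⟩
  16 * ∑ N (λ σ → G σ * G σ)
    ≤⟨ *-monoʳ-≤ 16 (C.doob N b₁ C.root 0<N C.size-root (double≤⇒≤ N b₁ 2b₁≤n) (half-remains N b₁ 2b₁≤n)) ⟩
  16 * (16 * ∑ N (λ σ → C.final C.root b₁ σ * C.final C.root b₁ σ))
    ≡⟨ *-assoc 16 16 (∑ N (λ σ → C.final C.root b₁ σ * C.final C.root b₁ σ)) ⟨
  16 * 16 * ∑ N (λ σ → C.final C.root b₁ σ * C.final C.root b₁ σ)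
    ≤⟨ *-monoʳ-≤ 256 (mono-S (∑-additive N) (λ σ → *-mono-≤ (end σ) (end σ))) ⟩
  256 * ∑ N (λ σ → dev N σ b₁ a₁ * dev N σ b₁ a₁)
    ≤⟨ *-monoʳ-≤ 256 var ⟩
  256 * (N ! * (N * (b₁ * a₁)))
    ≡⟨ cong (λ x → 256 * (N ! * (N * x))) (*-comm b₁ a₁) ⟩
  256 * (N ! * (N * (a₁ * b₁))) ∎)
  where
  open ≤-Reasoning
  module R = Columns N {suc b₁} toℕ (λ i → ≤-trans (F.toℕ≤pred[n] i) (double≤⇒≤ N b₁ 2b₁≤n))
  module C = Columns N {1} (λ _ → a₁) (λ _ → double≤⇒≤ N a₁ 2a₁≤n)
  F G : Code N → ℕ
  F σ = R.maximum R.root a₁ σ 0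
  G σ = C.maximum C.root b₁ σ 0
  bound : ∀ σ {a b} → a ≤ a₁ → b ≤ b₁ → dev N σ a b ≤ F σ
  bound σ {a} {b} p q = subst (λ x → dev N σ a x ≤ F σ) (F.toℕ-fromℕ< (s≤s q)) (R.dev≤maximum σ (fromℕ< (s≤s q)) p (double≤⇒≤ N a₁ 2a₁≤n))
  transposed : ∀ σ → R.final R.root a₁ σ ≤ G (inv N σ)
  transposed σ = R.final≤ σ (double≤⇒≤ N a₁ 2a₁≤n) (λ i → subst (_≤ G (inv N σ)) (dev-inv N σ (toℕ i) a₁)
    (C.dev≤maximum (inv N σ) fz (F.toℕ≤pred[n] i) (double≤⇒≤ N b₁ 2b₁≤n)))
  end : ∀ σ → C.final C.root b₁ σ ≤ dev N σ b₁ a₁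
  end σ = C.final≤ σ (double≤⇒≤ N b₁ 2b₁≤n) (λ _ → ≤-refl)

maximal-inequality : ∀ N → 2 ≤ N → ∀ {a₁ b₁} → 2 * a₁ ≤ N → 2 * b₁ ≤ N →
  Σ (Code N → ℕ) λ F → (∀ σ {a b} → a ≤ a₁ → b ≤ b₁ → dev N σ a b ≤ F σ) ×
    ∑ N (λ σ → F σ * F σ) ≤ 256 * (N ! * (N * (a₁ * b₁)))
maximal-inequality N@(suc (suc n)) (s≤s (s≤s _)) {a₁} {b₁} p q =
  maximal N (s≤s z≤n) {a₁} {b₁} p q (variance n {b₁} {a₁} (double≤⇒≤ N b₁ q) (double≤⇒≤ N a₁ p))

-- Transposing two values of a random permutation

sum-indicator : ∀ {n} (t : Fin n) (f : Fin n → ℕ) → sum (λ i → 𝟙 (t F.≟ i) * f i) ≡ f t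
sum-indicator {suc n} fz f = trans (cong (f fz + 0 +_) (trans (sum-const n 0) (*-zeroʳ n))) (trans (+-identityʳ (f fz + 0)) (+-identityʳ (f fz)))
sum-indicator {suc n} (fs t) f = trans (cong-S sum-additive (λ i → cong (_* f (fs i)) (𝟙-cong (fs t F.≟ fs i) (t F.≟ i) F.suc-injective (cong fs)))) (sum-indicator t (f ∘ fs))

sum-two-points : ∀ {n} (f g : Fin n → ℕ) {t t′ : Fin n} → ¬ t ≡ t′ → (∀ i → ¬ t ≡ i → ¬ t′ ≡ i → f i ≡ g i) →
                 sum f + (g t + g t′) ≡ sum g + (f t + f t′)
sum-two-points {n} f g {t} {t′} t≢t′ agree = trans (sym (expand f g)) (trans (cong-S sum-additive pointwise) (expand g f))
  where
  χ : Fin n → Fin n → ℕ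
  χ t i = 𝟙 (t F.≟ i)
  expand : ∀ f g → sum (λ i → f i + (χ t i * g i + χ t′ i * g i)) ≡ sum f + (g t + g t′)
  expand f g = trans (+-S sum-additive f (λ i → χ t i * g i + χ t′ i * g i)) (cong (sum f +_)
    (trans (+-S sum-additive (λ i → χ t i * g i) (λ i → χ t′ i * g i)) (cong₂ _+_ (sum-indicator t g) (sum-indicator t′ g))))
  pointwise : ∀ i → f i + (χ t i * g i + χ t′ i * g i) ≡ g i + (χ t i * f i + χ t′ i * f i)
  pointwise i with t F.≟ i | t′ F.≟ i
  ... | yes refl | yes refl = contradiction refl t≢t′
  ... | yes refl | no _  = swap (f i) (g i)
    where
    swap : ∀ x y → x + (y + 0 + 0) ≡ y + (x + 0 + 0)
    swap = solve-∀
  ... | no _ | yes refl  = swap (f i) (g i)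
    where
    swap : ∀ x y → x + (0 + (y + 0)) ≡ y + (0 + (x + 0))
    swap = solve-∀
  ... | no p | no q      = cong (_+ 0) (agree i p q)

∑w-permute : ∀ m n (π : Perm.Permutation n n) (G : Vec (Fin n) m → ℕ) → ∑w m n (λ w → G (mapᵥ (π Perm.⟨$⟩ʳ_) w)) ≡ ∑w m n G
∑w-permute zero n π G = refl
∑w-permute (suc m) n π G = begin
  sum (λ i → ∑w m n (λ w → G ((π Perm.⟨$⟩ʳ i) ∷ᵥ mapᵥ (π Perm.⟨$⟩ʳ_) w)))
    ≡⟨ cong-S sum-additive (λ i → ∑w-permute m n π (λ w → G ((π Perm.⟨$⟩ʳ i) ∷ᵥ w))) ⟩
  sum (λ i → f (π Perm.⟨$⟩ʳ i)) ≡⟨ sum≡ (λ i → f (π Perm.⟨$⟩ʳ i)) ⟩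
  Sumₚ.sum (λ i → f (π Perm.⟨$⟩ʳ i)) ≡⟨ Sumₚ.sum-permute f π ⟨
  Sumₚ.sum f ≡⟨ sum≡ f ⟨
  sum f ∎
  where
  open ≡-Reasoning
  f : Fin n → ℕ
  f i = ∑w m n (λ w → G (i ∷ᵥ w))

ge : ℕ → ℕ → ℕ
ge k b = 1 ∸ lt k b

lt+ge : ∀ k b → lt k b + ge k b ≡ 1
lt+ge k b = m+[n∸m]≡n (lt≤1 k b)

abstract
  tr : ∀ {n} → Fin n → Fin n → Fin n → Fin n
  tr u v = Perm.transpose u v Perm.⟨$⟩ʳ_

  tr-cases : ∀ {n} (u v x : Fin n) → (x ≡ u × tr u v x ≡ v) ⊎ (¬ x ≡ u × x ≡ v × tr u v x ≡ u) ⊎ (¬ x ≡ u × ¬ x ≡ v × tr u v x ≡ x)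
  tr-cases u v x with x F.≟ u
  ... | yes p = inj₁ (p , refl)
  ... | no ¬p with x F.≟ v
  ...   | yes q = inj₂ (inj₁ (¬p , q , refl))
  ...   | no ¬q = inj₂ (inj₂ (¬p , ¬q , refl))

  ∑w-tr : ∀ {m n} (u v : Fin n) (G : Vec (Fin n) m → ℕ) → ∑w m n (λ w → G (mapᵥ (tr u v) w)) ≡ ∑w m n G
  ∑w-tr {m} {n} u v = ∑w-permute m n (Perm.transpose u v)

module Lift (n a₀ a₁ b₀ b₁ e : ℕ) (a₀≤a₁ : a₀ ≤ a₁) (b₀≤b₁ : b₀ ≤ b₁) where

  -- On the box [a₀,a₁] × [b₀,b₁] the rank is within e of ab/n + j. The lower estimate is confined
  -- to the box, since an exchange raises the rank by 1 there but by 0 or 1 at other a ≤ a₁, b ≤ b₁.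
  Near : ℕ → (ℕ → ℕ → ℕ) → Set
  Near j r = ∀ {a} → a < suc a₁ → ∀ {b} → b < suc b₁ →
    n * r a b ≤ a * b + (e + j) * n × (a₀ ≤ a → b₀ ≤ b → a * b + j * n ≤ n * r a b + e * n)

  abstract
    near? : ∀ j r → Dec (Near j r)
    near? j r = allUpTo? (λ a → allUpTo? (λ b → (n * r a b ≤? a * b + (e + j) * n) ×-dec
      (a₀ ≤? a →-dec (b₀ ≤? b →-dec (a * b + j * n ≤? n * r a b + e * n)))) (suc b₁)) (suc a₁)

  near-cong : ∀ j {r r′} → (∀ a b → r a b ≡ r′ a b) → Near j r → Near j r′
  near-cong j eq h {a} p {b} q rewrite sym (eq a b) = h p q

  -- Exchanging a low value in a late row with a high value in an early row adds 1 to the rank on the whole box.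
  raise : ∀ j (w : Vec (Fin n) n) {u v t t′} → toℕ u < b₀ → b₁ ≤ toℕ v → toℕ t < a₀ → a₁ ≤ toℕ t′ →
          Inj w → lookup w t ≡ u → lookup w t′ ≡ v → Near j (rk (mapᵥ (tr u v) w)) → Near (suc j) (rk w)
  raise j w {u} {v} {t} {t′} u<b₀ b₁≤v t<a₀ a₁≤t′ inj wt wt′ near {a} a≤a₁ {b} b≤b₁ = upper , lower
    where
    φw = mapᵥ (tr u v) w
    X Y : Fin n → ℕ
    X i = lt (toℕ i) a * lt (toℕ (lookup φw i)) b
    Y i = lt (toℕ i) a * lt (toℕ (lookup w i)) b
    ltv : lt (toℕ v) b ≡ 0
    ltv = lt-no (≤-trans (≤-pred b≤b₁) b₁≤v)
    ltt′ : lt (toℕ t′) a ≡ 0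
    ltt′ = lt-no (≤-trans (≤-pred a≤a₁) a₁≤t′)
    t≢t′ : ¬ t ≡ t′
    t≢t′ refl = <-irrefl refl (<-≤-trans t<a₀ (≤-trans a₀≤a₁ a₁≤t′))
    at-t : lookup φw t ≡ v
    at-t = trans (V.lookup-map t (tr u v) w) (trans (cong (tr u v) wt) (case tr-cases u v u of λ
      { (inj₁ (_ , q)) → q ; (inj₂ (inj₁ (p , _))) → contradiction refl p ; (inj₂ (inj₂ (p , _))) → contradiction refl p }))
    agree : ∀ i → ¬ t ≡ i → ¬ t′ ≡ i → X i ≡ Y i
    agree i p q = cong (λ x → lt (toℕ i) a * lt (toℕ x) b) (trans (V.lookup-map i (tr u v) w) (case tr-cases u v (lookup w i) of λ
      { (inj₁ (x , _)) → contradiction (inj t i (trans wt (sym x))) p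
      ; (inj₂ (inj₁ (_ , x , _))) → contradiction (inj t′ i (trans wt′ (sym x))) q
      ; (inj₂ (inj₂ (_ , _ , x))) → x }))
    change : rk φw a b + lt (toℕ t) a * lt (toℕ u) b ≡ rk w a b
    change = begin
      sum X + lt (toℕ t) a * lt (toℕ u) b ≡⟨ cong (λ x → sum X + x) (trans (sym (+-identityʳ _)) (cong₂ _+_ (cong (λ x → lt (toℕ t) a * lt (toℕ x) b) (sym wt)) (sym (cong (_* lt (toℕ (lookup w t′)) b) ltt′)))) ⟩
      sum X + (Y t + Y t′) ≡⟨ sum-two-points X Y t≢t′ agree ⟩
      sum Y + (X t + X t′) ≡⟨ cong (λ x → sum Y + x) (cong₂ _+_ (trans (cong (λ x → lt (toℕ t) a * lt (toℕ x) b) at-t) (trans (cong (lt (toℕ t) a *_) ltv) (*-zeroʳ (lt (toℕ t) a)))) (cong (_* lt (toℕ (lookup φw t′)) b) ltt′)) ⟩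
      sum Y + 0 ≡⟨ +-identityʳ (sum Y) ⟩
      sum Y ∎
      where open ≡-Reasoning
    eq₁ : ∀ n x j e → x + (e + j) * n + n * 1 ≡ x + (e + suc j) * n
    eq₁ = solve-∀
    eq₂ : ∀ n x j → x + suc j * n ≡ x + j * n + n
    eq₂ = solve-∀
    eq₃ : ∀ n r y → n * r + y + n ≡ n * (r + 1) + y
    eq₃ = solve-∀
    upper : n * rk w a b ≤ a * b + (e + suc j) * n
    upper = begin
      n * rk w a b ≡⟨ cong (n *_) change ⟨
      n * (rk φw a b + lt (toℕ t) a * lt (toℕ u) b) ≤⟨ *-monoʳ-≤ n (+-monoʳ-≤ (rk φw a b) (*-mono-≤ (lt≤1 (toℕ t) a) (lt≤1 (toℕ u) b))) ⟩
      n * (rk φw a b + 1) ≡⟨ *-distribˡ-+ n (rk φw a b) 1 ⟩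
      n * rk φw a b + n * 1 ≤⟨ +-monoˡ-≤ (n * 1) (proj₁ (near a≤a₁ b≤b₁)) ⟩
      a * b + (e + j) * n + n * 1 ≡⟨ eq₁ n (a * b) j e ⟩
      a * b + (e + suc j) * n ∎
      where open ≤-Reasoning
    lower : a₀ ≤ a → b₀ ≤ b → a * b + suc j * n ≤ n * rk w a b + e * n
    lower a₀≤a b₀≤b = begin
      a * b + suc j * n ≡⟨ eq₂ n (a * b) j ⟩
      a * b + j * n + n ≤⟨ +-monoˡ-≤ n (proj₂ (near a≤a₁ b≤b₁) a₀≤a b₀≤b) ⟩
      n * rk φw a b + e * n + n ≡⟨ eq₃ n (rk φw a b) (e * n) ⟩
      n * (rk φw a b + 1) + e * n ≡⟨ cong (λ x → n * (rk φw a b + x) + e * n) (cong₂ _*_ (lt-yes (<-≤-trans t<a₀ a₀≤a)) (lt-yes (<-≤-trans u<b₀ b₀≤b))) ⟨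
      n * (rk φw a b + lt (toℕ t) a * lt (toℕ u) b) + e * n ≡⟨ cong (λ x → n * x + e * n) change ⟩
      n * rk w a b + e * n ∎
      where open ≤-Reasoning

  I : ℕ → Vec (Fin n) n → ℕ
  I j w = 𝟙 (inj? w) * 𝟙 (near? j (rk w))

  -- Fix also the high value v in the early row t and the low value u in the late row t′. Swapping
  -- the letters u and v permutes the words, and by `raise` it carries the configurations counted on
  -- the left to those on the right.
  exchange : ∀ j (t t′ : Fin n) →
    ∑w n n (λ w → I j w * ((lt (toℕ t) a₀ * ge (toℕ (lookup w t)) b₁) * (ge (toℕ t′) a₁ * lt (toℕ (lookup w t′)) b₀))) ≤
    ∑w n n (λ w → I (suc j) w * ((lt (toℕ t) a₀ * lt (toℕ (lookup w t)) b₀) * (ge (toℕ t′) a₁ * ge (toℕ (lookup w t′)) b₁)))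
  exchange j t t′ = begin
    ∑w n n (λ w → I j w * (A (lookup w t) * B (lookup w t′)))
      ≡⟨ spread (I j) A B ⟩
    sum (λ v → sum (λ u → ∑w n n (λ w → I j w * ((χ (lookup w t) v * A v) * (χ (lookup w t′) u * B u)))))
      ≡⟨ cong-S sum-additive (λ v → cong-S sum-additive (λ u → sym (∑w-tr u v (λ w → I j w * ((χ (lookup w t) v * A v) * (χ (lookup w t′) u * B u)))))) ⟩
    sum (λ v → sum (λ u → ∑w n n (λ w → I j (mapᵥ (tr u v) w) * ((χ (lookup (mapᵥ (tr u v) w) t) v * A v) * (χ (lookup (mapᵥ (tr u v) w) t′) u * B u)))))
      ≤⟨ mono-S sum-additive (λ v → mono-S sum-additive (λ u → mono-S (∑w-additive n n) (pointwise u v))) ⟩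
    sum (λ v → sum (λ u → ∑w n n (λ w → I (suc j) w * ((χ (lookup w t) u * A′ u) * (χ (lookup w t′) v * B′ v)))))
      ≡⟨ sum-swap sum-additive (λ u v → ∑w n n (λ w → I (suc j) w * ((χ (lookup w t) u * A′ u) * (χ (lookup w t′) v * B′ v)))) ⟩
    sum (λ u → sum (λ v → ∑w n n (λ w → I (suc j) w * ((χ (lookup w t) u * A′ u) * (χ (lookup w t′) v * B′ v)))))
      ≡⟨ spread (I (suc j)) A′ B′ ⟨
    ∑w n n (λ w → I (suc j) w * (A′ (lookup w t) * B′ (lookup w t′))) ∎
    where
    open ≤-Reasoning
    χ : Fin n → Fin n → ℕ
    χ x y = 𝟙 (x F.≟ y)
    A B A′ B′ : Fin n → ℕ
    A x = lt (toℕ t) a₀ * ge (toℕ x) b₁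
    B x = ge (toℕ t′) a₁ * lt (toℕ x) b₀
    A′ x = lt (toℕ t) a₀ * lt (toℕ x) b₀
    B′ x = ge (toℕ t′) a₁ * ge (toℕ x) b₁
    spread : ∀ (G : Vec (Fin n) n → ℕ) (A B : Fin n → ℕ) →
      ∑w n n (λ w → G w * (A (lookup w t) * B (lookup w t′))) ≡
      sum (λ v → sum (λ u → ∑w n n (λ w → G w * ((χ (lookup w t) v * A v) * (χ (lookup w t′) u * B u)))))
    spread G A B = sym (trans
      (cong-S sum-additive (λ v → sym (sum-swap (∑w-additive n n) (λ u w → G w * ((χ (lookup w t) v * A v) * (χ (lookup w t′) u * B u))))))
      (trans (sym (sum-swap (∑w-additive n n) (λ v w → sum (λ u → G w * ((χ (lookup w t) v * A v) * (χ (lookup w t′) u * B u))))))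
      (cong-S (∑w-additive n n) (λ w → trans
        (cong-S sum-additive (λ v → trans (*-S sum-additive (G w) (λ u → (χ (lookup w t) v * A v) * (χ (lookup w t′) u * B u)))
          (cong (G w *_) (trans (*-S sum-additive (χ (lookup w t) v * A v) (λ u → χ (lookup w t′) u * B u))
            (cong (χ (lookup w t) v * A v *_) (sum-indicator (lookup w t′) B))))))
        (trans (*-S sum-additive (G w) (λ v → χ (lookup w t) v * A v * B (lookup w t′)))
          (cong (G w *_) (trans (*ʳ-S sum-additive (B (lookup w t′)) (λ v → χ (lookup w t) v * A v))
            (cong (_* B (lookup w t′)) (sum-indicator (lookup w t) A)))))))))
    pointwise : ∀ u v w →
      I j (mapᵥ (tr u v) w) * ((χ (lookup (mapᵥ (tr u v) w) t) v * A v) * (χ (lookup (mapᵥ (tr u v) w) t′) u * B u)) ≤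
      I (suc j) w * ((χ (lookup w t) u * A′ u) * (χ (lookup w t′) v * B′ v))
    pointwise u v w
      with <-≤-connex (toℕ u) b₀ | <-≤-connex (toℕ v) b₁ | <-≤-connex (toℕ t) a₀ | <-≤-connex (toℕ t′) a₁
    ... | inj₂ u≥ | _ | _ | _ rewrite lt-no u≥ | *-zeroʳ (ge (toℕ t′) a₁) | *-zeroʳ (χ (lookup (mapᵥ (tr u v) w) t′) u) | *-zeroʳ (χ (lookup (mapᵥ (tr u v) w) t) v * A v) | *-zeroʳ (I j (mapᵥ (tr u v) w)) = z≤n
    ... | inj₁ _ | inj₁ v< | _ | _ rewrite lt-yes v< | *-zeroʳ (lt (toℕ t) a₀) | *-zeroʳ (χ (lookup (mapᵥ (tr u v) w) t) v) | *-zeroʳ (I j (mapᵥ (tr u v) w)) = z≤n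
    ... | inj₁ _ | inj₂ _ | inj₂ t≥ | _ rewrite lt-no t≥ | *-zeroʳ (χ (lookup (mapᵥ (tr u v) w) t) v) | *-zeroʳ (I j (mapᵥ (tr u v) w)) = z≤n
    ... | inj₁ _ | inj₂ _ | inj₁ _ | inj₁ t′< rewrite lt-yes t′< | *-zeroʳ (χ (lookup (mapᵥ (tr u v) w) t′) u) | *-zeroʳ (χ (lookup (mapᵥ (tr u v) w) t) v * A v) | *-zeroʳ (I j (mapᵥ (tr u v) w)) = z≤n
    ... | inj₁ u< | inj₂ v≥ | inj₁ t< | inj₂ t′≥ rewrite lt-yes u< | lt-no v≥ | lt-yes t< | lt-no t′≥
        | V.lookup-map t (tr u v) w | V.lookup-map t′ (tr u v) w
      with lookup w t F.≟ u | lookup w t′ F.≟ v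
    ...   | yes p | yes q = *-mono-≤ indicator (*-mono-≤ (*-mono-≤ (𝟙≤1 (tr u v (lookup w t) F.≟ v)) (≤-refl {1})) (*-mono-≤ (𝟙≤1 (tr u v (lookup w t′) F.≟ u)) (≤-refl {1})))
      where
      inj-back : Inj (mapᵥ (tr u v) w) → Inj w
      inj-back h i l e = h i l (trans (V.lookup-map i (tr u v) w) (trans (cong (tr u v) e) (sym (V.lookup-map l (tr u v) w))))
      indicator : I j (mapᵥ (tr u v) w) ≤ I (suc j) w
      indicator with inj? (mapᵥ (tr u v) w)
      ... | no _ = z≤n
      ... | yes h = ≤-trans (≤-reflexive (+-identityʳ _)) (≤-trans
              (𝟙-mono (near? j (rk (mapᵥ (tr u v) w))) (near? (suc j) (rk w)) (raise j w u< v≥ t< t′≥ (inj-back h) p q))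
              (≤-trans (≤-reflexive (sym (+-identityʳ _))) (≤-reflexive (cong (_* 𝟙 (near? (suc j) (rk w))) (sym (𝟙-yes (inj? w) (inj-back h)))))))
    ...   | no p | _ = ≤-trans (≤-reflexive (trans (cong (λ x → I j (mapᵥ (tr u v) w) * ((x * 1) * (χ (tr u v (lookup w t′)) u * 1))) (𝟙-no (tr u v (lookup w t) F.≟ v) (ne p))) (*-zeroʳ (I j (mapᵥ (tr u v) w))))) z≤n
      where
      ne : ∀ {x} → ¬ x ≡ u → ¬ tr u v x ≡ v
      ne {x} x≢u eq with tr-cases u v x
      ... | inj₁ (p , _) = x≢u p
      ... | inj₂ (inj₁ (_ , refl , q)) = x≢u (trans (sym eq) q)
      ... | inj₂ (inj₂ (_ , x≢v , q)) = x≢v (trans (sym q) eq)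
    ...   | yes _ | no q = ≤-trans (≤-reflexive (trans (cong (λ x → I j (mapᵥ (tr u v) w) * ((χ (tr u v (lookup w t)) v * 1) * (x * 1))) (𝟙-no (tr u v (lookup w t′) F.≟ u) (ne q))) (trans (cong (I j (mapᵥ (tr u v) w) *_) (*-zeroʳ (χ (tr u v (lookup w t)) v * 1))) (*-zeroʳ (I j (mapᵥ (tr u v) w)))))) z≤n
      where
      ne : ∀ {x} → ¬ x ≡ v → ¬ tr u v x ≡ u
      ne {x} x≢v eq with tr-cases u v x
      ... | inj₁ (refl , q) = x≢v (trans (sym eq) q)
      ... | inj₂ (inj₁ (_ , p , q)) = x≢v p
      ... | inj₂ (inj₂ (x≢u , _ , q)) = x≢u (trans (sym q) eq)

-- Bernoulli's inequality in the form (1 - d/(c+d))^m ≥ 1/2 when md/(c+d) ≤ 1/2.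
pow≤2pow : ∀ c d m → 0 < c + d → 2 * (m * d) ≤ c + d → (c + d) ^ m ≤ 2 * c ^ m
pow≤2pow c d m 0<T h = *-cancelʳ-≤ (T ^ m) (2 * c ^ m) T {{>-nonZero 0<T}} (+-cancelʳ-≤ (T ^ m * T) _ _ (begin
  T ^ m * T + T ^ m * T ≡⟨ alg (T ^ m * T) ⟩
  2 * (T ^ m * T) ≤⟨ *-monoʳ-≤ 2 (bernoulli m) ⟩
  2 * (c ^ m * T + m * d * T ^ m) ≡⟨ alg₂ (c ^ m) T m d (T ^ m) ⟩
  2 * c ^ m * T + 2 * (m * d) * T ^ m ≤⟨ +-monoʳ-≤ (2 * c ^ m * T) (*-monoˡ-≤ (T ^ m) h) ⟩
  2 * c ^ m * T + T * T ^ m ≡⟨ cong (2 * c ^ m * T +_) (*-comm T (T ^ m)) ⟩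
  2 * c ^ m * T + T ^ m * T ∎))
  where
  open ≤-Reasoning
  T = c + d
  alg : ∀ x → x + x ≡ 2 * x
  alg = solve-∀
  alg₂ : ∀ x T m d y → 2 * (x * T + m * d * y) ≡ 2 * x * T + 2 * (m * d) * y
  alg₂ = solve-∀
  bernoulli : ∀ m → T ^ m * T ≤ c ^ m * T + m * d * T ^ m
  bernoulli zero    = ≤-reflexive (sym (+-identityʳ (1 * T)))
  bernoulli (suc m) = begin
    T * T ^ m * T ≡⟨ *-assoc T (T ^ m) T ⟩
    T * (T ^ m * T) ≤⟨ *-monoʳ-≤ T (bernoulli m) ⟩
    T * (c ^ m * T + m * d * T ^ m) ≡⟨ alg₃ c d (c ^ m) T m (T ^ m) ⟩
    c * c ^ m * T + (d * (c ^ m * T) + m * d * (T * T ^ m)) ≤⟨ +-monoʳ-≤ (c * c ^ m * T) (+-monoˡ-≤ (m * d * (T * T ^ m)) (*-monoʳ-≤ d (*-monoˡ-≤ T (^-monoˡ-≤ m (m≤m+n c d))))) ⟩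
    c * c ^ m * T + (d * (T ^ m * T) + m * d * (T * T ^ m)) ≡⟨ alg₄ (c * c ^ m * T) d (T ^ m) T m ⟩
    c * c ^ m * T + suc m * d * (T * T ^ m) ∎
    where
    alg₃ : ∀ c d x T m y → (c + d) * (x * T + m * d * y) ≡ c * x * T + (d * (x * T) + m * d * ((c + d) * y))
    alg₃ = solve-∀
    alg₄ : ∀ z d y T m → z + (d * (y * T) + m * d * (T * y)) ≡ z + suc m * d * (T * y)
    alg₄ = solve-∀

ρ-full : ∀ n (σ : Code n) {b} → b ≤ n → ρ σ n b ≡ b
ρ-full zero    σ       z≤n = refl
ρ-full (suc n) (k , σ) {b} p = trans (cong (lt (toℕ k) b +_) (ρ-full n σ (remaining-≤ b k p))) (m+[n∸m]≡n (lt≤ (toℕ k) b))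

ρ-monoˡ : ∀ {n} (σ : Code n) {a c} b → a ≤ c → ρ σ a b ≤ ρ σ c b
ρ-monoˡ {n} σ {a} {c} b p = subst₂ _≤_ (ρ-inv n σ b a) (ρ-inv n σ b c) (ρ-monoʳ (inv n σ) b p)

sum-lt-self : ∀ n {a} → a ≤ n → sum {n} (λ t → lt (toℕ t) a) ≡ a
sum-lt-self n {a} p = trans (sum-lt n a id p) (trans (cong₂ _+_ (*-identityʳ a) (*-zeroʳ (n ∸ a))) (+-identityʳ a))

module LiftCount (n a₀ a₁ b₀ b₁ e : ℕ) (a₀≤a₁ : a₀ ≤ a₁) (b₀≤b₁ : b₀ ≤ b₁) (2a₁≤n : 2 * a₁ ≤ n) (2b₁≤n : 2 * b₁ ≤ n) where
  open Lift n a₀ a₁ b₀ b₁ e a₀≤a₁ b₀≤b₁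

  a₁≤n : a₁ ≤ n
  a₁≤n = double≤⇒≤ n a₁ 2a₁≤n
  b₁≤n : b₁ ≤ n
  b₁≤n = double≤⇒≤ n b₁ 2b₁≤n

  card : ℕ → ℕ
  card j = ∑ n (λ σ → 𝟙 (near? j (ρ σ)))

  pairs : (f g : ℕ → ℕ → ℕ) → Vec (Fin n) n → ℕ
  pairs f g w = sum (λ t → f (toℕ t) (toℕ (lookup w t))) * sum (λ t → g (toℕ t) (toℕ (lookup w t)))

  collect : ∀ j (f g : ℕ → ℕ → ℕ) →
    sum (λ t → sum (λ t′ → ∑w n n (λ w → I j w * (f (toℕ t) (toℕ (lookup w t)) * g (toℕ t′) (toℕ (lookup w t′)))))) ≡
    ∑ n (λ σ → 𝟙 (near? j (ρ σ)) * pairs f g (decode σ))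
  collect j f g = begin
    sum (λ t → sum (λ t′ → ∑w n n (λ w → I j w * (x w t * y w t′))))
      ≡⟨ cong-S sum-additive (λ t → sym (sum-swap (∑w-additive n n) (λ t′ w → I j w * (x w t * y w t′)))) ⟩
    sum (λ t → ∑w n n (λ w → sum (λ t′ → I j w * (x w t * y w t′))))
      ≡⟨ sum-swap (∑w-additive n n) (λ t w → sum (λ t′ → I j w * (x w t * y w t′))) ⟨
    ∑w n n (λ w → sum (λ t → sum (λ t′ → I j w * (x w t * y w t′))))
      ≡⟨ cong-S (∑w-additive n n) factor ⟩
    ∑w n n (λ w → 𝟙 (inj? w) * (𝟙 (near? j (rk w)) * pairs f g w))
      ≡⟨ ∑w-inj n (λ w → 𝟙 (near? j (rk w)) * pairs f g w) ⟩
    ∑ n (λ σ → 𝟙 (near? j (rk (decode σ))) * pairs f g (decode σ))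
      ≡⟨ cong-S (∑-additive n) (λ σ → cong (_* pairs f g (decode σ)) (𝟙-cong (near? j (rk (decode σ))) (near? j (ρ σ))
           (near-cong j (rk-decode σ)) (near-cong j (λ a b → sym (rk-decode σ a b))))) ⟩
    ∑ n (λ σ → 𝟙 (near? j (ρ σ)) * pairs f g (decode σ)) ∎
    where
    open ≡-Reasoning
    x y : Vec (Fin n) n → Fin n → ℕ
    x w t = f (toℕ t) (toℕ (lookup w t))
    y w t = g (toℕ t) (toℕ (lookup w t))
    factor : ∀ w → sum (λ t → sum (λ t′ → I j w * (x w t * y w t′))) ≡ 𝟙 (inj? w) * (𝟙 (near? j (rk w)) * pairs f g w)
    factor w = trans (cong-S sum-additive (λ t → trans (*-S sum-additive (I j w) (λ t′ → x w t * y w t′)) (cong (I j w *_) (*-S sum-additive (x w t) (y w)))))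
      (trans (*-S sum-additive (I j w) (λ t → x w t * sum (y w))) (trans (cong (I j w *_) (*ʳ-S sum-additive (sum (y w)) (x w)))
        (*-assoc (𝟙 (inj? w)) (𝟙 (near? j (rk w))) (sum (x w) * sum (y w)))))

  -- Rows are early below a₀ and late from a₁ on, values low below b₀ and high from b₁ on. `P`
  -- (early high) and `Q` (late low) mark the points that an exchange consumes, `K` (early low) and
  -- `Z` (late high) those that it creates.
  P Q K Z : ℕ → ℕ → ℕ
  P t x = lt t a₀ * ge x b₁
  Q t x = ge t a₁ * lt x b₀
  K t x = lt t a₀ * lt x b₀
  Z t x = ge t a₁ * ge x b₁

  exchanged : ∀ j → ∑ n (λ σ → 𝟙 (near? j (ρ σ)) * pairs P Q (decode σ)) ≤ ∑ n (λ σ → 𝟙 (near? (suc j) (ρ σ)) * pairs K Z (decode σ))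
  exchanged j = subst₂ _≤_ (collect j P Q) (collect (suc j) K Z) (mono-S sum-additive (λ t → mono-S sum-additive (λ t′ → exchange j t t′)))

  N# : (ℕ → ℕ → ℕ) → Code n → ℕ
  N# f σ = sum (λ t → f (toℕ t) (toℕ (lookup (decode σ) t)))

  split : ∀ σ (f g h : ℕ → ℕ → ℕ) → (∀ t x → f t x + g t x ≡ h t x) → N# f σ + N# g σ ≡ N# h σ
  split σ f g h e = trans (sym (+-S sum-additive (λ t → f (toℕ t) (toℕ (lookup (decode σ) t))) (λ t → g (toℕ t) (toℕ (lookup (decode σ) t)))))
    (cong-S sum-additive (λ t → e (toℕ t) (toℕ (lookup (decode σ) t))))

  column : ∀ σ b → b ≤ n → N# (λ t x → lt x b) σ ≡ b
  column σ b b≤n = trans (cong-S sum-additive (λ t → sym (trans (cong (_* lt (toℕ (lookup (decode σ) t)) b) (lt-yes (F.toℕ<n t))) (*-identityˡ _))))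
    (trans (rk-decode σ n b) (ρ-full n σ b≤n))

  P-count : ∀ σ → N# P σ + ρ σ a₀ b₁ ≡ a₀
  P-count σ = trans (cong (N# P σ +_) (sym (rk-decode σ a₀ b₁))) (trans
    (split σ P (λ t x → lt t a₀ * lt x b₁) (λ t x → lt t a₀) (λ t x → trans (sym (*-distribˡ-+ (lt t a₀) (ge x b₁) (lt x b₁))) (trans (cong (lt t a₀ *_) (trans (+-comm (ge x b₁) (lt x b₁)) (lt+ge x b₁))) (*-identityʳ (lt t a₀)))))
    (sum-lt-self n (≤-trans a₀≤a₁ a₁≤n)))

  ge-rows : ∀ σ b → b ≤ n → N# (λ t x → ge t a₁ * lt x b) σ + ρ σ a₁ b ≡ b
  ge-rows σ b b≤n = trans (cong (N# (λ t x → ge t a₁ * lt x b) σ +_) (sym (rk-decode σ a₁ b))) (trans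
    (split σ (λ t x → ge t a₁ * lt x b) (λ t x → lt t a₁ * lt x b) (λ t x → lt x b) (λ t x → trans (sym (*-distribʳ-+ (lt x b) (ge t a₁) (lt t a₁))) (trans (cong (_* lt x b) (trans (+-comm (ge t a₁) (lt t a₁)) (lt+ge t a₁))) (*-identityˡ (lt x b)))))
    (column σ b b≤n))

  Z-count : ∀ σ → N# Z σ + b₁ + a₁ ≡ n + ρ σ a₁ b₁
  Z-count σ = begin
    N# Z σ + b₁ + a₁ ≡⟨ cong (λ x → N# Z σ + x + a₁) (ge-rows σ b₁ b₁≤n) ⟨
    N# Z σ + (q + r) + a₁ ≡⟨ alg (N# Z σ) q r a₁ ⟩
    N# Z σ + q + a₁ + r ≡⟨ cong (λ x → x + a₁ + r) (split σ Z (λ t x → ge t a₁ * lt x b₁) (λ t x → ge t a₁) (λ t x → trans (sym (*-distribˡ-+ (ge t a₁) (ge x b₁) (lt x b₁))) (trans (cong (ge t a₁ *_) (trans (+-comm (ge x b₁) (lt x b₁)) (lt+ge x b₁))) (*-identityʳ (ge t a₁))))) ⟩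
    N# (λ t x → ge t a₁) σ + a₁ + r ≡⟨ cong (λ x → N# (λ t x → ge t a₁) σ + x + r) (sum-lt-self n a₁≤n) ⟨
    N# (λ t x → ge t a₁) σ + N# (λ t x → lt t a₁) σ + r
      ≡⟨ cong (_+ r) (split σ (λ t x → ge t a₁) (λ t x → lt t a₁) (λ _ _ → 1) (λ t x → trans (+-comm (ge t a₁) (lt t a₁)) (lt+ge t a₁))) ⟩
    N# (λ _ _ → 1) σ + r ≡⟨ cong (_+ r) (trans (sum-const n 1) (*-identityʳ n)) ⟩
    n + r ∎
    where
    open ≡-Reasoning
    q = N# (λ t x → ge t a₁ * lt x b₁) σ
    r = ρ σ a₁ b₁
    alg : ∀ z q r a → z + (q + r) + a ≡ z + q + a + r
    alg = solve-∀

  -- Near the mean there are about a₀β/n, b₀α/n, a₀b₀/n and αβ/n points of the kinds `P`, `Q`, `K`,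
  -- `Z`. Since (a₀β)(b₀α) = (a₀b₀)(αβ), the two sides of `exchanged` carry the same main factor
  -- `W`/n², and `far` keeps the relative errors that matter below 1/(d + 1).
  module Steps (d J : ℕ) (0<n : 0 < n) (0<e : 0 < e) (far : suc d * ((e + J) * n) ≤ a₀ * b₀) where
    x = a₀
    y = b₀
    α = n ∸ a₁
    β = n ∸ b₁
    E = (e + J) * n

    x≤α : x ≤ α
    x≤α = m+n≤o⇒m≤o∸n x (≤-trans (+-monoˡ-≤ a₁ a₀≤a₁) (≤-trans (≤-reflexive (cong (a₁ +_) (sym (+-identityʳ a₁)))) 2a₁≤n))
    y≤β : y ≤ β
    y≤β = m+n≤o⇒m≤o∸n y (≤-trans (+-monoˡ-≤ b₁ b₀≤b₁) (≤-trans (≤-reflexive (cong (b₁ +_) (sym (+-identityʳ b₁)))) 2b₁≤n))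

    0<xy : 0 < x * y
    0<xy = <-≤-trans (*-mono-≤ (s≤s (z≤n {d})) (*-mono-≤ (≤-trans 0<e (m≤m+n e J)) 0<n)) far

    W : ℕ
    W = (x * β) * (y * α)

    0<W : 0 < W
    0<W = <-≤-trans (*-mono-≤ 0<xy 0<xy) (*-mono-≤ (*-monoʳ-≤ x y≤β) (≤-trans (≤-reflexive (*-comm x y)) (*-monoʳ-≤ y x≤α)))

    -- From np = ns - nr ≥ u - E, where E is at most the fraction 1/(d + 1) of xy and hence of u.
    scaled-lower : ∀ {p r s u v} → p + r ≡ s → n * s ≡ u + v → n * r ≤ v + E → x * y ≤ u → d * u ≤ suc d * (n * p)
    scaled-lower {p} {r} {s} {u} {v} e₁ e₂ h xy≤u = +-cancelʳ-≤ (u + suc d * v) _ _ (begin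
      d * u + (u + suc d * v) ≡⟨ alg₁ d u v ⟩
      suc d * (u + v) ≡⟨ cong (suc d *_) (trans (sym e₂) (trans (cong (n *_) (sym e₁)) (*-distribˡ-+ n p r))) ⟩
      suc d * (n * p + n * r) ≤⟨ *-monoʳ-≤ (suc d) (+-monoʳ-≤ (n * p) h) ⟩
      suc d * (n * p + (v + E)) ≡⟨ alg₂ d (n * p) v E ⟩
      suc d * (n * p) + (suc d * E + suc d * v) ≤⟨ +-monoʳ-≤ (suc d * (n * p)) (+-monoˡ-≤ (suc d * v) (≤-trans far xy≤u)) ⟩
      suc d * (n * p) + (u + suc d * v) ∎)
      where
      open ≤-Reasoning
      alg₁ : ∀ d u v → d * u + (u + suc d * v) ≡ suc d * (u + v)
      alg₁ = solve-∀
      alg₂ : ∀ d p v E → suc d * (p + (v + E)) ≡ suc d * p + (suc d * E + suc d * v)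
      alg₂ = solve-∀

    complement : ∀ {b} c → b ≤ n → n * c ≡ c * (n ∸ b) + c * b
    complement {b} c b≤n = trans (*-comm n c) (trans (cong (c *_) (sym (m∸n+n≡m b≤n))) (*-distribˡ-+ c (n ∸ b) b))

    P-lower : ∀ j σ → j ≤ J → Near j (ρ σ) → d * (x * β) ≤ suc d * (n * N# P σ)
    P-lower j σ j≤J near = scaled-lower (P-count σ) (complement a₀ b₁≤n)
      (≤-trans (proj₁ (near (s≤s a₀≤a₁) ≤-refl)) (+-monoʳ-≤ (a₀ * b₁) (*-monoˡ-≤ n (+-monoʳ-≤ e j≤J)))) (*-monoʳ-≤ x y≤β)

    Q-lower : ∀ j σ → j ≤ J → Near j (ρ σ) → d * (y * α) ≤ suc d * (n * N# Q σ)
    Q-lower j σ j≤J near = scaled-lower (ge-rows σ b₀ (≤-trans b₀≤b₁ b₁≤n)) (complement b₀ a₁≤n)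
      (≤-trans (proj₁ (near ≤-refl (s≤s b₀≤b₁))) (+-mono-≤ (≤-reflexive (*-comm a₁ b₀)) (*-monoˡ-≤ n (+-monoʳ-≤ e j≤J))))
      (≤-trans (≤-reflexive (*-comm x y)) (*-monoʳ-≤ y x≤α))

    scaled-upper : ∀ {k u} → k ≤ u + E → x * y ≤ u → suc d * k ≤ (2 + d) * u
    scaled-upper {k} {u} h xy≤u = begin
      suc d * k ≤⟨ *-monoʳ-≤ (suc d) h ⟩
      suc d * (u + E) ≡⟨ *-distribˡ-+ (suc d) u E ⟩
      suc d * u + suc d * E ≤⟨ +-monoʳ-≤ (suc d * u) (≤-trans far xy≤u) ⟩
      suc d * u + u ≡⟨ +-comm (suc d * u) u ⟩
      (2 + d) * u ∎
      where open ≤-Reasoning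

    K-upper : ∀ j σ → j ≤ J → Near j (ρ σ) → suc d * (n * N# K σ) ≤ (2 + d) * (x * y)
    K-upper j σ j≤J near = scaled-upper (≤-trans (≤-reflexive (cong (n *_) (rk-decode σ a₀ b₀)))
      (≤-trans (proj₁ (near (s≤s a₀≤a₁) (s≤s b₀≤b₁))) (+-monoʳ-≤ (a₀ * b₀) (*-monoˡ-≤ n (+-monoʳ-≤ e j≤J))))) ≤-refl

    Z-upper : ∀ j σ → j ≤ J → Near j (ρ σ) → suc d * (n * N# Z σ) ≤ (2 + d) * (α * β)
    Z-upper j σ j≤J near = scaled-upper (+-cancelʳ-≤ (n * b₁ + n * a₁) _ _ (begin
      n * N# Z σ + (n * b₁ + n * a₁) ≡⟨ alg n (N# Z σ) b₁ a₁ ⟩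
      n * (N# Z σ + b₁ + a₁) ≡⟨ cong (n *_) (Z-count σ) ⟩
      n * (n + ρ σ a₁ b₁) ≡⟨ *-distribˡ-+ n n (ρ σ a₁ b₁) ⟩
      n * n + n * ρ σ a₁ b₁ ≤⟨ +-monoʳ-≤ (n * n) (≤-trans (proj₁ (near ≤-refl ≤-refl)) (+-monoʳ-≤ (a₁ * b₁) (*-monoˡ-≤ n (+-monoʳ-≤ e j≤J)))) ⟩
      n * n + (a₁ * b₁ + E) ≡⟨ cong₂ (λ p q → p * q + (a₁ * b₁ + E)) (sym (m∸n+n≡m a₁≤n)) (sym (m∸n+n≡m b₁≤n)) ⟩
      (α + a₁) * (β + b₁) + (a₁ * b₁ + E) ≡⟨ alg₂ α a₁ β b₁ E ⟩
      α * β + E + ((α + a₁) * b₁ + (β + b₁) * a₁) ≡⟨ cong₂ (λ p q → α * β + E + (p * b₁ + q * a₁)) (m∸n+n≡m a₁≤n) (m∸n+n≡m b₁≤n) ⟩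
      α * β + E + (n * b₁ + n * a₁) ∎)) (*-mono-≤ x≤α y≤β)
      where
      open ≤-Reasoning
      alg : ∀ n z b a → n * z + (n * b + n * a) ≡ n * (z + b + a)
      alg = solve-∀
      alg₂ : ∀ α a β b E → (α + a) * (β + b) + (a * b + E) ≡ α * β + E + ((α + a) * b + (β + b) * a)
      alg₂ = solve-∀

    step : ∀ j → j < J → card j * (d * d) ≤ card (suc j) * ((2 + d) * (2 + d))
    step j j<J = *-cancelʳ-≤ _ _ W {{>-nonZero 0<W}} (begin
      card j * (d * d) * W ≡⟨ alg₁ (card j) d (x * β) (y * α) ⟩
      card j * ((d * (x * β)) * (d * (y * α))) ≡⟨ *ʳ-S A ((d * (x * β)) * (d * (y * α))) (λ σ → 𝟙 (near? j (ρ σ))) ⟨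
      ∑ n (λ σ → 𝟙 (near? j (ρ σ)) * ((d * (x * β)) * (d * (y * α))))
        ≤⟨ mono-S A lower ⟩
      ∑ n (λ σ → (suc d * n) * (suc d * n) * (𝟙 (near? j (ρ σ)) * pairs P Q (decode σ)))
        ≡⟨ *-S A ((suc d * n) * (suc d * n)) (λ σ → 𝟙 (near? j (ρ σ)) * pairs P Q (decode σ)) ⟩
      (suc d * n) * (suc d * n) * ∑ n (λ σ → 𝟙 (near? j (ρ σ)) * pairs P Q (decode σ))
        ≤⟨ *-monoʳ-≤ ((suc d * n) * (suc d * n)) (exchanged j) ⟩
      (suc d * n) * (suc d * n) * ∑ n (λ σ → 𝟙 (near? (suc j) (ρ σ)) * pairs K Z (decode σ))
        ≡⟨ *-S A ((suc d * n) * (suc d * n)) (λ σ → 𝟙 (near? (suc j) (ρ σ)) * pairs K Z (decode σ)) ⟨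
      ∑ n (λ σ → (suc d * n) * (suc d * n) * (𝟙 (near? (suc j) (ρ σ)) * pairs K Z (decode σ)))
        ≤⟨ mono-S A upper ⟩
      ∑ n (λ σ → 𝟙 (near? (suc j) (ρ σ)) * (((2 + d) * (x * y)) * ((2 + d) * (α * β))))
        ≡⟨ *ʳ-S A (((2 + d) * (x * y)) * ((2 + d) * (α * β))) (λ σ → 𝟙 (near? (suc j) (ρ σ))) ⟩
      card (suc j) * (((2 + d) * (x * y)) * ((2 + d) * (α * β))) ≡⟨ alg₂ (card (suc j)) (2 + d) x y α β ⟩
      card (suc j) * ((2 + d) * (2 + d)) * W ∎)
      where
      open ≤-Reasoning
      A = ∑-additive n
      alg₁ : ∀ c d u v → c * (d * d) * (u * v) ≡ c * ((d * u) * (d * v))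
      alg₁ = solve-∀
      alg₂ : ∀ c d x y α β → c * ((d * (x * y)) * (d * (α * β))) ≡ c * (d * d) * ((x * β) * (y * α))
      alg₂ = solve-∀
      alg₃ : ∀ d n p q → (d * (n * p)) * (d * (n * q)) ≡ (d * n) * (d * n) * (1 * (p * q))
      alg₃ = solve-∀
      lower : ∀ σ → 𝟙 (near? j (ρ σ)) * ((d * (x * β)) * (d * (y * α))) ≤ (suc d * n) * (suc d * n) * (𝟙 (near? j (ρ σ)) * pairs P Q (decode σ))
      lower σ with near? j (ρ σ)
      ... | no _  = z≤n
      ... | yes h = ≤-trans (≤-reflexive (+-identityʳ _)) (≤-trans (*-mono-≤ (P-lower j σ (<⇒≤ j<J) h) (Q-lower j σ (<⇒≤ j<J) h))
                      (≤-reflexive (alg₃ (suc d) n (N# P σ) (N# Q σ))))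
      upper : ∀ σ → (suc d * n) * (suc d * n) * (𝟙 (near? (suc j) (ρ σ)) * pairs K Z (decode σ)) ≤ 𝟙 (near? (suc j) (ρ σ)) * (((2 + d) * (x * y)) * ((2 + d) * (α * β)))
      upper σ with near? (suc j) (ρ σ)
      ... | no _  = ≤-reflexive (*-zeroʳ ((suc d * n) * (suc d * n)))
      ... | yes h = ≤-trans (≤-reflexive (sym (alg₃ (suc d) n (N# K σ) (N# Z σ)))) (≤-trans (*-mono-≤ (K-upper (suc j) σ j<J h) (Z-upper (suc j) σ j<J h))
                      (≤-reflexive (sym (+-identityʳ _))))

    steps : ∀ g j → g + j ≤ J → card j * (d * d) ^ g ≤ card (g + j) * ((2 + d) * (2 + d)) ^ g
    steps zero    j p = ≤-refl
    steps (suc g) j p = begin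
      card j * ((d * d) * (d * d) ^ g) ≡⟨ *-assoc (card j) (d * d) _ ⟨
      card j * (d * d) * (d * d) ^ g ≤⟨ *-monoˡ-≤ ((d * d) ^ g) (step j (≤-trans (s≤s (m≤n+m j g)) p)) ⟩
      card (suc j) * D² * (d * d) ^ g ≡⟨ alg (card (suc j)) D² ((d * d) ^ g) ⟩
      card (suc j) * (d * d) ^ g * D² ≤⟨ *-monoˡ-≤ D² (steps g (suc j) (subst (_≤ J) (sym (+-suc g j)) p)) ⟩
      card (g + suc j) * D² ^ g * D² ≡⟨ cong (λ i → card i * D² ^ g * D²) (+-suc g j) ⟩
      card (suc g + j) * D² ^ g * D² ≡⟨ alg₂ (card (suc g + j)) (D² ^ g) D² ⟩
      card (suc g + j) * (D² * D² ^ g) ∎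
      where
      open ≤-Reasoning
      D² = (2 + d) * (2 + d)
      alg : ∀ x y z → x * y * z ≡ x * z * y
      alg = solve-∀
      alg₂ : ∀ x y z → x * y * z ≡ x * (z * y)
      alg₂ = solve-∀

    -- One exchange costs ((d + 2)/d)². By `pow≤2pow` a run of g of them costs at most 2, the
    -- condition there being 2 · (2g · 2) ≤ d + 2.
    halve : ∀ g j → 0 < d → 8 * g ≤ d + 2 → g + j ≤ J → card j ≤ 2 * card (g + j)
    halve g j 0<d 8g≤ p = *-cancelʳ-≤ _ _ (d ^ (2 * g)) {{>-nonZero (m^n>0′ d (2 * g) 0<d)}} (begin
      card j * d ^ (2 * g) ≡⟨ cong (card j *_) (sq d) ⟨
      card j * (d * d) ^ g ≤⟨ steps g j p ⟩
      card (g + j) * ((2 + d) * (2 + d)) ^ g ≡⟨ cong (card (g + j) *_) (trans (sq (2 + d)) (cong (_^ (2 * g)) (+-comm 2 d))) ⟩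
      card (g + j) * (d + 2) ^ (2 * g) ≤⟨ *-monoʳ-≤ (card (g + j)) (pow≤2pow d 2 (2 * g) (≤-trans 0<d (m≤m+n d 2)) (≤-trans (≤-reflexive (alg g)) 8g≤)) ⟩
      card (g + j) * (2 * d ^ (2 * g)) ≡⟨ alg₂ (card (g + j)) (d ^ (2 * g)) ⟩
      2 * card (g + j) * d ^ (2 * g) ∎)
      where
      open ≤-Reasoning
      m^n>0′ : ∀ m n → 0 < m → 0 < m ^ n
      m^n>0′ m n 0<m = m^n>0 m {{>-nonZero 0<m}} n
      sq : ∀ d → (d * d) ^ g ≡ d ^ (2 * g)
      sq d = trans (cong (λ x → (d * x) ^ g) (sym (*-identityʳ d))) (^-*-assoc d 2 g)
      alg : ∀ g → 2 * (2 * g * 2) ≡ 8 * g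
      alg = solve-∀
      alg₂ : ∀ x y → x * (2 * y) ≡ 2 * x * y
      alg₂ = solve-∀

    halves : ∀ g h → 0 < d → 8 * g ≤ d + 2 → h * g ≤ J → card 0 ≤ 2 ^ h * card (h * g)
    halves g zero    0<d 8g≤ p = ≤-reflexive (sym (+-identityʳ (card 0)))
    halves g (suc h) 0<d 8g≤ p = begin
      card 0 ≤⟨ halves g h 0<d 8g≤ (≤-trans (m≤n+m (h * g) g) p) ⟩
      2 ^ h * card (h * g) ≤⟨ *-monoʳ-≤ (2 ^ h) (halve g (h * g) 0<d 8g≤ p) ⟩
      2 ^ h * (2 * card (g + h * g)) ≡⟨ alg (2 ^ h) (card (g + h * g)) ⟩
      2 * 2 ^ h * card (suc h * g) ∎
      where
      open ≤-Reasoning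
      alg : ∀ x y → x * (2 * y) ≡ 2 * x * y
      alg = solve-∀

-- Every dyadic box is favourable with probability bounded below

module Start (n a₀ a₁ b₀ b₁ e : ℕ) (a₀≤a₁ : a₀ ≤ a₁) (b₀≤b₁ : b₀ ≤ b₁) where
  open Lift n a₀ a₁ b₀ b₁ e a₀≤a₁ b₀≤b₁

  -- Chebyshev's inequality for the maximal deviation F: either the permutation is near or F²
  -- exceeds (en)², and `small` makes the sum of F² at most half of n!(en)².
  start : ∀ k → 0 < n → 0 < e → (F : Code n → ℕ) → (∀ σ {a b} → a ≤ a₁ → b ≤ b₁ → dev n σ a b ≤ F σ) →
          ∑ n (λ σ → F σ * F σ) ≤ k * (n ! * (n * (a₁ * b₁))) → 2 * k * (a₁ * b₁) ≤ e * e * n →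
          n ! ≤ 2 * ∑ n (λ σ → 𝟙 (near? 0 (ρ σ)))
  start k 0<n 0<e F bound total small = *-cancelʳ-≤ (n !) (2 * C) X {{>-nonZero (*-mono-≤ (*-mono-≤ 0<e 0<n) (*-mono-≤ 0<e 0<n))}} (+-cancelʳ-≤ (n ! * X) _ _ (begin
    n ! * X + n ! * X ≡⟨ alg₁ (n ! * X) ⟩
    2 * (n ! * X) ≤⟨ *-monoʳ-≤ 2 summed ⟩
    2 * (X * C + k * (n ! * (n * (a₁ * b₁)))) ≡⟨ alg₂ X C k (n !) n (a₁ * b₁) ⟩
    2 * C * X + n ! * (n * (2 * k * (a₁ * b₁))) ≤⟨ +-monoʳ-≤ (2 * C * X) (*-monoʳ-≤ (n !) (*-monoʳ-≤ n small)) ⟩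
    2 * C * X + n ! * (n * (e * e * n)) ≡⟨ cong (λ x → 2 * C * X + n ! * x) (alg₃ n e) ⟩
    2 * C * X + n ! * X ∎))
    where
    open ≤-Reasoning
    A = ∑-additive n
    X = e * n * (e * n)
    C = ∑ n (λ σ → 𝟙 (near? 0 (ρ σ)))
    alg₁ : ∀ x → x + x ≡ 2 * x
    alg₁ = solve-∀
    alg₂ : ∀ X C k w n p → 2 * (X * C + k * (w * (n * p))) ≡ 2 * C * X + w * (n * (2 * k * p))
    alg₂ = solve-∀
    alg₃ : ∀ n e → n * (e * e * n) ≡ e * n * (e * n)
    alg₃ = solve-∀
    near : ∀ σ → F σ ≤ e * n → Near 0 (ρ σ)
    near σ h {a} a≤ {b} b≤ =
      ≤-trans (m≤n+∣m-n∣ (n * ρ σ a b) (a * b)) (≤-trans (+-monoʳ-≤ (a * b) h′) (≤-reflexive (cong (λ x → a * b + x * n) (sym (+-identityʳ e))))) ,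
      λ _ _ → ≤-trans (≤-reflexive (+-identityʳ (a * b))) (≤-trans (m≤n+∣n-m∣ (a * b) (n * ρ σ a b)) (+-monoʳ-≤ (n * ρ σ a b) h′))
      where
      h′ : dev n σ a b ≤ e * n
      h′ = ≤-trans (bound σ (≤-pred a≤) (≤-pred b≤)) h
    pointwise : ∀ σ → X ≤ X * 𝟙 (near? 0 (ρ σ)) + F σ * F σ
    pointwise σ with F σ ≤? e * n
    ... | yes h = ≤-trans (≤-reflexive (trans (sym (*-identityʳ X)) (cong (X *_) (sym (𝟙-yes (near? 0 (ρ σ)) (near σ h)))))) (m≤m+n _ (F σ * F σ))
    ... | no ¬h = ≤-trans (*-mono-≤ (≰⇒≥ ¬h) (≰⇒≥ ¬h)) (m≤n+m (F σ * F σ) (X * 𝟙 (near? 0 (ρ σ))))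
    summed : n ! * X ≤ X * C + k * (n ! * (n * (a₁ * b₁)))
    summed = begin
      n ! * X ≡⟨ ∑-const n X ⟨
      ∑ n (λ _ → X) ≤⟨ mono-S A pointwise ⟩
      ∑ n (λ σ → X * 𝟙 (near? 0 (ρ σ)) + F σ * F σ) ≡⟨ +-S A (λ σ → X * 𝟙 (near? 0 (ρ σ))) (λ σ → F σ * F σ) ⟩
      ∑ n (λ σ → X * 𝟙 (near? 0 (ρ σ))) + ∑ n (λ σ → F σ * F σ) ≡⟨ cong (_+ ∑ n (λ σ → F σ * F σ)) (*-S A X (λ σ → 𝟙 (near? 0 (ρ σ)))) ⟩
      X * C + ∑ n (λ σ → F σ * F σ) ≤⟨ +-monoʳ-≤ (X * C) total ⟩
      X * C + k * (n ! * (n * (a₁ * b₁))) ∎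

Dominates : (a₀ a₁ b₀ b₁ : ℕ) (r r′ : ℕ → ℕ → ℕ) → Set
Dominates a₀ a₁ b₀ b₁ r r′ = ∀ {a} → a < suc a₁ → ∀ {b} → b < suc b₁ → a₀ ≤ a → b₀ ≤ b → r′ a b ≤ r a b

abstract
  dominates? : ∀ a₀ a₁ b₀ b₁ r r′ → Dec (Dominates a₀ a₁ b₀ b₁ r r′)
  dominates? a₀ a₁ b₀ b₁ r r′ = allUpTo? (λ a → allUpTo? (λ b → a₀ ≤? a →-dec (b₀ ≤? b →-dec (r′ a b ≤? r a b))) (suc b₁)) (suc a₁)

favourable : ∀ n → (a₀ a₁ b₀ b₁ : ℕ) → ℕ
favourable n a₀ a₁ b₀ b₁ = ∑∑ n (λ π τ → 𝟙 (dominates? a₀ a₁ b₀ b₁ (ρ π) (ρ τ)))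

∑∑-product : ∀ n (f g : Code n → ℕ) → ∑∑ n (λ π τ → f π * g τ) ≡ ∑ n f * ∑ n g
∑∑-product n f g = trans (cong-S (∑-additive n) (λ π → *-S (∑-additive n) (f π) g)) (*ʳ-S (∑-additive n) (∑ n g) f)

-- τ is kept within e = hg of the mean and π is lifted by J = 2e, so that r_π ≥ ab/n + e ≥ r_τ on
-- the box. The lift consists of 2h runs of g exchanges at a factor 2 each; the two Chebyshev
-- estimates contribute the 4.
box-large : ∀ n {a₀ a₁ b₀ b₁} h g → 2 ≤ n → a₀ ≤ a₁ → b₀ ≤ b₁ → 2 * a₁ ≤ n → 2 * b₁ ≤ n → 0 < h → 0 < g →
  8 * g * (3 * (h * g) * n) ≤ a₀ * b₀ → 2 * 256 * (a₁ * b₁) ≤ h * g * (h * g) * n →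
  n ! * n ! ≤ 4 * 2 ^ (2 * h) * favourable n a₀ a₁ b₀ b₁
box-large n {a₀} {a₁} {b₀} {b₁} h g@(suc g′) 2≤n a₀≤a₁ b₀≤b₁ 2a₁≤n 2b₁≤n 0<h 0<g far spread = begin
  n ! * n ! ≤⟨ *-mono-≤ n!≤ n!≤ ⟩
  2 * card 0 * (2 * card 0) ≤⟨ *-monoˡ-≤ (2 * card 0) (*-monoʳ-≤ 2 (halves g (2 * h) (s≤s z≤n) (≤-reflexive (alg₁ g′)) ≤-refl)) ⟩
  2 * (2 ^ (2 * h) * card J) * (2 * card 0) ≡⟨ alg₂ (2 ^ (2 * h)) (card J) (card 0) ⟩
  4 * 2 ^ (2 * h) * (card J * card 0) ≡⟨ cong (4 * 2 ^ (2 * h) *_) (∑∑-product n (λ π → 𝟙 (near? J (ρ π))) (λ τ → 𝟙 (near? 0 (ρ τ)))) ⟨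
  4 * 2 ^ (2 * h) * ∑∑ n (λ π τ → 𝟙 (near? J (ρ π)) * 𝟙 (near? 0 (ρ τ)))
    ≤⟨ *-monoʳ-≤ (4 * 2 ^ (2 * h)) (mono-S (∑-additive n) (λ π → mono-S (∑-additive n) (λ τ →
         ≤-trans (≤-reflexive (sym (𝟙-× (near? J (ρ π)) (near? 0 (ρ τ))))) (𝟙-mono (near? J (ρ π) ×-dec near? 0 (ρ τ)) (dominates? a₀ a₁ b₀ b₁ (ρ π) (ρ τ)) (dominates π τ))))) ⟩
  4 * 2 ^ (2 * h) * favourable n a₀ a₁ b₀ b₁ ∎
  where
  open ≤-Reasoning
  e = h * g
  J = 2 * h * g
  0<n : 0 < n
  0<n = ≤-trans (s≤s z≤n) 2≤n
  0<e : 0 < e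
  0<e = *-mono-≤ 0<h 0<g
  open Lift n a₀ a₁ b₀ b₁ e a₀≤a₁ b₀≤b₁
  open LiftCount n a₀ a₁ b₀ b₁ e a₀≤a₁ b₀≤b₁ 2a₁≤n 2b₁≤n
  alg₁ : ∀ g → 8 * suc g ≡ 6 + 8 * g + 2
  alg₁ = solve-∀
  alg₂ : ∀ x y z → 2 * (x * y) * (2 * z) ≡ 4 * x * (y * z)
  alg₂ = solve-∀
  alg₃ : ∀ h g → h * g + 2 * h * g ≡ 3 * (h * g)
  alg₃ = solve-∀
  alg₄ : ∀ g → 8 * suc g ≡ suc (7 + 8 * g)
  alg₄ = solve-∀
  alg₅ : ∀ x h g n → x + 2 * h * g * n ≡ x + (h * g + 0) * n + h * g * n
  alg₅ = solve-∀
  -- d = 8g - 2 is the least value for which a run of g exchanges is known to cost a factor 2.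
  open Steps (6 + 8 * g′) J 0<n 0<e
    (≤-trans (*-mono-≤ (≤-trans (n≤1+n (7 + 8 * g′)) (≤-reflexive (sym (alg₄ g′)))) (≤-reflexive (cong (_* n) (alg₃ h g)))) far)
  n!≤ : n ! ≤ 2 * card 0
  n!≤ = let (F , bound , total) = maximal-inequality n 2≤n 2a₁≤n 2b₁≤n in
    Start.start n a₀ a₁ b₀ b₁ e a₀≤a₁ b₀≤b₁ 256 0<n 0<e F bound total spread
  dominates : ∀ π τ → Near J (ρ π) × Near 0 (ρ τ) → Dominates a₀ a₁ b₀ b₁ (ρ π) (ρ τ)
  dominates π τ (p , q) {a} a≤ {b} b≤ a₀≤a b₀≤b = *-cancelˡ-≤ n {{>-nonZero 0<n}} (+-cancelʳ-≤ (e * n) _ _ (begin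
    n * ρ τ a b + e * n ≤⟨ +-monoˡ-≤ (e * n) (proj₁ (q a≤ b≤)) ⟩
    a * b + (e + 0) * n + e * n ≡⟨ alg₅ (a * b) h g n ⟨
    a * b + 2 * h * g * n ≤⟨ proj₂ (p a≤ b≤) a₀≤a b₀≤b ⟩
    n * ρ π a b + e * n ∎))

empty : ∀ n → ℕ → ℕ → ℕ
empty n a b = ∑ n (λ σ → 𝟙 (ρ σ a b ≟ 0))

empty-lower : ∀ a n b s t → 0 < t → a ≤ n → (∀ m → n ∸ a ≤ m → b * t + s * m ≤ t * m) → n ! * s ^ a ≤ empty n a b * t ^ a
empty-lower zero    n b s t 0<t _ h = *-monoˡ-≤ 1 (≤-reflexive (sym (trans
  (cong-S (∑-additive n) (λ σ → 𝟙-yes (ρ σ 0 b ≟ 0) (ρ-zeroˡ σ b))) (trans (∑-const n 1) (*-identityʳ (n !))))))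
empty-lower (suc a) (suc n) b s t 0<t (s≤s a≤n) h = begin
  suc n * n ! * (s * s ^ a) ≡⟨ alg₁ (suc n) (n !) s (s ^ a) ⟩
  s * suc n * (n ! * s ^ a) ≤⟨ *-mono-≤ ratio (empty-lower a n b s t 0<t a≤n h) ⟩
  t * (suc n ∸ b) * (empty n a b * t ^ a) ≡⟨ alg₂ t (suc n ∸ b) (empty n a b) (t ^ a) ⟩
  (suc n ∸ b) * empty n a b * (t * t ^ a) ≤⟨ *-monoˡ-≤ (t * t ^ a) first-row ⟩
  empty (suc n) (suc a) b * (t * t ^ a) ∎
  where
  open ≤-Reasoning
  alg₁ : ∀ n w s x → n * w * (s * x) ≡ s * n * (w * x)
  alg₁ = solve-∀
  alg₂ : ∀ t m z x → t * m * (z * x) ≡ m * z * (t * x)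
  alg₂ = solve-∀
  here : b * t + s * suc n ≤ t * suc n
  here = h (suc n) (≤-trans (m∸n≤m n a) (n≤1+n n))
  b≤ : b ≤ suc n
  b≤ = *-cancelʳ-≤ b (suc n) t {{>-nonZero 0<t}} (≤-trans (m≤m+n (b * t) (s * suc n)) (≤-trans here (≤-reflexive (*-comm t (suc n)))))
  ratio : s * suc n ≤ t * (suc n ∸ b)
  ratio = subst (s * suc n ≤_) (sym (*-distribˡ-∸ t (suc n) b)) (m+n≤o⇒m≤o∸n (s * suc n)
    (≤-trans (≤-reflexive (trans (+-comm (s * suc n) (t * b)) (cong (_+ s * suc n) (*-comm t b)))) here))
  first-row : (suc n ∸ b) * empty n a b ≤ empty (suc n) (suc a) b
  first-row = begin
    (suc n ∸ b) * empty n a b ≤⟨ m≤n+m _ (b * G 1) ⟩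
    b * G 1 + (suc n ∸ b) * G 0 ≡⟨ sum-lt (suc n) b G b≤ ⟨
    sum {suc n} (λ k → G (lt (toℕ k) b)) ∎
    where
    G : ℕ → ℕ
    G x = ∑ n (λ σ → 𝟙 (x + ρ σ a (b ∸ x) ≟ 0))

^-distribʳ-* : ∀ k x y → (x * y) ^ k ≡ x ^ k * y ^ k
^-distribʳ-* zero    x y = refl
^-distribʳ-* (suc k) x y = trans (cong (x * y *_) (^-distribʳ-* k x y)) (alg x y (x ^ k) (y ^ k))
  where
  alg : ∀ x y u v → x * y * (u * v) ≡ x * u * (y * v)
  alg = solve-∀

pow-mono : ∀ x y s t a A → x * s ^ a ≤ y * t ^ a → s ≤ t → a ≤ A → x * s ^ A ≤ y * t ^ A
pow-mono x y s t a A h s≤t a≤A with m≤n⇒∃[o]m+o≡n a≤A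
... | o , refl = begin
  x * s ^ (a + o) ≡⟨ cong (x *_) (^-distribˡ-+-* s a o) ⟩
  x * (s ^ a * s ^ o) ≡⟨ *-assoc x _ _ ⟨
  x * s ^ a * s ^ o ≤⟨ *-mono-≤ h (^-monoˡ-≤ o s≤t) ⟩
  y * t ^ a * t ^ o ≡⟨ *-assoc y _ _ ⟩
  y * (t ^ a * t ^ o) ≡⟨ cong (y *_) (^-distribˡ-+-* t a o) ⟨
  y * t ^ (a + o) ∎
  where open ≤-Reasoning

-- If b ≥ n/4, then a ≤ 4c and every row avoids the columns with probability at least 1/4. Otherwise
-- each row does so with probability at least 1 - 1/D, D = ⌊n/(2b)⌋, and the a rows fit into 8c
-- blocks of ⌊D/2⌋ rows, each block costing a factor 2.
empty-probability : ∀ c n a b → a * b ≤ c * n → 2 * a ≤ n → 2 * b ≤ n → 12 * c ≤ n → 0 < n → n ! ≤ empty n a b * 2 ^ (8 * c)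
empty-probability c n a zero ab 2a≤n 2b≤n 12c≤n 0<n = ≤-trans (≤-reflexive (sym (trans
  (cong-S (∑-additive n) (λ σ → 𝟙-yes (ρ σ a 0 ≟ 0) (ρ-zeroʳ σ a))) (trans (∑-const n 1) (*-identityʳ (n !)))))) (m≤m*n (empty n a 0) (2 ^ (8 * c)) {{m^n≢0 2 (8 * c)}})
empty-probability c n a b@(suc b′) ab 2a≤n 2b≤n 12c≤n 0<n with ≤-total (4 * b) n
... | inj₂ n≤4b = begin
  n ! ≡⟨ trans (sym (*-identityʳ (n !))) (cong (n ! *_) (sym (^-zeroˡ a))) ⟩
  n ! * 1 ^ a ≤⟨ empty-lower a n b 1 4 (s≤s z≤n) (double≤⇒≤ n a 2a≤n) room ⟩
  empty n a b * 4 ^ a ≤⟨ *-monoʳ-≤ (empty n a b) (^-monoʳ-≤ 4 a≤4c) ⟩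
  empty n a b * 4 ^ (4 * c) ≡⟨ cong (empty n a b *_) (trans (^-*-assoc 2 2 (4 * c)) (cong (2 ^_) (sym (*-assoc 2 4 c)))) ⟩
  empty n a b * 2 ^ (8 * c) ∎
  where
  open ≤-Reasoning
  a≤4c : a ≤ 4 * c
  a≤4c = *-cancelʳ-≤ a (4 * c) b (≤-trans ab (≤-trans (*-monoʳ-≤ c n≤4b) (≤-reflexive (alg c b))))
    where
    alg : ∀ c b → c * (4 * b) ≡ 4 * c * b
    alg = solve-∀
  room : ∀ m → n ∸ a ≤ m → b * 4 + 1 * m ≤ 4 * m
  room m n-a≤m = subst (b * 4 + 1 * m ≤_) (alg₁ m) (+-monoˡ-≤ (1 * m) (begin
    b * 4 ≡⟨ alg₂ b ⟩
    2 * (2 * b) ≤⟨ *-monoʳ-≤ 2 2b≤n ⟩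
    2 * n ≤⟨ +-cancelʳ-≤ n _ _ (begin
      2 * n + n ≤⟨ *-monoʳ-≤ 3 n≤ ⟨∘⟩ alg₃ n ⟩
      3 * (m + 4 * c) ≡⟨ alg₄ m c ⟩
      3 * m + 12 * c ≤⟨ +-monoʳ-≤ (3 * m) 12c≤n ⟩
      3 * m + n ∎) ⟩
    3 * m ∎))
    where
    alg₁ : ∀ m → 3 * m + 1 * m ≡ 4 * m
    alg₁ = solve-∀
    alg₂ : ∀ b → b * 4 ≡ 2 * (2 * b)
    alg₂ = solve-∀
    alg₃ : ∀ n → 2 * n + n ≡ 3 * n
    alg₃ = solve-∀
    alg₄ : ∀ m c → 3 * (m + 4 * c) ≡ 3 * m + 12 * c
    alg₄ = solve-∀
    _⟨∘⟩_ : ∀ {x y z} → y ≤ z → x ≡ y → x ≤ z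
    p ⟨∘⟩ refl = p
    n≤ : n ≤ m + 4 * c
    n≤ = ≤-trans (≤-reflexive (sym (m∸n+n≡m (double≤⇒≤ n a 2a≤n)))) (+-mono-≤ n-a≤m a≤4c)
... | inj₁ 4b≤n = *-cancelʳ-≤ (n !) (empty n a b * 2 ^ (8 * c)) (s ^ A) {{>-nonZero (m^n>0 s {{>-nonZero 0<s}} A)}} (begin
  n ! * s ^ A ≤⟨ extend ⟩
  empty n a b * (suc s) ^ A ≡⟨ cong (λ x → empty n a b * x ^ A) (+-comm 1 s) ⟩
  empty n a b * (s + 1) ^ A ≤⟨ *-monoʳ-≤ (empty n a b) doubling ⟩
  empty n a b * (2 ^ (8 * c) * s ^ A) ≡⟨ *-assoc (empty n a b) _ _ ⟨
  empty n a b * 2 ^ (8 * c) * s ^ A ∎)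
  where
  open ≤-Reasoning
  D = n / (2 * b)
  m = D / 2
  s = D ∸ 1
  A = m * (8 * c)
  2≤D : 2 ≤ D
  2≤D = subst (_≤ D) (m*n/n≡m 2 (2 * b)) (/-monoˡ-≤ (2 * b) (≤-trans (≤-reflexive (alg b)) 4b≤n))
    where
    alg : ∀ b → 2 * (2 * b) ≡ 4 * b
    alg = solve-∀
  D≡ : suc s ≡ D
  D≡ = m+[n∸m]≡n (≤-trans (s≤s z≤n) 2≤D)
  0<s : 0 < s
  0<s = ∸-monoˡ-≤ 1 2≤D
  1≤m : 1 ≤ m
  1≤m = /-monoˡ-≤ 2 2≤D
  2m≤D : 2 * m ≤ D
  2m≤D = subst (_≤ D) (*-comm m 2) (m/n*n≤m D 2)
  D<2m+2 : D < 2 + 2 * m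
  D<2m+2 = subst₂ _<_ (sym (m≡m%n+[m/n]*n D 2)) (cong (2 +_) (*-comm m 2)) (+-monoˡ-< (m * 2) (m%n<n D 2))
  n<8mb : n ≤ 8 * m * b
  n<8mb = begin
    n ≡⟨ m≡m%n+[m/n]*n n (2 * b) ⟩
    n % (2 * b) + D * (2 * b) ≤⟨ +-monoˡ-≤ (D * (2 * b)) (<⇒≤ (m%n<n n (2 * b))) ⟩
    suc D * (2 * b) ≤⟨ *-monoˡ-≤ (2 * b) D<2m+2 ⟩
    (2 + 2 * m) * (2 * b) ≤⟨ *-monoˡ-≤ (2 * b) (+-monoˡ-≤ (2 * m) (*-monoʳ-≤ 2 1≤m)) ⟩
    (2 * m + 2 * m) * (2 * b) ≡⟨ alg m b ⟩
    8 * m * b ∎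
    where
    alg : ∀ m b → (2 * m + 2 * m) * (2 * b) ≡ 8 * m * b
    alg = solve-∀
  a≤A : a ≤ A
  a≤A = *-cancelʳ-≤ a A b (≤-trans ab (≤-trans (*-monoʳ-≤ c n<8mb) (≤-reflexive (alg c m b))))
    where
    alg : ∀ c m b → c * (8 * m * b) ≡ m * (8 * c) * b
    alg = solve-∀
  room : ∀ i → n ∸ a ≤ i → b * suc s + s * i ≤ suc s * i
  room i n-a≤i = +-monoˡ-≤ (s * i) (*-cancelˡ-≤ 2 (begin
    2 * (b * suc s) ≡⟨ cong (λ x → 2 * (b * x)) D≡ ⟩
    2 * (b * D) ≡⟨ alg b D ⟩
    D * (2 * b) ≤⟨ m/n*n≤m n (2 * b) ⟩
    n ≤⟨ half-remains n a 2a≤n ⟩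
    2 * (n ∸ a) ≤⟨ *-monoʳ-≤ 2 n-a≤i ⟩
    2 * i ∎))
    where
    alg : ∀ b D → 2 * (b * D) ≡ D * (2 * b)
    alg = solve-∀
  extend : n ! * s ^ A ≤ empty n a b * suc s ^ A
  extend = pow-mono (n !) (empty n a b) s (suc s) a A (empty-lower a n b s (suc s) (s≤s z≤n) (double≤⇒≤ n a 2a≤n) room) (n≤1+n s) a≤A
  doubling : (s + 1) ^ A ≤ 2 ^ (8 * c) * s ^ A
  doubling = begin
    (s + 1) ^ (m * (8 * c)) ≡⟨ ^-*-assoc (s + 1) m (8 * c) ⟨
    ((s + 1) ^ m) ^ (8 * c) ≤⟨ ^-monoˡ-≤ (8 * c) (pow≤2pow s 1 m (≤-trans 0<s (m≤m+n s 1))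
                                          (≤-trans (≤-reflexive (cong (2 *_) (*-identityʳ m))) (≤-trans 2m≤D (≤-reflexive (trans (sym D≡) (+-comm 1 s)))))) ⟩
    (2 * s ^ m) ^ (8 * c) ≡⟨ ^-distribʳ-* (8 * c) 2 (s ^ m) ⟩
    2 ^ (8 * c) * (s ^ m) ^ (8 * c) ≡⟨ cong (2 ^ (8 * c) *_) (^-*-assoc s m (8 * c)) ⟩
    2 ^ (8 * c) * s ^ A ∎

box-small : ∀ c n {a₀ a₁ b₀ b₁} → a₁ * b₁ ≤ c * n → 2 * a₁ ≤ n → 2 * b₁ ≤ n → 12 * c ≤ n → 0 < n →
            n ! * n ! ≤ 2 ^ (8 * c) * favourable n a₀ a₁ b₀ b₁
box-small c n {a₀} {a₁} {b₀} {b₁} h 2a₁≤n 2b₁≤n 12c≤n 0<n = begin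
  n ! * n ! ≤⟨ *-monoʳ-≤ (n !) (empty-probability c n a₁ b₁ h 2a₁≤n 2b₁≤n 12c≤n 0<n) ⟩
  n ! * (empty n a₁ b₁ * 2 ^ (8 * c)) ≡⟨ alg (n !) (empty n a₁ b₁) (2 ^ (8 * c)) ⟩
  2 ^ (8 * c) * (n ! * empty n a₁ b₁) ≡⟨ cong (2 ^ (8 * c) *_) (∑-const n (empty n a₁ b₁)) ⟨
  2 ^ (8 * c) * ∑∑ n (λ π τ → 𝟙 (ρ τ a₁ b₁ ≟ 0)) ≤⟨ *-monoʳ-≤ (2 ^ (8 * c)) (mono-S (∑-additive n) (λ π → mono-S (∑-additive n) (λ τ →
       𝟙-mono (ρ τ a₁ b₁ ≟ 0) (dominates? a₀ a₁ b₀ b₁ (ρ π) (ρ τ)) (λ z {a} p {b} q _ _ →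
         ≤-trans (ρ-monoˡ τ b (≤-pred p)) (≤-trans (ρ-monoʳ τ a₁ (≤-pred q)) (≤-trans (≤-reflexive z) z≤n)))))) ⟩
  2 ^ (8 * c) * favourable n a₀ a₁ b₀ b₁ ∎
  where
  open ≤-Reasoning
  alg : ∀ x y z → x * (y * z) ≡ z * (x * y)
  alg = solve-∀

-- The lower bound

abstract
  -- 2 · 256 comes from the maximal inequality inside Chebyshev's. 864 = 3 · 3 · 8 · 2 · 3 · 2
  -- collects a₁ ≤ 3a₀ and b₁ ≤ 3b₀, the factors 8 and 3 in the threshold for g, and g + 1 ≤ 2g used
  -- twice.
  h₀ : ℕ
  h₀ = 2 * 256 * 864

  h₀-large : 2 * 256 * 864 ≤ h₀
  h₀-large = ≤-refl

  0<h₀ : 0 < h₀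
  0<h₀ = s≤s z≤n

search : ∀ (f : ℕ → ℕ) y N → f 1 ≤ y → y < f (suc N) → ∃[ g ] (0 < g × f g ≤ y × y < f (suc g))
search f y zero    f1≤y y<f1 = contradiction f1≤y (<⇒≱ y<f1)
search f y (suc N) f1≤y y<f  with <-≤-connex y (f (suc N))
... | inj₁ y<f′ = search f y N f1≤y y<f′
... | inj₂ f≤y  = suc N , s≤s z≤n , f≤y , y<f

-- `c₀` bounds a₁b₁/n when even g = 1 is too large: 4 · 24h₀ from the product and 3 from the
-- rounding in the halvings. `K₀` adds the exponents of the two cases.
c₀ K₀ : ℕ
c₀ = 96 * h₀ + 3
K₀ = (2 + 2 * h₀) + 8 * c₀

-- The search brackets a₀b₀ between the thresholds of g and g + 1, so g is of order √(a₀b₀/n): the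
-- lower threshold is `far`, and the upper one yields `spread`. If g = 1 already fails, ab = O(n)
-- and the empty box serves.
box-probability : ∀ n {a₀ a₁ b₀ b₁} → 2 ≤ n → 12 * c₀ ≤ n → a₀ ≤ a₁ → b₀ ≤ b₁ → a₁ ≤ 1 + 2 * a₀ → b₁ ≤ 1 + 2 * b₀ →
                  2 * a₁ ≤ n → 2 * b₁ ≤ n → n ! * n ! ≤ 2 ^ K₀ * favourable n a₀ a₁ b₀ b₁
box-probability n {a₀} {a₁} {b₀} {b₁} 2≤n 12c≤n a₀≤a₁ b₀≤b₁ a₁≤ b₁≤ 2a₁≤n 2b₁≤n with <-≤-connex (a₀ * b₀) (f 1)
  where
  f : ℕ → ℕ
  f g = 8 * g * (3 * (h₀ * g) * n)
... | inj₁ few = ≤-trans (box-small c₀ n product 2a₁≤n 2b₁≤n 12c≤n (≤-trans (s≤s z≤n) 2≤n))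
    (*-monoˡ-≤ (favourable n a₀ a₁ b₀ b₁) (^-monoʳ-≤ 2 (m≤n+m (8 * c₀) (2 + 2 * h₀))))
  where
  open ≤-Reasoning
  alg₁ : ∀ a b → (1 + 2 * a) * (1 + 2 * b) ≡ 4 * (a * b) + (2 * a + 2 * b + 1)
  alg₁ = solve-∀
  alg₂ : ∀ h n → 4 * (8 * 1 * (3 * (h * 1) * n)) + (n + n + n) ≡ (96 * h + 3) * n
  alg₂ = solve-∀
  product : a₁ * b₁ ≤ c₀ * n
  product = begin
    a₁ * b₁ ≤⟨ *-mono-≤ a₁≤ b₁≤ ⟩
    (1 + 2 * a₀) * (1 + 2 * b₀) ≡⟨ alg₁ a₀ b₀ ⟩
    4 * (a₀ * b₀) + (2 * a₀ + 2 * b₀ + 1) ≤⟨ +-mono-≤ (*-monoʳ-≤ 4 (<⇒≤ few)) (+-mono-≤ (+-mono-≤ (≤-trans (*-monoʳ-≤ 2 a₀≤a₁) 2a₁≤n) (≤-trans (*-monoʳ-≤ 2 b₀≤b₁) 2b₁≤n)) (≤-trans (s≤s z≤n) 2≤n)) ⟩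
    4 * (8 * 1 * (3 * (h₀ * 1) * n)) + (n + n + n) ≡⟨ alg₂ h₀ n ⟩
    c₀ * n ∎
... | inj₂ many with search (λ g → 8 * g * (3 * (h₀ * g) * n)) (a₀ * b₀) (a₀ * b₀) many big
  where
  0<n : 0 < n
  0<n = ≤-trans (s≤s z≤n) 2≤n
  big : a₀ * b₀ < 8 * suc (a₀ * b₀) * (3 * (h₀ * suc (a₀ * b₀)) * n)
  big = ≤-trans (m≤n*m (suc (a₀ * b₀)) 8) (m≤m*n _ _ {{>-nonZero (*-mono-≤ (*-mono-≤ (s≤s (z≤n {2})) (*-mono-≤ 0<h₀ (s≤s (z≤n {a₀ * b₀})))) 0<n)}})
... | g , 0<g , lower , upper = ≤-trans (box-large n h₀ g 2≤n a₀≤a₁ b₀≤b₁ 2a₁≤n 2b₁≤n 0<h₀ 0<g lower spread)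
    (*-monoˡ-≤ (favourable n a₀ a₁ b₀ b₁) (≤-trans (≤-reflexive (sym (^-distribˡ-+-* 2 2 (2 * h₀)))) (^-monoʳ-≤ 2 (m≤m+n (2 + 2 * h₀) (8 * c₀)))))
  where
  open ≤-Reasoning
  0<n : 0 < n
  0<n = ≤-trans (s≤s z≤n) 2≤n
  0<a₀b₀ : 0 < a₀ * b₀
  0<a₀b₀ = <-≤-trans (*-mono-≤ (*-mono-≤ (s≤s (z≤n {7})) 0<g) (*-mono-≤ (*-mono-≤ (s≤s (z≤n {2})) (*-mono-≤ 0<h₀ 0<g)) 0<n)) lower
  0<a₀ : 0 < a₀
  0<a₀ = >-nonZero⁻¹ a₀ {{m*n≢0⇒m≢0 a₀ {{>-nonZero 0<a₀b₀}}}}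
  0<b₀ : 0 < b₀
  0<b₀ = >-nonZero⁻¹ b₀ {{m*n≢0⇒n≢0 a₀ {{>-nonZero 0<a₀b₀}}}}
  triple : ∀ {x} → 0 < x → 1 + 2 * x ≤ 3 * x
  triple {x} 0<x = +-monoˡ-≤ (2 * x) 0<x
  alg₁ : ∀ k a b → k * (3 * a * (3 * b)) ≡ k * 9 * (a * b)
  alg₁ = solve-∀
  alg₂ : ∀ k h g n → k * 9 * (8 * (g + g) * (3 * (h * (g + g)) * n)) ≡ k * 864 * (h * (g * g * n))
  alg₂ = solve-∀
  alg₃ : ∀ h g n → h * (h * (g * g * n)) ≡ h * g * (h * g) * n
  alg₃ = solve-∀
  spread : 2 * 256 * (a₁ * b₁) ≤ h₀ * g * (h₀ * g) * n
  spread = begin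
    2 * 256 * (a₁ * b₁) ≤⟨ *-monoʳ-≤ (2 * 256) (*-mono-≤ (≤-trans a₁≤ (triple 0<a₀)) (≤-trans b₁≤ (triple 0<b₀))) ⟩
    2 * 256 * (3 * a₀ * (3 * b₀)) ≡⟨ alg₁ (2 * 256) a₀ b₀ ⟩
    2 * 256 * 9 * (a₀ * b₀) ≤⟨ *-monoʳ-≤ (2 * 256 * 9) (<⇒≤ upper) ⟩
    2 * 256 * 9 * (8 * suc g * (3 * (h₀ * suc g) * n)) ≤⟨ *-monoʳ-≤ (2 * 256 * 9) (*-mono-≤ (*-monoʳ-≤ 8 (+-monoˡ-≤ g 0<g)) (*-monoˡ-≤ n (*-monoʳ-≤ 3 (*-monoʳ-≤ h₀ (+-monoˡ-≤ g 0<g))))) ⟩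
    2 * 256 * 9 * (8 * (g + g) * (3 * (h₀ * (g + g)) * n)) ≡⟨ alg₂ (2 * 256) h₀ g n ⟩
    2 * 256 * 864 * (h₀ * (g * g * n)) ≤⟨ *-monoˡ-≤ (h₀ * (g * g * n)) h₀-large ⟩
    h₀ * (h₀ * (g * g * n)) ≡⟨ alg₃ h₀ g n ⟩
    h₀ * g * (h₀ * g) * n ∎

-- Intersection of the dyadic boxes at the four corners

prod : ∀ {m} → (Fin m → ℕ) → ℕ
prod {zero}  f = 1
prod {suc m} f = f fz * prod (λ i → f (fs i))

prod≤1 : ∀ {m} (f : Fin m → ℕ) → (∀ i → f i ≤ 1) → prod f ≤ 1
prod≤1 {zero}  f h = ≤-refl
prod≤1 {suc m} f h = *-mono-≤ (h fz) (prod≤1 (f ∘ fs) (h ∘ fs))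

0<m*n : ∀ m {n} → 0 < m * n → 0 < m × 0 < n
0<m*n (suc m) {suc n} _ = s≤s z≤n , s≤s z≤n
0<m*n (suc m) {zero}  p = contradiction (subst (0 <_) (*-zeroʳ m) p) λ ()

0<prod : ∀ {m} (f : Fin m → ℕ) → 0 < prod f → ∀ i → 0 < f i
0<prod f p fz     = proj₁ (0<m*n (f fz) p)
0<prod f p (fs i) = 0<prod (f ∘ fs) (proj₂ (0<m*n (f fz) p)) i

prod-mono₂ : ∀ {n m} (f : Fin m → Code n → Code n → ℕ) → (∀ i → Mono₂ (f i)) → Mono₂ (λ π τ → prod (λ i → f i π τ))
prod-mono₂ {m = zero}  f mf p q = ≤-refl
prod-mono₂ {m = suc m} f mf p q = *-mono-≤ (mf fz p q) (prod-mono₂ (f ∘ fs) (mf ∘ fs) p q)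

harris-prod : ∀ n C {m} (f : Fin m → Code n → Code n → ℕ) → (∀ i → Mono₂ (f i)) → (∀ i → n ! * n ! ≤ C * ∑∑ n (f i)) →
              n ! * n ! ≤ C ^ m * ∑∑ n (λ π τ → prod (λ i → f i π τ))
harris-prod n C {zero}  f mf h = ≤-reflexive (sym (trans (+-identityʳ _) (trans (cong-S (∑-additive n) (λ _ → trans (∑-const n 1) (*-identityʳ (n !)))) (∑-const n (n !)))))
harris-prod n C {suc m} f mf h = *-cancelʳ-≤ T (C * C ^ m * ∑∑ n (λ π τ → f fz π τ * P π τ)) T {{>-nonZero (*-mono-≤ (1≤n! n) (1≤n! n))}} (begin
  T * T ≤⟨ *-mono-≤ (h fz) (harris-prod n C (f ∘ fs) (mf ∘ fs) (h ∘ fs)) ⟩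
  C * ∑∑ n (f fz) * (C ^ m * ∑∑ n P) ≡⟨ alg C (∑∑ n (f fz)) (C ^ m) (∑∑ n P) ⟩
  C * C ^ m * (∑∑ n (f fz) * ∑∑ n P) ≤⟨ *-monoʳ-≤ (C * C ^ m) (harris₂ n {f fz} {P} (mf fz) (prod-mono₂ (f ∘ fs) (mf ∘ fs))) ⟩
  C * C ^ m * (T * ∑∑ n (λ π τ → f fz π τ * P π τ)) ≡⟨ alg₂ (C * C ^ m) T (∑∑ n (λ π τ → f fz π τ * P π τ)) ⟩
  C * C ^ m * ∑∑ n (λ π τ → f fz π τ * P π τ) * T ∎)
  where
  open ≤-Reasoning
  T = n ! * n !
  P : Code n → Code n → ℕ
  P π τ = prod (λ i → f (fs i) π τ)
  alg : ∀ a b c d → a * b * (c * d) ≡ a * c * (b * d)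
  alg = solve-∀
  alg₂ : ∀ a b c → a * (b * c) ≡ a * c * b
  alg₂ = solve-∀

-- α and β are the identity or the reflection n ∸_, so that this is the box event at one of the four corners.
corner : ∀ n (α β : ℕ → ℕ) (a₀ a₁ b₀ b₁ : ℕ) → Code n → Code n → ℕ
corner n α β a₀ a₁ b₀ b₁ π τ = 𝟙 (dominates? a₀ a₁ b₀ b₁ (λ a b → ρ π (α a) (β b)) (λ a b → ρ τ (α a) (β b)))

corner-mono : ∀ n α β a₀ a₁ b₀ b₁ → Mono₂ (corner n α β a₀ a₁ b₀ b₁)
corner-mono n α β a₀ a₁ b₀ b₁ p q = 𝟙-mono (dominates? a₀ a₁ b₀ b₁ _ _) (dominates? a₀ a₁ b₀ b₁ _ _)
  (λ h {a} a≤ {b} b≤ a₀≤a b₀≤b → ≤-trans (q (α a) (β b)) (≤-trans (h a≤ b≤ a₀≤a b₀≤b) (p (α a) (β b))))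

complement-swap : ∀ {x y u v s : ℕ} → x + u ≡ s → y + v ≡ s → u ≤ v → y ≤ x
complement-swap {x} {y} {u} {v} e₁ e₂ u≤v = +-cancelʳ-≤ v y x (≤-trans (≤-reflexive (trans e₂ (sym e₁))) (+-monoʳ-≤ x u≤v))

-- Since r(a, n - b) is a minus the rank of the reflected permutation at (a, b), reflection reverses
-- the inequality between π and τ; exchanging the two permutations restores it.
corner-comp : ∀ n (α : ℕ → ℕ) {a₀ a₁ b₀ b₁} → (∀ {a} → a ≤ a₁ → α a ≤ n) → b₁ ≤ n →
              ∑∑ n (corner n α (n ∸_) a₀ a₁ b₀ b₁) ≡ ∑∑ n (corner n α id a₀ a₁ b₀ b₁)
corner-comp n α {a₀} {a₁} {b₀} {b₁} α≤ b₁≤n = begin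
  ∑∑ n (corner n α (n ∸_) a₀ a₁ b₀ b₁)
    ≡⟨ cong-S A (λ π → cong-S A (λ τ → 𝟙-cong (dominates? a₀ a₁ b₀ b₁ _ _) (dominates? a₀ a₁ b₀ b₁ _ _)
        (λ h {a} a≤ {b} b≤ p q → complement-swap (ρ-comp n τ (α≤ (≤-pred a≤)) (≤-trans (≤-pred b≤) b₁≤n)) (ρ-comp n π (α≤ (≤-pred a≤)) (≤-trans (≤-pred b≤) b₁≤n)) (h a≤ b≤ p q))
        (λ h {a} a≤ {b} b≤ p q → complement-swap (trans (+-comm (ρ π (α a) (n ∸ b)) _) (ρ-comp n π (α≤ (≤-pred a≤)) (≤-trans (≤-pred b≤) b₁≤n))) (trans (+-comm (ρ τ (α a) (n ∸ b)) _) (ρ-comp n τ (α≤ (≤-pred a≤)) (≤-trans (≤-pred b≤) b₁≤n))) (h a≤ b≤ p q)))) ⟩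
  ∑ n (λ π → ∑ n (λ τ → G (comp n τ) (comp n π))) ≡⟨ cong-S A (λ π → ∑-comp n (λ τ → G τ (comp n π))) ⟩
  ∑ n (λ π → ∑ n (λ τ → G τ (comp n π))) ≡⟨ ∑-comp n (λ π → ∑ n (λ τ → G τ π)) ⟩
  ∑ n (λ π → ∑ n (λ τ → G τ π)) ≡⟨ ∑-swap n A G ⟩
  ∑∑ n G ∎
  where
  open ≡-Reasoning
  A = ∑-additive n
  G = corner n α id a₀ a₁ b₀ b₁

corner-inv : ∀ n (α β : ℕ → ℕ) {a₀ a₁ b₀ b₁} → ∑∑ n (corner n α β a₀ a₁ b₀ b₁) ≡ ∑∑ n (corner n β α b₀ b₁ a₀ a₁)
corner-inv n α β {a₀} {a₁} {b₀} {b₁} = begin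
  ∑∑ n (corner n α β a₀ a₁ b₀ b₁)
    ≡⟨ cong-S A (λ π → cong-S A (λ τ → 𝟙-cong (dominates? a₀ a₁ b₀ b₁ _ _) (dominates? b₀ b₁ a₀ a₁ _ _)
         (λ h {b} b≤ {a} a≤ p q → subst₂ _≤_ (sym (ρ-inv n τ (β b) (α a))) (sym (ρ-inv n π (β b) (α a))) (h a≤ b≤ q p))
         (λ h {a} a≤ {b} b≤ p q → subst₂ _≤_ (ρ-inv n τ (β b) (α a)) (ρ-inv n π (β b) (α a)) (h b≤ a≤ q p)))) ⟩
  ∑ n (λ π → ∑ n (λ τ → G (inv n π) (inv n τ))) ≡⟨ cong-S A (λ π → ∑-inv n (G (inv n π))) ⟩
  ∑ n (λ π → ∑ n (λ τ → G (inv n π) τ)) ≡⟨ ∑-inv n (λ π → ∑ n (G π)) ⟩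
  ∑∑ n G ∎
  where
  open ≡-Reasoning
  A = ∑-additive n
  G = corner n β α b₀ b₁ a₀ a₁

flip? : ℕ → Fin 2 → ℕ → ℕ
flip? n fz      = id
flip? n (fs fz) = n ∸_

corner-count : ∀ n x y {a₀ a₁ b₀ b₁} → a₁ ≤ n → b₁ ≤ n →
  ∑∑ n (corner n (flip? n x) (flip? n y) a₀ a₁ b₀ b₁) ≡ favourable n a₀ a₁ b₀ b₁ ⊎
  ∑∑ n (corner n (flip? n x) (flip? n y) a₀ a₁ b₀ b₁) ≡ favourable n b₀ b₁ a₀ a₁
corner-count n fz      fz      p q = inj₁ refl
corner-count n fz      (fs fz) p q = inj₁ (corner-comp n id (λ a≤ → ≤-trans a≤ p) q)
corner-count n (fs fz) fz      p q = inj₂ (trans (corner-inv n (n ∸_) id) (corner-comp n id (λ b≤ → ≤-trans b≤ q) p))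
corner-count n (fs fz) (fs fz) p q = inj₂ (trans (corner-comp n (n ∸_) (λ {a} _ → m∸n≤m n a) q)
  (trans (corner-inv n (n ∸_) id) (corner-comp n id (λ b≤ → ≤-trans b≤ q) p)))

-- Iterated rounded halves of n. The rounding is the reason why the box estimates admit a₁ ≤ 1 + 2a₀
-- and not only a₁ ≤ 2a₀.
scale : ℕ → ℕ → ℕ
scale n zero    = n
scale n (suc i) = scale n i / 2

scale≤ : ∀ n i → scale n i ≤ n
scale≤ n zero    = ≤-refl
scale≤ n (suc i) = ≤-trans (m/n≤m (scale n i) 2) (scale≤ n i)

scale-* : ∀ n i → scale n i * 2 ^ i ≤ n
scale-* n zero    = ≤-reflexive (*-identityʳ n)
scale-* n (suc i) = begin
  scale n i / 2 * (2 * 2 ^ i) ≡⟨ *-assoc (scale n i / 2) 2 (2 ^ i) ⟨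
  scale n i / 2 * 2 * 2 ^ i ≤⟨ *-monoˡ-≤ (2 ^ i) (m/n*n≤m (scale n i) 2) ⟩
  scale n i * 2 ^ i ≤⟨ scale-* n i ⟩
  n ∎
  where open ≤-Reasoning

scale-decreasing : ∀ n i → scale n (suc i) ≤ scale n i
scale-decreasing n i = m/n≤m (scale n i) 2

scale-doubling : ∀ n i → scale n i ≤ 1 + 2 * scale n (suc i)
scale-doubling n i = begin
  scale n i ≡⟨ m≡m%n+[m/n]*n (scale n i) 2 ⟩
  scale n i % 2 + scale n i / 2 * 2 ≤⟨ +-mono-≤ (≤-pred (m%n<n (scale n i) 2)) (≤-reflexive (*-comm (scale n i / 2) 2)) ⟩
  1 + 2 * (scale n i / 2) ∎
  where open ≤-Reasoning

2*scale≤ : ∀ n i → 2 * scale n (suc i) ≤ n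
2*scale≤ n i = begin
  2 * (scale n i / 2) ≡⟨ *-comm 2 (scale n i / 2) ⟩
  scale n i / 2 * 2 ≤⟨ m/n*n≤m (scale n i) 2 ⟩
  scale n i ≤⟨ scale≤ n i ⟩
  n ∎
  where open ≤-Reasoning

locate′ : ∀ (d : ℕ → ℕ) y l → y ≤ d 0 → d (suc l) ≤ y → ∃[ i ] (i < suc l × d (suc i) ≤ y × y ≤ d i)
locate′ d y zero    top end = 0 , s≤s z≤n , end , top
locate′ d y (suc l) top end with ≤-total (d (suc l)) y
... | inj₂ y≤  = suc l , ≤-refl , end , y≤
... | inj₁ end′ = let (i , i<l , r) = locate′ d y l top end′ in i , m≤n⇒m≤1+n i<l , r

locate : ∀ n L y → 2 * y ≤ n → scale n (2 + L) ≤ y → ∃[ i ] (scale n (2 + toℕ {suc L} i) ≤ y × y ≤ scale n (1 + toℕ i))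
locate n L y 2y≤n end =
  let (i , i<l , r) = locate′ (λ i → scale n (suc i)) y L top end in
  fromℕ< i<l , subst (λ j → scale n (2 + j) ≤ y × y ≤ scale n (1 + j)) (sym (F.toℕ-fromℕ< i<l)) r
  where
  top : y ≤ scale n 1
  top = subst (_≤ scale n 1) (m*n/n≡m y 2) (/-monoˡ-≤ 2 (≤-trans (≤-reflexive (*-comm y 2)) 2y≤n))

side : ∀ n x → x ≤ n → ∃[ c ] ∃[ y ] (2 * y ≤ n × flip? n c y ≡ x)
side n x x≤n with ≤-total (2 * x) n
... | inj₁ p = fz , x , p , refl
... | inj₂ p = fs fz , n ∸ x , (begin
      2 * (n ∸ x) ≡⟨ *-distribˡ-∸ 2 n x ⟩
      2 * n ∸ 2 * x ≤⟨ ∸-monoʳ-≤ (2 * n) p ⟩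
      2 * n ∸ n ≡⟨ m+n∸m≡n n (n + 0) ⟩
      n + 0 ≡⟨ +-identityʳ n ⟩
      n ∎) , m∸[m∸n]≡n x≤n
  where open ≤-Reasoning

-- Three nested products, over columns, rows and corners, give 4(L + 1)² positively correlated box
-- events, each of probability at least 2^(-K₀).
lower-bound : ∀ n L → 2 ≤ n → 12 * c₀ ≤ n → n < 2 ^ (2 + L) →
              symSize n ^ 2 ≤ comparablePairs n * 2 ^ (K₀ * 4 * (suc L * suc L))
lower-bound n L 2≤n 12c≤n n<2^ = begin
  symSize n ^ 2 ≡⟨ trans (cong (_^ 2) (symSize≡ n)) (cong (n ! *_) (*-identityʳ (n !))) ⟩
  n ! * n ! ≤⟨ harris-prod n (((2 ^ K₀) ^ suc L) ^ suc L) {4} f₁ (λ c → prod-mono₂ (f₂ c) (λ i → prod-mono₂ (f₃ c i) (f₃-mono c i)))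
                                 (λ c → harris-prod n ((2 ^ K₀) ^ suc L) (f₂ c) (λ i → prod-mono₂ (f₃ c i) (f₃-mono c i))
                                   (λ i → harris-prod n (2 ^ K₀) (f₃ c i) (f₃-mono c i) (f₃-bound c i))) ⟩
  (((2 ^ K₀) ^ suc L) ^ suc L) ^ 4 * ∑∑ n (λ π τ → prod (λ c → f₁ c π τ))
                             ≤⟨ *-mono-≤ (≤-reflexive exponent) (mono-S (∑-additive n) (λ π → mono-S (∑-additive n) (λ τ → implies π τ))) ⟩
  2 ^ (K₀ * 4 * (suc L * suc L)) * ∑∑ n (λ π τ → 𝟙 (bruhatLeq? (decode π) (decode τ)))
                             ≡⟨ cong (2 ^ (K₀ * 4 * (suc L * suc L)) *_) (comparablePairs≡ n) ⟨
  2 ^ (K₀ * 4 * (suc L * suc L)) * comparablePairs n ≡⟨ *-comm _ (comparablePairs n) ⟩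
  comparablePairs n * 2 ^ (K₀ * 4 * (suc L * suc L)) ∎
  where
  open ≤-Reasoning
  bits : Fin 4 → Fin 2 × Fin 2
  bits fz                = fz , fz
  bits (fs fz)           = fz , fs fz
  bits (fs (fs fz))      = fs fz , fz
  bits (fs (fs (fs fz))) = fs fz , fs fz
  unbits : ∀ x y → ∃[ c ] bits c ≡ (x , y)
  unbits fz      fz      = fz , refl
  unbits fz      (fs fz) = fs fz , refl
  unbits (fs fz) fz      = fs (fs fz) , refl
  unbits (fs fz) (fs fz) = fs (fs (fs fz)) , refl
  f₃ : Fin 4 → Fin (suc L) → Fin (suc L) → Code n → Code n → ℕ
  f₃ c i j = corner n (flip? n (proj₁ (bits c))) (flip? n (proj₂ (bits c))) (scale n (2 + toℕ i)) (scale n (1 + toℕ i)) (scale n (2 + toℕ j)) (scale n (1 + toℕ j))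
  f₂ : Fin 4 → Fin (suc L) → Code n → Code n → ℕ
  f₂ c i π τ = prod (λ j → f₃ c i j π τ)
  f₁ : Fin 4 → Code n → Code n → ℕ
  f₁ c π τ = prod (λ i → f₂ c i π τ)
  f₃-mono : ∀ c i j → Mono₂ (f₃ c i j)
  f₃-mono c i j = corner-mono n (flip? n (proj₁ (bits c))) (flip? n (proj₂ (bits c))) (scale n (2 + toℕ i)) (scale n (1 + toℕ i)) (scale n (2 + toℕ j)) (scale n (1 + toℕ j))
  f₃-bound : ∀ c i j → n ! * n ! ≤ 2 ^ K₀ * ∑∑ n (f₃ c i j)
  f₃-bound c i j with corner-count n (proj₁ (bits c)) (proj₂ (bits c)) {scale n (2 + toℕ i)} {scale n (1 + toℕ i)} {scale n (2 + toℕ j)} {scale n (1 + toℕ j)} (scale≤ n (1 + toℕ i)) (scale≤ n (1 + toℕ j))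
  ... | inj₁ e = subst (λ x → n ! * n ! ≤ 2 ^ K₀ * x) (sym e) (box-probability n 2≤n 12c≤n (scale-decreasing n (1 + toℕ i)) (scale-decreasing n (1 + toℕ j)) (scale-doubling n (1 + toℕ i)) (scale-doubling n (1 + toℕ j)) (2*scale≤ n (toℕ i)) (2*scale≤ n (toℕ j)))
  ... | inj₂ e = subst (λ x → n ! * n ! ≤ 2 ^ K₀ * x) (sym e) (box-probability n 2≤n 12c≤n (scale-decreasing n (1 + toℕ j)) (scale-decreasing n (1 + toℕ i)) (scale-doubling n (1 + toℕ j)) (scale-doubling n (1 + toℕ i)) (2*scale≤ n (toℕ j)) (2*scale≤ n (toℕ i)))
  exponent : (((2 ^ K₀) ^ suc L) ^ suc L) ^ 4 ≡ 2 ^ (K₀ * 4 * (suc L * suc L))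
  exponent = trans (cong (_^ 4) (trans (cong (_^ suc L) (^-*-assoc 2 K₀ (suc L))) (^-*-assoc 2 (K₀ * suc L) (suc L))))
    (trans (^-*-assoc 2 (K₀ * suc L * suc L) 4) (cong (2 ^_) (alg K₀ (suc L))))
    where
    alg : ∀ k l → k * l * l * 4 ≡ k * 4 * (l * l)
    alg = solve-∀
  -- By n < 2^(2 + L) the last scale is 0, so the boxes reach the edge of the square.
  last≤ : ∀ y → scale n (2 + L) ≤ y
  last≤ y with scale n (2 + L) | scale-* n (2 + L)
  ... | zero  | _ = z≤n
  ... | suc x | h = contradiction (≤-trans (m≤m+n (2 ^ (2 + L)) (x * 2 ^ (2 + L))) h) (<⇒≱ n<2^)
  indicator : ∀ {P : Set} (d : Dec P) → 0 < 𝟙 d → P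
  indicator (yes p) _ = p
  holds : ∀ π τ → 0 < prod (λ c → f₁ c π τ) → BruhatLeq (decode π) (decode τ)
  holds π τ pos a b
    with side n (suc (toℕ a)) (F.toℕ<n a) | side n (suc (toℕ b)) (F.toℕ<n b)
  ... | x , u , 2u≤n , eu | y , v , 2v≤n , ev
    with locate n L u 2u≤n (last≤ u) | locate n L v 2v≤n (last≤ v) | unbits x y
  ... | i , u≥ , u≤ | j , v≥ , v≤ | c , refl = subst₂ _≤_
        (trans (cong₂ (ρ τ) eu ev) (sym (trans (rank≡rk (decode τ) _ _) (rk-decode τ _ _))))
        (trans (cong₂ (ρ π) eu ev) (sym (trans (rank≡rk (decode π) _ _) (rk-decode π _ _))))
        (indicator (dominates? _ _ _ _ _ _) (0<prod (λ j → f₃ c i j π τ) (0<prod (λ i → f₂ c i π τ) (0<prod (λ c → f₁ c π τ) pos c) i) j)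
          (s≤s u≤) (s≤s v≤) u≥ v≥)
  implies : ∀ π τ → prod (λ c → f₁ c π τ) ≤ 𝟙 (bruhatLeq? (decode π) (decode τ))
  implies π τ with bruhatLeq? (decode π) (decode τ)
  ... | yes _ = prod≤1 (λ c → f₁ c π τ) (λ c → prod≤1 (λ i → f₂ c i π τ) (λ i → prod≤1 (λ j → f₃ c i j π τ) (λ j → 𝟙≤1 (dominates? _ _ _ _ _ _))))
  ... | no ¬h with prod (λ c → f₁ c π τ) in eq
  ...   | zero  = z≤n
  ...   | suc _ = contradiction (holds π τ (subst (0 <_) (sym eq) (s≤s z≤n))) ¬h

-- The difference of two Bernoulli fields over a cell is a lazy symmetric random walk

-- A site is hit with weight 1 and missed with weight M; E N is the total weight of f at the difference
-- of the numbers of hits among N sites of the first and of the second field.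
module Walk (M : ℕ) where

  Q : ℕ
  Q = suc M * suc M

  E : ℕ → (ℤ → ℕ) → ℕ
  E zero f = f ℤ.0ℤ
  E (suc N) f = (M * M + 1) * E N f + M * (E N (f ∘ ℤ.suc) + E N (f ∘ ℤ.pred))

  step : (ℤ → ℕ) → ℤ → ℕ
  step f x = (M * M + 1) * f x + M * (f (ℤ.suc x) + f (ℤ.pred x))

  E-additive : ∀ N → Additive (E N)
  E-additive zero    = record { cong-S = λ e → e ℤ.0ℤ ; +-S = λ _ _ → refl ; *-S = λ _ _ → refl }
  E-additive (suc N) = record
    { cong-S = λ e → cong₂ (λ u v → (M * M + 1) * u + M * v) (cong-S A e) (cong₂ _+_ (cong-S A (e ∘ ℤ.suc)) (cong-S A (e ∘ ℤ.pred)))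
    ; +-S = λ f g → trans (cong₂ (λ u v → (M * M + 1) * u + M * v) (+-S A f g) (cong₂ _+_ (+-S A (f ∘ ℤ.suc) (g ∘ ℤ.suc)) (+-S A (f ∘ ℤ.pred) (g ∘ ℤ.pred))))
                    (alg (M * M + 1) M (E N f) (E N g) (E N (f ∘ ℤ.suc)) (E N (g ∘ ℤ.suc)) (E N (f ∘ ℤ.pred)) (E N (g ∘ ℤ.pred)))
    ; *-S = λ c f → trans (cong₂ (λ u v → (M * M + 1) * u + M * v) (*-S A c f) (cong₂ _+_ (*-S A c (f ∘ ℤ.suc)) (*-S A c (f ∘ ℤ.pred))))
                    (alg₂ (M * M + 1) M c (E N f) (E N (f ∘ ℤ.suc)) (E N (f ∘ ℤ.pred))) }
    where
    A = E-additive N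
    alg : ∀ m M a b c d e f → m * (a + b) + M * ((c + d) + (e + f)) ≡ (m * a + M * (c + e)) + (m * b + M * (d + f))
    alg = solve-∀
    alg₂ : ∀ m M x a c e → m * (x * a) + M * (x * c + x * e) ≡ x * (m * a + M * (c + e))
    alg₂ = solve-∀

  E-step : ∀ N f → E (suc N) f ≡ E N (step f)
  E-step N f = sym (trans (+-S A (λ x → (M * M + 1) * f x) (λ x → M * (f (ℤ.suc x) + f (ℤ.pred x))))
    (cong₂ _+_ (*-S A (M * M + 1) f) (trans (*-S A M (λ x → f (ℤ.suc x) + f (ℤ.pred x))) (cong (M *_) (+-S A (f ∘ ℤ.suc) (f ∘ ℤ.pred))))))
    where A = E-additive N

  mass : ∀ N → E N (λ _ → 1) ≡ Q ^ N
  mass zero    = refl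
  mass (suc N) = trans (cong₂ (λ u v → (M * M + 1) * u + M * v) (mass N) (cong₂ _+_ (mass N) (mass N))) (alg M (Q ^ N))
    where
    alg : ∀ M x → (M * M + 1) * x + M * (x + x) ≡ suc M * suc M * x
    alg = solve-∀

  E-const : ∀ N c → E N (λ _ → c) ≡ Q ^ N * c
  E-const N c = trans (const-S (E-additive N) c) (cong (_* c) (mass N))

  E-supersolution : ∀ N b c f → (∀ x → b * step f x ≤ c * f x) → b ^ N * E N f ≤ c ^ N * f ℤ.0ℤ
  E-supersolution zero    b c f h = ≤-refl
  E-supersolution (suc N) b c f h = begin
    b * b ^ N * E (suc N) f ≡⟨ cong (b * b ^ N *_) (E-step N f) ⟩
    b * b ^ N * E N (step f) ≡⟨ alg b (b ^ N) (E N (step f)) ⟩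
    b ^ N * (b * E N (step f)) ≡⟨ cong (b ^ N *_) (*-S A b (step f)) ⟨
    b ^ N * E N (λ x → b * step f x) ≤⟨ *-monoʳ-≤ (b ^ N) (mono-S A h) ⟩
    b ^ N * E N (λ x → c * f x) ≡⟨ cong (b ^ N *_) (*-S A c f) ⟩
    b ^ N * (c * E N f) ≡⟨ alg₂ (b ^ N) c (E N f) ⟩
    c * (b ^ N * E N f) ≤⟨ *-monoʳ-≤ c (E-supersolution N b c f h) ⟩
    c * (c ^ N * f ℤ.0ℤ) ≡⟨ *-assoc c (c ^ N) _ ⟨
    c * c ^ N * f ℤ.0ℤ ∎
    where
    open ≤-Reasoning
    A = E-additive N
    alg : ∀ b x y → b * x * y ≡ x * (b * y)
    alg = solve-∀
    alg₂ : ∀ b x y → b * (x * y) ≡ x * (b * y)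
    alg₂ = solve-∀

  E-bounded : ∀ N {f g} → (∀ x → ∣ x ∣ ≤ N → f x ≤ g x) → E N f ≤ E N g
  E-bounded zero    h = h ℤ.0ℤ z≤n
  E-bounded (suc N) {f} {g} h = +-mono-≤ (*-monoʳ-≤ (M * M + 1) (E-bounded N (λ x p → h x (m≤n⇒m≤1+n p))))
    (*-monoʳ-≤ M (+-mono-≤ (E-bounded N (λ x p → h (ℤ.suc x) (≤-trans (ℤₚ.∣i+j∣≤∣i∣+∣j∣ ℤ.1ℤ x) (s≤s p))))
                           (E-bounded N (λ x p → h (ℤ.pred x) (≤-trans (ℤₚ.∣i+j∣≤∣i∣+∣j∣ ℤ.-1ℤ x) (s≤s p))))))

  E-neg : ∀ N f → E N (λ x → f (ℤ.- x)) ≡ E N f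
  E-neg zero    f = refl
  E-neg (suc N) f = cong₂ (λ u v → (M * M + 1) * u + M * v) (E-neg N f) (trans
    (cong₂ _+_ (trans (cong-S (E-additive N) (λ x → cong f (ℤₚ.neg-distrib-+ ℤ.1ℤ x))) (E-neg N (f ∘ ℤ.pred)))
               (trans (cong-S (E-additive N) (λ x → cong f (ℤₚ.neg-distrib-+ ℤ.-1ℤ x))) (E-neg N (f ∘ ℤ.suc))))
    (+-comm (E N (f ∘ ℤ.pred)) _))

  E-+ : ∀ N K f → E N (λ X → E K (λ Y → f (X ℤ.+ Y))) ≡ E (N + K) f
  E-+ zero    K f = cong-S (E-additive K) (λ Y → cong f (ℤₚ.+-identityˡ Y))
  E-+ (suc N) K f = cong₂ (λ u v → (M * M + 1) * u + M * v) (E-+ N K f) (cong₂ _+_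
    (trans (cong-S (E-additive N) (λ X → cong-S (E-additive K) (λ Y → cong f (ℤₚ.+-assoc ℤ.1ℤ X Y)))) (E-+ N K (f ∘ ℤ.suc)))
    (trans (cong-S (E-additive N) (λ X → cong-S (E-additive K) (λ Y → cong f (ℤₚ.+-assoc ℤ.-1ℤ X Y)))) (E-+ N K (f ∘ ℤ.pred))))

  E-swap : ∀ N {B : Set} {S : (B → ℕ) → ℕ} → Additive S → (f : ℤ → B → ℕ) → S (λ b → E N (λ X → f X b)) ≡ E N (λ X → S (f X))
  E-swap zero    s f = refl
  E-swap (suc N) s f = trans (+-S s (λ b → (M * M + 1) * E N (λ X → f X b)) (λ b → M * (E N (λ X → f (ℤ.suc X) b) + E N (λ X → f (ℤ.pred X) b))))
    (cong₂ _+_ (trans (*-S s (M * M + 1) (λ b → E N (λ X → f X b))) (cong ((M * M + 1) *_) (E-swap N s f)))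
      (trans (*-S s M (λ b → E N (λ X → f (ℤ.suc X) b) + E N (λ X → f (ℤ.pred X) b))) (cong (M *_)
        (trans (+-S s (λ b → E N (λ X → f (ℤ.suc X) b)) (λ b → E N (λ X → f (ℤ.pred X) b)))
          (cong₂ _+_ (E-swap N s (f ∘ ℤ.suc)) (E-swap N s (f ∘ ℤ.pred)))))))

  down : ℕ → ℕ
  down zero    = 1
  down (suc m) = m

  neighbours : ∀ (g : ℕ → ℕ) x → g ∣ ℤ.suc x ∣ + g ∣ ℤ.pred x ∣ ≡ g (suc ∣ x ∣) + g (down ∣ x ∣)
  neighbours g (ℤ.+ zero)        = refl
  neighbours g (ℤ.+ suc m)       = refl
  neighbours g ℤ.-[1+ zero ]     = +-comm (g 0) (g 2)
  neighbours g ℤ.-[1+ suc m ]    = +-comm (g (suc m)) (g (3 + m))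

  step-even : ∀ g x → step (g ∘ ∣_∣) x ≡ (M * M + 1) * g ∣ x ∣ + M * (g (suc ∣ x ∣) + g (down ∣ x ∣))
  step-even g x = cong (λ y → (M * M + 1) * g ∣ x ∣ + M * y) (neighbours g x)

  sq quart : ℕ → ℕ
  sq m = m * m
  quart m = m * m * (m * m)

  V : ℕ → ℕ
  V N = 2 * M * N

  second : ∀ N → Q * E N (sq ∘ ∣_∣) ≡ V N * Q ^ N
  second zero    = trans (*-zeroʳ Q) (sym (trans (*-identityʳ (V 0)) (*-zeroʳ (2 * M))))
  second (suc N) = begin
    Q * E (suc N) (sq ∘ ∣_∣) ≡⟨ cong (Q *_) (E-step N (sq ∘ ∣_∣)) ⟩
    Q * E N (step (sq ∘ ∣_∣)) ≡⟨ cong (Q *_) (cong-S A (λ x → trans (step-even sq x) (local ∣ x ∣))) ⟩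
    Q * E N (λ x → Q * sq ∣ x ∣ + 2 * M) ≡⟨ cong (Q *_) (trans (+-S A (λ x → Q * sq ∣ x ∣) (λ _ → 2 * M)) (cong₂ _+_ (*-S A Q (sq ∘ ∣_∣)) (E-const N (2 * M)))) ⟩
    Q * (Q * E N (sq ∘ ∣_∣) + Q ^ N * (2 * M)) ≡⟨ cong (λ y → Q * (y + Q ^ N * (2 * M))) (second N) ⟩
    Q * (V N * Q ^ N + Q ^ N * (2 * M)) ≡⟨ alg Q M N (Q ^ N) ⟩
    V (suc N) * (Q * Q ^ N) ∎
    where
    open ≡-Reasoning
    A = E-additive N
    alg : ∀ Q M N x → Q * (2 * M * N * x + x * (2 * M)) ≡ 2 * M * suc N * (Q * x)
    alg = solve-∀
    local₀ : ∀ M → (M * M + 1) * 0 + M * (1 * 1 + 1 * 1) ≡ suc M * suc M * 0 + 2 * M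
    local₀ = solve-∀
    local₁ : ∀ M m → (M * M + 1) * (suc m * suc m) + M * ((2 + m) * (2 + m) + m * m) ≡ suc M * suc M * (suc m * suc m) + 2 * M
    local₁ = solve-∀
    local : ∀ m → (M * M + 1) * sq m + M * (sq (suc m) + sq (down m)) ≡ Q * sq m + 2 * M
    local zero    = local₀ M
    local (suc m) = local₁ M m

  -- For the variance v = V N / Q this reads E X⁴ ≤ v + 3v², the Gaussian value up to the lattice
  -- term v. It is the input for the Paley-Zygmund argument.
  fourth : ∀ N → Q * Q * E N (quart ∘ ∣_∣) ≤ Q ^ N * (V N * Q + 3 * (V N * V N))
  fourth zero    = ≤-trans (≤-reflexive (*-zeroʳ (Q * Q))) z≤n
  fourth (suc N) = begin
    Q * Q * E (suc N) (quart ∘ ∣_∣) ≡⟨ cong (Q * Q *_) (E-step N (quart ∘ ∣_∣)) ⟩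
    Q * Q * E N (step (quart ∘ ∣_∣)) ≡⟨ cong (Q * Q *_) (cong-S A (λ x → trans (step-even quart x) (local ∣ x ∣))) ⟩
    Q * Q * E N (λ x → Q * quart ∣ x ∣ + (12 * M * sq ∣ x ∣ + 2 * M))
      ≡⟨ cong (Q * Q *_) (trans (+-S A (λ x → Q * quart ∣ x ∣) (λ x → 12 * M * sq ∣ x ∣ + 2 * M))
           (cong₂ _+_ (*-S A Q (quart ∘ ∣_∣)) (trans (+-S A (λ x → 12 * M * sq ∣ x ∣) (λ _ → 2 * M)) (cong₂ _+_ (*-S A (12 * M) (sq ∘ ∣_∣)) (E-const N (2 * M)))))) ⟩
    Q * Q * (Q * E₄ + (12 * M * E₂ + Q ^ N * (2 * M))) ≡⟨ alg₁ Q M E₄ E₂ (Q ^ N) ⟩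
    Q * (Q * Q * E₄ + (12 * M * (Q * E₂) + Q * Q ^ N * (2 * M)))
      ≤⟨ *-monoʳ-≤ Q (+-monoˡ-≤ (12 * M * (Q * E₂) + Q * Q ^ N * (2 * M)) (fourth N)) ⟩
    Q * (Q ^ N * (V N * Q + 3 * (V N * V N)) + (12 * M * (Q * E₂) + Q * Q ^ N * (2 * M)))
      ≡⟨ cong (λ y → Q * (Q ^ N * (V N * Q + 3 * (V N * V N)) + (12 * M * y + Q * Q ^ N * (2 * M)))) (second N) ⟩
    Q * (Q ^ N * (V N * Q + 3 * (V N * V N)) + (12 * M * (V N * Q ^ N) + Q * Q ^ N * (2 * M)))
      ≤⟨ m≤m+n _ (Q * Q ^ N * (12 * (M * M))) ⟩
    Q * (Q ^ N * (V N * Q + 3 * (V N * V N)) + (12 * M * (V N * Q ^ N) + Q * Q ^ N * (2 * M))) + Q * Q ^ N * (12 * (M * M))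
      ≡⟨ alg₂ Q M N (Q ^ N) ⟩
    Q * Q ^ N * (V (suc N) * Q + 3 * (V (suc N) * V (suc N))) ∎
    where
    open ≤-Reasoning
    A = E-additive N
    E₂ = E N (sq ∘ ∣_∣)
    E₄ = E N (quart ∘ ∣_∣)
    alg₁ : ∀ Q M a b x → Q * Q * (Q * a + (12 * M * b + x * (2 * M))) ≡ Q * (Q * Q * a + (12 * M * (Q * b) + Q * x * (2 * M)))
    alg₁ = solve-∀
    alg₂ : ∀ Q M N x → Q * (x * (2 * M * N * Q + 3 * (2 * M * N * (2 * M * N))) + (12 * M * (2 * M * N * x) + Q * x * (2 * M))) + Q * x * (12 * (M * M))
         ≡ Q * x * (2 * M * suc N * Q + 3 * (2 * M * suc N * (2 * M * suc N)))
    alg₂ = solve-∀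
    local₀ : ∀ M → (M * M + 1) * 0 + M * (1 * 1 * (1 * 1) + 1 * 1 * (1 * 1)) ≡ suc M * suc M * 0 + (12 * M * 0 + 2 * M)
    local₀ = solve-∀
    local₁ : ∀ M m → (M * M + 1) * (suc m * suc m * (suc m * suc m)) + M * ((2 + m) * (2 + m) * ((2 + m) * (2 + m)) + m * m * (m * m))
           ≡ suc M * suc M * (suc m * suc m * (suc m * suc m)) + (12 * M * (suc m * suc m) + 2 * M)
    local₁ = solve-∀
    local : ∀ m → (M * M + 1) * quart m + M * (quart (suc m) + quart (down m)) ≡ Q * quart m + (12 * M * sq m + 2 * M)
    local zero    = local₀ M
    local (suc m) = local₁ M m

  -- [x < -y]
  below : ℕ → ℤ → ℕ
  below y (ℤ.+ n)      = 0
  below y ℤ.-[1+ n ]   = lt y (suc n)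

  beyond : ∀ y x → lt y ∣ x ∣ ≡ below y x + below y (ℤ.- x)
  beyond y (ℤ.+ zero)  = refl
  beyond y (ℤ.+ suc n) = refl
  beyond y ℤ.-[1+ n ]  = sym (+-identityʳ (lt y (suc n)))

  -- Paley–Zygmund: 8uv ≤ 16v²[u > v/4] + u² + 2v² with u = Qx², v = V N.
  anticoncentration : ∀ N y → 4 * (Q * (y * y)) ≤ V N → Q ≤ V N → 0 < V N → Q ^ N ≤ 16 * E N (below y)
  anticoncentration N y 4Qy²≤V Q≤V 0<V = *-cancelˡ-≤ (2 * (V N * V N)) {{>-nonZero (*-mono-≤ (s≤s (z≤n {1})) (*-mono-≤ 0<V 0<V))}} (+-cancelʳ-≤ (6 * (V N * V N) * Q ^ N) _ _ (begin
    2 * (v * v) * q + 6 * (v * v) * q ≡⟨ alg₁ v q ⟩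
    8 * v * (v * q) ≡⟨ cong (8 * v *_) (second N) ⟨
    8 * v * (Q * E N (sq ∘ ∣_∣)) ≡⟨ trans (sym (*-assoc (8 * v) Q _)) (sym (*-S A (8 * v * Q) (sq ∘ ∣_∣))) ⟩
    E N (λ x → 8 * v * Q * sq ∣ x ∣) ≤⟨ mono-S A (λ x → pointwise ∣ x ∣) ⟩
    E N (λ x → 16 * (v * v) * lt y ∣ x ∣ + (Q * Q * quart ∣ x ∣ + 2 * (v * v)))
      ≡⟨ trans (+-S A (λ x → 16 * (v * v) * lt y ∣ x ∣) (λ x → Q * Q * quart ∣ x ∣ + 2 * (v * v)))
           (cong₂ _+_ (*-S A (16 * (v * v)) (λ x → lt y ∣ x ∣)) (trans (+-S A (λ x → Q * Q * quart ∣ x ∣) (λ _ → 2 * (v * v))) (cong₂ _+_ (*-S A (Q * Q) (quart ∘ ∣_∣)) (E-const N (2 * (v * v)))))) ⟩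
    16 * (v * v) * E N (λ x → lt y ∣ x ∣) + (Q * Q * E N (quart ∘ ∣_∣) + q * (2 * (v * v)))
      ≤⟨ +-mono-≤ (≤-reflexive (cong (16 * (v * v) *_) twice)) (+-monoˡ-≤ (q * (2 * (v * v))) (≤-trans (fourth N) (*-monoʳ-≤ q (+-monoˡ-≤ (3 * (v * v)) (*-monoʳ-≤ v Q≤V))))) ⟩
    16 * (v * v) * (2 * E N (below y)) + (q * (v * v + 3 * (v * v)) + q * (2 * (v * v)))
      ≡⟨ alg₂ v q (E N (below y)) ⟩
    2 * (v * v) * (16 * E N (below y)) + 6 * (v * v) * q ∎))
    where
    open ≤-Reasoning
    A = E-additive N
    v = V N
    q = Q ^ N
    alg₁ : ∀ v q → 2 * (v * v) * q + 6 * (v * v) * q ≡ 8 * v * (v * q)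
    alg₁ = solve-∀
    alg₂ : ∀ v q e → 16 * (v * v) * (2 * e) + (q * (v * v + 3 * (v * v)) + q * (2 * (v * v))) ≡ 2 * (v * v) * (16 * e) + 6 * (v * v) * q
    alg₂ = solve-∀
    twice : E N (λ x → lt y ∣ x ∣) ≡ 2 * E N (below y)
    twice = trans (cong-S A (beyond y)) (trans (+-S A (below y) (λ x → below y (ℤ.- x)))
      (trans (cong (E N (below y) +_) (E-neg N (below y))) (cong (E N (below y) +_) (sym (+-identityʳ _)))))
    pointwise : ∀ m → 8 * v * Q * sq m ≤ 16 * (v * v) * lt y m + (Q * Q * quart m + 2 * (v * v))
    pointwise m with <-≤-connex y m
    ... | inj₁ y<m rewrite lt-yes y<m = +-cancelʳ-≤ (16 * (v * v)) _ _ (begin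
        8 * v * Q * (m * m) + 16 * (v * v) ≡⟨ alg₃ v Q m ⟩
        2 * (Q * (m * m) * (4 * v)) + 16 * (v * v) ≤⟨ +-monoˡ-≤ (16 * (v * v)) (2mn≤m²+n² (Q * (m * m)) (4 * v)) ⟩
        Q * (m * m) * (Q * (m * m)) + 4 * v * (4 * v) + 16 * (v * v) ≤⟨ m≤m+n _ (2 * (v * v)) ⟩
        Q * (m * m) * (Q * (m * m)) + 4 * v * (4 * v) + 16 * (v * v) + 2 * (v * v) ≡⟨ alg₄ v Q m ⟩
        16 * (v * v) * 1 + (Q * Q * quart m + 2 * (v * v)) + 16 * (v * v) ∎)
      where
      alg₃ : ∀ v Q m → 8 * v * Q * (m * m) + 16 * (v * v) ≡ 2 * (Q * (m * m) * (4 * v)) + 16 * (v * v)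
      alg₃ = solve-∀
      alg₄ : ∀ v Q m → Q * (m * m) * (Q * (m * m)) + 4 * v * (4 * v) + 16 * (v * v) + 2 * (v * v) ≡ 16 * (v * v) * 1 + (Q * Q * (m * m * (m * m)) + 2 * (v * v)) + 16 * (v * v)
      alg₄ = solve-∀
    ... | inj₂ m≤y = begin
        8 * v * Q * (m * m) ≡⟨ alg₅ v Q m ⟩
        2 * v * (4 * (Q * (m * m))) ≤⟨ *-monoʳ-≤ (2 * v) (≤-trans (*-monoʳ-≤ 4 (*-monoʳ-≤ Q (*-mono-≤ m≤y m≤y))) 4Qy²≤V) ⟩
        2 * v * v ≡⟨ *-assoc 2 v v ⟩
        2 * (v * v) ≤⟨ ≤-trans (m≤n+m (2 * (v * v)) (Q * Q * quart m)) (m≤n+m _ (16 * (v * v) * lt y m)) ⟩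
        16 * (v * v) * lt y m + (Q * Q * quart m + 2 * (v * v)) ∎
      where
      alg₅ : ∀ v Q m → 8 * v * Q * (m * m) ≡ 2 * v * (4 * (Q * (m * m)))
      alg₅ = solve-∀

abstract
  -- 2^15 · 2^k ≤ 2^(16k) for every k ≥ 1, so a potential 2^k can be charged to the exponential
  -- moment 4^(8k) at the price 1/K₁.
  K₁ : ℕ
  K₁ = 2 ^ 15

  K₁-pow : ∀ j → K₁ * 2 ^ j ≡ 2 ^ (15 + j)
  K₁-pow j = sym (^-distribˡ-+-* 2 15 j)

  K₁-large : 64 * 6 ≤ K₁
  K₁-large = ≤ᵇ⇒≤ (64 * 6) (2 ^ 15) tt

-- Contraction of the potentials at one cell

module Persistence (M : ℕ) where
  open Walk M

  -- A discrete substitute for cosh(x/s): growing like 4^(x/s), with second difference O(growth s (x) / s²).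
  growth : ℕ → ℕ → ℕ → ℕ
  growth s zero    m = 0
  growth s (suc f) m = m * m + 4 * growth s f (m ∸ s)

  growth-zero : ∀ s f → growth s f 0 ≡ 0
  growth-zero s zero    = refl
  growth-zero s (suc f) = trans (cong (λ x → 4 * growth s f x) (0∸n≡0 s)) (cong (4 *_) (growth-zero s f))

  -- After multiplication by s² the summand m² contributes 2s², and the shifted copy contributes by
  -- induction 4(2s² + 8G), in which s ≤ m turns 8s² into at most 8m². Truncation at the left end is
  -- harmless because `growth s f 0` is 0.
  growth-second-difference : ∀ s f m → 0 < s →
    s * s * (growth s f (suc m) + growth s f (down m)) ≤ s * s * (2 * growth s f m) + (2 * (s * s) + 8 * growth s f m)
  growth-second-difference s zero m 0<s = ≤-trans (≤-reflexive (*-zeroʳ (s * s))) z≤n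
  growth-second-difference s (suc f) m 0<s with <-≤-connex m s
  ... | inj₁ m<s = begin
    s * s * (suc m * suc m + 4 * growth s f (suc m ∸ s) + (down m * down m + 4 * growth s f (down m ∸ s)))
      ≡⟨ cong₂ (λ a b → s * s * (suc m * suc m + 4 * a + (down m * down m + 4 * b))) (vanish (suc m) m<s) (vanish (down m) (down≤ m m<s)) ⟩
    s * s * (suc m * suc m + 4 * 0 + (down m * down m + 4 * 0)) ≡⟨ cong (s * s *_) (square m) ⟩
    s * s * (2 * (m * m) + 2) ≤⟨ m≤m+n _ (s * s * (2 * (4 * growth s f (m ∸ s))) + 8 * growth s (suc f) m) ⟩
    s * s * (2 * (m * m) + 2) + (s * s * (2 * (4 * growth s f (m ∸ s))) + 8 * growth s (suc f) m)
                                                                  ≡⟨ alg (s * s) (m * m) (4 * growth s f (m ∸ s)) (8 * growth s (suc f) m) ⟩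
    s * s * (2 * growth s (suc f) m) + (2 * (s * s) + 8 * growth s (suc f) m) ∎
    where
    open ≤-Reasoning
    vanish : ∀ k → k ≤ s → growth s f (k ∸ s) ≡ 0
    vanish k k≤s = trans (cong (growth s f) (m≤n⇒m∸n≡0 k≤s)) (growth-zero s f)
    down≤ : ∀ m → m < s → down m ≤ s
    down≤ zero    _ = 0<s
    down≤ (suc m) p = ≤-trans (n≤1+n m) (<⇒≤ p)
    square : ∀ m → suc m * suc m + 4 * 0 + (down m * down m + 4 * 0) ≡ 2 * (m * m) + 2
    square zero    = refl
    square (suc m) = eq m
      where
      eq : ∀ m → suc (suc m) * suc (suc m) + 4 * 0 + (m * m + 4 * 0) ≡ 2 * (suc m * suc m) + 2
      eq = solve-∀
    alg : ∀ S u v w → S * (2 * u + 2) + (S * (2 * v) + w) ≡ S * (2 * (u + v)) + (2 * S + w)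
    alg = solve-∀
  ... | inj₂ s≤m with m≤n⇒∃[o]m+o≡n s≤m
  growth-second-difference s@(suc s′) (suc f) .(s + d) 0<s | inj₂ s≤m | d , refl = begin
    s * s * (suc (s + d) * suc (s + d) + 4 * growth s f (suc (s + d) ∸ s) + ((s′ + d) * (s′ + d) + 4 * growth s f (s′ + d ∸ s)))
      ≤⟨ *-monoʳ-≤ (s * s) (+-mono-≤ (+-monoʳ-≤ (suc (s + d) * suc (s + d)) (*-monoʳ-≤ 4 (≤-reflexive (cong (growth s f) (trans (cong (_∸ s) (sym (+-suc s d))) (m+n∸m≡n s (suc d)))))))
           (+-monoʳ-≤ ((s′ + d) * (s′ + d)) (*-monoʳ-≤ 4 (left d)))) ⟩
    s * s * (suc (s + d) * suc (s + d) + 4 * growth s f (suc d) + ((s′ + d) * (s′ + d) + 4 * growth s f (down d)))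
      ≡⟨ alg₁ s′ d (growth s f (suc d)) (growth s f (down d)) ⟩
    s * s * (2 * ((s + d) * (s + d)) + 2) + 4 * (s * s * (growth s f (suc d) + growth s f (down d)))
      ≤⟨ +-monoʳ-≤ (s * s * (2 * ((s + d) * (s + d)) + 2)) (*-monoʳ-≤ 4 (growth-second-difference s f d 0<s)) ⟩
    s * s * (2 * ((s + d) * (s + d)) + 2) + 4 * (s * s * (2 * G) + (2 * (s * s) + 8 * G))
      ≤⟨ m≤m+n _ (16 * (s * d) + 8 * (d * d)) ⟩
    s * s * (2 * ((s + d) * (s + d)) + 2) + 4 * (s * s * (2 * G) + (2 * (s * s) + 8 * G)) + (16 * (s * d) + 8 * (d * d))
      ≡⟨ alg₂ s d G ⟩
    s * s * (2 * ((s + d) * (s + d) + 4 * G)) + (2 * (s * s) + 8 * ((s + d) * (s + d) + 4 * G))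
      ≡⟨ cong (λ x → s * s * (2 * ((s + d) * (s + d) + 4 * growth s f x)) + (2 * (s * s) + 8 * ((s + d) * (s + d) + 4 * growth s f x))) (m+n∸m≡n s d) ⟨
    s * s * (2 * growth s (suc f) (s + d)) + (2 * (s * s) + 8 * growth s (suc f) (s + d)) ∎
    where
    open ≤-Reasoning
    G = growth s f d
    left : ∀ d → growth s f (s′ + d ∸ s) ≤ growth s f (down d)
    left zero    = ≤-trans (≤-reflexive (trans (cong (growth s f) (m≤n⇒m∸n≡0 (≤-trans (≤-reflexive (+-identityʳ s′)) (n≤1+n s′)))) (growth-zero s f))) z≤n
    left (suc d) = ≤-reflexive (cong (growth s f) (trans (cong (_∸ s) (+-suc s′ d)) (m+n∸m≡n s d)))
    alg₁ : ∀ s′ d a b → suc s′ * suc s′ * (suc (suc s′ + d) * suc (suc s′ + d) + 4 * a + ((s′ + d) * (s′ + d) + 4 * b))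
         ≡ suc s′ * suc s′ * (2 * ((suc s′ + d) * (suc s′ + d)) + 2) + 4 * (suc s′ * suc s′ * (a + b))
    alg₁ = solve-∀
    alg₂ : ∀ s d G → s * s * (2 * ((s + d) * (s + d)) + 2) + 4 * (s * s * (2 * G) + (2 * (s * s) + 8 * G)) + (16 * (s * d) + 8 * (d * d))
         ≡ s * s * (2 * ((s + d) * (s + d) + 4 * G)) + (2 * (s * s) + 8 * ((s + d) * (s + d) + 4 * G))
    alg₂ = solve-∀

  growth-lower : ∀ s {{_ : NonZero s}} f m → m ≤ f → s * s * 4 ^ (m / s) ≤ s * s + 3 * growth s f m
  growth-lower s zero    zero    p = ≤-reflexive (trans (cong (λ k → s * s * 4 ^ k) (0/n≡0 s)) (trans (*-identityʳ (s * s)) (sym (+-identityʳ (s * s)))))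
  growth-lower s (suc f) m p with <-≤-connex m s
  ... | inj₁ m<s = ≤-trans (≤-reflexive (trans (cong (λ k → s * s * 4 ^ k) (m<n⇒m/n≡0 m<s)) (*-identityʳ (s * s)))) (m≤m+n (s * s) _)
  ... | inj₂ s≤m = begin
    s * s * 4 ^ (m / s) ≡⟨ cong (λ k → s * s * 4 ^ k) (m/n≡1+[m∸n]/n s≤m) ⟩
    s * s * (4 * 4 ^ ((m ∸ s) / s)) ≡⟨ alg₁ (s * s) (4 ^ ((m ∸ s) / s)) ⟩
    4 * (s * s * 4 ^ ((m ∸ s) / s)) ≤⟨ *-monoʳ-≤ 4 (growth-lower s f (m ∸ s) (≤-pred (≤-trans (∸-monoʳ-< {m} (>-nonZero⁻¹ s) s≤m) p))) ⟩
    4 * (s * s + 3 * G) ≡⟨ alg₂ (s * s) G ⟩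
    s * s + (3 * (s * s) + 12 * G) ≤⟨ +-monoʳ-≤ (s * s) (+-monoˡ-≤ (12 * G) (*-monoʳ-≤ 3 (*-mono-≤ s≤m s≤m))) ⟩
    s * s + (3 * (m * m) + 12 * G) ≡⟨ alg₃ (s * s) (m * m) G ⟩
    s * s + 3 * (m * m + 4 * G) ∎
    where
    open ≤-Reasoning
    G = growth s f (m ∸ s)
    alg₁ : ∀ S x → S * (4 * x) ≡ 4 * (S * x)
    alg₁ = solve-∀
    alg₂ : ∀ S G → 4 * (S + 3 * G) ≡ S + (3 * S + 12 * G)
    alg₂ = solve-∀
    alg₃ : ∀ S m G → S + (3 * m + 12 * G) ≡ S + 3 * (m + 4 * G)
    alg₃ = solve-∀

  -- 3(s² + growth) dominates s² · 4^(|x|/s), and one step multiplies s² + growth by at most 1 +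
  -- 8M/(s²Q) on average. The hypothesis keeps N such factors below 2, and 3 · 2 = 6.
  exponential-moment : ∀ s {{_ : NonZero s}} N → 16 * (M * N) ≤ s * s * Q → E N (λ x → 4 ^ (∣ x ∣ / s)) ≤ 6 * Q ^ N
  exponential-moment s N h = *-cancelˡ-≤ ((s * s) ^ N * (s * s)) {{m*n≢0 ((s * s) ^ N) (s * s) {{m^n≢0 (s * s) N {{m*n≢0 s s}}}} {{m*n≢0 s s}}}} (begin
    S ^ N * S * E N (λ x → 4 ^ (∣ x ∣ / s)) ≡⟨ *-assoc (S ^ N) S _ ⟩
    S ^ N * (S * E N (λ x → 4 ^ (∣ x ∣ / s))) ≡⟨ cong (S ^ N *_) (*-S A S (λ x → 4 ^ (∣ x ∣ / s))) ⟨
    S ^ N * E N (λ x → S * 4 ^ (∣ x ∣ / s)) ≤⟨ *-monoʳ-≤ (S ^ N) (E-bounded N (λ x p → ≤-trans (growth-lower s N ∣ x ∣ p) (+-monoˡ-≤ (3 * growth s N ∣ x ∣) (m≤n*m S 3)) )) ⟩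
    S ^ N * E N (λ x → 3 * S + 3 * growth s N ∣ x ∣) ≡⟨ cong (S ^ N *_) (trans (cong-S A (λ x → sym (*-distribˡ-+ 3 S (growth s N ∣ x ∣)))) (*-S A 3 Ψ)) ⟩
    S ^ N * (3 * E N Ψ) ≡⟨ alg₁ (S ^ N) (E N Ψ) ⟩
    3 * (S ^ N * E N Ψ) ≤⟨ *-monoʳ-≤ 3 (E-supersolution N S (S * Q + 8 * M) Ψ (λ x → super ∣ x ∣ x refl)) ⟩
    3 * ((S * Q + 8 * M) ^ N * (S + growth s N 0)) ≡⟨ cong (λ x → 3 * ((S * Q + 8 * M) ^ N * (S + x))) (growth-zero s N) ⟩
    3 * ((S * Q + 8 * M) ^ N * (S + 0)) ≤⟨ *-monoʳ-≤ 3 (*-mono-≤ (pow≤2pow (S * Q) (8 * M) N positive (≤-trans (≤-reflexive (alg₂ N M)) (≤-trans h (m≤m+n (S * Q) (8 * M))))) (≤-reflexive (+-identityʳ S))) ⟩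
    3 * (2 * (S * Q) ^ N * S) ≡⟨ cong (λ x → 3 * (2 * x * S)) (^-distribʳ-* N S Q) ⟩
    3 * (2 * (S ^ N * Q ^ N) * S) ≡⟨ alg₃ (S ^ N) (Q ^ N) S ⟩
    S ^ N * S * (6 * Q ^ N) ∎)
    where
    open ≤-Reasoning
    A = E-additive N
    S = s * s
    Ψ : ℤ → ℕ
    Ψ x = S + growth s N ∣ x ∣
    alg₁ : ∀ x y → x * (3 * y) ≡ 3 * (x * y)
    alg₁ = solve-∀
    alg₂ : ∀ N M → 2 * (N * (8 * M)) ≡ 16 * (M * N)
    alg₂ = solve-∀
    alg₃ : ∀ x y S → 3 * (2 * (x * y) * S) ≡ x * S * (6 * y)
    alg₃ = solve-∀
    positive : 0 < S * Q + 8 * M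
    positive = ≤-trans (*-mono-≤ (*-mono-≤ (>-nonZero⁻¹ s) (>-nonZero⁻¹ s)) (s≤s (z≤n {M + M * suc M}))) (m≤m+n (S * Q) (8 * M))
    alg₄ : ∀ M S g u d → S * ((M * M + 1) * (S + g) + M * (S + u + (S + d))) ≡ S * (M * M + 1) * (S + g) + (M * (2 * (S * S)) + M * (S * (u + d)))
    alg₄ = solve-∀
    alg₅ : ∀ M S g → S * (M * M + 1) * (S + g) + (M * (2 * (S * S)) + M * (S * (2 * g) + (2 * S + 8 * g))) + 6 * (M * S) ≡ (S * (suc M * suc M) + 8 * M) * (S + g)
    alg₅ = solve-∀
    super : ∀ m x → ∣ x ∣ ≡ m → S * step Ψ x ≤ (S * Q + 8 * M) * Ψ x
    super m x refl = begin
      S * step Ψ x ≡⟨ cong (S *_) (step-even (λ m → S + growth s N m) x) ⟩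
      S * ((M * M + 1) * (S + g) + M * (S + u + (S + d))) ≡⟨ alg₄ M S g u d ⟩
      S * (M * M + 1) * (S + g) + (M * (2 * (S * S)) + M * (S * (u + d)))
        ≤⟨ +-monoʳ-≤ (S * (M * M + 1) * (S + g)) (+-monoʳ-≤ (M * (2 * (S * S))) (*-monoʳ-≤ M (growth-second-difference s N m (>-nonZero⁻¹ s)))) ⟩
      S * (M * M + 1) * (S + g) + (M * (2 * (S * S)) + M * (S * (2 * g) + (2 * S + 8 * g))) ≤⟨ m≤m+n _ (6 * (M * S)) ⟩
      S * (M * M + 1) * (S + g) + (M * (2 * (S * S)) + M * (S * (2 * g) + (2 * S + 8 * g))) + 6 * (M * S) ≡⟨ alg₅ M S g ⟩
      (S * Q + 8 * M) * (S + g) ∎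
      where
      g = growth s N m
      u = growth s N (suc m)
      d = growth s N (down m)

  pos : ℤ → ℕ
  pos (ℤ.+ n)    = 1
  pos ℤ.-[1+ n ] = 0

  pos≤1 : ∀ x → pos x ≤ 1
  pos≤1 (ℤ.+ n)    = ≤-refl
  pos≤1 ℤ.-[1+ n ] = z≤n

  pos+below : ∀ v {y} X → ∣ v ∣ ≤ y → pos (v ℤ.+ X) + below y X ≤ 1
  pos+below v (ℤ.+ n) h = ≤-trans (≤-reflexive (+-identityʳ _)) (pos≤1 (v ℤ.+ ℤ.+ n))
  pos+below v {y} ℤ.-[1+ n ] h with <-≤-connex y (suc n)
  ... | inj₂ p rewrite lt-no p = ≤-trans (≤-reflexive (+-identityʳ _)) (pos≤1 (v ℤ.+ ℤ.-[1+ n ]))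
  ... | inj₁ p rewrite lt-yes p = ≤-reflexive (cong (_+ 1) (negative v (≤-<-trans h p)))
    where
    negative : ∀ v → ∣ v ∣ < suc n → pos (v ℤ.+ ℤ.-[1+ n ]) ≡ 0
    negative (ℤ.+ m)    q = cong pos (ℤₚ.⊖-< q) ⟨trans⟩ neg (suc n ∸ m) (m<n⇒0<n∸m q)
      where
      _⟨trans⟩_ : ∀ {x y z : ℕ} → x ≡ y → y ≡ z → x ≡ z
      _⟨trans⟩_ = trans
      neg : ∀ k → 0 < k → pos (ℤ.- ℤ.+ k) ≡ 0
      neg (suc k) _ = refl
    negative ℤ.-[1+ m ] q = refl

  pot : ∀ s .{{_ : NonZero s}} → ℤ → ℕ
  pot s x = 2 ^ (∣ x ∣ / s)

  +-/ : ∀ s .{{_ : NonZero s}} a b → (a + b) / s ≤ suc (a / s + b / s)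
  +-/ s a b = ≤-pred (m<n*o⇒m/o<n {a + b} {2 + (a / s + b / s)} {s} (begin-strict
    a + b ≡⟨ cong₂ _+_ (m≡m%n+[m/n]*n a s) (m≡m%n+[m/n]*n b s) ⟩
    a % s + a / s * s + (b % s + b / s * s) <⟨ +-mono-< (+-monoˡ-< (a / s * s) (m%n<n a s)) (+-monoˡ-< (b / s * s) (m%n<n b s)) ⟩
    s + a / s * s + (s + b / s * s) ≡⟨ alg s (a / s) (b / s) ⟩
    (2 + (a / s + b / s)) * s ∎))
    where
    open ≤-Reasoning
    alg : ∀ s x y → s + x * s + (s + y * s) ≡ (2 + (x + y)) * s
    alg = solve-∀

  /-multiple : ∀ k x s t .{{_ : NonZero s}} .{{_ : NonZero t}} → k * t ≤ s → k * (x / s) ≤ x / t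
  /-multiple k x s t h = subst (_≤ x / t) (m*n/n≡m (k * (x / s)) t) (/-monoˡ-≤ t (begin
    k * (x / s) * t ≡⟨ alg k (x / s) t ⟩
    x / s * (k * t) ≤⟨ *-monoʳ-≤ (x / s) h ⟩
    x / s * s ≤⟨ m/n*n≤m x s ⟩
    x ∎))
    where
    open ≤-Reasoning
    alg : ∀ k x t → k * x * t ≡ x * (k * t)
    alg = solve-∀

  -- Potentials arrive at scale r and leave at scale s. The scale s₀ is at least twice the standard
  -- deviation of the cell, so 4^(|X|/s₀) has bounded mean; p = 8s₀ is so much larger that 2^(|X|/p)
  -- has mean at most 1 + 6/K₁; s = 4p leaves room for rounding two exponents.
  module OneStep (N r s₀ p s : ℕ) .{{_ : NonZero r}} {{_ : NonZero s₀}} .{{_ : NonZero p}} .{{_ : NonZero s}}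
    (p≡ : p ≡ 8 * s₀) (s≡ : s ≡ 4 * p) (16r≤p : 16 * r ≤ p)
    (spread : 16 * (M * N) ≤ s₀ * s₀ * Q) (concentrated : 4 * (Q * (16 * r * (16 * r))) ≤ V N) (Q≤V : Q ≤ V N) where

    K₁≢0 : NonZero K₁
    K₁≢0 = >-nonZero (≤-trans (s≤s z≤n) K₁-large)

    e : ℤ → ℕ
    e X = ∣ X ∣ / p

    E2^e : K₁ * E N (λ X → 2 ^ e X) ≤ (K₁ + 6) * Q ^ N
    E2^e = begin
      K₁ * E N (λ X → 2 ^ e X) ≡⟨ *-S A K₁ (λ X → 2 ^ e X) ⟨
      E N (λ X → K₁ * 2 ^ e X) ≤⟨ mono-S A pointwise ⟩
      E N (λ X → K₁ + 4 ^ (∣ X ∣ / s₀)) ≡⟨ trans (+-S A (λ _ → K₁) (λ X → 4 ^ (∣ X ∣ / s₀))) (cong (_+ E N (λ X → 4 ^ (∣ X ∣ / s₀))) (E-const N K₁)) ⟩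
      Q ^ N * K₁ + E N (λ X → 4 ^ (∣ X ∣ / s₀)) ≤⟨ +-monoʳ-≤ (Q ^ N * K₁) (exponential-moment s₀ N spread) ⟩
      Q ^ N * K₁ + 6 * Q ^ N ≡⟨ cong (_+ 6 * Q ^ N) (*-comm (Q ^ N) K₁) ⟩
      K₁ * Q ^ N + 6 * Q ^ N ≡⟨ *-distribʳ-+ (Q ^ N) K₁ 6 ⟨
      (K₁ + 6) * Q ^ N ∎
      where
      open ≤-Reasoning
      A = E-additive N
      pointwise : ∀ X → K₁ * 2 ^ e X ≤ K₁ + 4 ^ (∣ X ∣ / s₀)
      pointwise X with e X | /-multiple 8 ∣ X ∣ p s₀ (≤-reflexive (sym p≡))
      ... | zero  | _ = ≤-trans (≤-reflexive (*-identityʳ K₁)) (m≤m+n K₁ _)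
      ... | suc k | h = ≤-trans (begin
            K₁ * 2 ^ suc k ≡⟨ K₁-pow (suc k) ⟩
            2 ^ (15 + suc k) ≤⟨ ^-monoʳ-≤ 2 (≤-trans (m≤m+n (15 + suc k) (15 * k)) (≤-reflexive (alg k))) ⟩
            2 ^ (2 * (8 * suc k)) ≤⟨ ^-monoʳ-≤ 2 (*-monoʳ-≤ 2 h) ⟩
            2 ^ (2 * (∣ X ∣ / s₀)) ≡⟨ ^-*-assoc 2 2 (∣ X ∣ / s₀) ⟨
            4 ^ (∣ X ∣ / s₀) ∎) (m≤n+m _ K₁)
        where
        alg : ∀ k → 15 + suc k + 15 * k ≡ 2 * (8 * suc k)
        alg = solve-∀

    E2^e≤2 : E N (λ X → 2 ^ e X) ≤ 2 * Q ^ N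
    E2^e≤2 = *-cancelˡ-≤ K₁ {{K₁≢0}} (≤-trans E2^e (≤-trans (*-monoˡ-≤ (Q ^ N) (+-monoʳ-≤ K₁ (≤-trans (m≤n*m 6 64) K₁-large))) (≤-reflexive (alg K₁ (Q ^ N)))))
      where
      alg : ∀ k x → (k + k) * x ≡ k * (2 * x)
      alg = solve-∀

    -- x is the entry above the cell, t the sum of the row to its left, X the cell. The constraint
    -- falls on the new entry x + t + X; the second potential belongs to t + X, which goes on to the
    -- right.
    value : ℤ → ℤ → ℤ → ℕ
    value x t X = pos (x ℤ.+ (t ℤ.+ X)) * (pot s (x ℤ.+ (t ℤ.+ X)) * pot s (t ℤ.+ X))

    module _ (x t : ℤ) where
      u : ℕ
      u = ∣ x ∣ + ∣ t ∣

      outer inner : ∀ X → ℕ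
      outer X = ∣ x ℤ.+ (t ℤ.+ X) ∣
      inner X = ∣ t ℤ.+ X ∣

      outer≤ : ∀ X → outer X ≤ u + ∣ X ∣
      outer≤ X = ≤-trans (ℤₚ.∣i+j∣≤∣i∣+∣j∣ x (t ℤ.+ X)) (≤-trans (+-monoʳ-≤ ∣ x ∣ (ℤₚ.∣i+j∣≤∣i∣+∣j∣ t X)) (≤-reflexive (sym (+-assoc (∣ x ∣) (∣ t ∣) (∣ X ∣)))))
      inner≤ : ∀ X → inner X ≤ u + ∣ X ∣
      inner≤ X = ≤-trans (ℤₚ.∣i+j∣≤∣i∣+∣j∣ t X) (+-monoˡ-≤ ∣ X ∣ (m≤n+m ∣ t ∣ ∣ x ∣))

      exponents : ∀ X → outer X / s + inner X / s ≤ 2 * ((u + ∣ X ∣) / s)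
      exponents X = ≤-trans (+-mono-≤ (/-monoˡ-≤ s (outer≤ X)) (/-monoˡ-≤ s (inner≤ X))) (≤-reflexive (cong ((u + ∣ X ∣) / s +_) (sym (+-identityʳ _))))

      -- Put q = ⌊|X|/p⌋ and k = ⌊(u + |X|)/s⌋. From s = 4p and u ≤ p one gets 4k < q + 2, and for
      -- integers this forces 2k ≤ q. In particular both potentials leave at 1 when |X| < p.
      small-exponents : u ≤ p → ∀ X → outer X / s + inner X / s ≤ e X
      small-exponents u≤p X = ≤-trans (exponents X) (bound (e X) (m≡m%n+[m/n]*n ∣ X ∣ p))
        where
        bound : ∀ q → ∣ X ∣ ≡ ∣ X ∣ % p + q * p → 2 * ((u + ∣ X ∣) / s) ≤ q
        bound q eq = k-bound q ((u + ∣ X ∣) / s) (m<n*o⇒m/o<n {u + ∣ X ∣} {2 + q} {p} (begin-strict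
            u + ∣ X ∣ ≡⟨ cong (u +_) eq ⟩
            u + (∣ X ∣ % p + q * p) <⟨ +-mono-≤-< u≤p (+-monoˡ-< (q * p) (m%n<n ∣ X ∣ p)) ⟩
            p + (p + q * p) ∎))
          where
          open ≤-Reasoning
          k-bound : ∀ q k → (u + ∣ X ∣) / p < 2 + q → 2 * ((u + ∣ X ∣) / s) ≤ q
          k-bound q _ h = go q ((u + ∣ X ∣) / s) (≤-<-trans (/-multiple 4 (u + ∣ X ∣) s p (≤-reflexive (sym s≡))) h)
            where
            go : ∀ q k → 4 * k < 2 + q → 2 * k ≤ q
            go q zero    _ = z≤n
            go q (suc k) h = ≤-pred (≤-pred (≤-trans (≤-trans (m≤m+n (2 + 2 * suc k) (2 * k)) (≤-trans (≤-reflexive (alg k)) (n≤1+n (4 * suc k)))) h))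
              where
              alg : ∀ k → 2 + 2 * suc k + 2 * k ≡ 4 * suc k
              alg = solve-∀

      combine : ∀ X → pot s (x ℤ.+ (t ℤ.+ X)) * pot s (t ℤ.+ X) ≡ 2 ^ (outer X / s + inner X / s)
      combine X = sym (^-distribˡ-+-* 2 (outer X / s) (inner X / s))

      -- The constraint is violated with probability 1/16, which beats the growth of the potential.
      small-case : u ≤ 16 * r → 64 * E N (value x t) ≤ 63 * Q ^ N
      small-case u≤16r = *-cancelˡ-≤ K₁ {{K₁≢0}} (+-cancelʳ-≤ (K₁ * (4 * Q ^ N)) _ _ (begin
        K₁ * (64 * E N (value x t)) + K₁ * (4 * Q ^ N)
          ≤⟨ +-monoʳ-≤ (K₁ * (64 * E N (value x t))) (*-monoʳ-≤ K₁ (*-monoʳ-≤ 4 (anticoncentration N (16 * r) concentrated Q≤V (≤-trans (s≤s z≤n) Q≤V)))) ⟩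
        K₁ * (64 * E N (value x t)) + K₁ * (4 * (16 * B)) ≡⟨ alg₁ K₁ (E N (value x t)) B ⟩
        64 * (K₁ * (E N (value x t) + B)) ≤⟨ *-monoʳ-≤ 64 (*-monoʳ-≤ K₁ total) ⟩
        64 * (K₁ * E N (λ X → 2 ^ e X)) ≤⟨ *-monoʳ-≤ 64 E2^e ⟩
        64 * ((K₁ + 6) * Q ^ N) ≡⟨ *-assoc 64 (K₁ + 6) (Q ^ N) ⟨
        -- The loss 64 · 6/K₁ is at most 3, the gain 64/16 is 4: hence 63.
        64 * (K₁ + 6) * Q ^ N ≤⟨ *-monoˡ-≤ (Q ^ N) (≤-trans (≤-reflexive (*-distribˡ-+ 64 K₁ 6)) (+-monoʳ-≤ (64 * K₁) (≤-trans K₁-large (m≤n*m K₁ 3)))) ⟩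
        (64 * K₁ + 3 * K₁) * Q ^ N ≡⟨ alg₂ K₁ (Q ^ N) ⟩
        K₁ * (63 * Q ^ N) + K₁ * (4 * Q ^ N) ∎))
        where
        open ≤-Reasoning
        A = E-additive N
        B = E N (below (16 * r))
        alg₁ : ∀ k x b → k * (64 * x) + k * (4 * (16 * b)) ≡ 64 * (k * (x + b))
        alg₁ = solve-∀
        alg₂ : ∀ k q → (64 * k + 3 * k) * q ≡ k * (63 * q) + k * (4 * q)
        alg₂ = solve-∀
        pointwise : ∀ X → value x t X + below (16 * r) X ≤ 2 ^ e X
        pointwise X = begin
          pos v * (pot s v * pot s (t ℤ.+ X)) + below (16 * r) X ≡⟨ cong (λ y → pos v * y + below (16 * r) X) (combine X) ⟩
          pos v * 2 ^ (outer X / s + inner X / s) + below (16 * r) X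
            ≤⟨ +-mono-≤ (*-monoʳ-≤ (pos v) (^-monoʳ-≤ 2 (small-exponents (≤-trans u≤16r 16r≤p) X))) (m≤m*n (below (16 * r) X) (2 ^ e X) {{m^n≢0 2 (e X)}}) ⟩
          pos v * 2 ^ e X + below (16 * r) X * 2 ^ e X ≡⟨ *-distribʳ-+ (2 ^ e X) (pos v) (below (16 * r) X) ⟨
          (pos v + below (16 * r) X) * 2 ^ e X ≤⟨ *-monoˡ-≤ (2 ^ e X) (subst (λ z → pos z + below (16 * r) X ≤ 1) (ℤₚ.+-assoc x t X) (pos+below (x ℤ.+ t) X (≤-trans (ℤₚ.∣i+j∣≤∣i∣+∣j∣ x t) u≤16r))) ⟩
          1 * 2 ^ e X ≡⟨ *-identityˡ (2 ^ e X) ⟩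
          2 ^ e X ∎
          where v = x ℤ.+ (t ℤ.+ X)
        total : E N (value x t) + B ≤ E N (λ X → 2 ^ e X)
        total = ≤-trans (≤-reflexive (sym (+-S A (value x t) (below (16 * r))))) (mono-S A pointwise)

      -- Passing from the scale r to s lowers the exponent of the potential of u by more than X can restore.
      large-case : 16 * r ≤ u → 64 * E N (value x t) ≤ 63 * (Q ^ N * (pot r x * pot r t))
      large-case 16r≤u = begin
        64 * E N (value x t) ≤⟨ *-monoʳ-≤ 64 (mono-S A pointwise) ⟩
        64 * E N (λ X → 2 ^ (2 + 2 * (u / s)) * 2 ^ e X) ≡⟨ cong (64 *_) (*-S A (2 ^ (2 + 2 * (u / s))) (λ X → 2 ^ e X)) ⟩
        64 * (2 ^ (2 + 2 * (u / s)) * E N (λ X → 2 ^ e X)) ≤⟨ *-mono-≤ (m≤m+n 64 62) (*-monoʳ-≤ (2 ^ (2 + 2 * (u / s))) E2^e≤2) ⟩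
        126 * (2 ^ (2 + 2 * (u / s)) * (2 * Q ^ N)) ≡⟨ alg₁ (2 ^ (2 + 2 * (u / s))) (Q ^ N) ⟩
        63 * (Q ^ N * (2 * (2 * 2 ^ (2 + 2 * (u / s))))) ≤⟨ *-monoʳ-≤ 63 (*-monoʳ-≤ (Q ^ N) (^-monoʳ-≤ 2 exps)) ⟩
        63 * (Q ^ N * 2 ^ (∣ x ∣ / r + ∣ t ∣ / r)) ≡⟨ cong (λ y → 63 * (Q ^ N * y)) (^-distribˡ-+-* 2 (∣ x ∣ / r) (∣ t ∣ / r)) ⟩
        63 * (Q ^ N * (pot r x * pot r t)) ∎
        where
        open ≤-Reasoning
        A = E-additive N
        alg₁ : ∀ k q → 126 * (k * (2 * q)) ≡ 63 * (q * (2 * (2 * k)))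
        alg₁ = solve-∀
        pointwise : ∀ X → value x t X ≤ 2 ^ (2 + 2 * (u / s)) * 2 ^ e X
        pointwise X = begin
          pos (x ℤ.+ (t ℤ.+ X)) * (pot s (x ℤ.+ (t ℤ.+ X)) * pot s (t ℤ.+ X)) ≤⟨ *-monoˡ-≤ _ (pos≤1 (x ℤ.+ (t ℤ.+ X))) ⟩
          1 * (pot s (x ℤ.+ (t ℤ.+ X)) * pot s (t ℤ.+ X)) ≡⟨ trans (*-identityˡ _) (combine X) ⟩
          2 ^ (outer X / s + inner X / s) ≤⟨ ^-monoʳ-≤ 2 (≤-trans (exponents X) (begin
            2 * ((u + ∣ X ∣) / s) ≤⟨ *-monoʳ-≤ 2 (+-/ s u ∣ X ∣) ⟩
            2 * suc (u / s + ∣ X ∣ / s) ≡⟨ alg₂ (u / s) (∣ X ∣ / s) ⟩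
            2 + 2 * (u / s) + 2 * (∣ X ∣ / s) ≤⟨ +-monoʳ-≤ (2 + 2 * (u / s)) (≤-trans (*-monoˡ-≤ (∣ X ∣ / s) (m≤m+n 2 2)) (/-multiple 4 ∣ X ∣ s p (≤-reflexive (sym s≡)))) ⟩
            2 + 2 * (u / s) + e X ∎)) ⟩
          2 ^ (2 + 2 * (u / s) + e X) ≡⟨ ^-distribˡ-+-* 2 (2 + 2 * (u / s)) (e X) ⟩
          2 ^ (2 + 2 * (u / s)) * 2 ^ e X ∎
          where
          alg₂ : ∀ a b → 2 * suc (a + b) ≡ 2 + 2 * a + 2 * b
          alg₂ = solve-∀
        8r≤s : 8 * r ≤ s
        8r≤s = ≤-trans (*-monoˡ-≤ r (m≤m+n 8 8)) (≤-trans 16r≤p (≤-trans (m≤n*m p 4) (≤-reflexive (sym s≡))))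
        16≤w : 16 ≤ u / r
        16≤w = subst (_≤ u / r) (m*n/n≡m 16 r) (/-monoˡ-≤ r 16r≤u)
        -- With w = ⌊u/r⌋ ≥ 16 and 8⌊u/s⌋ ≤ w, the left side is at most w - 1, and so is below the
        -- exponents at scale r. In the 4, two units come from rounding, one from `E2^e≤2` and one
        -- from 64 ≤ 2 · 63.
        exps : 4 + 2 * (u / s) ≤ ∣ x ∣ / r + ∣ t ∣ / r
        exps = ≤-pred (*-cancelˡ-≤ 4 (begin
          4 * suc (4 + 2 * (u / s)) ≡⟨ alg₃ (u / s) ⟩
          20 + 8 * (u / s) ≤⟨ +-monoʳ-≤ 20 (/-multiple 8 u s r 8r≤s) ⟩
          20 + u / r ≤⟨ +-monoˡ-≤ (u / r) (≤-trans (m≤m+n 20 28) (*-monoʳ-≤ 3 16≤w)) ⟩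
          3 * (u / r) + u / r ≡⟨ alg₄ (u / r) ⟩
          4 * (u / r) ≤⟨ *-monoʳ-≤ 4 (+-/ r (∣ x ∣) (∣ t ∣)) ⟩
          4 * suc (∣ x ∣ / r + ∣ t ∣ / r) ∎))
          where
          alg₃ : ∀ k → 4 * suc (4 + 2 * k) ≡ 20 + 8 * k
          alg₃ = solve-∀
          alg₄ : ∀ w → 3 * w + w ≡ 4 * w
          alg₄ = solve-∀

      one-step : 64 * E N (value x t) ≤ 63 * (Q ^ N * (pot r x * pot r t))
      one-step with ≤-total u (16 * r)
      ... | inj₁ h = ≤-trans (small-case h) (*-monoʳ-≤ 63 (m≤m*n (Q ^ N) (pot r x * pot r t) {{m*n≢0 (pot r x) (pot r t) {{m^n≢0 2 (∣ x ∣ / r)}} {{m^n≢0 2 (∣ t ∣ / r)}}}}))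
      ... | inj₂ h = large-case h

-- Rows of cells

-- The law of a cell as a function of its number of sites. The walk and the two Bernoulli fields are
-- instances and share the row operator `op`.
record Kernel : Set₁ where
  field
    run      : ℕ → (ℤ → ℕ) → ℕ
    additive : ∀ N → Additive (run N)
    swap     : ∀ N {B : Set} {S : (B → ℕ) → ℕ} → Additive S → (f : ℤ → B → ℕ) → S (λ b → run N (λ X → f X b)) ≡ run N (λ X → S (f X))

open Kernel

total : ∀ {J} → Vec ℕ J → ℕ
total []ᵥ       = 0
total (N ∷ᵥ Ns) = N + total Ns

-- Entry j of the state is increased by the sum of the variables of the cells 0, …, j (and by t).
op : Kernel → ∀ {J} → Vec ℕ J → (Vec ℤ J → ℕ) → Vec ℤ J → ℤ → ℕ
op K []ᵥ       f []ᵥ       t = f []ᵥ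
op K (N ∷ᵥ Ns) f (x ∷ᵥ xs) t = run K N (λ X → op K Ns (λ ys → f ((x ℤ.+ (t ℤ.+ X)) ∷ᵥ ys)) xs (t ℤ.+ X))

op-additive : ∀ K {J} (Ns : Vec ℕ J) xs t → Additive (λ f → op K Ns f xs t)
op-additive K []ᵥ       []ᵥ       t = record { cong-S = λ e → e []ᵥ ; +-S = λ _ _ → refl ; *-S = λ _ _ → refl }
op-additive K (N ∷ᵥ Ns) (x ∷ᵥ xs) t = record
  { cong-S = λ e → cong-S (additive K N) (λ X → cong-S (op-additive K Ns xs (t ℤ.+ X)) (λ ys → e _))
  ; +-S = λ f g → trans (cong-S (additive K N) (λ X → +-S (op-additive K Ns xs (t ℤ.+ X)) (λ ys → f (_ ∷ᵥ ys)) (λ ys → g (_ ∷ᵥ ys))))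
      (+-S (additive K N) (λ X → op K Ns (λ ys → f ((x ℤ.+ (t ℤ.+ X)) ∷ᵥ ys)) xs (t ℤ.+ X)) (λ X → op K Ns (λ ys → g ((x ℤ.+ (t ℤ.+ X)) ∷ᵥ ys)) xs (t ℤ.+ X)))
  ; *-S = λ c f → trans (cong-S (additive K N) (λ X → *-S (op-additive K Ns xs (t ℤ.+ X)) c (λ ys → f (_ ∷ᵥ ys))))
      (*-S (additive K N) c (λ X → op K Ns (λ ys → f ((x ℤ.+ (t ℤ.+ X)) ∷ᵥ ys)) xs (t ℤ.+ X))) }

-- The state moves by partial sums of the cells, so two independent rows act like one row whose
-- cells are convolved. This serves to pair the fields of π and τ into a walk and to merge
-- successive rows without a check.
op-compose : ∀ {K L KL : Kernel} (a b c : ℕ → ℕ) →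
             (∀ k f → run K (a k) (λ X → run L (b k) (λ Y → f (X ℤ.+ Y))) ≡ run KL (c k) f) →
             ∀ {J} (ks : Vec ℕ J) f xs t u →
             op K (mapᵥ a ks) (λ ys → op L (mapᵥ b ks) f ys u) xs t ≡ op KL (mapᵥ c ks) f xs (t ℤ.+ u)
op-compose a b c compose []ᵥ       f []ᵥ       t u = refl
op-compose {K} {L} {KL} a b c compose (k ∷ᵥ ks) f (x ∷ᵥ xs) t u = begin
  run K (a k) (λ X → op K as (λ ys → run L (b k) (λ Y → op L bs (h X Y) ys (u ℤ.+ Y))) xs (t ℤ.+ X))
    ≡⟨ cong-S (additive K (a k)) (λ X → swap L (b k) (op-additive K as xs (t ℤ.+ X)) (λ Y ys → op L bs (h X Y) ys (u ℤ.+ Y))) ⟩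
  run K (a k) (λ X → run L (b k) (λ Y → op K as (λ ys → op L bs (h X Y) ys (u ℤ.+ Y)) xs (t ℤ.+ X)))
    ≡⟨ cong-S (additive K (a k)) (λ X → cong-S (additive L (b k)) (λ Y → op-compose {K} {L} {KL} a b c compose ks (h X Y) xs (t ℤ.+ X) (u ℤ.+ Y))) ⟩
  run K (a k) (λ X → run L (b k) (λ Y → op KL cs (h X Y) xs ((t ℤ.+ X) ℤ.+ (u ℤ.+ Y))))
    ≡⟨ cong-S (additive K (a k)) (λ X → cong-S (additive L (b k)) (λ Y → cong₂ (λ p q → op KL cs (λ zs → f (p ∷ᵥ zs)) xs q) (reassoc x t X u Y) (reassoc′ t X u Y))) ⟩
  run K (a k) (λ X → run L (b k) (λ Y → g (X ℤ.+ Y)))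
    ≡⟨ compose k g ⟩
  run KL (c k) g ∎
  where
  open ≡-Reasoning
  as = mapᵥ a ks
  bs = mapᵥ b ks
  cs = mapᵥ c ks
  h : ℤ → ℤ → Vec ℤ _ → ℕ
  h X Y zs = f (((x ℤ.+ (t ℤ.+ X)) ℤ.+ (u ℤ.+ Y)) ∷ᵥ zs)
  g : ℤ → ℕ
  g Z = op KL cs (λ zs → f ((x ℤ.+ ((t ℤ.+ u) ℤ.+ Z)) ∷ᵥ zs)) xs ((t ℤ.+ u) ℤ.+ Z)
  reassoc : ∀ x t X u Y → (x ℤ.+ (t ℤ.+ X)) ℤ.+ (u ℤ.+ Y) ≡ x ℤ.+ ((t ℤ.+ u) ℤ.+ (X ℤ.+ Y))
  reassoc = ℤR.solve-∀
  reassoc′ : ∀ t X u Y → (t ℤ.+ X) ℤ.+ (u ℤ.+ Y) ≡ (t ℤ.+ u) ℤ.+ (X ℤ.+ Y)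
  reassoc′ = ℤR.solve-∀

module Rows (M : ℕ) where
  open Walk M
  open Persistence M

  walk : Kernel
  walk = record { run = E ; additive = E-additive ; swap = E-swap }

  pw : ℕ → ℤ → ℕ
  pw ε = pot (2 ^ ε) {{m^n≢0 2 ε}}

  pw-zero : ∀ ε → pw ε ℤ.0ℤ ≡ 1
  pw-zero ε = cong (2 ^_) (0/n≡0 (2 ^ ε) {{m^n≢0 2 ε}})

  -- The scale 2^ε fits the standard deviation of a cell of N sites, up to fixed factors.
  record Fits (ε N : ℕ) : Set where
    field
      spread       : 16 * (M * N) ≤ 2 ^ (8 + ε) * 2 ^ (8 + ε) * Q
      concentrated : 4 * (Q * (16 * 2 ^ ε * (16 * 2 ^ ε))) ≤ V N
      many         : Q ≤ V N

  one-step′ : ∀ ε N → Fits ε N → ∀ x t →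
    64 * E N (λ X → pos (x ℤ.+ (t ℤ.+ X)) * (pw (13 + ε) (x ℤ.+ (t ℤ.+ X)) * pw (13 + ε) (t ℤ.+ X))) ≤ 63 * (Q ^ N * (pw ε x * pw ε t))
  one-step′ ε N fits = OneStep.one-step N (2 ^ ε) (2 ^ (8 + ε)) (2 ^ (11 + ε)) (2 ^ (13 + ε))
    {{m^n≢0 2 ε}} {{m^n≢0 2 (8 + ε)}} {{m^n≢0 2 (11 + ε)}} {{m^n≢0 2 (13 + ε)}}
    (^-distribˡ-+-* 2 3 (8 + ε)) (^-distribˡ-+-* 2 2 (11 + ε))
    (subst (_≤ 2 ^ (11 + ε)) (^-distribˡ-+-* 2 4 ε) (^-monoʳ-≤ 2 {4 + ε} {11 + ε} (+-monoˡ-≤ ε (m≤m+n 4 7))))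
    (Fits.spread fits) (Fits.concentrated fits) (Fits.many fits)

  allpos : ∀ {J} → Vec ℤ J → ℕ
  allpos []ᵥ       = 1
  allpos (x ∷ᵥ xs) = pos x * allpos xs

  weights : ∀ {J} → ℕ → Vec ℤ J → ℕ
  weights ε []ᵥ       = 1
  weights ε (x ∷ᵥ xs) = pw ε x * weights (13 + ε) xs

  FitsRow : ∀ {J} → ℕ → Vec ℕ J → Set
  FitsRow ε []ᵥ       = ⊤
  FitsRow ε (N ∷ᵥ Ns) = Fits ε N × FitsRow (13 + ε) Ns

  -- Each cell pays 63/64, takes the column potential from scale ε to 13 + ε, and hands the
  -- potential of the running sum to its right neighbour at the same new scale. At the right end
  -- that potential is discarded, being at least 1.
  row-bound : ∀ {J} ε (Ns : Vec ℕ J) → FitsRow ε Ns → ∀ f C → (∀ ys → f ys ≤ C * (allpos ys * weights (13 + ε) ys)) →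
              ∀ xs t → 64 ^ J * op walk Ns f xs t ≤ 63 ^ J * (C * Q ^ total Ns * (weights ε xs * pw ε t))
  row-bound ε []ᵥ _ f C h []ᵥ t = *-monoʳ-≤ 1 (≤-trans (h []ᵥ) (*-mono-≤ (≤-reflexive (sym (*-identityʳ C))) (≤-trans (m^n>0 2 (∣ t ∣ / 2 ^ ε)) (≤-reflexive (sym (+-identityʳ (pw ε t)))))))
    where instance _ = m^n≢0 2 ε
  row-bound {suc J} ε (N ∷ᵥ Ns) (fits , fitsRow) f C h (x ∷ᵥ xs) t = begin
    64 * 64 ^ J * E N (λ X → g X) ≡⟨ alg₁ (64 ^ J) (E N g) ⟩
    64 * (64 ^ J * E N g) ≡⟨ cong (64 *_) (*-S A (64 ^ J) g) ⟨
    64 * E N (λ X → 64 ^ J * g X) ≤⟨ *-monoʳ-≤ 64 (mono-S A cell) ⟩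
    64 * E N (λ X → R * value X) ≡⟨ cong (64 *_) (*-S A R value) ⟩
    64 * (R * E N value) ≡⟨ alg₂ R (E N value) ⟩
    R * (64 * E N value) ≤⟨ *-monoʳ-≤ R (one-step′ ε N fits x t) ⟩
    R * (63 * (Q ^ N * (pw ε x * pw ε t))) ≡⟨ alg₃ (63 ^ J) C (Q ^ total Ns) (weights (13 + ε) xs) (Q ^ N) (pw ε x) (pw ε t) ⟩
    63 * 63 ^ J * (C * (Q ^ N * Q ^ total Ns) * (pw ε x * weights (13 + ε) xs * pw ε t))
      ≡⟨ cong (λ q → 63 * 63 ^ J * (C * q * (pw ε x * weights (13 + ε) xs * pw ε t))) (^-distribˡ-+-* Q N (total Ns)) ⟨
    63 * 63 ^ J * (C * Q ^ (N + total Ns) * (pw ε x * weights (13 + ε) xs * pw ε t)) ∎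
    where
    open ≤-Reasoning
    A = E-additive N
    g value : ℤ → ℕ
    g X = op walk Ns (λ ys → f ((x ℤ.+ (t ℤ.+ X)) ∷ᵥ ys)) xs (t ℤ.+ X)
    value X = pos (x ℤ.+ (t ℤ.+ X)) * (pw (13 + ε) (x ℤ.+ (t ℤ.+ X)) * pw (13 + ε) (t ℤ.+ X))
    R = 63 ^ J * (C * Q ^ total Ns * weights (13 + ε) xs)
    alg₁ : ∀ a b → 64 * a * b ≡ 64 * (a * b)
    alg₁ = solve-∀
    alg₂ : ∀ a b → 64 * (a * b) ≡ a * (64 * b)
    alg₂ = solve-∀
    alg₃ : ∀ s c q w k x t → s * (c * q * w) * (63 * (k * (x * t))) ≡ 63 * s * (c * (k * q) * (x * w * t))
    alg₃ = solve-∀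
    alg₄ : ∀ c p y a w → c * (p * a * (y * w)) ≡ c * (p * y) * (a * w)
    alg₄ = solve-∀
    alg₅ : ∀ s c p y q w z → s * (c * (p * y) * q * (w * z)) ≡ s * (c * q * w) * (p * (y * z))
    alg₅ = solve-∀
    cell : ∀ X → 64 ^ J * g X ≤ R * value X
    cell X = ≤-trans (row-bound (13 + ε) Ns fitsRow (λ ys → f (y ∷ᵥ ys)) (C * (pos y * pw (13 + ε) y))
        (λ ys → ≤-trans (h (y ∷ᵥ ys)) (≤-reflexive (alg₄ C (pos y) (pw (13 + ε) y) (allpos ys) (weights (13 + (13 + ε)) ys)))) xs (t ℤ.+ X))
      (≤-reflexive (alg₅ (63 ^ J) C (pos y) (pw (13 + ε) y) (Q ^ total Ns) (weights (13 + ε) xs) (pw (13 + ε) (t ℤ.+ X))))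
      where y = x ℤ.+ (t ℤ.+ X)

  persist : ∀ {J} → List (Vec ℕ J) → Vec ℤ J → ℕ
  persist []       D = 1
  persist (Ns ∷ rs) D = op walk Ns (λ D′ → allpos D′ * persist rs D′) D ℤ.0ℤ

  FitsRows : ∀ {J} → ℕ → List (Vec ℕ J) → Set
  FitsRows ε []        = ⊤
  FitsRows ε (Ns ∷ rs) = FitsRow ε Ns × FitsRows (13 + ε) rs

  totals : ∀ {J} → List (Vec ℕ J) → ℕ
  totals []        = 0
  totals (Ns ∷ rs) = total Ns + totals rs

  0<weights : ∀ {J} ε (D : Vec ℤ J) → 0 < weights ε D
  0<weights ε []ᵥ       = s≤s z≤n
  0<weights ε (x ∷ᵥ xs) = *-mono-≤ (m^n>0 2 (_/_ (∣ x ∣) (2 ^ ε) {{m^n≢0 2 ε}})) (0<weights (13 + ε) xs)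

  -- The bound for the later rows serves as the test function of the present row. A row starts with
  -- running sum 0, whose potential is 1.
  persistence : ∀ {J} ε (rs : List (Vec ℕ J)) → FitsRows ε rs → ∀ D →
                (64 ^ J) ^ length rs * persist rs D ≤ (63 ^ J) ^ length rs * (Q ^ totals rs * weights ε D)
  persistence ε [] _ D = *-monoʳ-≤ 1 (≤-trans (0<weights ε D) (≤-reflexive (sym (+-identityʳ (weights ε D)))))
  persistence {J} ε (Ns ∷ rs) (fits , fitsRows) D = begin
    64 ^ J * c * op walk Ns f D ℤ.0ℤ ≡⟨ *-assoc (64 ^ J) c _ ⟩
    64 ^ J * (c * op walk Ns f D ℤ.0ℤ) ≡⟨ cong (64 ^ J *_) (*-S (op-additive walk Ns D ℤ.0ℤ) c f) ⟨
    64 ^ J * op walk Ns (λ D′ → c * f D′) D ℤ.0ℤ ≤⟨ row-bound ε Ns fits (λ D′ → c * f D′) (d * q) bound D ℤ.0ℤ ⟩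
    63 ^ J * (d * q * Q ^ total Ns * (weights ε D * pw ε ℤ.0ℤ)) ≡⟨ cong (λ y → 63 ^ J * (d * q * Q ^ total Ns * (weights ε D * y))) (pw-zero ε) ⟩
    63 ^ J * (d * q * Q ^ total Ns * (weights ε D * 1)) ≡⟨ alg (63 ^ J) d q (Q ^ total Ns) (weights ε D) ⟩
    63 ^ J * d * (Q ^ total Ns * q * weights ε D) ≡⟨ cong (λ y → 63 ^ J * d * (y * weights ε D)) (^-distribˡ-+-* Q (total Ns) (totals rs)) ⟨
    63 ^ J * d * (Q ^ (total Ns + totals rs) * weights ε D) ∎
    where
    open ≤-Reasoning
    c = (64 ^ J) ^ length rs
    d = (63 ^ J) ^ length rs
    q = Q ^ totals rs
    f : Vec ℤ J → ℕ
    f D′ = allpos D′ * persist rs D′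
    alg : ∀ x d q y w → x * (d * q * y * (w * 1)) ≡ x * d * (y * q * w)
    alg = solve-∀
    alg₂ : ∀ c a p → c * (a * p) ≡ a * (c * p)
    alg₂ = solve-∀
    alg₃ : ∀ a d q w → a * (d * (q * w)) ≡ d * q * (a * w)
    alg₃ = solve-∀
    bound : ∀ D′ → c * f D′ ≤ d * q * (allpos D′ * weights (13 + ε) D′)
    bound D′ = begin
      c * (allpos D′ * persist rs D′) ≡⟨ alg₂ c (allpos D′) (persist rs D′) ⟩
      allpos D′ * (c * persist rs D′) ≤⟨ *-monoʳ-≤ (allpos D′) (persistence (13 + ε) rs fitsRows D′) ⟩
      allpos D′ * (d * (q * weights (13 + ε) D′)) ≡⟨ alg₃ (allpos D′) d q (weights (13 + ε) D′) ⟩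
      d * q * (allpos D′ * weights (13 + ε) D′) ∎

-- Domination of the first rows of a random permutation by a Bernoulli field

lt-shift : ∀ c k b → c ≤ k → lt (k ∸ c) b ≡ lt k (c + b)
lt-shift zero    k       b p       = refl
lt-shift (suc c) (suc k) b (s≤s p) = lt-shift c k b p

sum-split : ∀ c m (f : ℕ → ℕ) → sum {c + m} (λ k → f (toℕ k)) ≡ sum {c} (λ k → f (toℕ k)) + sum {m} (λ k → f (c + toℕ k))
sum-split zero m f = refl
sum-split (suc c) m f = trans (cong (f 0 +_) (sum-split c m (f ∘ suc))) (sym (+-assoc (f 0) _ _))

sum-cong-toℕ : ∀ m {f g : ℕ → ℕ} → (∀ k → k < m → f k ≡ g k) → sum {m} (λ k → f (toℕ k)) ≡ sum {m} (λ k → g (toℕ k))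
sum-cong-toℕ m h = cong-S (sum-additive {m}) (λ k → h (toℕ k) (F.toℕ<n k))

sum-cast : ∀ {m n} → m ≡ n → (f : ℕ → ℕ) → sum {m} (λ k → f (toℕ k)) ≡ sum {n} (λ k → f (toℕ k))
sum-cast refl f = refl

-- cs lists the numbers of values still available in consecutive column blocks.  Using the value of index k
-- moves every entry of the state at or to the right of the block of k by s.
upd : ∀ {J} → ℤ → Vec ℕ J → Vec ℤ J → ℕ → Vec ℤ J
upd s []ᵥ       []ᵥ       k = []ᵥ
upd s (c ∷ᵥ cs) (x ∷ᵥ xs) k with k <? c
... | yes _ = mapᵥ (ℤ._+ s) (x ∷ᵥ xs)
... | no _  = x ∷ᵥ upd s cs xs (k ∸ c)

use : ∀ {J} → Vec ℕ J → ℕ → Vec ℕ J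
use []ᵥ       k = []ᵥ
use (c ∷ᵥ cs) k with k <? c
... | yes _ = (c ∸ 1) ∷ᵥ cs
... | no _  = c ∷ᵥ use cs (k ∸ c)

cum : ∀ {J} → Vec ℕ J → Fin J → ℕ
cum (c ∷ᵥ cs) fz     = c
cum (c ∷ᵥ cs) (fs j) = c + cum cs j

lookup-upd : ∀ {J} s (cs : Vec ℕ J) D k j → lookup (upd s cs D k) j ≡ lookup D j ℤ.+ s ℤ.* (ℤ.+ lt k (cum cs j))
lookup-upd s (c ∷ᵥ cs) (x ∷ᵥ xs) k j with k <? c
lookup-upd s (c ∷ᵥ cs) (x ∷ᵥ xs) k fz | yes p = cong (λ z → x ℤ.+ z) (trans (sym (ℤₚ.*-identityʳ s)) (cong (λ y → s ℤ.* (ℤ.+ y)) (sym (lt-yes p))))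
lookup-upd s (c ∷ᵥ cs) (x ∷ᵥ xs) k (fs j) | yes p = trans (V.lookup-map j (ℤ._+ s) xs)
  (cong (λ z → lookup xs j ℤ.+ z) (trans (sym (ℤₚ.*-identityʳ s)) (cong (λ y → s ℤ.* (ℤ.+ y)) (sym (lt-yes (≤-trans p (m≤m+n c (cum cs j))))))))
lookup-upd s (c ∷ᵥ cs) (x ∷ᵥ xs) k fz | no ¬p = trans (sym (ℤₚ.+-identityʳ x)) (cong (λ z → x ℤ.+ z) (trans (sym (ℤₚ.*-zeroʳ s)) (cong (λ y → s ℤ.* (ℤ.+ y)) (sym (lt-no (≮⇒≥ ¬p))))))
lookup-upd s (c ∷ᵥ cs) (x ∷ᵥ xs) k (fs j) | no ¬p = trans (lookup-upd s cs xs (k ∸ c) j) (cong (λ y → lookup xs j ℤ.+ s ℤ.* (ℤ.+ y)) (lt-shift c k (cum cs j) (≮⇒≥ ¬p)))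

cum-use : ∀ {J} (cs : Vec ℕ J) k j → cum (use cs k) j ≡ cum cs j ∸ lt k (cum cs j)
cum-use (c ∷ᵥ cs) k j with k <? c
cum-use (c ∷ᵥ cs) k fz     | yes p = cong (c ∸_) (sym (lt-yes p))
cum-use (c ∷ᵥ cs) k (fs j) | yes p = trans (sym (+-∸-comm (cum cs j) (≤-trans (s≤s z≤n) p))) (cong (c + cum cs j ∸_) (sym (lt-yes (≤-trans p (m≤m+n c (cum cs j))))))
cum-use (c ∷ᵥ cs) k fz     | no ¬p = cong (c ∸_) (sym (lt-no (≮⇒≥ ¬p)))
cum-use (c ∷ᵥ cs) k (fs j) | no ¬p = trans (cong (c +_) (cum-use cs (k ∸ c) j)) (trans (sym (+-∸-assoc c (lt≤ (k ∸ c) (cum cs j)))) (cong (c + cum cs j ∸_) (lt-shift c k (cum cs j) (≮⇒≥ ¬p))))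

total-use-hit : ∀ {J} (cs : Vec ℕ J) k → k < total cs → suc (total (use cs k)) ≡ total cs
total-use-hit (c ∷ᵥ cs) k h with k <? c
... | yes p = cong (_+ total cs) (m+[n∸m]≡n (≤-trans (s≤s z≤n) p))
... | no ¬p = trans (sym (+-suc c _)) (cong (c +_) (total-use-hit cs (k ∸ c) (subst (k ∸ c <_) (m+n∸m≡n c (total cs)) (∸-monoˡ-< h (≮⇒≥ ¬p)))))

total-use-miss : ∀ {J} (cs : Vec ℕ J) k → total cs ≤ k → total (use cs k) ≡ total cs
total-use-miss []ᵥ       k h = refl
total-use-miss (c ∷ᵥ cs) k h with k <? c
... | yes p = contradiction (≤-trans (m≤m+n c (total cs)) h) (<⇒≱ p)
... | no ¬p = cong (c +_) (total-use-miss cs (k ∸ c) (m+n≤o⇒m≤o∸n (total cs) (≤-trans (≤-reflexive (+-comm (total cs) c)) h)))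

_≤ᵥ_ : ∀ {J} → Vec ℕ J → Vec ℕ J → Set
[]ᵥ       ≤ᵥ []ᵥ       = ⊤
(c ∷ᵥ cs) ≤ᵥ (d ∷ᵥ ds) = c ≤ d × cs ≤ᵥ ds

≤ᵥ-refl : ∀ {J} (cs : Vec ℕ J) → cs ≤ᵥ cs
≤ᵥ-refl []ᵥ       = tt
≤ᵥ-refl (c ∷ᵥ cs) = ≤-refl , ≤ᵥ-refl cs

use-≤ᵥ : ∀ {J} (cs βs : Vec ℕ J) k → cs ≤ᵥ βs → use cs k ≤ᵥ βs
use-≤ᵥ []ᵥ       []ᵥ       k _       = tt
use-≤ᵥ (c ∷ᵥ cs) (β ∷ᵥ βs) k (p , q) with k <? c
... | yes _ = ≤-trans (m∸n≤m c 1) p , q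
... | no _  = p , use-≤ᵥ cs βs (k ∸ c) q

module Field (M : ℕ) where
  open Walk M using (E; Q; E-additive)
  open Persistence M using (pos)
  open Rows M using (walk; allpos)

  -- A model row with at most one point: none at weight M, one in a given block at weight β, for its
  -- β columns.
  row : ∀ {J} → ℤ → Vec ℕ J → (Vec ℤ J → ℕ) → Vec ℤ J → ℕ
  row s []ᵥ       f []ᵥ       = M * f []ᵥ
  row s (β ∷ᵥ βs) f (x ∷ᵥ xs) = row s βs (λ ys → f (x ∷ᵥ ys)) xs + β * f (mapᵥ (ℤ._+ s) (x ∷ᵥ xs))

  row-mono : ∀ {J} s (βs : Vec ℕ J) {f g} D → (∀ ys → f ys ≤ g ys) → row s βs f D ≤ row s βs g D
  row-mono s []ᵥ       []ᵥ       h = *-monoʳ-≤ M (h []ᵥ)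
  row-mono s (β ∷ᵥ βs) (x ∷ᵥ xs) h = +-mono-≤ (row-mono s βs xs (λ ys → h (x ∷ᵥ ys))) (*-monoʳ-≤ β (h _))

  row-*ˡ : ∀ {J} s (βs : Vec ℕ J) c f D → row s βs (λ ys → c * f ys) D ≡ c * row s βs f D
  row-*ˡ s []ᵥ       c f []ᵥ       = alg M c (f []ᵥ)
    where
    alg : ∀ M c x → M * (c * x) ≡ c * (M * x)
    alg = solve-∀
  row-*ˡ s (β ∷ᵥ βs) c f (x ∷ᵥ xs) = trans (cong (_+ β * (c * f (mapᵥ (ℤ._+ s) (x ∷ᵥ xs)))) (row-*ˡ s βs c (λ ys → f (x ∷ᵥ ys)) xs)) (alg c β (row s βs (λ ys → f (x ∷ᵥ ys)) xs) (f (mapᵥ (ℤ._+ s) (x ∷ᵥ xs))))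
    where
    alg : ∀ c b r y → c * r + b * (c * y) ≡ c * (r + b * y)
    alg = solve-∀

  digit : ∀ {J} → Vec ℕ J → ℕ → ℕ → ℕ → ℕ
  digit cs hit miss k = lt k (total cs) * hit + ge k (total cs) * miss

  digit-hit : ∀ {J} (cs : Vec ℕ J) hit miss k → k < total cs → digit cs hit miss k ≡ hit
  digit-hit cs hit miss k p rewrite lt-yes p = trans (+-identityʳ (hit + 0)) (+-identityʳ hit)

  digit-miss : ∀ {J} (cs : Vec ℕ J) hit miss k → total cs ≤ k → digit cs hit miss k ≡ miss
  digit-miss cs hit miss k p rewrite lt-no p = +-identityʳ miss

  -- A permutation row chooses one of c ≤ β values in each block or one of the w values beyond all
  -- blocks. `hit` and `miss` weigh the two kinds of continuation, and Φ is the factor at which the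
  -- model row dominates.
  digit-sum : ∀ {J} s (cs βs : Vec ℕ J) w {hit miss Φ} f D → cs ≤ᵥ βs → hit ≤ Φ → miss * w ≤ Φ * M →
              sum {total cs + w} (λ k → digit cs hit miss (toℕ k) * f (upd s cs D (toℕ k))) ≤ Φ * row s βs f D
  digit-sum s []ᵥ []ᵥ w {hit} {miss} {Φ} f []ᵥ _ _ h = begin
    sum {w} (λ k → (0 + 1 * miss) * f []ᵥ) ≡⟨ sum-const w ((0 + 1 * miss) * f []ᵥ) ⟩
    w * ((0 + 1 * miss) * f []ᵥ) ≡⟨ alg w miss (f []ᵥ) ⟩
    miss * w * f []ᵥ ≤⟨ *-monoˡ-≤ (f []ᵥ) h ⟩
    Φ * M * f []ᵥ ≡⟨ *-assoc Φ M (f []ᵥ) ⟩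
    Φ * (M * f []ᵥ) ∎
    where
    open ≤-Reasoning
    alg : ∀ w m x → w * ((0 + 1 * m) * x) ≡ m * w * x
    alg = solve-∀
  digit-sum s (c ∷ᵥ cs) (β ∷ᵥ βs) w {hit} {miss} {Φ} f (x ∷ᵥ xs) (c≤β , cs≤βs) hit≤ miss≤ = begin
    sum {c + total cs + w} (λ k → g (toℕ k)) ≡⟨ sum-cast (+-assoc c (total cs) w) g ⟩
    sum {c + (total cs + w)} (λ k → g (toℕ k)) ≡⟨ sum-split c (total cs + w) g ⟩
    sum {c} (λ k → g (toℕ k)) + sum {total cs + w} (λ k → g (c + toℕ k))
      ≡⟨ cong₂ _+_ (trans (sum-cong-toℕ c {g} {λ _ → hit * y} hits) (sum-const c (hit * y)))
                   (sum-cong-toℕ (total cs + w) {λ k → g (c + k)} {λ k → digit cs hit miss k * f (x ∷ᵥ upd s cs xs k)} (λ k _ → misses k)) ⟩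
    c * (hit * y) + sum {total cs + w} (λ k → digit cs hit miss (toℕ k) * f (x ∷ᵥ upd s cs xs (toℕ k)))
      ≤⟨ +-mono-≤ (*-mono-≤ c≤β (*-monoˡ-≤ y hit≤)) (digit-sum s cs βs w (λ ys → f (x ∷ᵥ ys)) xs cs≤βs hit≤ miss≤) ⟩
    β * (Φ * y) + Φ * row s βs (λ ys → f (x ∷ᵥ ys)) xs ≡⟨ alg β Φ y (row s βs (λ ys → f (x ∷ᵥ ys)) xs) ⟩
    Φ * (row s βs (λ ys → f (x ∷ᵥ ys)) xs + β * y) ∎
    where
    open ≤-Reasoning
    y = f (mapᵥ (ℤ._+ s) (x ∷ᵥ xs))
    g : ℕ → ℕ
    g k = digit (c ∷ᵥ cs) hit miss k * f (upd s (c ∷ᵥ cs) (x ∷ᵥ xs) k)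
    alg : ∀ b p y r → b * (p * y) + p * r ≡ p * (r + b * y)
    alg = solve-∀
    hits : ∀ k → k < c → g k ≡ hit * y
    hits k p = cong₂ _*_ (digit-hit (c ∷ᵥ cs) hit miss k (≤-trans p (m≤m+n c (total cs)))) moved
      where
      moved : f (upd s (c ∷ᵥ cs) (x ∷ᵥ xs) k) ≡ y
      moved with k <? c
      ... | yes _ = refl
      ... | no ¬p = contradiction p ¬p
    misses : ∀ k → g (c + k) ≡ digit cs hit miss k * f (x ∷ᵥ upd s cs xs k)
    misses k = cong₂ _*_ (cong (λ z → z * hit + (1 ∸ z) * miss) (trans (sym (lt-shift c (c + k) (total cs) (m≤m+n c k))) (cong (λ z → lt z (total cs)) (m+n∸m≡n c k)))) kept
      where
      kept : f (upd s (c ∷ᵥ cs) (x ∷ᵥ xs) (c + k)) ≡ f (x ∷ᵥ upd s cs xs k)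
      kept with c + k <? c
      ... | yes p = contradiction (m≤m+n c k) (<⇒≱ p)
      ... | no _  = cong (λ z → f (x ∷ᵥ upd s cs xs z)) (m+n∸m≡n c k)

  ff : ℕ → ℕ → ℕ
  ff w zero    = 1
  ff w (suc r) = w * ff (w ∸ 1) r

  -- The last factor of the longer falling factorial is w - r, which is at least M.
  ff-hit : ∀ w r → M + r ≤ w → M * ff w r ≤ ff w (suc r)
  ff-hit w zero    h = *-monoˡ-≤ 1 (≤-trans (≤-reflexive (sym (+-identityʳ M))) h)
  ff-hit w (suc r) h = begin
    M * (w * ff (w ∸ 1) r) ≡⟨ alg M w (ff (w ∸ 1) r) ⟩
    w * (M * ff (w ∸ 1) r) ≤⟨ *-monoʳ-≤ w (ff-hit (w ∸ 1) r (∸-monoˡ-≤ 1 (≤-trans (≤-reflexive (sym (+-suc M r))) h))) ⟩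
    w * ff (w ∸ 1) (suc r) ∎
    where
    open ≤-Reasoning
    alg : ∀ M w x → M * (w * x) ≡ w * (M * x)
    alg = solve-∀

  check : ∀ {J} → Bool → Vec ℤ J → ℕ
  check false D = 1
  check true  D = allpos D

  eval : ∀ {m J} → List Bool → Code m → Code m → Vec ℕ J → Vec ℕ J → Vec ℤ J → ℕ
  eval         []       π       τ        cs cs′ D = 1
  eval {zero}  (c ∷ fl) π       τ        cs cs′ D = 1
  eval {suc m} (c ∷ fl) (k , π) (k′ , τ) cs cs′ D =
    let D′ = upd ℤ.-1ℤ cs′ (upd ℤ.1ℤ cs D (toℕ k)) (toℕ k′) in
    check c D′ * eval fl π τ (use cs (toℕ k)) (use cs′ (toℕ k′)) D′

  rows : ∀ {J} → Vec ℕ J → List Bool → Vec ℤ J → ℕ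
  rows βs []       D = 1
  rows βs (c ∷ fl) D = row ℤ.1ℤ βs (row ℤ.-1ℤ βs (λ D′ → check c D′ * rows βs fl D′)) D

  eval≤rows : ∀ {J} (βs : Vec ℕ J) fl m cs cs′ w w′ D → cs ≤ᵥ βs → cs′ ≤ᵥ βs → m ≡ total cs + w → m ≡ total cs′ + w′ →
    length fl ≤ m → M + length fl ≤ w → M + length fl ≤ w′ →
    (M * M) ^ length fl * ∑∑ m (λ π τ → eval fl π τ cs cs′ D) ≤
    ff w (length fl) * ff w′ (length fl) * ((m ∸ length fl) ! * (m ∸ length fl) !) * rows βs fl D
  eval≤rows βs [] m cs cs′ w w′ D _ _ _ _ _ _ _ = ≤-reflexive (trans (cong (1 *_) (trans (cong-S (∑-additive m) (λ _ → trans (∑-const m 1) (*-identityʳ (m !)))) (∑-const m (m !)))) (alg (m ! * m !)))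
    where
    alg : ∀ x → 1 * x ≡ 1 * 1 * x * 1
    alg = solve-∀
  eval≤rows {J} βs (c ∷ fl) (suc m) cs cs′ w w′ D cs≤ cs′≤ e e′ (s≤s r≤m) h h′ = begin
    M * M * (M * M) ^ r * sum {suc m} (λ k → ∑ m (λ π → sum {suc m} (λ k′ → ∑ m (λ τ → chk k k′ * ev k k′ π τ))))
      ≡⟨ cong (M * M * (M * M) ^ r *_) (cong-S (sum-additive {suc m}) (λ k → sum-swap (∑-additive m) (λ k′ π → ∑ m (λ τ → chk k k′ * ev k k′ π τ)))) ⟩
    M * M * (M * M) ^ r * sum {suc m} (λ k → sum {suc m} (λ k′ → ∑∑ m (λ π τ → chk k k′ * ev k k′ π τ)))
      ≡⟨ *-S (∘-additive {h = λ k k′ → k , k′} (sum-additive {suc m}) (λ _ → sum-additive {suc m})) (M * M * (M * M) ^ r) (λ (k , k′) → ∑∑ m (λ π τ → chk k k′ * ev k k′ π τ)) ⟨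
    sum {suc m} (λ k → sum {suc m} (λ k′ → M * M * (M * M) ^ r * ∑∑ m (λ π τ → chk k k′ * ev k k′ π τ)))
      ≤⟨ mono-S (sum-additive {suc m}) (λ k → mono-S (sum-additive {suc m}) (λ k′ → each k k′)) ⟩
    sum {suc m} (λ k → sum {suc m} (λ k′ → W * digit cs hit miss (toℕ k) * (digit cs′ hit′ miss′ (toℕ k′) * g (upd ℤ.-1ℤ cs′ (D₁ k) (toℕ k′)))))
      ≡⟨ cong-S (sum-additive {suc m}) (λ k → *-S (sum-additive {suc m}) (W * digit cs hit miss (toℕ k)) (λ k′ → digit cs′ hit′ miss′ (toℕ k′) * g (upd ℤ.-1ℤ cs′ (D₁ k) (toℕ k′)))) ⟩
    sum {suc m} (λ k → W * digit cs hit miss (toℕ k) * sum {suc m} (λ k′ → digit cs′ hit′ miss′ (toℕ k′) * g (upd ℤ.-1ℤ cs′ (D₁ k) (toℕ k′))))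
      ≤⟨ mono-S (sum-additive {suc m}) (λ k → *-monoʳ-≤ (W * digit cs hit miss (toℕ k)) (≤-trans (≤-reflexive (sum-cast e′ (λ k′ → digit cs′ hit′ miss′ k′ * g (upd ℤ.-1ℤ cs′ (D₁ k) k′))))
           (digit-sum ℤ.-1ℤ cs′ βs w′ {hit′} {miss′} {ff w′ (suc r)} g (D₁ k) cs′≤ (ff-hit w′ r (≤-trans (+-monoʳ-≤ M (n≤1+n r)) h′)) (≤-reflexive (alg₁ M (ff (w′ ∸ 1) r) w′))))) ⟩
    sum {suc m} (λ k → W * digit cs hit miss (toℕ k) * (ff w′ (suc r) * row ℤ.-1ℤ βs g (D₁ k)))
      ≡⟨ cong-S (sum-additive {suc m}) (λ k → alg₂ W (digit cs hit miss (toℕ k)) (ff w′ (suc r)) (row ℤ.-1ℤ βs g (D₁ k))) ⟩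
    sum {suc m} (λ k → ff w′ (suc r) * W * (digit cs hit miss (toℕ k) * row ℤ.-1ℤ βs g (D₁ k)))
      ≡⟨ *-S (sum-additive {suc m}) (ff w′ (suc r) * W) (λ k → digit cs hit miss (toℕ k) * row ℤ.-1ℤ βs g (D₁ k)) ⟩
    ff w′ (suc r) * W * sum {suc m} (λ k → digit cs hit miss (toℕ k) * row ℤ.-1ℤ βs g (D₁ k))
      ≤⟨ *-monoʳ-≤ (ff w′ (suc r) * W) (≤-trans (≤-reflexive (sum-cast e (λ k → digit cs hit miss k * row ℤ.-1ℤ βs g (upd ℤ.1ℤ cs D k))))
           (digit-sum ℤ.1ℤ cs βs w {hit} {miss} {ff w (suc r)} (row ℤ.-1ℤ βs g) D cs≤ (ff-hit w r (≤-trans (+-monoʳ-≤ M (n≤1+n r)) h)) (≤-reflexive (alg₁ M (ff (w ∸ 1) r) w)))) ⟩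
    ff w′ (suc r) * W * (ff w (suc r) * rows βs (c ∷ fl) D) ≡⟨ alg₃ (ff w (suc r)) (ff w′ (suc r)) W (rows βs (c ∷ fl) D) ⟩
    ff w (suc r) * ff w′ (suc r) * W * rows βs (c ∷ fl) D ∎
    where
    open ≤-Reasoning
    r = length fl
    W = (m ∸ r) ! * (m ∸ r) !
    hit = M * ff w r
    miss = M * ff (w ∸ 1) r
    hit′ = M * ff w′ r
    miss′ = M * ff (w′ ∸ 1) r
    D₁ : Fin (suc m) → Vec ℤ J
    D₁ k = upd ℤ.1ℤ cs D (toℕ k)
    D₂ : Fin (suc m) → Fin (suc m) → Vec ℤ J
    D₂ k k′ = upd ℤ.-1ℤ cs′ (D₁ k) (toℕ k′)
    g : Vec ℤ J → ℕ
    g D′ = check c D′ * rows βs fl D′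
    chk : Fin (suc m) → Fin (suc m) → ℕ
    chk k k′ = check c (D₂ k k′)
    ev : Fin (suc m) → Fin (suc m) → Code m → Code m → ℕ
    ev k k′ π τ = eval fl π τ (use cs (toℕ k)) (use cs′ (toℕ k′)) (D₂ k k′)
    alg₁ : ∀ M f w → M * f * w ≡ w * f * M
    alg₁ = solve-∀
    alg₂ : ∀ W d f x → W * d * (f * x) ≡ f * W * (d * x)
    alg₂ = solve-∀
    alg₃ : ∀ a b W x → b * W * (a * x) ≡ a * b * W * x
    alg₃ = solve-∀
    alg₄ : ∀ M p c s → M * M * p * (c * s) ≡ M * M * c * (p * s)
    alg₄ = solve-∀
    alg₅ : ∀ M c a b W x → M * M * c * (a * b * W * x) ≡ W * (M * a) * (M * b * (c * x))
    alg₅ = solve-∀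
    -- A hit leaves w unchanged; a miss lowers it by one, together with the number r of rows to
    -- come, so M + r ≤ w persists.
    next : ∀ (cs : Vec ℕ J) w → suc m ≡ total cs + w → M + suc r ≤ w → ∀ k → k < suc m →
           ∃[ v ] (m ≡ total (use cs k) + v × M + r ≤ v × M * ff v r ≡ digit cs (M * ff w r) (M * ff (w ∸ 1) r) k)
    next cs w e h k k≤m with <-≤-connex k (total cs)
    ... | inj₁ p = w , suc-injective (trans e (cong (_+ w) (sym (total-use-hit cs k p)))) , ≤-trans (+-monoʳ-≤ M (n≤1+n r)) h , sym (digit-hit cs (M * ff w r) (M * ff (w ∸ 1) r) k p)
    ... | inj₂ p = w ∸ 1 , suc-injective (trans e (trans (cong₂ _+_ (sym (total-use-miss cs k p)) (sym (m+[n∸m]≡n 1≤w))) (+-suc (total (use cs k)) (w ∸ 1)))) ,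
                   ∸-monoˡ-≤ 1 (≤-trans (≤-reflexive (sym (+-suc M r))) h) , sym (digit-miss cs (M * ff w r) (M * ff (w ∸ 1) r) k p)
      where
      1≤w : 1 ≤ w
      1≤w = ≤-trans (s≤s z≤n) (≤-trans (m≤n+m (suc r) M) h)
    each : ∀ k k′ → M * M * (M * M) ^ r * ∑∑ m (λ π τ → chk k k′ * ev k k′ π τ) ≤
           W * digit cs hit miss (toℕ k) * (digit cs′ hit′ miss′ (toℕ k′) * g (D₂ k k′))
    each k k′ with next cs w e h (toℕ k) (F.toℕ<n k) | next cs′ w′ e′ h′ (toℕ k′) (F.toℕ<n k′)
    ... | v , ev₁ , ev₂ , ev₃ | v′ , ev₁′ , ev₂′ , ev₃′ = begin
      M * M * (M * M) ^ r * ∑∑ m (λ π τ → chk k k′ * ev k k′ π τ)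
        ≡⟨ cong (M * M * (M * M) ^ r *_) (trans (cong-S (∑-additive m) (λ π → *-S (∑-additive m) (chk k k′) (ev k k′ π))) (*-S (∑-additive m) (chk k k′) (λ π → ∑ m (ev k k′ π)))) ⟩
      M * M * (M * M) ^ r * (chk k k′ * ∑∑ m (ev k k′)) ≡⟨ alg₄ M ((M * M) ^ r) (chk k k′) (∑∑ m (ev k k′)) ⟩
      M * M * chk k k′ * ((M * M) ^ r * ∑∑ m (ev k k′))
        ≤⟨ *-monoʳ-≤ (M * M * chk k k′) (eval≤rows βs fl m (use cs (toℕ k)) (use cs′ (toℕ k′)) v v′ (D₂ k k′) (use-≤ᵥ cs βs (toℕ k) cs≤) (use-≤ᵥ cs′ βs (toℕ k′) cs′≤) ev₁ ev₁′ r≤m ev₂ ev₂′) ⟩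
      M * M * chk k k′ * (ff v r * ff v′ r * W * rows βs fl (D₂ k k′))
        ≡⟨ alg₅ M (chk k k′) (ff v r) (ff v′ r) W (rows βs fl (D₂ k k′)) ⟩
      W * (M * ff v r) * (M * ff v′ r * g (D₂ k k′))
        ≡⟨ cong₂ (λ a b → W * a * (b * g (D₂ k k′))) ev₃ ev₃′ ⟩
      W * digit cs hit miss (toℕ k) * (digit cs′ hit′ miss′ (toℕ k′) * g (D₂ k k′)) ∎

  allpos-1 : ∀ {J} (D : Vec ℤ J) → (∀ j → pos (lookup D j) ≡ 1) → allpos D ≡ 1
  allpos-1 []ᵥ       h = refl
  allpos-1 (x ∷ᵥ xs) h = cong₂ _*_ (h fz) (allpos-1 xs (h ∘ fs))

  -- The initial state plus r_π - r_τ after a rows is an invariant of the recursion: each row moves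
  -- its first contribution from the ranks into the state.
  eval-1 : ∀ {m J} fl (π τ : Code m) (cs cs′ : Vec ℕ J) D →
           (∀ a → a ≤ length fl → ∀ j → pos (lookup D j ℤ.+ ((ℤ.+ ρ π a (cum cs j)) ℤ.- (ℤ.+ ρ τ a (cum cs′ j)))) ≡ 1) →
           eval fl π τ cs cs′ D ≡ 1
  eval-1         []       π       τ        cs cs′ D h = refl
  eval-1 {zero}  (c ∷ fl) π       τ        cs cs′ D h = refl
  eval-1 {suc m} (c ∷ fl) (k , π) (k′ , τ) cs cs′ D h = cong₂ _*_ (passes c) (eval-1 fl π τ (use cs (toℕ k)) (use cs′ (toℕ k′)) D′ later)
    where
    D′ = upd ℤ.-1ℤ cs′ (upd ℤ.1ℤ cs D (toℕ k)) (toℕ k′)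
    regroup : ∀ d x y p q → d ℤ.+ ℤ.1ℤ ℤ.* x ℤ.+ ℤ.-1ℤ ℤ.* y ℤ.+ (p ℤ.- q) ≡ d ℤ.+ ((x ℤ.+ p) ℤ.- (y ℤ.+ q))
    regroup = ℤR.solve-∀
    shifted : ∀ a j → lookup D′ j ℤ.+ ((ℤ.+ ρ π a (cum (use cs (toℕ k)) j)) ℤ.- (ℤ.+ ρ τ a (cum (use cs′ (toℕ k′)) j))) ≡
                      lookup D j ℤ.+ ((ℤ.+ ρ {suc m} (k , π) (suc a) (cum cs j)) ℤ.- (ℤ.+ ρ {suc m} (k′ , τ) (suc a) (cum cs′ j)))
    shifted a j = begin
      lookup D′ j ℤ.+ ((ℤ.+ ρ π a (cum (use cs (toℕ k)) j)) ℤ.- (ℤ.+ ρ τ a (cum (use cs′ (toℕ k′)) j)))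
        ≡⟨ cong₂ (λ u v → u ℤ.+ v) (trans (lookup-upd ℤ.-1ℤ cs′ (upd ℤ.1ℤ cs D (toℕ k)) (toℕ k′) j) (cong (ℤ._+ ℤ.-1ℤ ℤ.* (ℤ.+ lt (toℕ k′) (cum cs′ j))) (lookup-upd ℤ.1ℤ cs D (toℕ k) j)))
             (cong₂ (λ u v → (ℤ.+ ρ π a u) ℤ.- (ℤ.+ ρ τ a v)) (cum-use cs (toℕ k) j) (cum-use cs′ (toℕ k′) j)) ⟩
      lookup D j ℤ.+ ℤ.1ℤ ℤ.* (ℤ.+ x) ℤ.+ ℤ.-1ℤ ℤ.* (ℤ.+ y) ℤ.+ ((ℤ.+ ρ π a (cum cs j ∸ x)) ℤ.- (ℤ.+ ρ τ a (cum cs′ j ∸ y)))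
        ≡⟨ regroup (lookup D j) (ℤ.+ x) (ℤ.+ y) (ℤ.+ ρ π a (cum cs j ∸ x)) (ℤ.+ ρ τ a (cum cs′ j ∸ y)) ⟩
      lookup D j ℤ.+ (((ℤ.+ x) ℤ.+ (ℤ.+ ρ π a (cum cs j ∸ x))) ℤ.- ((ℤ.+ y) ℤ.+ (ℤ.+ ρ τ a (cum cs′ j ∸ y)))) ∎
      where
      open ≡-Reasoning
      x = lt (toℕ k) (cum cs j)
      y = lt (toℕ k′) (cum cs′ j)
    later : ∀ a → a ≤ length fl → ∀ j → pos (lookup D′ j ℤ.+ ((ℤ.+ ρ π a (cum (use cs (toℕ k)) j)) ℤ.- (ℤ.+ ρ τ a (cum (use cs′ (toℕ k′)) j)))) ≡ 1
    later a a≤ j = trans (cong pos (shifted a j)) (h (suc a) (s≤s a≤) j)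
    passes : ∀ c → check c D′ ≡ 1
    passes false = refl
    passes true  = allpos-1 D′ (λ j → trans (cong pos (sym (trans (cong₂ (λ u v → lookup D′ j ℤ.+ ((ℤ.+ u) ℤ.- (ℤ.+ v))) (ρ-zeroˡ π _) (ρ-zeroˡ τ _)) (ℤₚ.+-identityʳ (lookup D′ j))))) (later 0 z≤n j))

-- From single-point rows to random walks over cells

module Comparison (M : ℕ) where
  open Walk M using (E; Q; E-additive; E-+)
  open Persistence M using (pos)
  open Rows M
  open Field M

  bern : ℤ → ℕ → (ℤ → ℕ) → ℕ
  bern s zero    g = g ℤ.0ℤ
  bern s (suc N) g = M * bern s N g + bern s N (λ x → g (s ℤ.+ x))

  bern-additive : ∀ s N → Additive (bern s N)
  bern-additive s zero    = record { cong-S = λ e → e ℤ.0ℤ ; +-S = λ _ _ → refl ; *-S = λ _ _ → refl }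
  bern-additive s (suc N) = record
    { cong-S = λ e → cong₂ (λ u v → M * u + v) (cong-S A e) (cong-S A (λ x → e (s ℤ.+ x)))
    ; +-S = λ f g → trans (cong₂ (λ u v → M * u + v) (+-S A f g) (+-S A (λ x → f (s ℤ.+ x)) (λ x → g (s ℤ.+ x))))
                    (alg M (bern s N f) (bern s N g) (bern s N (λ x → f (s ℤ.+ x))) (bern s N (λ x → g (s ℤ.+ x))))
    ; *-S = λ c f → trans (cong₂ (λ u v → M * u + v) (*-S A c f) (*-S A c (λ x → f (s ℤ.+ x))))
                    (alg₂ M c (bern s N f) (bern s N (λ x → f (s ℤ.+ x)))) }
    where
    A = bern-additive s N
    alg : ∀ M a b c d → M * (a + b) + (c + d) ≡ M * a + c + (M * b + d)
    alg = solve-∀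
    alg₂ : ∀ M x a c → M * (x * a) + x * c ≡ x * (M * a + c)
    alg₂ = solve-∀

  bern-swap : ∀ s N {B : Set} {S : (B → ℕ) → ℕ} → Additive S → (f : ℤ → B → ℕ) → S (λ b → bern s N (λ X → f X b)) ≡ bern s N (λ X → S (f X))
  bern-swap s zero    a f = refl
  bern-swap s (suc N) a f = trans (+-S a (λ b → M * bern s N (λ X → f X b)) (λ b → bern s N (λ X → f (s ℤ.+ X) b)))
    (cong₂ _+_ (trans (*-S a M (λ b → bern s N (λ X → f X b))) (cong (M *_) (bern-swap s N a f))) (bern-swap s N a (λ X → f (s ℤ.+ X))))

  bernoulli : ℤ → Kernel
  bernoulli s = record { run = bern s ; additive = bern-additive s ; swap = bern-swap s }

  -- A site of each sign together moves by 0 with weight M² + 1 and by 1 or -1 with weight M each,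
  -- which is the step of `E`.
  bern-walk : ∀ N f → bern ℤ.1ℤ N (λ X → bern ℤ.-1ℤ N (λ Y → f (X ℤ.+ Y))) ≡ E N f
  bern-walk zero    f = refl
  bern-walk (suc N) f = begin
    M * bern ℤ.1ℤ N (λ X → M * u f X + u′ f X) + bern ℤ.1ℤ N (λ X → M * u f (ℤ.1ℤ ℤ.+ X) + u′ f (ℤ.1ℤ ℤ.+ X))
      ≡⟨ cong₂ (λ x y → M * x + y) (linear (u f) (u′ f)) (linear (λ X → u f (ℤ.1ℤ ℤ.+ X)) (λ X → u′ f (ℤ.1ℤ ℤ.+ X))) ⟩
    M * (M * bern ℤ.1ℤ N (u f) + bern ℤ.1ℤ N (u′ f)) + (M * bern ℤ.1ℤ N (λ X → u f (ℤ.1ℤ ℤ.+ X)) + bern ℤ.1ℤ N (λ X → u′ f (ℤ.1ℤ ℤ.+ X)))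
      ≡⟨ cong₂ (λ x y → M * (M * x + y) + (M * bern ℤ.1ℤ N (λ X → u f (ℤ.1ℤ ℤ.+ X)) + bern ℤ.1ℤ N (λ X → u′ f (ℤ.1ℤ ℤ.+ X)))) (bern-walk N f) (merge (λ X Y → X ℤ.+ (ℤ.-1ℤ ℤ.+ Y)) ℤ.pred move₁) ⟩
    M * (M * E N f + E N (f ∘ ℤ.pred)) + (M * bern ℤ.1ℤ N (λ X → u f (ℤ.1ℤ ℤ.+ X)) + bern ℤ.1ℤ N (λ X → u′ f (ℤ.1ℤ ℤ.+ X)))
      ≡⟨ cong₂ (λ x y → M * (M * E N f + E N (f ∘ ℤ.pred)) + (M * x + y)) (merge (λ X Y → (ℤ.1ℤ ℤ.+ X) ℤ.+ Y) ℤ.suc (ℤₚ.+-assoc ℤ.1ℤ)) (merge (λ X Y → (ℤ.1ℤ ℤ.+ X) ℤ.+ (ℤ.-1ℤ ℤ.+ Y)) id move₂) ⟩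
    M * (M * E N f + E N (f ∘ ℤ.pred)) + (M * E N (f ∘ ℤ.suc) + E N f) ≡⟨ alg M (E N f) (E N (f ∘ ℤ.pred)) (E N (f ∘ ℤ.suc)) ⟩
    (M * M + 1) * E N f + M * (E N (f ∘ ℤ.suc) + E N (f ∘ ℤ.pred)) ∎
    where
    open ≡-Reasoning
    A = bern-additive ℤ.1ℤ N
    u u′ : (ℤ → ℕ) → ℤ → ℕ
    u f X = bern ℤ.-1ℤ N (λ Y → f (X ℤ.+ Y))
    u′ f X = bern ℤ.-1ℤ N (λ Y → f (X ℤ.+ (ℤ.-1ℤ ℤ.+ Y)))
    linear : ∀ (g h : ℤ → ℕ) → bern ℤ.1ℤ N (λ X → M * g X + h X) ≡ M * bern ℤ.1ℤ N g + bern ℤ.1ℤ N h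
    linear g h = trans (+-S A (λ X → M * g X) h) (cong (_+ bern ℤ.1ℤ N h) (*-S A M g))
    merge : ∀ (p : ℤ → ℤ → ℤ) (q : ℤ → ℤ) → (∀ X Y → p X Y ≡ q (X ℤ.+ Y)) →
            bern ℤ.1ℤ N (λ X → bern ℤ.-1ℤ N (λ Y → f (p X Y))) ≡ E N (f ∘ q)
    merge p q e = trans (cong-S A (λ X → cong-S (bern-additive ℤ.-1ℤ N) (λ Y → cong f (e X Y)))) (bern-walk N (f ∘ q))
    move₁ : ∀ X Y → X ℤ.+ (ℤ.-1ℤ ℤ.+ Y) ≡ ℤ.-1ℤ ℤ.+ (X ℤ.+ Y)
    move₁ = ℤR.solve-∀
    move₂ : ∀ X Y → (ℤ.1ℤ ℤ.+ X) ℤ.+ (ℤ.-1ℤ ℤ.+ Y) ≡ X ℤ.+ Y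
    move₂ = ℤR.solve-∀
    alg : ∀ M e p s → M * (M * e + p) + (M * s + e) ≡ (M * M + 1) * e + M * (s + p)
    alg = solve-∀

  bern-none : ∀ s N g → M ^ N * g ℤ.0ℤ ≤ bern s N g
  bern-none s zero    g = ≤-reflexive (+-identityʳ (g ℤ.0ℤ))
  bern-none s (suc N) g = ≤-trans (≤-reflexive (*-assoc M (M ^ N) _)) (≤-trans (*-monoʳ-≤ M (bern-none s N g)) (m≤m+n _ _))

  -- Only the configurations with no hit or exactly one are kept: M^N g(0) + N M^(N-1) g(s),
  -- multiplied by M.
  bern-one : ∀ s N g → M ^ N * (M * g ℤ.0ℤ + N * g s) ≤ M * bern s N g
  bern-one s zero    g = ≤-reflexive (trans (+-identityʳ _) (+-identityʳ _))
  bern-one s (suc N) g = begin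
    M * M ^ N * (M * g ℤ.0ℤ + suc N * g s) ≡⟨ alg M (M ^ N) (g ℤ.0ℤ) N (g s) ⟩
    M * (M ^ N * (M * g ℤ.0ℤ + N * g s)) + M * (M ^ N * g s)
      ≤⟨ +-mono-≤ (*-monoʳ-≤ M (bern-one s N g)) (*-monoʳ-≤ M (≤-trans (≤-reflexive (cong (λ z → M ^ N * g z) (sym (ℤₚ.+-identityʳ s)))) (bern-none s N (λ x → g (s ℤ.+ x))))) ⟩
    M * (M * bern s N g) + M * bern s N (λ x → g (s ℤ.+ x)) ≡⟨ *-distribˡ-+ M (M * bern s N g) _ ⟨
    M * bern s (suc N) g ∎
    where
    open ≤-Reasoning
    alg : ∀ M x a N b → M * x * (M * a + suc N * b) ≡ M * (x * (M * a + N * b)) + M * (x * b)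
    alg = solve-∀

  shift : ∀ {J} → ℤ → Vec ℤ J → Vec ℤ J
  shift t = mapᵥ (ℤ._+ t)

  op-none : ∀ {J} s (βs : Vec ℕ J) f xs t → M ^ total βs * f (shift t xs) ≤ op (bernoulli s) βs f xs t
  op-none s []ᵥ       f []ᵥ       t = ≤-reflexive (+-identityʳ (f []ᵥ))
  op-none s (β ∷ᵥ βs) f (x ∷ᵥ xs) t = begin
    M ^ (β + total βs) * f (shift t (x ∷ᵥ xs)) ≡⟨ cong (_* f (shift t (x ∷ᵥ xs))) (^-distribˡ-+-* M β (total βs)) ⟩
    M ^ β * M ^ total βs * f (shift t (x ∷ᵥ xs)) ≡⟨ *-assoc (M ^ β) (M ^ total βs) _ ⟩
    M ^ β * (M ^ total βs * f (shift t (x ∷ᵥ xs))) ≤⟨ *-monoʳ-≤ (M ^ β) (op-none s βs (λ ys → f ((x ℤ.+ t) ∷ᵥ ys)) xs t) ⟩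
    M ^ β * op (bernoulli s) βs (λ ys → f ((x ℤ.+ t) ∷ᵥ ys)) xs t ≡⟨ cong (λ z → M ^ β * op (bernoulli s) βs (λ ys → f ((x ℤ.+ z) ∷ᵥ ys)) xs z) (ℤₚ.+-identityʳ t) ⟨
    M ^ β * g ℤ.0ℤ ≤⟨ bern-none s β g ⟩
    bern s β g ∎
    where
    open ≤-Reasoning
    g : ℤ → ℕ
    g X = op (bernoulli s) βs (λ ys → f ((x ℤ.+ (t ℤ.+ X)) ∷ᵥ ys)) xs (t ℤ.+ X)

  -- The single-point row is the part of the independent row with at most one hit. After a hit in
  -- the first block all later blocks are empty, which is `op-none` with running sum s.
  row≤op : ∀ {J} s (βs : Vec ℕ J) f xs → M ^ total βs * row s βs f xs ≤ M * op (bernoulli s) βs f xs ℤ.0ℤ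
  row≤op s []ᵥ       f []ᵥ       = ≤-reflexive (+-identityʳ (M * f []ᵥ))
  row≤op s (β ∷ᵥ βs) f (x ∷ᵥ xs) = begin
    M ^ (β + T) * (row s βs (λ ys → f (x ∷ᵥ ys)) xs + β * f (shift s (x ∷ᵥ xs)))
      ≡⟨ trans (cong (_* (row s βs (λ ys → f (x ∷ᵥ ys)) xs + β * f (shift s (x ∷ᵥ xs)))) (^-distribˡ-+-* M β T)) (alg (M ^ β) (M ^ T) (row s βs (λ ys → f (x ∷ᵥ ys)) xs) β (f (shift s (x ∷ᵥ xs)))) ⟩
    M ^ β * (M ^ T * row s βs (λ ys → f (x ∷ᵥ ys)) xs + β * (M ^ T * f (shift s (x ∷ᵥ xs))))
      ≤⟨ *-monoʳ-≤ (M ^ β) (+-mono-≤ (≤-trans (row≤op s βs (λ ys → f (x ∷ᵥ ys)) xs) (≤-reflexive (cong (λ z → M * op (bernoulli s) βs (λ ys → f (z ∷ᵥ ys)) xs ℤ.0ℤ) (sym (ℤₚ.+-identityʳ x)))))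
           (*-monoʳ-≤ β (≤-trans (op-none s βs (λ ys → f ((x ℤ.+ s) ∷ᵥ ys)) xs s) (≤-reflexive (cong (λ z → op (bernoulli s) βs (λ ys → f ((x ℤ.+ z) ∷ᵥ ys)) xs z) (sym (ℤₚ.+-identityˡ s))))))) ⟩
    M ^ β * (M * g ℤ.0ℤ + β * g s) ≤⟨ bern-one s β g ⟩
    M * bern s β g ∎
    where
    open ≤-Reasoning
    T = total βs
    g : ℤ → ℕ
    g X = op (bernoulli s) βs (λ ys → f ((x ℤ.+ (ℤ.0ℤ ℤ.+ X)) ∷ᵥ ys)) xs (ℤ.0ℤ ℤ.+ X)
    alg : ∀ x y r b z → x * y * (r + b * z) ≡ x * (y * r + b * (y * z))
    alg = solve-∀

  pair≤walk : ∀ {J} (βs : Vec ℕ J) h D → M ^ total βs * M ^ total βs * row ℤ.1ℤ βs (row ℤ.-1ℤ βs h) D ≤ M * M * op walk βs h D ℤ.0ℤ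
  pair≤walk βs h D = begin
    T * T * row ℤ.1ℤ βs (row ℤ.-1ℤ βs h) D ≡⟨ *-assoc T T _ ⟩
    T * (T * row ℤ.1ℤ βs (row ℤ.-1ℤ βs h) D) ≡⟨ cong (T *_) (row-*ˡ ℤ.1ℤ βs T (row ℤ.-1ℤ βs h) D) ⟨
    T * row ℤ.1ℤ βs (λ D′ → T * row ℤ.-1ℤ βs h D′) D ≤⟨ *-monoʳ-≤ T (row-mono ℤ.1ℤ βs D (λ D′ → row≤op ℤ.-1ℤ βs h D′)) ⟩
    T * row ℤ.1ℤ βs (λ D′ → M * G D′) D ≡⟨ cong (T *_) (row-*ˡ ℤ.1ℤ βs M G D) ⟩
    T * (M * row ℤ.1ℤ βs G D) ≡⟨ alg T M (row ℤ.1ℤ βs G D) ⟩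
    M * (T * row ℤ.1ℤ βs G D) ≤⟨ *-monoʳ-≤ M (row≤op ℤ.1ℤ βs G D) ⟩
    M * (M * op (bernoulli ℤ.1ℤ) βs G D ℤ.0ℤ) ≡⟨ *-assoc M M _ ⟨
    M * M * op (bernoulli ℤ.1ℤ) βs G D ℤ.0ℤ ≡⟨ cong (M * M *_) composed ⟩
    M * M * op walk βs h D ℤ.0ℤ ∎
    where
    open ≤-Reasoning
    T = M ^ total βs
    G : Vec ℤ _ → ℕ
    G D′ = op (bernoulli ℤ.-1ℤ) βs h D′ ℤ.0ℤ
    alg : ∀ x y z → x * (y * z) ≡ y * (x * z)
    alg = solve-∀
    composed : op (bernoulli ℤ.1ℤ) βs G D ℤ.0ℤ ≡ op walk βs h D ℤ.0ℤ
    composed = subst (λ ks → op (bernoulli ℤ.1ℤ) ks (λ D′ → op (bernoulli ℤ.-1ℤ) ks h D′ ℤ.0ℤ) D ℤ.0ℤ ≡ op walk ks h D ℤ.0ℤ) (V.map-id βs)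
      (op-compose {bernoulli ℤ.1ℤ} {bernoulli ℤ.-1ℤ} {walk} id id id bern-walk βs h D ℤ.0ℤ ℤ.0ℤ)

  walkRows : ∀ {J} → Vec ℕ J → List Bool → Vec ℤ J → ℕ
  walkRows βs []       D = 1
  walkRows βs (c ∷ fl) D = op walk βs (λ D′ → check c D′ * walkRows βs fl D′) D ℤ.0ℤ

  rows≤walkRows : ∀ {J} (βs : Vec ℕ J) fl D → (M ^ total βs * M ^ total βs) ^ length fl * rows βs fl D ≤ (M * M) ^ length fl * walkRows βs fl D
  rows≤walkRows βs []       D = ≤-refl
  rows≤walkRows βs (c ∷ fl) D = begin
    T² * T² ^ r * row ℤ.1ℤ βs (row ℤ.-1ℤ βs f) D ≡⟨ alg₁ T² (T² ^ r) (row ℤ.1ℤ βs (row ℤ.-1ℤ βs f) D) ⟩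
    T² ^ r * (T² * row ℤ.1ℤ βs (row ℤ.-1ℤ βs f) D) ≤⟨ *-monoʳ-≤ (T² ^ r) (pair≤walk βs f D) ⟩
    T² ^ r * (M * M * op walk βs f D ℤ.0ℤ) ≡⟨ alg₂ (T² ^ r) (M * M) (op walk βs f D ℤ.0ℤ) ⟩
    M * M * (T² ^ r * op walk βs f D ℤ.0ℤ) ≡⟨ cong (M * M *_) (*-S A (T² ^ r) f) ⟨
    M * M * op walk βs (λ D′ → T² ^ r * f D′) D ℤ.0ℤ ≤⟨ *-monoʳ-≤ (M * M) (mono-S A inner) ⟩
    M * M * op walk βs (λ D′ → (M * M) ^ r * g D′) D ℤ.0ℤ ≡⟨ cong (M * M *_) (*-S A ((M * M) ^ r) g) ⟩
    M * M * ((M * M) ^ r * op walk βs g D ℤ.0ℤ) ≡⟨ *-assoc (M * M) ((M * M) ^ r) _ ⟨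
    M * M * (M * M) ^ r * op walk βs g D ℤ.0ℤ ∎
    where
    open ≤-Reasoning
    r = length fl
    T² = M ^ total βs * M ^ total βs
    A = op-additive walk βs D ℤ.0ℤ
    f g : Vec ℤ _ → ℕ
    f D′ = check c D′ * rows βs fl D′
    g D′ = check c D′ * walkRows βs fl D′
    alg₁ : ∀ x y z → x * y * z ≡ y * (x * z)
    alg₁ = solve-∀
    alg₂ : ∀ x y z → x * (y * z) ≡ y * (x * z)
    alg₂ = solve-∀
    inner : ∀ D′ → T² ^ r * f D′ ≤ (M * M) ^ r * g D′
    inner D′ = ≤-trans (≤-reflexive (alg₂ (T² ^ r) (check c D′) (rows βs fl D′))) (≤-trans (*-monoʳ-≤ (check c D′) (rows≤walkRows βs fl D′)) (≤-reflexive (alg₂ (check c D′) ((M * M) ^ r) (walkRows βs fl D′))))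

  -- A block of suc l rows is checked only after its last row.
  block : ℕ → List Bool → List Bool
  block zero    fl = true ∷ fl
  block (suc l) fl = false ∷ block l fl

  flags : List ℕ → List Bool
  flags []       = []
  flags (l ∷ ls) = block l (flags ls)

  cells : ∀ {J} → Vec ℕ J → List ℕ → List (Vec ℕ J)
  cells βs []       = []
  cells βs (l ∷ ls) = mapᵥ (suc l *_) βs ∷ cells βs ls

  walk-block : ∀ {J} (βs : Vec ℕ J) l fl D →
    walkRows βs (block l fl) D ≡ op walk (mapᵥ (suc l *_) βs) (λ D′ → allpos D′ * walkRows βs fl D′) D ℤ.0ℤ
  walk-block βs zero    fl D = cong (λ ks → op walk ks (λ D′ → allpos D′ * walkRows βs fl D′) D ℤ.0ℤ)
    (trans (sym (V.map-id βs)) (V.map-cong (λ k → sym (+-identityʳ k)) βs))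
  walk-block βs (suc l) fl D = begin
    op walk βs (λ D′ → 1 * walkRows βs (block l fl) D′) D ℤ.0ℤ
      ≡⟨ cong-S (op-additive walk βs D ℤ.0ℤ) (λ D′ → trans (*-identityˡ _) (walk-block βs l fl D′)) ⟩
    op walk βs (λ D′ → op walk (mapᵥ (suc l *_) βs) F D′ ℤ.0ℤ) D ℤ.0ℤ
      ≡⟨ cong (λ ks → op walk ks (λ D′ → op walk (mapᵥ (suc l *_) βs) F D′ ℤ.0ℤ) D ℤ.0ℤ) (V.map-id βs) ⟨
    op walk (mapᵥ id βs) (λ D′ → op walk (mapᵥ (suc l *_) βs) F D′ ℤ.0ℤ) D ℤ.0ℤ
      ≡⟨ op-compose {walk} {walk} {walk} id (suc l *_) (suc (suc l) *_) (λ k f → E-+ k (suc l * k) f) βs F D ℤ.0ℤ ℤ.0ℤ ⟩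
    op walk (mapᵥ (suc (suc l) *_) βs) F D ℤ.0ℤ ∎
    where
    open ≡-Reasoning
    F : Vec ℤ _ → ℕ
    F D′ = allpos D′ * walkRows βs fl D′

  walk-flags : ∀ {J} (βs : Vec ℕ J) ls D → walkRows βs (flags ls) D ≡ persist (cells βs ls) D
  walk-flags βs []       D = refl
  walk-flags βs (l ∷ ls) D = trans (walk-block βs l (flags ls) D)
    (cong-S (op-additive walk (mapᵥ (suc l *_) βs) D ℤ.0ℤ) (λ D′ → cong (allpos D′ *_) (walk-flags βs ls D′)))

  sizes : List ℕ → ℕ
  sizes []       = 0
  sizes (l ∷ ls) = suc l + sizes ls

  length-block : ∀ l fl → length (block l fl) ≡ suc l + length fl
  length-block zero    fl = refl
  length-block (suc l) fl = cong suc (length-block l fl)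

  length-flags : ∀ ls → length (flags ls) ≡ sizes ls
  length-flags []       = refl
  length-flags (l ∷ ls) = trans (length-block l (flags ls)) (cong (suc l +_) (length-flags ls))

  length-cells : ∀ {J} (βs : Vec ℕ J) ls → length (cells βs ls) ≡ length ls
  length-cells βs []       = refl
  length-cells βs (l ∷ ls) = cong suc (length-cells βs ls)

  total-map : ∀ {J} k (βs : Vec ℕ J) → total (mapᵥ (k *_) βs) ≡ k * total βs
  total-map k []ᵥ       = sym (*-zeroʳ k)
  total-map k (β ∷ᵥ βs) = trans (cong (k * β +_) (total-map k βs)) (sym (*-distribˡ-+ k β (total βs)))

  totals-cells : ∀ {J} (βs : Vec ℕ J) ls → totals (cells βs ls) ≡ sizes ls * total βs
  totals-cells βs []       = refl
  totals-cells βs (l ∷ ls) = trans (cong₂ _+_ (total-map (suc l) βs) (totals-cells βs ls)) (sym (*-distribʳ-+ (total βs) (suc l) (sizes ls)))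

  ff-! : ∀ n A → A ≤ n → ff n A * (n ∸ A) ! ≡ n !
  ff-! n       zero    _       = +-identityʳ (n !)
  ff-! (suc n) (suc A) (s≤s p) = trans (*-assoc (suc n) (ff n A) _) (cong (suc n *_) (ff-! n A p))

  ff-ratio : ∀ n w A u v → w ≤ n → u * n ≤ v * w → ff u A * n ^ A ≤ ff v A * w ^ A
  ff-ratio n w zero    u v _   _ = ≤-refl
  ff-ratio n w (suc A) u v w≤n h = begin
    u * ff (u ∸ 1) A * (n * n ^ A) ≡⟨ alg u (ff (u ∸ 1) A) n (n ^ A) ⟩
    u * n * (ff (u ∸ 1) A * n ^ A) ≤⟨ *-mono-≤ h (ff-ratio n w A (u ∸ 1) (v ∸ 1) w≤n next) ⟩
    v * w * (ff (v ∸ 1) A * w ^ A) ≡⟨ alg v (ff (v ∸ 1) A) w (w ^ A) ⟨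
    v * ff (v ∸ 1) A * (w * w ^ A) ∎
    where
    open ≤-Reasoning
    alg : ∀ u f n x → u * f * (n * x) ≡ u * n * (f * x)
    alg = solve-∀
    next : (u ∸ 1) * n ≤ (v ∸ 1) * w
    next = begin
      (u ∸ 1) * n ≡⟨ *-distribʳ-∸ n u 1 ⟩
      u * n ∸ 1 * n ≤⟨ ∸-mono h (≤-trans (≤-reflexive (*-identityˡ w)) (≤-trans w≤n (≤-reflexive (sym (*-identityˡ n))))) ⟩
      v * w ∸ 1 * w ≡⟨ *-distribʳ-∸ w v 1 ⟨
      (v ∸ 1) * w ∎

  -- Bernoulli's inequality 1 - B/n ≤ (1 - 1/n)^B for n = suc n′, with denominators cleared.
  union-bound : ∀ n′ B → (suc n′ ∸ B) * suc n′ ^ B ≤ suc n′ * n′ ^ B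
  union-bound n′ zero    = ≤-refl
  union-bound n′ (suc B) = begin
    (n′ ∸ B) * (suc n′ * suc n′ ^ B) ≡⟨ *-assoc (n′ ∸ B) (suc n′) _ ⟨
    (n′ ∸ B) * suc n′ * suc n′ ^ B ≤⟨ *-monoˡ-≤ (suc n′ ^ B) one ⟩
    n′ * (suc n′ ∸ B) * suc n′ ^ B ≡⟨ *-assoc n′ (suc n′ ∸ B) _ ⟩
    n′ * ((suc n′ ∸ B) * suc n′ ^ B) ≤⟨ *-monoʳ-≤ n′ (union-bound n′ B) ⟩
    n′ * (suc n′ * n′ ^ B) ≡⟨ alg n′ (suc n′) (n′ ^ B) ⟩
    suc n′ * (n′ * n′ ^ B) ∎
    where
    open ≤-Reasoning
    alg : ∀ x y z → x * (y * z) ≡ y * (x * z)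
    alg = solve-∀
    one : (n′ ∸ B) * suc n′ ≤ n′ * (suc n′ ∸ B)
    one with ≤-total B n′
    ... | inj₂ n′≤B rewrite m≤n⇒m∸n≡0 n′≤B = z≤n
    ... | inj₁ B≤n′ rewrite +-∸-assoc 1 B≤n′ = ≤-trans (≤-reflexive (*-suc (n′ ∸ B) n′)) (≤-trans (+-monoˡ-≤ ((n′ ∸ B) * n′) (m∸n≤m n′ B)) (≤-reflexive (trans (cong (n′ +_) (*-comm (n′ ∸ B) n′)) (sym (*-suc n′ (n′ ∸ B))))))

  -- This compares the normalisations, the probabilities of no point in A × B for the permutation
  -- and for the field. Their quotient is at most ((1 - 1/n)(1 + 1/M))^(AB), and (n - 1)(M + 1) ≤ nM
  -- + (n - M) brings it under `pow≤2pow`.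
  density : ∀ n A B → 0 < n → A ≤ n → M ≤ n → 0 < M → 2 * (A * B * (n ∸ M)) ≤ n * M →
            ff (n ∸ B) A * (n ∸ A) ! * suc M ^ (A * B) ≤ 2 * n ! * M ^ (A * B)
  density n@(suc n′) A B _ A≤n M≤n 0<M h = *-cancelʳ-≤ _ _ (n ^ AB) {{m^n≢0 n AB}} (begin
    ff w A * (n ∸ A) ! * suc M ^ AB * n ^ AB ≡⟨ alg₁ (ff w A) ((n ∸ A) !) (suc M ^ AB) (n ^ AB) ⟩
    (n ∸ A) ! * suc M ^ AB * (ff w A * n ^ AB) ≤⟨ *-monoʳ-≤ ((n ∸ A) ! * suc M ^ AB) without ⟩
    (n ∸ A) ! * suc M ^ AB * (ff n A * n′ ^ AB) ≡⟨ alg₂ ((n ∸ A) !) (suc M ^ AB) (ff n A) (n′ ^ AB) ⟩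
    ff n A * (n ∸ A) ! * (n′ ^ AB * suc M ^ AB) ≡⟨ cong₂ _*_ (ff-! n A A≤n) (sym (^-distribʳ-* AB n′ (suc M))) ⟩
    n ! * (n′ * suc M) ^ AB ≤⟨ *-monoʳ-≤ (n !) (≤-trans (^-monoˡ-≤ AB step) (pow≤2pow (n * M) (n ∸ M) AB (≤-trans (*-mono-≤ (s≤s (z≤n {n′})) 0<M) (m≤m+n (n * M) (n ∸ M))) (≤-trans h (m≤m+n (n * M) (n ∸ M))))) ⟩
    n ! * (2 * (n * M) ^ AB) ≡⟨ cong (λ x → n ! * (2 * x)) (^-distribʳ-* AB n M) ⟩
    n ! * (2 * (n ^ AB * M ^ AB)) ≡⟨ alg₃ (n !) (n ^ AB) (M ^ AB) ⟩
    2 * n ! * M ^ AB * n ^ AB ∎)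
    where
    open ≤-Reasoning
    w = n ∸ B
    AB = A * B
    alg₁ : ∀ a b c d → a * b * c * d ≡ b * c * (a * d)
    alg₁ = solve-∀
    alg₂ : ∀ b c a d → b * c * (a * d) ≡ a * b * (d * c)
    alg₂ = solve-∀
    alg₃ : ∀ a b c → a * (2 * (b * c)) ≡ 2 * a * c * b
    alg₃ = solve-∀
    step : n′ * suc M ≤ n * M + (n ∸ M)
    step = begin
      n′ * suc M ≡⟨ *-suc n′ M ⟩
      n′ + n′ * M ≡⟨ +-comm n′ (n′ * M) ⟩
      n′ * M + n′ ≤⟨ +-monoʳ-≤ (n′ * M) (≤-trans (n≤1+n n′) (≤-reflexive (sym (m+[n∸m]≡n M≤n)))) ⟩
      n′ * M + (M + (n ∸ M)) ≡⟨ alg n′ M (n ∸ M) ⟩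
      n * M + (n ∸ M) ∎
      where
      alg : ∀ n M d → n * M + (M + d) ≡ suc n * M + d
      alg = solve-∀
    without : ff w A * n ^ AB ≤ ff n A * n′ ^ AB
    without = *-cancelʳ-≤ _ _ (n ^ A) {{m^n≢0 n A}} (begin
      ff w A * n ^ AB * n ^ A ≡⟨ cong (λ x → ff w A * x * n ^ A) (pow n) ⟩
      ff w A * (n ^ B) ^ A * n ^ A ≡⟨ alg₄ (ff w A) ((n ^ B) ^ A) (n ^ A) ⟩
      ff w A * n ^ A * (n ^ B) ^ A ≤⟨ *-monoˡ-≤ ((n ^ B) ^ A) (ff-ratio n w A w n (m∸n≤m n B) (≤-reflexive (*-comm w n))) ⟩
      ff n A * w ^ A * (n ^ B) ^ A ≡⟨ trans (*-assoc (ff n A) _ _) (cong (ff n A *_) (sym (^-distribʳ-* A w (n ^ B)))) ⟩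
      ff n A * (w * n ^ B) ^ A ≤⟨ *-monoʳ-≤ (ff n A) (^-monoˡ-≤ A (union-bound n′ B)) ⟩
      ff n A * (n * n′ ^ B) ^ A ≡⟨ cong (ff n A *_) (^-distribʳ-* A n (n′ ^ B)) ⟩
      ff n A * (n ^ A * (n′ ^ B) ^ A) ≡⟨ alg₅ (ff n A) (n ^ A) ((n′ ^ B) ^ A) ⟩
      ff n A * (n′ ^ B) ^ A * n ^ A ≡⟨ cong (λ x → ff n A * x * n ^ A) (pow n′) ⟨
      ff n A * n′ ^ AB * n ^ A ∎)
      where
      pow : ∀ x → x ^ (A * B) ≡ (x ^ B) ^ A
      pow x = trans (cong (x ^_) (*-comm A B)) (sym (^-*-assoc x B A))
      alg₄ : ∀ a b c → a * b * c ≡ a * c * b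
      alg₄ = solve-∀
      alg₅ : ∀ a b c → a * (b * c) ≡ a * c * b
      alg₅ = solve-∀

  pos-minus : ∀ {x y} → y ≤ x → pos ((ℤ.+ x) ℤ.- (ℤ.+ y)) ≡ 1
  pos-minus {x} {y} y≤x = cong pos (trans (ℤₚ.m-n≡m⊖n x y) (ℤₚ.⊖-≥ y≤x))

  cum≤total : ∀ {J} (cs : Vec ℕ J) j → cum cs j ≤ total cs
  cum≤total (c ∷ᵥ cs) fz     = m≤m+n c (total cs)
  cum≤total (c ∷ᵥ cs) (fs j) = +-monoʳ-≤ c (cum≤total cs j)

  bruhat⇒rank : ∀ n (π τ : Code n) → BruhatLeq (decode π) (decode τ) → ∀ a b → a ≤ n → b ≤ n → ρ τ a b ≤ ρ π a b
  bruhat⇒rank n π τ h zero    b       _ _ = ≤-trans (≤-reflexive (ρ-zeroˡ τ b)) z≤n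
  bruhat⇒rank n π τ h (suc a) zero    _ _ = ≤-trans (≤-reflexive (ρ-zeroʳ τ (suc a))) z≤n
  bruhat⇒rank n π τ h (suc a) (suc b) p q = subst₂ _≤_
    (trans (rank≡rk (decode τ) _ _) (trans (rk-decode τ _ _) (cong₂ (λ x y → ρ τ (suc x) (suc y)) (F.toℕ-fromℕ< p) (F.toℕ-fromℕ< q))))
    (trans (rank≡rk (decode π) _ _) (trans (rk-decode π _ _) (cong₂ (λ x y → ρ π (suc x) (suc y)) (F.toℕ-fromℕ< p) (F.toℕ-fromℕ< q))))
    (h (fromℕ< p) (fromℕ< q))

  comparable≤eval : ∀ n {J} (βs : Vec ℕ J) ls → sizes ls ≤ n → total βs ≤ n →
    comparablePairs n ≤ ∑∑ n (λ π τ → eval (flags ls) π τ βs βs (replicate J ℤ.0ℤ))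
  comparable≤eval n {J} βs ls A≤n B≤n = begin
    comparablePairs n ≡⟨ comparablePairs≡ n ⟩
    ∑ n (λ π → ∑ n (λ τ → 𝟙 (bruhatLeq? (decode π) (decode τ)))) ≤⟨ mono-S (∑-additive n) (λ π → mono-S (∑-additive n) (pointwise π)) ⟩
    ∑∑ n (λ π τ → eval (flags ls) π τ βs βs (replicate J ℤ.0ℤ)) ∎
    where
    open ≤-Reasoning
    pointwise : ∀ (π τ : Code n) → 𝟙 (bruhatLeq? (decode π) (decode τ)) ≤ eval (flags ls) π τ βs βs (replicate J ℤ.0ℤ)
    pointwise π τ with bruhatLeq? (decode π) (decode τ)
    ... | no _  = z≤n
    ... | yes h = ≤-reflexive (sym (eval-1 (flags ls) π τ βs βs (replicate J ℤ.0ℤ) (λ a a≤ j →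
          trans (cong pos (trans (cong (ℤ._+ ((ℤ.+ ρ π a (cum βs j)) ℤ.- (ℤ.+ ρ τ a (cum βs j)))) (V.lookup-replicate j ℤ.0ℤ)) (ℤₚ.+-identityˡ _)))
            (pos-minus (bruhat⇒rank n π τ h a (cum βs j) (≤-trans a≤ (≤-trans (≤-reflexive (length-flags ls)) A≤n)) (≤-trans (cum≤total βs j) B≤n))))))

  weights-zero : ∀ J ε → weights ε (replicate J ℤ.0ℤ) ≡ 1
  weights-zero zero    ε = refl
  weights-zero (suc J) ε = cong₂ _*_ (pw-zero ε) (weights-zero J (13 + ε))

  -- The 4 is the factor 2 of `density`, paid once for π and once for τ.
  upper-count : ∀ n {J} (βs : Vec ℕ J) ls ε → FitsRows ε (cells βs ls) → 0 < n → 0 < M → M + sizes ls + total βs ≤ n →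
    2 * (sizes ls * total βs * (n ∸ M)) ≤ n * M →
    (64 ^ J) ^ length ls * comparablePairs n ≤ (63 ^ J) ^ length ls * (4 * (n ! * n !))
  upper-count n {J} βs ls ε fits 0<n 0<M room h = *-cancelʳ-≤ _ _ X {{X≢0}} (begin
    c * cp * X ≡⟨ alg₁ c cp X ⟩
    c * (X * cp) ≤⟨ *-monoʳ-≤ c counted ⟩
    c * (F * F * (f * f) * persist (cells βs ls) D₀) ≡⟨ alg₂ c (F * F * (f * f)) (persist (cells βs ls) D₀) ⟩
    F * F * (f * f) * (c * persist (cells βs ls) D₀) ≤⟨ *-monoʳ-≤ (F * F * (f * f)) persisted ⟩
    F * F * (f * f) * (d * (S * S)) ≡⟨ alg₃ F f d S ⟩
    d * ((F * f * S) * (F * f * S)) ≤⟨ *-monoʳ-≤ d (*-mono-≤ dens dens) ⟩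
    d * ((2 * n ! * m) * (2 * n ! * m)) ≡⟨ alg₄ d (n !) m ⟩
    d * (4 * (n ! * n !)) * (m * m) ≡⟨ cong (d * (4 * (n ! * n !)) *_) X≡ ⟨
    d * (4 * (n ! * n !)) * X ∎)
    where
    open ≤-Reasoning
    A = sizes ls
    B = total βs
    L = length (flags ls)
    cp = comparablePairs n
    D₀ = replicate J ℤ.0ℤ
    w = n ∸ B
    c = (64 ^ J) ^ length ls
    d = (63 ^ J) ^ length ls
    F = ff w A
    f = (n ∸ A) !
    S = suc M ^ (A * B)
    m = M ^ (A * B)
    X = (M ^ B * M ^ B) ^ A
    instance _ = >-nonZero 0<M
    X≢0 : NonZero X
    X≢0 = m^n≢0 (M ^ B * M ^ B) A {{m*n≢0 (M ^ B) (M ^ B) {{m^n≢0 M B}} {{m^n≢0 M B}}}}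
    B≤n : B ≤ n
    B≤n = ≤-trans (m≤n+m B (M + A)) room
    A≤n : A ≤ n
    A≤n = ≤-trans (m≤n+m A M) (≤-trans (m≤m+n (M + A) B) room)
    M≤n : M ≤ n
    M≤n = ≤-trans (m≤m+n M A) (≤-trans (m≤m+n (M + A) B) room)
    X≡ : X ≡ m * m
    X≡ = trans (^-distribʳ-* A (M ^ B) (M ^ B)) (cong₂ _*_ pow pow)
      where
      pow : (M ^ B) ^ A ≡ M ^ (A * B)
      pow = trans (^-*-assoc M B A) (cong (M ^_) (*-comm B A))
    alg₁ : ∀ c p x → c * p * x ≡ c * (x * p)
    alg₁ = solve-∀
    alg₂ : ∀ c p x → c * (p * x) ≡ p * (c * x)
    alg₂ = solve-∀
    alg₃ : ∀ F f d S → F * F * (f * f) * (d * (S * S)) ≡ d * ((F * f * S) * (F * f * S))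
    alg₃ = solve-∀
    alg₄ : ∀ d n m → d * ((2 * n * m) * (2 * n * m)) ≡ d * (4 * (n * n)) * (m * m)
    alg₄ = solve-∀
    dens : F * f * S ≤ 2 * n ! * m
    dens = density n A B 0<n A≤n M≤n 0<M h
    persisted : c * persist (cells βs ls) D₀ ≤ d * (S * S)
    persisted = subst₂ (λ k T → (64 ^ J) ^ k * persist (cells βs ls) D₀ ≤ (63 ^ J) ^ k * T) (length-cells βs ls)
      (trans (cong₂ _*_ (trans (cong (Q ^_) (totals-cells βs ls)) (^-distribʳ-* (A * B) (suc M) (suc M))) (weights-zero J ε)) (*-identityʳ (S * S)))
      (persistence ε (cells βs ls) fits D₀)
    room′ : M + L ≤ w
    room′ = subst (λ k → M + k ≤ w) (sym (length-flags ls)) (m+n≤o⇒m≤o∸n (M + A) room)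
    n≡ : n ≡ B + w
    n≡ = sym (m+[n∸m]≡n B≤n)
    alg₅ : ∀ x y z → x * y * z ≡ y * (x * z)
    alg₅ = solve-∀
    alg₆ : ∀ x y z → x * (y * z) ≡ y * (x * z)
    alg₆ = solve-∀
    counted : X * cp ≤ F * F * (f * f) * persist (cells βs ls) D₀
    counted = *-cancelˡ-≤ ((M * M) ^ A) {{m^n≢0 (M * M) A {{m*n≢0 M M}}}} (begin
      (M * M) ^ A * (X * cp) ≡⟨ alg₆ ((M * M) ^ A) X cp ⟩
      X * ((M * M) ^ A * cp) ≤⟨ *-monoʳ-≤ X (≤-trans (*-monoʳ-≤ ((M * M) ^ A) (comparable≤eval n βs ls A≤n B≤n)) evaluated) ⟩
      X * (F * F * (f * f) * rows βs (flags ls) D₀) ≡⟨ alg₆ X (F * F * (f * f)) (rows βs (flags ls) D₀) ⟩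
      F * F * (f * f) * (X * rows βs (flags ls) D₀) ≤⟨ *-monoʳ-≤ (F * F * (f * f)) walked ⟩
      F * F * (f * f) * ((M * M) ^ A * persist (cells βs ls) D₀) ≡⟨ alg₆ (F * F * (f * f)) ((M * M) ^ A) (persist (cells βs ls) D₀) ⟩
      (M * M) ^ A * (F * F * (f * f) * persist (cells βs ls) D₀) ∎)
      where
      evaluated : (M * M) ^ A * ∑∑ n (λ π τ → eval (flags ls) π τ βs βs D₀) ≤ F * F * (f * f) * rows βs (flags ls) D₀
      evaluated = subst (λ k → (M * M) ^ k * ∑∑ n (λ π τ → eval (flags ls) π τ βs βs D₀) ≤ ff w k * ff w k * ((n ∸ k) ! * (n ∸ k) !) * rows βs (flags ls) D₀)
        (length-flags ls)
        (eval≤rows βs (flags ls) n βs βs w w D₀ (≤ᵥ-refl βs) (≤ᵥ-refl βs) n≡ n≡ (≤-trans (≤-reflexive (length-flags ls)) A≤n) room′ room′)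
      walked : X * rows βs (flags ls) D₀ ≤ (M * M) ^ A * persist (cells βs ls) D₀
      walked = subst (λ k → (M ^ B * M ^ B) ^ k * rows βs (flags ls) D₀ ≤ (M * M) ^ k * persist (cells βs ls) D₀) (length-flags ls)
        (subst (λ y → (M ^ B * M ^ B) ^ L * rows βs (flags ls) D₀ ≤ (M * M) ^ L * y) (walk-flags βs ls D₀) (rows≤walkRows βs (flags ls) D₀))

-- Choice of scales

2^≤⇒≤log : ∀ k {n} → 2 ^ k ≤ n → k ≤ ⌊log₂ n ⌋
2^≤⇒≤log k h = subst (_≤ _) (⌊log₂[2^n]⌋≡n k) (⌊log₂⌋-mono-≤ h)

log-upper : ∀ n → n < 2 ^ suc ⌊log₂ n ⌋
log-upper n = ≰⇒> (λ h → <-irrefl refl (2^≤⇒≤log (suc ⌊log₂ n ⌋) h))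

log-lower : ∀ n → 0 < n → 2 ^ ⌊log₂ n ⌋ ≤ n
log-lower n = go n n ≤-refl
  where
  open ≤-Reasoning
  go : ∀ f n → n ≤ f → 0 < n → 2 ^ ⌊log₂ n ⌋ ≤ n
  go (suc f) (suc zero)         _       _ = ≤-refl
  go (suc f) n@(suc (suc m)) (s≤s p) _ = begin
    2 ^ ⌊log₂ n ⌋ ≡⟨ cong (2 ^_) (m+[n∸m]≡n {1} {⌊log₂ n ⌋} (2^≤⇒≤log 1 {n} (s≤s (s≤s z≤n)))) ⟨
    2 * 2 ^ (⌊log₂ n ⌋ ∸ 1) ≡⟨ cong (λ k → 2 * 2 ^ k) (⌊log₂⌊n/2⌋⌋≡⌊log₂n⌋∸1 n) ⟨
    2 * 2 ^ ⌊log₂ ⌊ n /2⌋ ⌋ ≤⟨ *-monoʳ-≤ 2 (go f ⌊ n /2⌋ (≤-trans (s≤s (⌊n/2⌋≤n m)) p) (s≤s z≤n)) ⟩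
    2 * ⌊ n /2⌋ ≡⟨ cong (⌊ n /2⌋ +_) (+-identityʳ ⌊ n /2⌋) ⟩
    ⌊ n /2⌋ + ⌊ n /2⌋ ≤⟨ +-monoʳ-≤ ⌊ n /2⌋ (⌊n/2⌋≤⌈n/2⌉ n) ⟩
    ⌊ n /2⌋ + ⌈ n /2⌉ ≡⟨ ⌊n/2⌋+⌈n/2⌉≡n n ⟩
    n ∎

-- Gaps between powers of 2^26 are not powers of two themselves. Three quarters of one suffices,
-- since 9/16 ≥ 1/2 for the area of a cell.
Near : ℕ → ℕ → Set
Near P x = x ≤ P × 3 * P ≤ 4 * x

abstract
  up : ℕ → ℕ
  up e = 26 + e

  up≡ : ∀ e → up e ≡ 26 + e
  up≡ e = refl

2+≤up : ∀ e → 2 + e ≤ up e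
2+≤up e = subst (2 + e ≤_) (sym (up≡ e)) (+-monoˡ-≤ e (m≤m+n 2 24))

2^≤2^up : ∀ e → 2 ^ e ≤ 2 ^ up e
2^≤2^up e = ^-monoʳ-≤ 2 {e} {up e} (≤-trans (m≤n+m e 2) (2+≤up e))

-- The successive differences of 2^e, 2^(26+e), 2^(52+e), …
gaps : ℕ → ∀ J → Vec ℕ J
gaps e zero    = []ᵥ
gaps e (suc J) = (2 ^ up e ∸ 2 ^ e) ∷ᵥ gaps (up e) J

total-gaps : ∀ e J → 2 ^ e + total (gaps e J) ≡ 2 ^ (26 * J + e)
total-gaps e zero    = +-identityʳ (2 ^ e)
total-gaps e (suc J) = begin
  2 ^ e + (2 ^ up e ∸ 2 ^ e + total (gaps (up e) J)) ≡⟨ +-assoc (2 ^ e) (2 ^ up e ∸ 2 ^ e) (total (gaps (up e) J)) ⟨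
  2 ^ e + (2 ^ up e ∸ 2 ^ e) + total (gaps (up e) J) ≡⟨ cong (_+ total (gaps (up e) J)) (m+[n∸m]≡n (2^≤2^up e)) ⟩
  2 ^ up e + total (gaps (up e) J) ≡⟨ total-gaps (up e) J ⟩
  2 ^ (26 * J + up e) ≡⟨ cong (λ x → 2 ^ (26 * J + x)) (up≡ e) ⟩
  2 ^ (26 * J + (26 + e)) ≡⟨ cong (2 ^_) (alg J e) ⟩
  2 ^ (26 * suc J + e) ∎
  where
  open ≡-Reasoning
  alg : ∀ J e → 26 * J + (26 + e) ≡ 26 * suc J + e
  alg = solve-∀

near-difference : ∀ P p → 2 ^ 2 * p ≤ P → Near P (P ∸ p)
near-difference P p h = m∸n≤m P p , +-cancelʳ-≤ (4 * p) _ _ (begin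
  3 * P + 4 * p ≤⟨ +-monoʳ-≤ (3 * P) h ⟩
  3 * P + P ≡⟨ alg P ⟩
  4 * P ≡⟨ cong (4 *_) (m∸n+n≡m (≤-trans (m≤n*m p 4) h)) ⟨
  4 * (P ∸ p + p) ≡⟨ *-distribˡ-+ 4 (P ∸ p) p ⟩
  4 * (P ∸ p) + 4 * p ∎)
  where
  open ≤-Reasoning
  alg : ∀ P → 3 * P + P ≡ 4 * P
  alg = solve-∀

near-gap : ∀ e → Near (2 ^ up e) (2 ^ up e ∸ 2 ^ e)
near-gap e = near-difference (2 ^ up e) (2 ^ e)
  (subst (_≤ 2 ^ up e) (^-distribˡ-+-* 2 2 e) (^-monoʳ-≤ 2 {2 + e} {up e} (2+≤up e)))

near-power : ∀ e → Near (2 ^ e) (2 ^ e)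
near-power e = ≤-refl {2 ^ e} , *-monoˡ-≤ (2 ^ e) (m≤m+n 3 1)

near-positive : ∀ {e x} → Near (2 ^ e) x → 0 < x
near-positive {e} {zero}  (_ , h) = contradiction h (<⇒≱ (*-mono-≤ {1} {3} {1} {2 ^ e} (s≤s z≤n) (m^n>0 2 e)))
near-positive {e} {suc x} _       = s≤s z≤n

abstract
  c₈ : ℕ
  c₈ = 2 ^ 8

  c₈-pow : ∀ k → 2 ^ (8 + k) ≡ c₈ * 2 ^ k
  c₈-pow k = ^-distribˡ-+-* 2 8 k

-- A cell of about 2^(u + v) sites has variance about 2^(u + v + 1)/M. For u + v = 2ε + δ this is
-- 2^(2ε) up to fixed factors, because `wide` and `narrow` keep M · 2^δ / (M + 1)² between 2^10 and
-- 2^12.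
module Scales (M δ : ℕ) (wide : 4 * (16 * (16 * (suc M * suc M))) ≤ M * 2 ^ δ) (narrow : 16 * (M * 2 ^ δ) ≤ c₈ * c₈ * (suc M * suc M)) where
  open Walk M using (Q; V)
  open Rows M
  open Comparison M using (cells; sizes)

  fits : ∀ {x y} u v ε → Near (2 ^ u) x → Near (2 ^ v) y → u + v ≡ ε + ε + δ → Fits ε (x * y)
  fits {x} {y} u v ε (x≤ , 3u≤) (y≤ , 3v≤) e = record { spread = spread ; concentrated = concentrated ; many = ≤-trans large concentrated }
    where
    open ≤-Reasoning
    G = 2 ^ ε * 2 ^ ε
    P≡ : 2 ^ u * 2 ^ v ≡ 2 ^ δ * G
    P≡ = trans (sym (^-distribˡ-+-* 2 u v)) (trans (cong (2 ^_) e) (trans (^-distribˡ-+-* 2 (ε + ε) δ) (trans (*-comm (2 ^ (ε + ε)) (2 ^ δ)) (cong (2 ^ δ *_) (^-distribˡ-+-* 2 ε ε)))))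
    lift : ∀ c g q → c * c * q * (g * g) ≡ c * g * (c * g) * q
    lift = solve-∀
    alg₁ : ∀ M d g → 16 * (M * (d * g)) ≡ 16 * (M * d) * g
    alg₁ = solve-∀
    spread : 16 * (M * (x * y)) ≤ 2 ^ (8 + ε) * 2 ^ (8 + ε) * Q
    spread = begin
      16 * (M * (x * y)) ≤⟨ *-monoʳ-≤ 16 (*-monoʳ-≤ M (≤-trans (*-mono-≤ x≤ y≤) (≤-reflexive P≡))) ⟩
      16 * (M * (2 ^ δ * G)) ≡⟨ alg₁ M (2 ^ δ) G ⟩
      16 * (M * 2 ^ δ) * G ≤⟨ *-monoˡ-≤ G narrow ⟩
      c₈ * c₈ * Q * G ≡⟨ lift c₈ (2 ^ ε) Q ⟩
      c₈ * 2 ^ ε * (c₈ * 2 ^ ε) * Q ≡⟨ cong (λ z → z * z * Q) (c₈-pow ε) ⟨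
      2 ^ (8 + ε) * 2 ^ (8 + ε) * Q ∎
    half : 2 ^ u * 2 ^ v ≤ 2 * (x * y)
    half = *-cancelˡ-≤ 8 (begin
      8 * (2 ^ u * 2 ^ v) ≤⟨ *-monoˡ-≤ (2 ^ u * 2 ^ v) (m≤m+n 8 1) ⟩
      9 * (2 ^ u * 2 ^ v) ≡⟨ alg₂ (2 ^ u) (2 ^ v) ⟩
      3 * 2 ^ u * (3 * 2 ^ v) ≤⟨ *-mono-≤ 3u≤ 3v≤ ⟩
      4 * x * (4 * y) ≡⟨ alg₃ x y ⟩
      8 * (2 * (x * y)) ∎)
      where
      alg₂ : ∀ a b → 9 * (a * b) ≡ 3 * a * (3 * b)
      alg₂ = solve-∀
      alg₃ : ∀ a b → 4 * a * (4 * b) ≡ 8 * (2 * (a * b))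
      alg₃ = solve-∀
    concentrated : 4 * (Q * (16 * 2 ^ ε * (16 * 2 ^ ε))) ≤ V (x * y)
    concentrated = begin
      4 * (Q * (16 * 2 ^ ε * (16 * 2 ^ ε))) ≡⟨ alg₄ Q (2 ^ ε) ⟩
      4 * (16 * (16 * Q)) * G ≤⟨ *-monoˡ-≤ G wide ⟩
      M * 2 ^ δ * G ≡⟨ trans (*-assoc M (2 ^ δ) G) (cong (M *_) (sym P≡)) ⟩
      M * (2 ^ u * 2 ^ v) ≤⟨ *-monoʳ-≤ M half ⟩
      M * (2 * (x * y)) ≡⟨ alg₅ M (x * y) ⟩
      2 * M * (x * y) ∎
      where
      alg₄ : ∀ q g → 4 * (q * (16 * g * (16 * g))) ≡ 4 * (16 * (16 * q)) * (g * g)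
      alg₄ = solve-∀
      alg₅ : ∀ M z → M * (2 * z) ≡ 2 * M * z
      alg₅ = solve-∀
    large : Q ≤ 4 * (Q * (16 * 2 ^ ε * (16 * 2 ^ ε)))
    large = ≤-trans (≤-reflexive (sym (*-identityʳ Q))) (≤-trans (*-monoʳ-≤ Q (*-mono-≤ one one)) (m≤n*m _ 4))
      where
      one : 1 ≤ 16 * 2 ^ ε
      one = *-mono-≤ (s≤s (z≤n {15})) (m^n>0 2 ε)

  -- A step of 26 in the area exponent is a step of 13 in the exponent of the standard deviation.
  next : ∀ u v ε → u + v ≡ ε + ε + δ → u + up v ≡ (13 + ε) + (13 + ε) + δ
  next u v ε e = trans (cong (u +_) (up≡ v)) (trans (alg₁ u v) (trans (cong (26 +_) e) (alg₂ ε δ)))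
    where
    alg₁ : ∀ u v → u + (26 + v) ≡ 26 + (u + v)
    alg₁ = solve-∀
    alg₂ : ∀ ε δ → 26 + (ε + ε + δ) ≡ (13 + ε) + (13 + ε) + δ
    alg₂ = solve-∀

  fits-gaps : ∀ {x} u v ε J → Near (2 ^ u) x → u + up v ≡ ε + ε + δ → FitsRow ε (mapᵥ (x *_) (gaps v J))
  fits-gaps u v ε zero    _ _ = tt
  fits-gaps u v ε (suc J) h e = fits u (up v) ε h (near-gap v) e , fits-gaps u (up v) (13 + ε) J h (next u (up v) ε e)

  nextˡ : ∀ u v ε → u + v ≡ ε + ε + δ → up u + v ≡ (13 + ε) + (13 + ε) + δ
  nextˡ u v ε e = trans (+-comm (up u) v) (next v u ε (trans (+-comm v u) e))

  columns : ℕ → ∀ J → Vec ℕ (suc J)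
  columns v J = 2 ^ v ∷ᵥ gaps v J

  fits-row : ∀ {x} u v ε J → Near (2 ^ u) x → u + v ≡ ε + ε + δ → FitsRow ε (mapᵥ (x *_) (columns v J))
  fits-row u v ε J h e = fits u v ε h (near-power v) e , fits-gaps u v (13 + ε) J h (next u v ε e)

  rowGaps : ℕ → ℕ → List ℕ
  rowGaps u zero    = []
  rowGaps u (suc I) = (2 ^ up u ∸ 2 ^ u) ∸ 1 ∷ rowGaps (up u) I

  rowSizes : ℕ → ℕ → List ℕ
  rowSizes u I = 2 ^ u ∸ 1 ∷ rowGaps u I

  gap-suc : ∀ u → suc ((2 ^ up u ∸ 2 ^ u) ∸ 1) ≡ 2 ^ up u ∸ 2 ^ u
  gap-suc u = m+[n∸m]≡n (near-positive {up u} (near-gap u))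

  power-suc : ∀ u → suc (2 ^ u ∸ 1) ≡ 2 ^ u
  power-suc u = m+[n∸m]≡n (m^n>0 2 u)

  sizes-gaps : ∀ u I → 2 ^ u + sizes (rowGaps u I) ≡ 2 ^ (26 * I + u)
  sizes-gaps u I = trans (cong (2 ^ u +_) (same u I)) (total-gaps u I)
    where
    same : ∀ u I → sizes (rowGaps u I) ≡ total (gaps u I)
    same u zero    = refl
    same u (suc I) = cong₂ _+_ (gap-suc u) (same (up u) I)

  sizes-rows : ∀ u I → sizes (rowSizes u I) ≡ 2 ^ (26 * I + u)
  sizes-rows u I = trans (cong (_+ sizes (rowGaps u I)) (power-suc u)) (sizes-gaps u I)

  length-rows : ∀ u I → length (rowSizes u I) ≡ suc I
  length-rows u I = cong suc (go u I)
    where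
    go : ∀ u I → length (rowGaps u I) ≡ I
    go u zero    = refl
    go u (suc I) = cong suc (go (up u) I)

  fits-rowGaps : ∀ u v ε J I → up u + v ≡ ε + ε + δ → FitsRows ε (cells (columns v J) (rowGaps u I))
  fits-rowGaps u v ε J zero    e = tt
  fits-rowGaps u v ε J (suc I) e =
    fits-row (up u) v ε J (subst (Near (2 ^ up u)) (sym (gap-suc u)) (near-gap u)) e ,
    fits-rowGaps (up u) v (13 + ε) J I (nextˡ (up u) v ε e)

  fits-rows : ∀ u v J I → u + v ≡ δ → FitsRows 0 (cells (columns v J) (rowSizes u I))
  fits-rows u v J I e =
    fits-row u v 0 J (subst (Near (2 ^ u)) (sym (power-suc u)) (near-power u)) e ,
    fits-rowGaps u v 13 J I (nextˡ u v 0 e)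

-- The grid starts at u + v = L + 11, where a cell has a bounded mean number of points and ε = 0.
-- Steps of 26 lead in both directions from about 100q to about 126q, out of L ≈ 200q; as 3 · 126 <
-- 2 · 200, this stays below n^(2/3).
upper-rate : ∀ n L q ρ′ → 32 ≤ q → ρ′ < 200 → L ≡ 200 * q + ρ′ → 2 ^ L ≤ n → n < 2 ^ suc L →
             (64 ^ q) ^ q * comparablePairs n ≤ (63 ^ q) ^ q * (4 * (n ! * n !))
upper-rate n L q ρ′ 32≤q ρ′< L≡ 2^L≤n n< =
  subst₂ (λ j k → (64 ^ j) ^ k * comparablePairs n ≤ (63 ^ j) ^ k * (4 * (n ! * n !))) 1+I (trans (length-rows u I) 1+I)
    (Comparison.upper-count M n (columns v I) (rowSizes u I) 0 (fits-rows u v I I uv) 0<n 0<M room sparse)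
  where
  open ≤-Reasoning
  I = q ∸ 1
  1≤q : 1 ≤ q
  1≤q = ≤-trans (s≤s z≤n) 32≤q
  1+I : suc I ≡ q
  1+I = m+[n∸m]≡n 1≤q
  u = 100 * q + ρ′
  v = 100 * q + 11
  δ = L + 11
  A = 2 ^ (26 * I + u)
  B = 2 ^ (26 * I + v)
  M = n ∸ (A + B)
  k = L ∸ 1
  -- A common bound for A and B: q - 1 steps of 26 from at most 100q + 199.
  X = 2 ^ (126 * q + 174)
  uv : u + v ≡ δ
  uv = trans (alg q ρ′) (cong (_+ 11) (sym L≡))
    where
    alg : ∀ q r → (100 * q + r) + (100 * q + 11) ≡ 200 * q + r + 11
    alg = solve-∀
  200q≤L : 200 * q ≤ L
  200q≤L = ≤-trans (m≤m+n (200 * q) ρ′) (≤-reflexive (sym L≡))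
  1+k : suc k ≡ L
  1+k = m+[n∸m]≡n (≤-trans (≤-trans 1≤q (m≤n*m q 200)) 200q≤L)
  exponent : ∀ x → x ≤ 100 * q + 199 → 26 * I + x ≤ 126 * q + 174
  exponent x h = +-cancelʳ-≤ 26 _ _ (begin
    26 * I + x + 26 ≡⟨ trans (alg I x) (cong (λ z → 26 * z + x) 1+I) ⟩
    26 * q + x ≤⟨ +-monoʳ-≤ (26 * q) h ⟩
    26 * q + (100 * q + 199) ≤⟨ m≤m+n _ 1 ⟩
    26 * q + (100 * q + 199) + 1 ≡⟨ alg₂ q ⟩
    126 * q + 174 + 26 ∎)
    where
    alg : ∀ I x → 26 * I + x + 26 ≡ 26 * suc I + x
    alg = solve-∀
    alg₂ : ∀ q → 26 * q + (100 * q + 199) + 1 ≡ 126 * q + 174 + 26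
    alg₂ = solve-∀
  A≤X : A ≤ X
  A≤X = ^-monoʳ-≤ 2 (exponent u (+-monoʳ-≤ (100 * q) (≤-pred ρ′<)))
  B≤X : B ≤ X
  B≤X = ^-monoʳ-≤ 2 (exponent v (+-monoʳ-≤ (100 * q) (m≤m+n 11 188)))
  cube-exponent : 2 + 3 * (126 * q + 174) ≤ k + k
  cube-exponent = +-cancelʳ-≤ 2 _ _ (begin
    2 + 3 * (126 * q + 174) + 2 ≡⟨ alg q ⟩
    378 * q + 526 ≤⟨ +-monoʳ-≤ (378 * q) (≤-trans (m≤m+n 526 178) (*-monoʳ-≤ 22 32≤q)) ⟩
    378 * q + 22 * q ≡⟨ alg₂ q ⟩
    200 * q + 200 * q ≤⟨ +-mono-≤ 200q≤L 200q≤L ⟩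
    L + L ≡⟨ cong (λ z → z + z) 1+k ⟨
    suc k + suc k ≡⟨ alg₃ k ⟩
    k + k + 2 ∎)
    where
    alg : ∀ q → 2 + 3 * (126 * q + 174) + 2 ≡ 378 * q + 526
    alg = solve-∀
    alg₂ : ∀ q → 378 * q + 22 * q ≡ 200 * q + 200 * q
    alg₂ = solve-∀
    alg₃ : ∀ k → suc k + suc k ≡ k + k + 2
    alg₃ = solve-∀
  A+B≤2^k : A + B ≤ 2 ^ k
  A+B≤2^k = begin
    A + B ≤⟨ +-mono-≤ A≤X B≤X ⟩
    X + X ≡⟨ cong (X +_) (+-identityʳ X) ⟨
    2 * X ≤⟨ ^-monoʳ-≤ 2 (≤-pred (begin
      suc (suc (126 * q + 174)) ≡⟨ alg q ⟩
      126 * q + 176 ≤⟨ +-monoʳ-≤ (126 * q) (≤-trans (m≤m+n 176 2192) (*-monoʳ-≤ 74 32≤q)) ⟩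
      126 * q + 74 * q ≡⟨ *-distribʳ-+ q 126 74 ⟨
      200 * q ≤⟨ 200q≤L ⟩
      L ≡⟨ 1+k ⟨
      suc k ∎)) ⟩
    2 ^ k ∎
    where
    alg : ∀ q → suc (suc (126 * q + 174)) ≡ 126 * q + 176
    alg = solve-∀
  2^k+2^k≤n : 2 ^ k + 2 ^ k ≤ n
  2^k+2^k≤n = ≤-trans (≤-reflexive (trans (cong (2 ^ k +_) (sym (+-identityʳ (2 ^ k)))) (cong (2 ^_) 1+k))) 2^L≤n
  A+B≤n : A + B ≤ n
  A+B≤n = ≤-trans A+B≤2^k (≤-trans (m≤m+n (2 ^ k) (2 ^ k)) 2^k+2^k≤n)
  2^k≤M : 2 ^ k ≤ M
  2^k≤M = m+n≤o⇒m≤o∸n (2 ^ k) (≤-trans (+-monoʳ-≤ (2 ^ k) A+B≤2^k) 2^k+2^k≤n)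
  0<M : 0 < M
  0<M = ≤-trans (m^n>0 2 k) 2^k≤M
  0<n : 0 < n
  0<n = ≤-trans 0<M (m∸n≤m n (A + B))
  3≤A+B : 3 ≤ A + B
  3≤A+B = +-mono-≤ (^-monoʳ-≤ 2 {1} {26 * I + u} (≤-trans (≤-trans 1≤q (m≤n*m q 100)) (≤-trans (m≤m+n (100 * q) ρ′) (m≤n+m u (26 * I))))) (m^n>0 2 (26 * I + v))
  M+3≤ : M + 3 ≤ 2 ^ suc L
  M+3≤ = ≤-trans (+-monoʳ-≤ M 3≤A+B) (≤-trans (≤-reflexive (m∸n+n≡m A+B≤n)) (<⇒≤ n<))
  -- (M + 1)² ≤ M(M + 3), and M + 3 ≤ n < 2^(L + 1) because A + B ≥ 3.
  wide : 4 * (16 * (16 * (suc M * suc M))) ≤ M * 2 ^ δ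
  wide = begin
    4 * (16 * (16 * (suc M * suc M))) ≡⟨ cong (λ z → 4 * (16 * (16 * z))) (alg M) ⟩
    4 * (16 * (16 * (M * M + 2 * M + 1))) ≤⟨ *-monoʳ-≤ 4 (*-monoʳ-≤ 16 (*-monoʳ-≤ 16 (+-monoʳ-≤ (M * M + 2 * M) 0<M))) ⟩
    4 * (16 * (16 * (M * M + 2 * M + M))) ≡⟨ cong (λ z → 4 * (16 * (16 * z))) (alg₂ M) ⟩
    4 * (16 * (16 * (M * (M + 3)))) ≤⟨ *-monoʳ-≤ 4 (*-monoʳ-≤ 16 (*-monoʳ-≤ 16 (*-monoʳ-≤ M M+3≤))) ⟩
    4 * (16 * (16 * (M * 2 ^ suc L))) ≡⟨ alg₃ M (2 ^ suc L) ⟩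
    M * (4 * (16 * (16 * 2 ^ suc L))) ≡⟨ cong (λ z → M * (4 * (16 * z))) (^-distribˡ-+-* 2 4 (suc L)) ⟨
    M * (4 * (16 * 2 ^ (4 + suc L))) ≡⟨ cong (λ z → M * (4 * z)) (^-distribˡ-+-* 2 4 (4 + suc L)) ⟨
    M * (4 * 2 ^ (4 + (4 + suc L))) ≡⟨ cong (M *_) (^-distribˡ-+-* 2 2 (4 + (4 + suc L))) ⟨
    M * 2 ^ (2 + (4 + (4 + suc L))) ≡⟨ cong (λ z → M * 2 ^ z) (+-comm 11 L) ⟩
    M * 2 ^ δ ∎
    where
    alg : ∀ M → suc M * suc M ≡ M * M + 2 * M + 1
    alg = solve-∀
    alg₂ : ∀ M → M * M + 2 * M + M ≡ M * (M + 3)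
    alg₂ = solve-∀
    alg₃ : ∀ M z → 4 * (16 * (16 * (M * z))) ≡ M * (4 * (16 * (16 * z)))
    alg₃ = solve-∀
  narrow : 16 * (M * 2 ^ δ) ≤ c₈ * c₈ * (suc M * suc M)
  narrow = begin
    16 * (M * 2 ^ δ) ≡⟨ cong (λ z → 16 * (M * 2 ^ z)) (trans (+-comm L 11) (cong (11 +_) (sym 1+k))) ⟩
    16 * (M * 2 ^ (12 + k)) ≡⟨ alg M (2 ^ (12 + k)) ⟩
    M * (16 * 2 ^ (12 + k)) ≡⟨ cong (M *_) (^-distribˡ-+-* 2 4 (12 + k)) ⟨
    M * 2 ^ (8 + (8 + k)) ≡⟨ cong (M *_) (trans (c₈-pow (8 + k)) (cong (c₈ *_) (c₈-pow k))) ⟩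
    M * (c₈ * (c₈ * 2 ^ k)) ≡⟨ alg₂ M c₈ (2 ^ k) ⟩
    c₈ * c₈ * (M * 2 ^ k) ≤⟨ *-monoʳ-≤ (c₈ * c₈) (*-mono-≤ (n≤1+n M) (≤-trans 2^k≤M (n≤1+n M))) ⟩
    c₈ * c₈ * (suc M * suc M) ∎
    where
    alg : ∀ M z → 16 * (M * z) ≡ M * (16 * z)
    alg = solve-∀
    alg₂ : ∀ M c z → M * (c * (c * z)) ≡ c * c * (M * z)
    alg₂ = solve-∀
  open Scales M δ wide narrow
  room : M + Comparison.sizes M (rowSizes u I) + total (columns v I) ≤ n
  room = ≤-reflexive (trans (cong₂ (λ a b → M + a + b) (sizes-rows u I) (total-gaps v I)) (trans (+-assoc M A B) (m∸n+n≡m A+B≤n)))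
  sparse : 2 * (Comparison.sizes M (rowSizes u I) * total (columns v I) * (n ∸ M)) ≤ n * M
  sparse = begin
    2 * (Comparison.sizes M (rowSizes u I) * total (columns v I) * (n ∸ M))
      ≡⟨ cong₂ (λ a b → 2 * (a * b * (n ∸ M))) (sizes-rows u I) (total-gaps v I) ⟩
    2 * (A * B * (n ∸ M)) ≡⟨ cong (λ z → 2 * (A * B * z)) (m∸[m∸n]≡n A+B≤n) ⟩
    2 * (A * B * (A + B)) ≤⟨ *-monoʳ-≤ 2 (*-mono-≤ (*-mono-≤ A≤X B≤X) (+-mono-≤ A≤X B≤X)) ⟩
    2 * (X * X * (X + X)) ≡⟨ alg X ⟩
    4 * X ^ 3 ≡⟨ cong (4 *_) (trans (^-*-assoc 2 (126 * q + 174) 3) (cong (2 ^_) (*-comm (126 * q + 174) 3))) ⟩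
    4 * 2 ^ (3 * (126 * q + 174)) ≡⟨ ^-distribˡ-+-* 2 2 (3 * (126 * q + 174)) ⟨
    2 ^ (2 + 3 * (126 * q + 174)) ≤⟨ ^-monoʳ-≤ 2 cube-exponent ⟩
    2 ^ (k + k) ≡⟨ ^-distribˡ-+-* 2 k k ⟩
    2 ^ k * 2 ^ k ≤⟨ *-mono-≤ (≤-trans (m≤m+n (2 ^ k) (2 ^ k)) 2^k+2^k≤n) 2^k≤M ⟩
    n * M ∎
    where
    alg : ∀ X → 2 * (X * X * (X + X)) ≡ 4 * (X * (X * (X * 1)))
    alg = solve-∀

-- From the rate 63/64 to powers of two

2*pow≤pow : ∀ c → 0 < c → 2 * c ^ suc c ≤ suc c ^ suc c
2*pow≤pow c 0<c = *-cancelʳ-≤ _ _ c {{>-nonZero 0<c}} (begin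
  2 * c ^ suc c * c ≤⟨ m≤m+n _ (c ^ suc c) ⟩
  2 * c ^ suc c * c + c ^ suc c ≡⟨ alg (c ^ suc c) c ⟩
  c ^ suc c * (c + suc c) ≤⟨ bernoulli-≤ (suc c) ⟩
  suc c ^ suc c * c ∎)
  where
  open ≤-Reasoning
  alg : ∀ x c → 2 * x * c + x ≡ x * (c + suc c)
  alg = solve-∀
  bernoulli-≤ : ∀ m → c ^ m * (c + m) ≤ suc c ^ m * c
  bernoulli-≤ zero    = ≤-reflexive (cong (1 *_) (+-identityʳ c))
  bernoulli-≤ (suc m) = begin
    c * c ^ m * (c + suc m) ≡⟨ alg₁ c (c ^ m) m ⟩
    c * (c ^ m * (c + m)) + c ^ m * c ≤⟨ +-mono-≤ (*-monoʳ-≤ c (bernoulli-≤ m)) (*-monoˡ-≤ c (^-monoˡ-≤ m (n≤1+n c))) ⟩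
    c * (suc c ^ m * c) + suc c ^ m * c ≡⟨ alg₂ c (suc c ^ m) ⟩
    suc c * suc c ^ m * c ∎
    where
    alg₁ : ∀ c x m → c * x * (c + suc m) ≡ c * (x * (c + m)) + x * c
    alg₁ = solve-∀
    alg₂ : ∀ c x → c * (x * c) + x * c ≡ suc c * x * c
    alg₂ = solve-∀

-- The power d = (c + 1)e turns (c/(c + 1))^Z into at most 2^(-Ze), because (1 + 1/c)^(c + 1) ≥ 2,
-- and the constant 4 into 2^(2d). By `room` the first pays for the second and for 2^L.
amplify : ∀ c e Z L cp N → 0 < c → suc c ^ Z * cp ≤ c ^ Z * (4 * N) → L + 2 * (suc c * e) ≤ Z * e →
          cp ^ (suc c * e) * 2 ^ L ≤ N ^ (suc c * e)
amplify c e Z L cp N 0<c h room = *-cancelˡ-≤ (c ^ (Z * d) * 2 ^ (2 * d)) {{m*n≢0 _ _ {{m^n≢0 c (Z * d)}} {{m^n≢0 2 (2 * d)}}}} (begin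
  c ^ (Z * d) * 2 ^ (2 * d) * (cp ^ d * 2 ^ L) ≡⟨ alg₁ (c ^ (Z * d)) (2 ^ (2 * d)) (cp ^ d) (2 ^ L) ⟩
  2 ^ L * 2 ^ (2 * d) * c ^ (Z * d) * cp ^ d ≡⟨ cong (λ x → x * c ^ (Z * d) * cp ^ d) (^-distribˡ-+-* 2 L (2 * d)) ⟨
  2 ^ (L + 2 * d) * c ^ (Z * d) * cp ^ d ≤⟨ *-monoˡ-≤ (cp ^ d) (*-monoˡ-≤ (c ^ (Z * d)) (^-monoʳ-≤ 2 room)) ⟩
  2 ^ (Z * e) * c ^ (Z * d) * cp ^ d ≤⟨ *-monoˡ-≤ (cp ^ d) growth ⟩
  suc c ^ (Z * d) * cp ^ d ≡⟨ trans (cong (_* cp ^ d) (sym (^-*-assoc (suc c) Z d))) (sym (^-distribʳ-* d (suc c ^ Z) cp)) ⟩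
  (suc c ^ Z * cp) ^ d ≤⟨ ^-monoˡ-≤ d h ⟩
  (c ^ Z * (4 * N)) ^ d ≡⟨ trans (^-distribʳ-* d (c ^ Z) (4 * N)) (cong₂ _*_ (^-*-assoc c Z d) (trans (^-distribʳ-* d 4 N) (cong (_* N ^ d) (^-*-assoc 2 2 d)))) ⟩
  c ^ (Z * d) * (2 ^ (2 * d) * N ^ d) ≡⟨ *-assoc (c ^ (Z * d)) (2 ^ (2 * d)) (N ^ d) ⟨
  c ^ (Z * d) * 2 ^ (2 * d) * N ^ d ∎)
  where
  open ≤-Reasoning
  instance _ = >-nonZero 0<c
  d = suc c * e
  alg₁ : ∀ a b x y → a * b * (x * y) ≡ y * b * a * x
  alg₁ = solve-∀
  regroup : ∀ x → x ^ (Z * d) ≡ (x ^ suc c) ^ (Z * e)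
  regroup x = trans (cong (x ^_) (alg₂ Z (suc c) e)) (sym (^-*-assoc x (suc c) (Z * e)))
    where
    alg₂ : ∀ Z c e → Z * (c * e) ≡ c * (Z * e)
    alg₂ = solve-∀
  growth : 2 ^ (Z * e) * c ^ (Z * d) ≤ suc c ^ (Z * d)
  growth = begin
    2 ^ (Z * e) * c ^ (Z * d) ≡⟨ trans (cong (2 ^ (Z * e) *_) (regroup c)) (sym (^-distribʳ-* (Z * e) 2 (c ^ suc c))) ⟩
    (2 * c ^ suc c) ^ (Z * e) ≤⟨ ^-monoˡ-≤ (Z * e) (2*pow≤pow c 0<c) ⟩
    (suc c ^ suc c) ^ (Z * e) ≡⟨ regroup (suc c) ⟨
    suc c ^ (Z * d) ∎

abstract
  -- L ≤ 400q gives L² ≤ e₀q²/2, half of the exponent that `amplify` provides; the other half covers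
  -- 2 · 64e₀ since q ≥ 32. `P₀` secures q = ⌊L/200⌋ ≥ 32.
  e₀ P₀ : ℕ
  e₀ = 2 * (400 * 400)
  P₀ = 2 ^ (200 * 32)

  e₀-square : ∀ q → 2 * (400 * q * (400 * q)) ≤ e₀ * (q * q)
  e₀-square q = ≤-reflexive (alg 400 q)
    where
    alg : ∀ c q → 2 * (c * q * (c * q)) ≡ 2 * (c * c) * (q * q)
    alg = solve-∀

  0<e₀ : 0 < e₀
  0<e₀ = s≤s z≤n

  P₀-log : ∀ n → P₀ ≤ n → 200 * 32 ≤ ⌊log₂ n ⌋
  P₀-log n h = 2^≤⇒≤log (200 * 32) {n} h

N₀ : ℕ
N₀ = P₀ + (2 + 12 * c₀)

N₀-scale : ∀ {n} → N₀ ≤ n → 200 * 32 ≤ ⌊log₂ n ⌋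
N₀-scale {n} h = P₀-log n (m+n≤o⇒m≤o P₀ h)

N₀-two : ∀ {n} → N₀ ≤ n → 2 ≤ n
N₀-two h = m+n≤o⇒m≤o 2 (m+n≤o⇒n≤o P₀ h)

N₀-box : ∀ {n} → N₀ ≤ n → 12 * c₀ ≤ n
N₀-box h = m+n≤o⇒n≤o 2 (m+n≤o⇒n≤o P₀ h)

upper-bound : ∀ n → N₀ ≤ n → let L = ⌊log₂ n ⌋ in comparablePairs n ^ (64 * e₀) * 2 ^ (L * L) ≤ symSize n ^ (2 * (64 * e₀))
upper-bound n N₀≤n = begin
  comparablePairs n ^ (64 * e₀) * 2 ^ (L * L) ≤⟨ amplify 63 e₀ (q * q) (L * L) (comparablePairs n) (n ! * n !) (s≤s z≤n) rate exponents ⟩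
  (n ! * n !) ^ (64 * e₀) ≡⟨ cong (_^ (64 * e₀)) (cong (n ! *_) (*-identityʳ (n !))) ⟨
  ((n !) ^ 2) ^ (64 * e₀) ≡⟨ ^-*-assoc (n !) 2 (64 * e₀) ⟩
  (n !) ^ (2 * (64 * e₀)) ≡⟨ cong (_^ (2 * (64 * e₀))) (symSize≡ n) ⟨
  symSize n ^ (2 * (64 * e₀)) ∎
  where
  open ≤-Reasoning
  L = ⌊log₂ n ⌋
  q = L / 200
  32≤q : 32 ≤ q
  32≤q = ≤-trans (≤-reflexive (sym (trans (cong (_/ 200) (*-comm 200 32)) (m*n/n≡m 32 200)))) (/-monoˡ-≤ 200 (N₀-scale N₀≤n))
  L≡ : L ≡ 200 * q + L % 200
  L≡ = trans (m≡m%n+[m/n]*n L 200) (trans (+-comm (L % 200) (q * 200)) (cong (_+ L % 200) (*-comm q 200)))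
  rate : 64 ^ (q * q) * comparablePairs n ≤ 63 ^ (q * q) * (4 * (n ! * n !))
  rate = subst₂ (λ a b → a * comparablePairs n ≤ b * (4 * (n ! * n !))) (^-*-assoc 64 q q) (^-*-assoc 63 q q)
    (upper-rate n L q (L % 200) 32≤q (m%n<n L 200) L≡ (log-lower n (≤-trans (s≤s z≤n) (N₀-two N₀≤n))) (log-upper n))
  L≤400q : L ≤ 400 * q
  L≤400q = begin
    L ≡⟨ L≡ ⟩
    200 * q + L % 200 ≤⟨ +-monoʳ-≤ (200 * q) (<⇒≤ (m%n<n L 200)) ⟩
    200 * q + 200 ≤⟨ +-monoʳ-≤ (200 * q) (≤-trans (≤-reflexive (sym (*-identityʳ 200))) (*-monoʳ-≤ 200 (≤-trans (s≤s z≤n) 32≤q))) ⟩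
    200 * q + 200 * q ≡⟨ *-distribʳ-+ q 200 200 ⟨
    400 * q ∎
  alg₂ : ∀ l e → 2 * (l + 2 * (64 * e)) ≡ 2 * l + 256 * e
  alg₂ = solve-∀
  alg₃ : ∀ z e → e * z + z * e ≡ 2 * (z * e)
  alg₃ = solve-∀
  exponents : L * L + 2 * (64 * e₀) ≤ q * q * e₀
  exponents = *-cancelˡ-≤ 2 (begin
    2 * (L * L + 2 * (64 * e₀)) ≡⟨ alg₂ (L * L) e₀ ⟩
    2 * (L * L) + 256 * e₀ ≤⟨ +-mono-≤ (*-monoʳ-≤ 2 (*-mono-≤ L≤400q L≤400q)) (*-monoˡ-≤ e₀ (≤-trans (m≤m+n 256 768) (*-mono-≤ 32≤q 32≤q))) ⟩
    2 * (400 * q * (400 * q)) + q * q * e₀ ≤⟨ +-monoˡ-≤ (q * q * e₀) (e₀-square q) ⟩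
    e₀ * (q * q) + q * q * e₀ ≡⟨ alg₃ (q * q) e₀ ⟩
    2 * (q * q * e₀) ∎)

lower-bound-log : ∀ n → N₀ ≤ n → let L = ⌊log₂ n ⌋ in symSize n ^ 2 ≤ comparablePairs n * 2 ^ (K₀ * 4 * (L * L))
lower-bound-log n N₀≤n with ⌊log₂ n ⌋ in eq
... | zero  = contradiction (subst (200 * 32 ≤_) eq (N₀-scale N₀≤n)) λ ()
... | suc L = lower-bound n L (N₀-two N₀≤n) (N₀-box N₀≤n) (subst (λ L → n < 2 ^ suc L) eq (log-upper n))

-- The probability is `comparablePairs n` over `symSize n` squared. Powers of 2 and the rounded
-- binary logarithm replace exp and log, which changes only the constants; the power d lets c be as
-- small as a multiple of 1/d.
theorem1p1 : ∃[ C ] ∃[ d ] ∃[ N ] (0 < d ×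
    ((n : ℕ) → N ≤ n →
    (symSize n ^ 2 ≤ comparablePairs n * 2 ^ (C * (⌊log₂ n ⌋ * ⌊log₂ n ⌋)))
    × (comparablePairs n ^ d * 2 ^ (⌊log₂ n ⌋ * ⌊log₂ n ⌋) ≤ symSize n ^ (2 * d))))
theorem1p1 = K₀ * 4 , 64 * e₀ , N₀ , *-mono-≤ (s≤s (z≤n {63})) 0<e₀ , λ n N₀≤n → lower-bound-log n N₀≤n , upper-bound n N₀≤n
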